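{- For a graph $H$, let $\mathrm{ex}_{\mathcal{P}}(n,H)$ denote the maximum number of edges in an $n$-vertex planar graph that does not contain $H$ as a subgraph. For positive integers $m$, let $S_{m,m}$ be the double star obtained by taking an edge $xy$, joining $x$ to $m$ new vertices and joining $y$ to $m$ further new vertices (distinct from the first $m$). Then for every integer $n\geq 3$, \[ \mathrm{ex}_{\mathcal{P}}(n,S_{m,m})=\begin{cases} n & \text{if } m=1 \text{ and } 3\mid n,\\ n-1 & \text{if } m=1 \text{ and } 3\nmid n,\\ 2n-4 & \text{if } m=2 \text{ and } n\geq 16,\\ \lfloor 5n/2\rfloor-5 & \text{if } m=3 \text{ and } n\geq 10,\\ 3n-6 & \text{if } m\geq 4. \end{cases} \]
   Context: All graphs are finite, simple and undirected. A graph is $H$-free if it contains no subgraph isomorphic to $H$. -}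

module Defs where

open import Data.Bool using (Bool; true; false; T)
open import Data.Bool.Properties using (T?)
open import Data.Fin using (Fin; _<_)
open import Data.Fin.Properties using (_<?_)
open import Data.List using (List; []; _∷_; _++_; length; filter; allFin; cartesianProduct)
open import Data.Nat using (ℕ; _≤_)
open import Data.Product using (∃-syntax; _×_; _,_; proj₁; proj₂)
open import Data.Rational as ℚ using (ℚ; 0ℚ; 1ℚ)
open import Function.Definitions using (Injective)
open import Relation.Binary.Definitions using (Symmetric; Irreflexive)
open import Relation.Binary.PropositionalEquality using (_≡_; _≢_; refl)
open import Relation.Nullary using (¬_; Dec)
open import Relation.Nullary.Decidable using (_×-dec_)

-- An n-vertex graph is a Graph (Fin n).
record Graph (V : Set) : Set where
  field
    adj : V → V → Bool

  _~_ : V → V → Set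
  u ~ v = T (adj u v)

  field
    ~-sym    : Symmetric _~_
    ~-irrefl : Irreflexive _≡_ _~_

-- Each undirected edge is represented by its increasing pair of ends.
IsEdge : ∀ {n} → Graph (Fin n) → Fin n × Fin n → Set
IsEdge G (u , v) = u < v × Graph._~_ G u v

isEdge? : ∀ {n} (G : Graph (Fin n)) e → Dec (IsEdge G e)
isEdge? G (u , v) = (u <? v) ×-dec T? (Graph.adj G u v)

edges : ∀ {n} → Graph (Fin n) → List (Fin n × Fin n)
edges {n} G = filter (isEdge? G) (cartesianProduct (allFin n) (allFin n))

edgeCount : ∀ {n} → Graph (Fin n) → ℕ
edgeCount G = length (edges G)

-- Subgraphs need not be induced, so only adjacency is preserved.
record _Contains_ {V W : Set} (G : Graph V) (H : Graph W) : Set where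
  private
    module G = Graph G
    module H = Graph H
  field
    embed     : W → V
    injective : Injective _≡_ _≡_ embed
    preserves : ∀ {a b} → a H.~ b → embed a G.~ embed b

_Free_ : {V W : Set} → Graph W → Graph V → Set
H Free G = ¬ (G Contains H)

-- In a plane drawing, edges are simple polygonal arcs with rational corners.  Rational
-- coordinates lose nothing: a finite polygonal drawing in ℝ² can be perturbed
-- to have rational corners, and two segments with rational ends that meet in
-- ℝ² also meet in a rational point.

Point : Set
Point = ℚ × ℚ

_∈[_,_] : Point → Point → Point → Set
(x , y) ∈[ (x₀ , y₀) , (x₁ , y₁) ] =
  ∃[ t ] 0ℚ ℚ.≤ t × t ℚ.≤ 1ℚ
       × x ≡ x₀ ℚ.+ t ℚ.* (x₁ ℚ.- x₀)
       × y ≡ y₀ ℚ.+ t ℚ.* (y₁ ℚ.- y₀)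

-- A polygonal path is the list of its successive corners, ends included.
data _∈path_ (p : Point) : List Point → Set where
  here  : ∀ {a b ps} → p ∈[ a , b ] → p ∈path (a ∷ b ∷ ps)
  there : ∀ {a b ps} → p ∈path (b ∷ ps) → p ∈path (a ∷ b ∷ ps)

data Simple : List Point → Set where
  segment : ∀ {a b} → a ≢ b → Simple (a ∷ b ∷ [])
  extend  : ∀ {a b c ps} → a ≢ b →
            (∀ {p} → p ∈[ a , b ] → p ∈path (b ∷ c ∷ ps) → p ≡ b) →
            Simple (b ∷ c ∷ ps) → Simple (a ∷ b ∷ c ∷ ps)

record Drawing {n} (G : Graph (Fin n)) : Set where
  field
    pos           : Fin n → Point
    pos-injective : Injective _≡_ _≡_ pos
    -- Interior corners of the arc; irrelevant for pairs that are not edges.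
    bends         : Fin n × Fin n → List Point

  arc : Fin n × Fin n → List Point
  arc (u , v) = pos u ∷ bends (u , v) ++ pos v ∷ []

  Interior : Fin n × Fin n → Point → Set
  Interior e p = p ∈path arc e × p ≢ pos (proj₁ e) × p ≢ pos (proj₂ e)

  field
    arc-simple        : ∀ {e} → IsEdge G e → Simple (arc e)
    interior-vertex   : ∀ {e p} → IsEdge G e → Interior e p → ∀ w → p ≢ pos w
    interior-disjoint : ∀ {e f p} → IsEdge G e → IsEdge G f → e ≢ f →
                        Interior e p → ¬ (p ∈path arc f)

Planar : ∀ {n} → Graph (Fin n) → Set
Planar = Drawing

-- ex𝒫[ n , H ]≡ k: the maximum defining ex𝒫(n, H) is attained and equals k.
record ex𝒫[_,_]≡_ (n : ℕ) {W : Set} (H : Graph W) (k : ℕ) : Set where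
  field
    attained : ∃[ G ] Planar {n} G × H Free G × edgeCount G ≡ k
    maximal  : (G : Graph (Fin n)) → Planar G → H Free G → edgeCount G ≤ k

data StarVertex (m k : ℕ) : Set where
  hubX hubY : StarVertex m k
  leafX     : Fin m → StarVertex m k
  leafY     : Fin k → StarVertex m k

starAdj : ∀ {m k} → StarVertex m k → StarVertex m k → Bool
starAdj hubX      hubY      = true
starAdj hubY      hubX      = true
starAdj hubX      (leafX _) = true
starAdj (leafX _) hubX      = true
starAdj hubY      (leafY _) = true
starAdj (leafY _) hubY      = true
starAdj _         _         = false

starAdj-sym : ∀ {m k} (a b : StarVertex m k) → T (starAdj a b) → T (starAdj b a)
starAdj-sym hubX      hubY      h = h
starAdj-sym hubY      hubX      h = h
starAdj-sym hubX      (leafX _) h = h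
starAdj-sym (leafX _) hubX      h = h
starAdj-sym hubY      (leafY _) h = h
starAdj-sym (leafY _) hubY      h = h

starAdj-irrefl : ∀ {m k} (a : StarVertex m k) → ¬ T (starAdj a a)
starAdj-irrefl hubX      ()
starAdj-irrefl hubY      ()
starAdj-irrefl (leafX _) ()
starAdj-irrefl (leafY _) ()

S : (m k : ℕ) → Graph (StarVertex m k)
S m k = record
  { adj      = starAdj
  ; ~-sym    = λ {a} {b} → starAdj-sym a b
  ; ~-irrefl = λ { {a} refl → starAdj-irrefl a }
  }

{-# OPTIONS --safe #-}

-- Of a plane drawing only this is retained: the order of the vertices by abscissa and, for a vertex u and an edge cd, the
-- parity of the number of crossings of cd with the upward ray from u.  Any two disjoint edges give a linear equation between
-- these parities; the equations survive the contraction of edges, and for K₅, K₃,₃ and some subdivisions they add up to 0 = 1.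
-- Mader's argument then bounds the number of edges by 3n − 6.
--
-- If x and y are adjacent vertices of degree above m in a graph without S m m, then deg x + deg y is at most 2m + 1 plus the
-- number of their common neighbours.  Call these degrees heavy.  For m = 1 two adjacent heavy vertices lie in a component
-- that is a triangle.  For m = 2 and m = 3 a vertex without heavy neighbours is paid for by its light neighbours, and where
-- heavy vertices are adjacent the inequality forces many triangles, hence by planarity small rigid clusters that are
-- compensated by light vertices next to them or, when those are few, by the number of vertices.
--
-- The extremal graphs are disjoint triangles, a star, two hubs joined to all vertices of an axis, the same with a matching
-- along the axis, and the double wheel.
module Submission where

open import Data.Fin using (Fin)
open import Defs
open import Data.Bool using (Bool; true; false; not; _∧_; _∨_)
open import Data.Empty using (⊥; ⊥-elim)
open import Data.List using (List; []; _∷_; _++_; length; filterᵇ)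
open import Data.List.Membership.Propositional using (_∈_; _∉_)
open import Data.Product using (_×_; _,_; proj₁; proj₂; ∃-syntax)
open import Data.Sum using (_⊎_; inj₁; inj₂)
open import Function using (_∘_; Equivalence)
open import Relation.Nullary using (¬_; Dec; yes; no)
open import Relation.Nullary.Decidable using (_×-dec_; ¬?)

module Counting where
 open import Data.List.Membership.Propositional.Properties using (∈-∃++)
 open import Data.List.Relation.Binary.Permutation.Propositional using (_↭_; refl; prep; swap; trans; ↭-sym)
 open import Data.List.Relation.Binary.Permutation.Propositional.Properties using (∈-resp-↭; shift)
 open import Data.List.Relation.Unary.All as All using (All; []; _∷_)
 open import Data.List.Relation.Unary.AllPairs using ([]; _∷_)
 open import Data.List.Relation.Unary.Any using (here; there)
 open import Data.List.Relation.Unary.Unique.Propositional using (Unique)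
 open import Data.Nat
 open import Data.Nat.Properties
 open import Relation.Binary.PropositionalEquality as ≡ using (_≡_; _≢_; cong; cong₂; subst)
 open import Relation.Unary using (Decidable)
 open import Algebra.Properties.CommutativeSemigroup +-commutativeSemigroup using (interchange; x∙yz≈y∙xz)

 private variable
  A B : Set

 ∑ : List A → (A → ℕ) → ℕ
 ∑ []       f = 0
 ∑ (x ∷ xs) f = f x + ∑ xs f

 bit : Bool → ℕ
 bit true  = 1
 bit false = 0

 count : (A → Bool) → List A → ℕ
 count p xs = ∑ xs (λ x → bit (p x))

 bit≤1 : ∀ b → bit b ≤ 1
 bit≤1 true  = ≤-refl
 bit≤1 false = z≤n

 ∑-mono : ∀ (xs : List A) {f g : A → ℕ} → (∀ {x} → x ∈ xs → f x ≤ g x) → ∑ xs f ≤ ∑ xs g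
 ∑-mono []       h = z≤n
 ∑-mono (x ∷ xs) h = +-mono-≤ (h (here ≡.refl)) (∑-mono xs (h ∘ there))

 ∑-cong : ∀ (xs : List A) {f g : A → ℕ} → (∀ {x} → x ∈ xs → f x ≡ g x) → ∑ xs f ≡ ∑ xs g
 ∑-cong []       h = ≡.refl
 ∑-cong (x ∷ xs) h = cong₂ _+_ (h (here ≡.refl)) (∑-cong xs (h ∘ there))

 ∑-+ : ∀ (xs : List A) (f g : A → ℕ) → ∑ xs (λ x → f x + g x) ≡ ∑ xs f + ∑ xs g
 ∑-+ []       f g = ≡.refl
 ∑-+ (x ∷ xs) f g = ≡.trans (cong (f x + g x +_) (∑-+ xs f g)) (interchange (f x) (g x) (∑ xs f) (∑ xs g))

 ∑-* : ∀ (xs : List A) k (f : A → ℕ) → ∑ xs (λ x → k * f x) ≡ k * ∑ xs f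
 ∑-* []       k f = ≡.sym (*-zeroʳ k)
 ∑-* (x ∷ xs) k f = ≡.trans (cong (k * f x +_) (∑-* xs k f)) (≡.sym (*-distribˡ-+ k (f x) (∑ xs f)))

 ∑-const : ∀ (xs : List A) k → ∑ xs (λ _ → k) ≡ k * length xs
 ∑-const []       k = ≡.sym (*-zeroʳ k)
 ∑-const (x ∷ xs) k = ≡.trans (cong (k +_) (∑-const xs k)) (≡.sym (*-suc k (length xs)))

 ∑-one : ∀ (xs : List A) → ∑ xs (λ _ → 1) ≡ length xs
 ∑-one xs = ≡.trans (∑-const xs 1) (*-identityˡ _)

 Two Three : (A → Set) → Set
 Two P   = ∃[ x ] ∃[ y ] x ≢ y × P x × P y
 Three P = ∃[ x ] ∃[ y ] ∃[ z ] (x ≢ y × x ≢ z × y ≢ z) × P x × P y × P z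

 ∑-zero : ∀ (xs : List A) → ∑ xs (λ _ → 0) ≡ 0
 ∑-zero []       = ≡.refl
 ∑-zero (x ∷ xs) = ∑-zero xs

 ∑-comm : ∀ (xs : List A) (ys : List B) (f : A → B → ℕ) →
  ∑ xs (λ x → ∑ ys (f x)) ≡ ∑ ys (λ y → ∑ xs (λ x → f x y))
 ∑-comm []       ys f = ≡.sym (∑-zero ys)
 ∑-comm (x ∷ xs) ys f = ≡.trans (cong (∑ ys (f x) +_) (∑-comm xs ys f)) (≡.sym (∑-+ ys (f x) _))

 ∑-↭ : ∀ {xs ys : List A} (f : A → ℕ) → xs ↭ ys → ∑ xs f ≡ ∑ ys f
 ∑-↭ f refl        = ≡.refl
 ∑-↭ f (prep x p)  = cong (f x +_) (∑-↭ f p)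
 ∑-↭ f (swap x y p) = ≡.trans (cong (λ z → f x + (f y + z)) (∑-↭ f p)) (x∙yz≈y∙xz (f x) (f y) _)
 ∑-↭ f (trans p q) = ≡.trans (∑-↭ f p) (∑-↭ f q)

 ∑-filter : ∀ (p : A → Bool) (xs : List A) (f : A → ℕ) → ∑ (filterᵇ p xs) f ≡ ∑ xs (λ x → bit (p x) * f x)
 ∑-filter p [] f = ≡.refl
 ∑-filter p (x ∷ xs) f with p x
 ... | true  = cong₂ _+_ (≡.sym (+-identityʳ (f x))) (∑-filter p xs f)
 ... | false = ∑-filter p xs f

 bit-∧ : ∀ a b → bit a * bit b ≡ bit (a ∧ b)
 bit-∧ true  b = +-identityʳ (bit b)
 bit-∧ false b = ≡.refl

 count-filter : ∀ (p q : A → Bool) xs → count q (filterᵇ p xs) ≡ count (λ x → p x ∧ q x) xs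
 count-filter p q xs = ≡.trans (∑-filter p xs _) (∑-cong xs (λ {x} _ → bit-∧ (p x) (q x)))

 length-filter : ∀ (p : A → Bool) xs → length (filterᵇ p xs) ≡ count p xs
 length-filter p [] = ≡.refl
 length-filter p (x ∷ xs) with p x
 ... | true  = cong suc (length-filter p xs)
 ... | false = length-filter p xs

 ∈-filter⁺ : ∀ (p : A → Bool) {xs x} → x ∈ xs → p x ≡ true → x ∈ filterᵇ p xs
 ∈-filter⁺ p {y ∷ xs} (here ≡.refl) h rewrite h = here ≡.refl
 ∈-filter⁺ p {y ∷ xs} (there i) h with p y
 ... | true  = there (∈-filter⁺ p i h)
 ... | false = ∈-filter⁺ p i h

 ∈-filter⁻ : ∀ (p : A → Bool) {xs x} → x ∈ filterᵇ p xs → (x ∈ xs) × p x ≡ true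
 ∈-filter⁻ p {y ∷ xs} i with p y in e
 ∈-filter⁻ p {y ∷ xs} (here ≡.refl) | true = here ≡.refl , e
 ∈-filter⁻ p {y ∷ xs} (there i)   | true = there (proj₁ (∈-filter⁻ p i)) , proj₂ (∈-filter⁻ p {xs} i)
 ∈-filter⁻ p {y ∷ xs} i           | false = there (proj₁ (∈-filter⁻ p i)) , proj₂ (∈-filter⁻ p {xs} i)

 unique-filter : ∀ (p : A → Bool) {xs} → Unique xs → Unique (filterᵇ p xs)
 unique-filter p [] = []
 unique-filter p {x ∷ xs} (h ∷ u) with p x
 ... | true  = All.tabulate (λ i → All.lookup h (proj₁ (∈-filter⁻ p i))) ∷ unique-filter p u
 ... | false = unique-filter p u

 unique-↭ : ∀ {xs ys : List A} → xs ↭ ys → Unique xs → Unique ys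
 unique-↭ refl u = u
 unique-↭ (prep x p) (h ∷ u) = All.tabulate (λ i → All.lookup h (∈-resp-↭ (↭-sym p) i)) ∷ unique-↭ p u
 unique-↭ (swap x y p) ((xy ∷ h) ∷ (k ∷ u)) =
  ((xy ∘ ≡.sym) ∷ All.tabulate (λ i → All.lookup k (∈-resp-↭ (↭-sym p) i)))
  ∷ (All.tabulate (λ i → All.lookup h (∈-resp-↭ (↭-sym p) i)) ∷ unique-↭ p u)
 unique-↭ (trans p q) u = unique-↭ q (unique-↭ p u)

 front : ∀ {x : A} {xs} → x ∈ xs → ∃[ ys ] xs ↭ x ∷ ys
 front i with ∈-∃++ i
 ... | ys , zs , ≡.refl = ys ++ zs , shift _ ys zs

 tail∈ : ∀ {x y : A} {ys} → y ∈ x ∷ ys → y ≢ x → y ∈ ys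
 tail∈ (here e)  h = ⊥-elim (h e)
 tail∈ (there i) h = i

 length≤count : ∀ (p : A → Bool) {ys xs} → Unique ys → (∀ {y} → y ∈ ys → (y ∈ xs) × p y ≡ true) → length ys ≤ count p xs
 length≤count p {[]} u h = z≤n
 length≤count p {y ∷ ys} {xs} (k ∷ u) h with h (here ≡.refl)
 ... | i , e with front i
 ...   | zs , π rewrite ∑-↭ (λ x → bit (p x)) π | e = s≤s (length≤count p u
     (λ j → tail∈ (∈-resp-↭ π (proj₁ (h (there j)))) (All.lookup k j ∘ ≡.sym) , proj₂ (h (there j))))

 count-pos : ∀ (p : A → Bool) xs {k} → suc k ≤ count p xs → ∃[ x ] (x ∈ xs) × p x ≡ true
 count-pos p (x ∷ xs) h with p x in e
 ... | true  = x , here ≡.refl , e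
 ... | false with count-pos p xs h
 ...   | y , i , k = y , there i , k

 ∑-<⇒∃ : ∀ (xs : List A) (f g : A → ℕ) → ∑ xs f < ∑ xs g → ∃[ x ] (x ∈ xs) × f x < g x
 ∑-<⇒∃ (x ∷ xs) f g h with f x <? g x
 ... | yes k = x , here ≡.refl , k
 ... | no k with ∑-<⇒∃ xs f g (+-cancelˡ-< (g x) _ _ (≤-trans (s≤s (+-monoˡ-≤ (∑ xs f) (≮⇒≥ k))) h))
 ...   | y , i , l = y , there i , l

 find-or-none : ∀ {P : A → Set} → Decidable P → ∀ xs → (∃[ x ] (x ∈ xs) × P x) ⊎ (∀ {x} → x ∈ xs → ¬ P x)
 find-or-none P? [] = inj₂ (λ ())
 find-or-none P? (x ∷ xs) with P? x
 ... | yes h = inj₁ (x , here ≡.refl , h)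
 ... | no h with find-or-none P? xs
 ...   | inj₁ (y , i , k) = inj₁ (y , there i , k)
 ...   | inj₂ k = inj₂ (λ { (here ≡.refl) → h ; (there i) → k i })

 count≤length : ∀ (p : A → Bool) xs → count p xs ≤ length xs
 count≤length p []       = z≤n
 count≤length p (x ∷ xs) = +-mono-≤ (bit≤1 (p x)) (count≤length p xs)

 count-not : ∀ (p : A → Bool) xs → count p xs + count (λ x → not (p x)) xs ≡ length xs
 count-not p xs = ≡.trans (≡.sym (∑-+ xs _ _)) (≡.trans (∑-cong xs (λ {x} _ → e (p x))) (∑-one xs))
  where
  e : ∀ b → bit b + bit (not b) ≡ 1
  e true  = ≡.refl
  e false = ≡.refl

 count-mono : ∀ {p q : A → Bool} xs → (∀ {x} → x ∈ xs → p x ≡ true → q x ≡ true) → count p xs ≤ count q xs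
 count-mono {p = p} {q} xs h = ∑-mono xs (λ {x} i → e (p x) (q x) (h i))
  where
  e : ∀ a b → (a ≡ true → b ≡ true) → bit a ≤ bit b
  e false b h = z≤n
  e true b h rewrite h ≡.refl = ≤-refl

 bit-∨∧ : ∀ a b → bit a + bit b ≡ bit (a ∨ b) + bit (a ∧ b)
 bit-∨∧ true  b = ≡.refl
 bit-∨∧ false b = ≡.sym (+-identityʳ (bit b))

 module _ (_≟_ : (x y : A) → Dec (x ≡ y)) where
  member? : ∀ x (ys : List A) → Dec (x ∈ ys)
  member? x [] = no λ ()
  member? x (y ∷ ys) with x ≟ y
  ... | yes e = yes (here e)
  ... | no h with member? x ys
  ...   | yes i = yes (there i)
  ...   | no k  = no λ { (here e) → h e ; (there i) → k i }

  exhaustive : ∀ (p : A → Bool) {ys xs} → Unique ys → (∀ {y} → y ∈ ys → (y ∈ xs) × p y ≡ true) →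
   count p xs ≤ length ys → ∀ {z} → z ∈ xs → p z ≡ true → z ∈ ys
  exhaustive p {ys} {xs} u h k {z} i e with member? z ys
  ... | yes j = j
  ... | no j = ⊥-elim (<⇒≱ {length ys} (length≤count p {z ∷ ys} {xs}
   (All.tabulate (λ l → λ { ≡.refl → j l }) ∷ u) λ { (here ≡.refl) → i , e ; (there l) → h l }) k)

 find-pair : ∀ {P : A → A → Set} → (∀ x y → Dec (P x y)) → ∀ xs →
  (∃[ x ] ∃[ y ] (x ∈ xs) × (y ∈ xs) × P x y) ⊎ (∀ {x y} → x ∈ xs → y ∈ xs → ¬ P x y)
 find-pair {P = P} P? xs with find-or-none row? xs
  where
  row? : ∀ x → Dec (∃[ y ] (y ∈ xs) × P x y)
  row? x with find-or-none (P? x) xs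
  ... | inj₁ h = yes h
  ... | inj₂ h = no λ { (y , i , p) → h i p }
 ... | inj₁ (x , i , y , j , p) = inj₁ (x , y , i , j , p)
 ... | inj₂ h = inj₂ λ {x} {y} i j p → h i (y , j , p)

 module _ (p : A → Bool) {xs : List A} (u : Unique xs) where
  Solution : A → Set
  Solution x = (x ∈ xs) × p x ≡ true

  pick₂ : 2 ≤ count p xs → Two Solution
  pick₂ h = go (filterᵇ p xs) (unique-filter p u) (∈-filter⁻ p) (subst (2 ≤_) (≡.sym (length-filter p xs)) h)
   where
   go : ∀ zs → Unique zs → (∀ {z} → z ∈ zs → Solution z) → 2 ≤ length zs → Two Solution
   go (a ∷ []) _ _ (s≤s ())
   go (a ∷ b ∷ zs) ((ab ∷ _) ∷ _) s _ = a , b , ab , s (here ≡.refl) , s (there (here ≡.refl))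

  pick₃ : 3 ≤ count p xs →
   Three Solution
  pick₃ h = go (filterᵇ p xs) (unique-filter p u) (∈-filter⁻ p) (subst (3 ≤_) (≡.sym (length-filter p xs)) h)
   where
   go : ∀ zs → Unique zs → (∀ {z} → z ∈ zs → Solution z) → 3 ≤ length zs →
    Three Solution
   go (a ∷ []) _ _ (s≤s ())
   go (a ∷ b ∷ []) _ _ (s≤s (s≤s ()))
   go (a ∷ b ∷ c ∷ zs) ((ab ∷ ac ∷ _) ∷ (bc ∷ _) ∷ _) s _ =
    a , b , c , (ab , ac , bc) , s (here ≡.refl) , s (there (here ≡.refl)) , s (there (there (here ≡.refl)))

 length-⊆ : ∀ {xs ys : List A} → Unique xs → (∀ {x} → x ∈ xs → x ∈ ys) → length xs ≤ length ys
 length-⊆ {ys = ys} u h = ≤-trans (length≤count (λ _ → true) {xs = ys} u (λ i → h i , ≡.refl)) (count≤length _ ys)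

 count≤cover : ∀ (p : A → Bool) {xs : List A} {ys} → Unique xs → (∀ {x} → x ∈ xs → p x ≡ true → x ∈ ys) → count p xs ≤ length ys
 count≤cover p {xs} u h = ≤-trans (≤-reflexive (≡.sym (length-filter p xs)))
  (length-⊆ (unique-filter p u) (λ i → let j , e = ∈-filter⁻ p i in h j e))

 ∑-split : ∀ (p q : A → Bool) (xs : List A) (f : A → ℕ) → (∀ {x} → q x ≡ true → p x ≡ true) →
  ∑ (filterᵇ p xs) f ≡ ∑ (filterᵇ q xs) f + ∑ (filterᵇ (λ x → p x ∧ not (q x)) xs) f
 ∑-split p q xs f h = ≡.trans (∑-filter p xs f) (≡.trans (∑-cong xs (λ {x} _ → e (p x) (q x) (f x) h))
  (≡.trans (∑-+ xs _ _) (≡.sym (cong₂ _+_ (∑-filter q xs f) (∑-filter _ xs f)))))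
  where
  e : ∀ a b k → (b ≡ true → a ≡ true) → bit a * k ≡ bit b * k + bit (a ∧ not b) * k
  e true  true  k h = ≡.sym (+-identityʳ _)
  e true  false k h = ≡.refl
  e false true  k h with h ≡.refl
  ... | ()
  e false false k h = ≡.refl

 term≤∑ : ∀ {xs : List A} (f : A → ℕ) {x} → x ∈ xs → f x ≤ ∑ xs f
 term≤∑ f (here ≡.refl) = m≤m+n _ _
 term≤∑ f {x} (there {y} i) = ≤-trans (term≤∑ f i) (m≤n+m _ (f y))

 ∨-introˡ : ∀ {a b} → a ≡ true → a ∨ b ≡ true
 ∨-introˡ ≡.refl = ≡.refl

 ∨-introʳ : ∀ a {b} → b ≡ true → a ∨ b ≡ true
 ∨-introʳ true  h = ≡.refl
 ∨-introʳ false h = h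

 positive : ∀ {k} → 1 ≤ k → (0 <ᵇ k) ≡ true
 positive (s≤s _) = ≡.refl

 positive⁻ : ∀ {k} → (0 <ᵇ k) ≡ true → 1 ≤ k
 positive⁻ {suc k} _ = s≤s z≤n

 zero-or : ∀ k → k ≡ 0 ⊎ 1 ≤ k
 zero-or zero    = inj₁ ≡.refl
 zero-or (suc k) = inj₂ (s≤s z≤n)

 ∑-strict : ∀ (xs : List A) {f g : A → ℕ} {x} → (∀ {y} → y ∈ xs → f y ≤ g y) → x ∈ xs → f x < g x → ∑ xs f < ∑ xs g
 ∑-strict (x ∷ xs) h (here ≡.refl) l = +-mono-≤ l (∑-mono xs (h ∘ there))
 ∑-strict (x ∷ xs) h (there i) l = ≤-trans (≤-reflexive (≡.sym (+-suc _ _))) (+-mono-≤ (h (here ≡.refl)) (∑-strict xs (h ∘ there) i l))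

 ∑-partition : ∀ (p : A → Bool) xs f → ∑ (filterᵇ p xs) f + ∑ (filterᵇ (λ x → not (p x)) xs) f ≡ ∑ xs f
 ∑-partition p xs f = ≡.trans (cong₂ _+_ (∑-filter p xs f) (∑-filter _ xs f)) (≡.trans (≡.sym (∑-+ xs _ _)) (∑-cong xs λ {x} _ → e (p x) (f x)))
  where
  e : ∀ b k → bit b * k + bit (not b) * k ≡ k
  e true  k = ≡.trans (+-identityʳ _) (+-identityʳ k)
  e false k = +-identityʳ k

open import Relation.Binary.Definitions using (DecidableEquality; Tri; tri<; tri≈; tri>)
open import Relation.Binary.PropositionalEquality using (_≡_; _≢_; refl; sym; trans; cong; cong₂; subst; subst₂)

module Geometry where
 open import Data.Bool using (_xor_; if_then_else_)
 open import Data.Bool.Solver using (module xor-∧-Solver)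
 open import Data.Rational using (ℚ; 0ℚ; 1ℚ; _+_; _*_; _-_; -_; _<_; _≤_; 1/_; positive; nonNegative; >-nonZero)
 open import Data.Rational.Properties
 open import Data.Rational.Solver using (module +-*-Solver)
 open import Relation.Nullary.Decidable using (⌊_⌋)

 private module R = +-*-Solver
 open R using (_:=_; _:+_; _:*_; _:-_; :-_; con)
 private module X = xor-∧-Solver

 0<- : ∀ {p q} → p < q → 0ℚ < q - p
 0<- {p} {q} h = subst (_< q - p) (+-inverseʳ p) (+-monoˡ-< (- p) h)

 0≤- : ∀ {p q} → p ≤ q → 0ℚ ≤ q - p
 0≤- {p} {q} h = subst (_≤ q - p) (+-inverseʳ p) (+-monoˡ-≤ (- p) h)

 0<* : ∀ {p q} → 0ℚ < p → 0ℚ < q → 0ℚ < p * q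
 0<* {p} {q} h k = positive⁻¹ (p * q) {{pos*pos⇒pos p {{positive h}} q {{positive k}}}}

 0≤* : ∀ {p q} → 0ℚ ≤ p → 0ℚ ≤ q → 0ℚ ≤ p * q
 0≤* {p} {q} h k = nonNegative⁻¹ (p * q) {{nonNeg*nonNeg⇒nonNeg p {{nonNegative h}} q {{nonNegative k}}}}

 0<+ : ∀ {p q} → 0ℚ < p → 0ℚ < q → 0ℚ < p + q
 0<+ {p} {q} h k = subst (_< p + q) (+-identityˡ 0ℚ) (+-mono-< h k)

 0≤+ : ∀ {p q} → 0ℚ ≤ p → 0ℚ ≤ q → 0ℚ ≤ p + q
 0≤+ {p} {q} h k = subst (_≤ p + q) (+-identityˡ 0ℚ) (+-mono-≤ h k)

 0<neg : ∀ {p} → p < 0ℚ → 0ℚ < - p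
 0<neg h = neg-antimono-< h

 recip : ∀ {D} → 0ℚ < D → ℚ
 recip {D} h = (1/ D) {{>-nonZero h}}

 recip-inverse : ∀ {D} (h : 0ℚ < D) → D * recip h ≡ 1ℚ
 recip-inverse {D} h = *-inverseʳ D {{>-nonZero h}}

 0<recip : ∀ {D} (h : 0ℚ < D) → 0ℚ < recip h
 0<recip {D} h = positive⁻¹ (recip h) {{1/pos⇒pos D {{positive h}}}}

 ratio≤1 : ∀ {q D} (h : 0ℚ < D) → q ≤ D → q * recip h ≤ 1ℚ
 ratio≤1 {q} {D} h k = subst (q * recip h ≤_) (recip-inverse h)
  (*-monoʳ-≤-nonNeg (recip h) {{nonNegative (<⇒≤ (0<recip h))}} k)

 data Positiveᵥ (x y : ℚ) : Set where
  right : 0ℚ < x → Positiveᵥ x y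
  above : x ≡ 0ℚ → 0ℚ < y → Positiveᵥ x y

 scaleᵥ : ∀ {k x y} → 0ℚ < k → Positiveᵥ x y → Positiveᵥ (k * x) (k * y)
 scaleᵥ h (right p)       = right (0<* h p)
 scaleᵥ {k} h (above refl p) = above (*-zeroʳ k) (0<* h p)

 addᵥ : ∀ {x y x′ y′} → Positiveᵥ x y → Positiveᵥ x′ y′ → Positiveᵥ (x + x′) (y + y′)
 addᵥ (right p) (right q) = right (0<+ p q)
 addᵥ {x} (right p) (above refl q) = right (subst (0ℚ <_) (sym (+-identityʳ x)) p)
 addᵥ {x′ = x′} (above refl p) (right q) = right (subst (0ℚ <_) (sym (+-identityˡ x′)) q)
 addᵥ (above refl p) (above refl q) = above refl (0<+ p q)

 nonzeroᵥ : ∀ {x y} → x ≡ 0ℚ → y ≡ 0ℚ → ¬ Positiveᵥ x y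
 nonzeroᵥ refl refl (right p)   = <-irrefl refl p
 nonzeroᵥ refl refl (above _ p) = <-irrefl refl p

 -- Lexicographic order of the plane: the order of abscissae after an
 -- infinitesimal shear, so that no two distinct points are on a common vertical.
 data _≺_ : Point → Point → Set where
  left  : ∀ {a b c d} → a < c → (a , b) ≺ (c , d)
  below : ∀ {a b d} → b < d → (a , b) ≺ (a , d)

 ≺-trans : ∀ {p q r} → p ≺ q → q ≺ r → p ≺ r
 ≺-trans (left h)  (left k)  = left (<-trans h k)
 ≺-trans (left h)  (below k) = left h
 ≺-trans (below h) (left k)  = left k
 ≺-trans (below h) (below k) = below (<-trans h k)

 ≺-irrefl : ∀ {p} → ¬ (p ≺ p)
 ≺-irrefl (left h)  = <-irrefl refl h
 ≺-irrefl (below h) = <-irrefl refl h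

 ≺-cmp : ∀ p q → Tri (p ≺ q) (p ≡ q) (q ≺ p)
 ≺-cmp (a , b) (c , d) with <-cmp a c
 ... | tri< h _ _ = tri< (left h) (λ { refl → <-irrefl refl h }) (λ k → ≺-irrefl (≺-trans (left h) k))
 ... | tri> _ _ h = tri> (λ k → ≺-irrefl (≺-trans (left h) k)) (λ { refl → <-irrefl refl h }) (left h)
 ... | tri≈ _ refl _ with <-cmp b d
 ...   | tri< h _ _ = tri< (below h) (λ { refl → <-irrefl refl h }) (λ k → ≺-irrefl (≺-trans (below h) k))
 ...   | tri≈ _ refl _ = tri≈ ≺-irrefl refl ≺-irrefl
 ...   | tri> _ _ h = tri> (λ k → ≺-irrefl (≺-trans (below h) k)) (λ { refl → <-irrefl refl h }) (below h)

 _≺?_ : ∀ p q → Dec (p ≺ q)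
 p ≺? q with ≺-cmp p q
 ... | tri< h _ _ = yes h
 ... | tri≈ h _ _ = no h
 ... | tri> h _ _ = no h

 abstract
  _≺ᵇ_ : Point → Point → Bool
  p ≺ᵇ q = ⌊ p ≺? q ⌋

  ≺⇒true : ∀ {p q} → p ≺ q → (p ≺ᵇ q) ≡ true
  ≺⇒true {p} {q} h with p ≺? q
  ... | yes _ = refl
  ... | no k  = ⊥-elim (k h)

  ≻⇒false : ∀ {p q} → q ≺ p → (p ≺ᵇ q) ≡ false
  ≻⇒false {p} {q} h with p ≺? q
  ... | yes k = ⊥-elim (≺-irrefl (≺-trans h k))
  ... | no _  = refl

  ≺ᵇ-refl : ∀ p → (p ≺ᵇ p) ≡ false
  ≺ᵇ-refl p with p ≺? p
  ... | yes k = ⊥-elim (≺-irrefl k)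
  ... | no _  = refl

 ≺ᵇ-anti : ∀ {p q} → p ≢ q → (q ≺ᵇ p) ≡ not (p ≺ᵇ q)
 ≺ᵇ-anti {p} {q} h with ≺-cmp p q
 ... | tri< k _ _ = trans (≻⇒false k) (sym (cong not (≺⇒true k)))
 ... | tri≈ _ k _ = ⊥-elim (h k)
 ... | tri> _ _ k = trans (≺⇒true k) (sym (cong not (≻⇒false k)))

 ≺-difference : ∀ {p q} → p ≺ q → Positiveᵥ (proj₁ q - proj₁ p) (proj₂ q - proj₂ p)
 ≺-difference (left h)          = right (0<- h)
 ≺-difference (below {a} h) = above (+-inverseʳ a) (0<- h)

 det : Point → Point → Point → ℚ
 det (ax , ay) (bx , by) (cx , cy) = (bx - ax) * (cy - ay) - (by - ay) * (cx - ax)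

 det-swap : ∀ a b c → det b a c ≡ - det a b c
 det-swap (ax , ay) (bx , by) (cx , cy) = R.solve 6 (λ ax ay bx by cx cy →
  (ax :- bx) :* (cy :- by) :- (ay :- by) :* (cx :- bx)
  := :- ((bx :- ax) :* (cy :- ay) :- (by :- ay) :* (cx :- ax))) refl ax ay bx by cx cy

 det-total : ∀ a b c d → det a b c - det a b d ≡ det c d b - det c d a
 det-total (ax , ay) (bx , by) (cx , cy) (dx , dy) = R.solve 8 (λ ax ay bx by cx cy dx dy →
  ((bx :- ax) :* (cy :- ay) :- (by :- ay) :* (cx :- ax)) :- ((bx :- ax) :* (dy :- ay) :- (by :- ay) :* (dx :- ax))
  := ((dx :- cx) :* (by :- cy) :- (dy :- cy) :* (bx :- cx)) :- ((dx :- cx) :* (ay :- cy) :- (dy :- cy) :* (ax :- cx)))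
  refl ax ay bx by cx cy dx dy

 endpointˡ : ∀ a b → a ∈[ a , b ]
 endpointˡ (ax , ay) (bx , by) = 0ℚ , ≤-refl , ≤ᵇ⇒≤ {0ℚ} {1ℚ} _ , e ax bx , e ay by
  where
  e : ∀ u v → u ≡ u + 0ℚ * (v - u)
  e = R.solve 2 (λ u v → u := u :+ con 0ℚ :* (v :- u)) refl

 reverse-segment : ∀ {p a b} → p ∈[ a , b ] → p ∈[ b , a ]
 reverse-segment {_ , _} {ax , ay} {bx , by} (t , 0≤t , t≤1 , refl , refl) =
  1ℚ - t , 0≤- t≤1 , subst (_≤ 1ℚ) (flip₁ t) (+-monoʳ-≤ 1ℚ (neg-antimono-≤ 0≤t)) , e ax bx t , e ay by t
  where
  flip₁ : ∀ t → 1ℚ - t ≡ 1ℚ - t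
  flip₁ t = refl
  e : ∀ u v t → u + t * (v - u) ≡ v + (1ℚ - t) * (u - v)
  e = R.solve 3 (λ u v t → u :+ t :* (v :- u) := v :+ (con 1ℚ :- t) :* (u :- v)) refl

 endpointʳ : ∀ a b → b ∈[ a , b ]
 endpointʳ a b = reverse-segment {b} {b} {a} (endpointˡ b a)

 Apart : Point → Point → Point → Point → Set
 Apart a b c d = ∀ {p} → p ∈[ a , b ] → ¬ (p ∈[ c , d ])

 common-coordinate : ∀ {D} (h : 0ℚ < D) s t u w u′ w′ → D * u + t * w ≡ D * u′ + s * w′ →
  u + (t * recip h) * w ≡ u′ + (s * recip h) * w′
 common-coordinate {D} h s t u w u′ w′ e = trans (scaled t u w) (trans (cong (recip h *_) e) (sym (scaled s u′ w′)))
  where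
  scaled : ∀ t u w → u + (t * recip h) * w ≡ recip h * (D * u + t * w)
  scaled t u w = trans (cong (_+ (t * recip h) * w) (trans (sym (*-identityˡ u)) (cong (_* u) (sym (recip-inverse h)))))
   (R.solve 5 (λ D i t u w → D :* i :* u :+ (t :* i) :* w := i :* (D :* u :+ t :* w)) refl D (recip h) t u w)

 crossing : ∀ a b c d → 0ℚ < det a b c → det a b d ≤ 0ℚ → 0ℚ ≤ det c d b → det c d a ≤ 0ℚ → ¬ Apart a b c d
 crossing a@(ax , ay) b@(bx , by) c@(cx , cy) d@(dx , dy) hc hd hb ha apart =
  apart {ax + (t * recip 0<D) * (bx - ax) , ay + (t * recip 0<D) * (by - ay)}
   (t * recip 0<D , 0≤* 0≤t 0≤i , ratio≤1 0<D t≤D , refl , refl)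
   (s * recip 0<D , 0≤* (<⇒≤ hc) 0≤i , ratio≤1 0<D s≤D
    , common-coordinate 0<D s t ax (bx - ax) cx (dx - cx) (ex ax ay bx by cx cy dx dy)
    , common-coordinate 0<D s t ay (by - ay) cy (dy - cy) (ey ax ay bx by cx cy dx dy))
  where
  s t D : ℚ
  s = det a b c
  t = - det c d a
  D = det a b c - det a b d
  0<D : 0ℚ < D
  0<D = subst (_< D) (+-identityˡ 0ℚ) (+-mono-<-≤ hc (neg-antimono-≤ hd))
  0≤i : 0ℚ ≤ recip 0<D
  0≤i = <⇒≤ (0<recip 0<D)
  0≤t : 0ℚ ≤ t
  0≤t = neg-antimono-≤ ha
  s≤D : s ≤ D
  s≤D = subst (_≤ D) (+-identityʳ s) (+-monoʳ-≤ s (neg-antimono-≤ hd))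
  t≤D : t ≤ D
  t≤D = subst₂ _≤_ (+-identityˡ t) (sym (det-total a b c d)) (+-monoˡ-≤ t hb)
  ex : ∀ ax ay bx by cx cy dx dy → _
  ex = R.solve 8 (λ ax ay bx by cx cy dx dy →
   let
     dabc = (bx :- ax) :* (cy :- ay) :- (by :- ay) :* (cx :- ax)
     dabd = (bx :- ax) :* (dy :- ay) :- (by :- ay) :* (dx :- ax)
     dcda = (dx :- cx) :* (ay :- cy) :- (dy :- cy) :* (ax :- cx)
   in (dabc :- dabd) :* ax :+ (:- dcda) :* (bx :- ax) := (dabc :- dabd) :* cx :+ dabc :* (dx :- cx)) refl
  ey : ∀ ax ay bx by cx cy dx dy → _
  ey = R.solve 8 (λ ax ay bx by cx cy dx dy →
   let
     dabc = (bx :- ax) :* (cy :- ay) :- (by :- ay) :* (cx :- ax)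
     dabd = (bx :- ax) :* (dy :- ay) :- (by :- ay) :* (dx :- ax)
     dcda = (dx :- cx) :* (ay :- cy) :- (dy :- cy) :* (ax :- cx)
   in (dabc :- dabd) :* ay :+ (:- dcda) :* (by :- ay) := (dabc :- dabd) :* cy :+ dabc :* (dy :- cy)) refl

 collinear-between : ∀ a b c → det a b c ≡ 0ℚ → a ≺ c → c ≺ b → c ∈[ a , b ]
 collinear-between (ax , ay) (bx , by) (cx , cy) e ac cb = go (≺-trans ac cb) ac cb
  where
  e′ : (by - ay) * (cx - ax) ≡ (bx - ax) * (cy - ay)
  e′ = sym (trans (R.solve 2 (λ u v → u := (u :- v) :+ v) refl ((bx - ax) * (cy - ay)) ((by - ay) * (cx - ax)))
      (trans (cong (_+ (by - ay) * (cx - ax)) e) (+-identityˡ _)))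
  along : ∀ {D} (h : 0ℚ < D) t u w v → D * (v - u) ≡ t * w → v ≡ u + (t * recip h) * w
  along {D} h t u w v q = trans (R.solve 2 (λ u v → v := u :+ con 1ℚ :* (v :- u)) refl u v)
   (cong (u +_) (trans (cong (_* (v - u)) (sym (recip-inverse h)))
    (trans (R.solve 3 (λ D i x → D :* i :* x := i :* (D :* x)) refl D (recip h) (v - u))
     (trans (cong (recip h *_) q) (R.solve 3 (λ i t w → i :* (t :* w) := t :* i :* w) refl (recip h) t w)))))
  ≼ˣ : ∀ {p q} → p ≺ q → proj₁ p ≤ proj₁ q
  ≼ˣ (left h)  = <⇒≤ h
  ≼ˣ (below h) = ≤-refl
  go : (ax , ay) ≺ (bx , by) → (ax , ay) ≺ (cx , cy) → (cx , cy) ≺ (bx , by) → (cx , cy) ∈[ (ax , ay) , (bx , by) ]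
  go (left h) ac cb = (cx - ax) * recip 0<D , 0≤* (0≤- (≼ˣ ac)) (<⇒≤ (0<recip 0<D)) ,
   ratio≤1 0<D (+-monoˡ-≤ (- ax) (≼ˣ cb)) ,
   along 0<D (cx - ax) ax (bx - ax) cx (*-comm (bx - ax) (cx - ax)) ,
   along 0<D (cx - ax) ay (by - ay) cy (trans (sym e′) (*-comm (by - ay) (cx - ax)))
   where
   0<D : 0ℚ < bx - ax
   0<D = 0<- h
  go (below h) (left k) (left l) = ⊥-elim (<-irrefl refl (<-trans k l))
  go (below h) (left k) (below l) = ⊥-elim (<-irrefl refl k)
  go (below h) (below k) (left l) = ⊥-elim (<-irrefl refl l)
  go (below h) (below k) (below l) = (cy - ay) * recip 0<D , 0≤* (0≤- (<⇒≤ k)) (<⇒≤ (0<recip 0<D)) ,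
   ratio≤1 0<D (+-monoˡ-≤ (- ay) (<⇒≤ l)) ,
   R.solve 2 (λ u t → u := u :+ t :* (u :- u)) refl ax ((cy - ay) * recip 0<D) ,
   along 0<D (cy - ay) ay (by - ay) cy (*-comm (by - ay) (cy - ay))
   where
   0<D : 0ℚ < by - ay
   0<D = 0<- h

 abstract
  negative? : ℚ → Bool
  negative? q = ⌊ q <? 0ℚ ⌋

  negative⇒true : ∀ {q} → q < 0ℚ → negative? q ≡ true
  negative⇒true {q} h with q <? 0ℚ
  ... | yes _ = refl
  ... | no k  = ⊥-elim (k h)

  positive⇒false : ∀ {q} → 0ℚ < q → negative? q ≡ false
  positive⇒false {q} h with q <? 0ℚ
  ... | yes k = ⊥-elim (<-irrefl refl (<-trans h k))
  ... | no _  = refl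

 -- Whether the upward ray from p meets the segment ab.
 hits : Point → Point → Point → Bool
 hits p a b = if a ≺ᵇ b
  then ((a ≺ᵇ p) ∧ (not (b ≺ᵇ p) ∧ negative? (det a b p)))
  else ((b ≺ᵇ p) ∧ (not (a ≺ᵇ p) ∧ negative? (det b a p)))

 hits-sym : ∀ p a b → hits p a b ≡ hits p b a
 hits-sym p a b with ≺-cmp a b
 ... | tri< h _ _ rewrite ≺⇒true h | ≻⇒false h = refl
 ... | tri≈ _ refl _ = refl
 ... | tri> _ _ h rewrite ≺⇒true h | ≻⇒false h = refl

 -- As the foot of an upward ray moves along ab, the parity of its hits on cd
 -- changes only when the foot passes below c or d.
 SweepParity : Point → Point → Point → Point → Set
 SweepParity a b c d =
  hits a c d xor (hits b c d xor (hits c a b xor hits d a b))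
  ≡ (a ≺ᵇ c) xor ((b ≺ᵇ c) xor ((a ≺ᵇ d) xor (b ≺ᵇ d)))

 apart-swap : ∀ {a b c d} → Apart a b c d → Apart c d a b
 apart-swap h p q = h q p

 apart-flip : ∀ {a b c d} → Apart a b c d → Apart b a c d
 apart-flip {a} {b} h {p} q = h (reverse-segment {p} {b} {a} q)

 det-cycle : ∀ a b c → det a b c ≡ det b c a
 det-cycle (ax , ay) (bx , by) (cx , cy) = R.solve 6 (λ ax ay bx by cx cy →
  (bx :- ax) :* (cy :- ay) :- (by :- ay) :* (cx :- ax)
  := (cx :- bx) :* (ay :- by) :- (cy :- by) :* (ax :- bx)) refl ax ay bx by cx cy

 -- The affine dependence of four points of the plane, in difference form.
 affine-dependence : ∀ o p q r →
  (det o q r * (proj₁ p - proj₁ o) + det o r p * (proj₁ q - proj₁ o)) + det o p q * (proj₁ r - proj₁ o) ≡ 0ℚ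
  × (det o q r * (proj₂ p - proj₂ o) + det o r p * (proj₂ q - proj₂ o)) + det o p q * (proj₂ r - proj₂ o) ≡ 0ℚ
 affine-dependence (ax , ay) (bx , by) (cx , cy) (dx , dy) = ex (bx - ax) (by - ay) (cx - ax) (cy - ay) (dx - ax) (dy - ay)
  , ey (bx - ax) (by - ay) (cx - ax) (cy - ay) (dx - ax) (dy - ay)
  where
  ex : ∀ px py qx qy rx ry → ((qx * ry - qy * rx) * px + (rx * py - ry * px) * qx) + (px * qy - py * qx) * rx ≡ 0ℚ
  ex = R.solve 6 (λ px py qx qy rx ry → ((qx :* ry :- qy :* rx) :* px :+ (rx :* py :- ry :* px) :* qx)
   :+ (px :* qy :- py :* qx) :* rx := con 0ℚ) refl
  ey : ∀ px py qx qy rx ry → ((qx * ry - qy * rx) * py + (rx * py - ry * px) * qy) + (px * qy - py * qx) * ry ≡ 0ℚ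
  ey = R.solve 6 (λ px py qx qy rx ry → ((qx :* ry :- qy :* rx) :* py :+ (rx :* py :- ry :* px) :* qy)
   :+ (px :* qy :- py :* qx) :* ry := con 0ℚ) refl

 data Ahead (k : ℚ) (o p : Point) : Set where
  ahead  : 0ℚ < k → o ≺ p → Ahead k o p
  behind : k < 0ℚ → p ≺ o → Ahead k o p

 aheadᵥ : ∀ {k o p} → Ahead k o p → Positiveᵥ (k * (proj₁ p - proj₁ o)) (k * (proj₂ p - proj₂ o))
 aheadᵥ (ahead h q) = scaleᵥ h (≺-difference q)
 aheadᵥ {k} {ox , oy} {px , py} (behind h q) =
  subst₂ Positiveᵥ (e k px ox) (e k py oy) (scaleᵥ (0<neg h) (≺-difference q))
  where
  e : ∀ k p o → - k * (o - p) ≡ k * (p - o)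
  e = R.solve 3 (λ k p o → :- k :* (o :- p) := k :* (p :- o)) refl

 unbalanced : ∀ o p q r → Ahead (det o q r) o p → Ahead (det o r p) o q → ¬ Ahead (det o p q) o r
 unbalanced o p q r h k l = nonzeroᵥ (proj₁ dep) (proj₂ dep) (addᵥ (addᵥ (aheadᵥ h) (aheadᵥ k)) (aheadᵥ l))
  where
  dep = affine-dependence o p q r

 positive-cycle : ∀ a b c → 0ℚ < det a b c → 0ℚ < det b c a
 positive-cycle a b c = subst (0ℚ <_) (det-cycle a b c)

 negative-cycle : ∀ a b c → det a b c < 0ℚ → det b c a < 0ℚ
 negative-cycle a b c = subst (_< 0ℚ) (det-cycle a b c)

 positive-swap : ∀ a b c → 0ℚ < det a b c → det b a c < 0ℚ
 positive-swap a b c h = subst (_< 0ℚ) (sym (det-swap a b c)) (neg-antimono-< h)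

 negative-swap : ∀ a b c → det a b c < 0ℚ → 0ℚ < det b a c
 negative-swap a b c h = subst (0ℚ <_) (sym (det-swap a b c)) (neg-antimono-< h)

 nested-crossing : ∀ a b c d → a ≺ c → c ≺ b → a ≺ d → d ≺ b → 0ℚ < det a b c → det a b d < 0ℚ → ¬ Apart a b c d
 nested-crossing a b c d ac cb ad db h k = crossing a b c d h (<⇒≤ k)
  (≮⇒≥ λ l → unbalanced b a c d (behind (negative-cycle d b c (negative-cycle c d b l)) (≺-trans ac cb))
   (behind (negative-cycle a b d k) cb) (behind (positive-swap a b c h) db))
  (≮⇒≥ λ l → unbalanced a b c d (ahead (positive-cycle d a c (positive-cycle c d a l)) (≺-trans ac cb))
   (ahead (positive-cycle b a d (negative-swap a b d k)) ac) (ahead h ad))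

 overlap-crossing⁺ : ∀ a b c d → a ≺ c → c ≺ b → b ≺ d → 0ℚ < det a b c → 0ℚ < det c d b → ¬ Apart a b c d
 overlap-crossing⁺ a b c d ac cb bd h k = crossing a b c d h
  (≮⇒≥ λ l → unbalanced b c a d (behind (positive-swap a b d l) cb)
   (behind (positive-swap d b c (positive-cycle c d b k)) (≺-trans ac cb))
   (ahead (positive-cycle a b c h) bd))
  (<⇒≤ k)
  (≮⇒≥ λ l → unbalanced c b d a (ahead l cb)
   (ahead (positive-cycle b c a (positive-cycle a b c h)) (≺-trans cb bd))
   (behind (positive-swap b c d (positive-cycle d b c (positive-cycle c d b k))) ac))

 overlap-crossing⁻ : ∀ a b c d → a ≺ c → c ≺ b → b ≺ d → det a b c < 0ℚ → det c d b < 0ℚ → ¬ Apart a b c d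
 overlap-crossing⁻ a b c d ac cb bd h k apart = crossing b a c d (negative-swap a b c h)
  (≮⇒≥ λ l → unbalanced b a c d (behind (negative-cycle d b c (negative-cycle c d b k)) (≺-trans ac cb))
   (behind (negative-cycle a b d (subst₂ _<_ (trans (cong -_ (det-swap a b d)) (neg-involutive (det a b d))) refl (neg-antimono-< l))) cb)
   (ahead (negative-swap a b c h) bd))
  (≮⇒≥ λ l → unbalanced c d b a (ahead (negative-swap b c a (negative-cycle a b c h)) (≺-trans cb bd))
   (ahead (positive-cycle d c a (negative-swap c d a l)) cb) (behind k ac))
  (<⇒≤ k) (apart-flip {a} {b} {c} {d} apart)
  where
  neg-involutive : ∀ p → - - p ≡ p
  neg-involutive = R.solve 1 (λ p → :- (:- p) := p) refl

 not-between : ∀ a b c d → Apart a b c d → a ≺ c → c ≺ b → det a b c ≢ 0ℚ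
 not-between a b c d apart ac cb e = apart (collinear-between a b c e ac cb) (endpointˡ c d)

 sweep-nested : ∀ a b c d → Apart a b c d → a ≺ c → c ≺ d → d ≺ b → negative? (det a b c) ≡ negative? (det a b d)
 sweep-nested a b c d apart ac cd db with <-cmp (det a b c) 0ℚ | <-cmp (det a b d) 0ℚ
 ... | tri≈ _ e _ | _ = ⊥-elim (not-between a b c d apart ac (≺-trans cd db) e)
 ... | tri< _ _ _ | tri≈ _ e _ = ⊥-elim (apart (collinear-between a b d e (≺-trans ac cd) db) (endpointʳ c d))
 ... | tri> _ _ _ | tri≈ _ e _ = ⊥-elim (apart (collinear-between a b d e (≺-trans ac cd) db) (endpointʳ c d))
 ... | tri< h _ _ | tri< k _ _ = trans (negative⇒true h) (sym (negative⇒true k))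
 ... | tri> _ _ h | tri> _ _ k = trans (positive⇒false h) (sym (positive⇒false k))
 ... | tri> _ _ h | tri< k _ _ = ⊥-elim (nested-crossing a b c d ac (≺-trans cd db) (≺-trans ac cd) db h k apart)
 ... | tri< h _ _ | tri> _ _ k = ⊥-elim (nested-crossing a b d c (≺-trans ac cd) db ac (≺-trans cd db) k h
  (apart-swap {d} {c} {a} {b} (apart-flip {c} {d} {a} {b} (apart-swap {a} {b} {c} {d} apart))))

 sweep-overlap : ∀ a b c d → Apart a b c d → a ≺ c → c ≺ b → b ≺ d → negative? (det a b c) ≡ not (negative? (det c d b))
 sweep-overlap a b c d apart ac cb bd with <-cmp (det a b c) 0ℚ | <-cmp (det c d b) 0ℚ
 ... | tri≈ _ e _ | _ = ⊥-elim (not-between a b c d apart ac cb e)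
 ... | tri< _ _ _ | tri≈ _ e _ = ⊥-elim (apart (endpointʳ a b) (collinear-between c d b e cb bd))
 ... | tri> _ _ _ | tri≈ _ e _ = ⊥-elim (apart (endpointʳ a b) (collinear-between c d b e cb bd))
 ... | tri< h _ _ | tri> _ _ k = trans (negative⇒true h) (cong not (sym (positive⇒false k)))
 ... | tri> _ _ h | tri< k _ _ = trans (positive⇒false h) (cong not (sym (negative⇒true k)))
 ... | tri> _ _ h | tri> _ _ k = ⊥-elim (overlap-crossing⁺ a b c d ac cb bd h k apart)
 ... | tri< h _ _ | tri< k _ _ = ⊥-elim (overlap-crossing⁻ a b c d ac cb bd h k apart)

 sweep-ordered : ∀ a b c d → Apart a b c d → a ≺ b → c ≺ d → a ≺ c → SweepParity a b c d
 sweep-ordered a b c d apart ab cd ac with ≺-cmp b c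
 ... | tri≈ _ refl _ = ⊥-elim (apart (endpointʳ a b) (endpointˡ c d))
 ... | tri< bc _ _
  rewrite ≺⇒true ab | ≺⇒true cd | ≻⇒false ac | ≺⇒true ac | ≺⇒true bc | ≻⇒false bc
  | ≺⇒true (≺-trans ac cd) | ≺⇒true (≺-trans bc cd) = refl
 ... | tri> _ _ cb with ≺-cmp b d
 ...   | tri≈ _ refl _ = ⊥-elim (apart (endpointʳ a b) (endpointʳ c d))
 ...   | tri< bd _ _
  rewrite ≺⇒true ab | ≺⇒true cd | ≻⇒false ac | ≺⇒true ac | ≺⇒true cb | ≻⇒false cb
  | ≺⇒true (≺-trans ac cd) | ≺⇒true bd | ≻⇒false bd | sweep-overlap a b c d apart ac cb bd
  with negative? (det c d b)
 ...     | true  = refl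
 ...     | false = refl
 sweep-ordered a b c d apart ab cd ac | tri> _ _ cb | tri> _ _ db
  rewrite ≺⇒true ab | ≺⇒true cd | ≻⇒false ac | ≺⇒true ac | ≺⇒true cb | ≻⇒false cb
  | ≺⇒true (≺-trans ac cd) | ≻⇒false db | ≺⇒true db | sweep-nested a b c d apart ac cd db
  with negative? (det a b d)
 ...     | true  = refl
 ...     | false = refl

 sweep-swap : ∀ {a b c d} → Apart a b c d → SweepParity c d a b → SweepParity a b c d
 sweep-swap {a} {b} {c} {d} apart h = trans
  (X.solve 4 (λ p q r s → p X.:+ (q X.:+ (r X.:+ s)) X.:= r X.:+ (s X.:+ (p X.:+ q))) refl
   (hits a c d) (hits b c d) (hits c a b) (hits d a b))
  (trans h (trans flipped (X.solve 4 (λ p q r s → p X.:+ (r X.:+ (q X.:+ s)) X.:= p X.:+ (q X.:+ (r X.:+ s)))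
   refl (a ≺ᵇ c) (b ≺ᵇ c) (a ≺ᵇ d) (b ≺ᵇ d))))
  where
  nots : ∀ p q r s → not p xor (not q xor (not r xor not s)) ≡ p xor (q xor (r xor s))
  nots false false false false = refl
  nots false false false true = refl
  nots false false true false = refl
  nots false false true true = refl
  nots false true false false = refl
  nots false true false true = refl
  nots false true true false = refl
  nots false true true true = refl
  nots true false false false = refl
  nots true false false true = refl
  nots true false true false = refl
  nots true false true true = refl
  nots true true false false = refl
  nots true true false true = refl
  nots true true true false = refl
  nots true true true true = refl
  flipped : (c ≺ᵇ a) xor ((d ≺ᵇ a) xor ((c ≺ᵇ b) xor (d ≺ᵇ b)))
   ≡ (a ≺ᵇ c) xor ((a ≺ᵇ d) xor ((b ≺ᵇ c) xor (b ≺ᵇ d)))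
  flipped rewrite ≺ᵇ-anti {a} {c} (λ { refl → apart (endpointˡ a b) (endpointˡ c d) })
   | ≺ᵇ-anti {a} {d} (λ { refl → apart (endpointˡ a b) (endpointʳ c d) })
   | ≺ᵇ-anti {b} {c} (λ { refl → apart (endpointʳ a b) (endpointˡ c d) })
   | ≺ᵇ-anti {b} {d} (λ { refl → apart (endpointʳ a b) (endpointʳ c d) })
   = nots (a ≺ᵇ c) (a ≺ᵇ d) (b ≺ᵇ c) (b ≺ᵇ d)

 sweep-flip : ∀ {a b c d} → SweepParity b a c d → SweepParity a b c d
 sweep-flip {a} {b} {c} {d} h rewrite hits-sym c a b | hits-sym d a b = trans
  (X.solve 3 (λ p q r → p X.:+ (q X.:+ r) X.:= q X.:+ (p X.:+ r)) refl (hits a c d) (hits b c d) _)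
  (trans h (X.solve 4 (λ p q r s → q X.:+ (p X.:+ (s X.:+ r)) X.:= p X.:+ (q X.:+ (r X.:+ s))) refl
   (a ≺ᵇ c) (b ≺ᵇ c) (a ≺ᵇ d) (b ≺ᵇ d)))

 sweep-point : ∀ a c d → SweepParity a a c d
 sweep-point a c d = trans
  (X.solve 2 (λ p q → p X.:+ (p X.:+ q) X.:= q) refl (hits a c d) _)
  (trans (degenerate c d) (X.solve 2 (λ p q → con₀ X.:= p X.:+ (p X.:+ (q X.:+ q))) refl (a ≺ᵇ c) (a ≺ᵇ d)))
  where
  con₀ : ∀ {n} → X.Polynomial n
  con₀ = X.con false
  miss : ∀ p → hits p a a ≡ false
  miss p rewrite ≺ᵇ-refl a with a ≺ᵇ p
  ... | true  = refl
  ... | false = refl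
  degenerate : ∀ c d → hits c a a xor hits d a a ≡ false
  degenerate c d rewrite miss c | miss d = refl

 sweep-rising : ∀ a b c d → Apart a b c d → a ≺ b → c ≺ d → SweepParity a b c d
 sweep-rising a b c d apart ab cd with ≺-cmp a c
 ... | tri< ac _ _ = sweep-ordered a b c d apart ab cd ac
 ... | tri≈ _ refl _ = ⊥-elim (apart (endpointˡ a b) (endpointˡ c d))
 ... | tri> _ _ ca = sweep-swap apart (sweep-ordered c d a b (apart-swap {a} {b} {c} {d} apart) cd ab ca)

 sweep-target-rising : ∀ a b c d → Apart a b c d → c ≺ d → SweepParity a b c d
 sweep-target-rising a b c d apart cd with ≺-cmp a b
 ... | tri< ab _ _ = sweep-rising a b c d apart ab cd
 ... | tri≈ _ refl _ = sweep-point a c d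
 ... | tri> _ _ ba = sweep-flip {a} {b} {c} {d} (sweep-rising b a c d (apart-flip {a} {b} {c} {d} apart) ba cd)

 sweep-parity : ∀ a b c d → Apart a b c d → SweepParity a b c d
 sweep-parity a b c d apart with ≺-cmp c d
 ... | tri< cd _ _ = sweep-target-rising a b c d apart cd
 ... | tri≈ _ refl _ = sweep-swap {a} {b} {c} {c} apart (sweep-point c a b)
 ... | tri> _ _ dc = sweep-swap {a} {b} {c} {d} apart (sweep-flip {c} {d} {a} {b}
  (sweep-swap {d} {c} {a} {b} apart₁ (sweep-target-rising a b d c (apart-swap {d} {c} {a} {b} apart₁) dc)))
  where
  apart₁ : Apart d c a b
  apart₁ = apart-flip {c} {d} {a} {b} (apart-swap {a} {b} {c} {d} apart)

 pathHits : Point → List Point → Bool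
 pathHits p []           = false
 pathHits p (_ ∷ [])     = false
 pathHits p (a ∷ b ∷ ps) = hits p a b xor pathHits p (b ∷ ps)

 end : Point → List Point → Point
 end a []       = a
 end a (b ∷ ps) = end b ps

 PathParity : Point → List Point → Point → List Point → Set
 PathParity a ps c qs =
  pathHits a (c ∷ qs) xor (pathHits (end a ps) (c ∷ qs) xor (pathHits c (a ∷ ps) xor pathHits (end c qs) (a ∷ ps)))
  ≡ (a ≺ᵇ c) xor ((end a ps ≺ᵇ c) xor ((a ≺ᵇ end c qs) xor (end a ps ≺ᵇ end c qs)))

 segment-path-parity : ∀ a b c qs → (∀ {p} → p ∈[ a , b ] → ¬ (p ∈path (c ∷ qs))) → PathParity a (b ∷ []) c qs
 segment-path-parity a b c [] _ = X.solve 3 (λ p q r →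
  X.con false X.:+ (X.con false X.:+ ((r X.:+ X.con false) X.:+ (r X.:+ X.con false))) X.:= p X.:+ (q X.:+ (p X.:+ q)))
  refl (a ≺ᵇ c) (b ≺ᵇ c) (hits c a b)
 segment-path-parity a b c (d ∷ qs) apart = trans
  (X.solve 7 (λ p q r s t u v →
   (p X.:+ q) X.:+ ((r X.:+ s) X.:+ ((t X.:+ X.con false) X.:+ v))
   X.:= (p X.:+ (r X.:+ (t X.:+ u))) X.:+ (q X.:+ (s X.:+ ((u X.:+ X.con false) X.:+ v)))) refl
   (hits a c d) (pathHits a (d ∷ qs)) (hits b c d) (pathHits b (d ∷ qs)) (hits c a b) (hits d a b) _)
  (trans (cong₂ _xor_ (sweep-parity a b c d (λ h k → apart h (here k)))
            (segment-path-parity a b d qs (λ h k → apart h (there k))))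
   (X.solve 6 (λ p q r s t u → (p X.:+ (q X.:+ (r X.:+ s))) X.:+ (r X.:+ (s X.:+ (t X.:+ u)))
    X.:= p X.:+ (q X.:+ (t X.:+ u))) refl
    (a ≺ᵇ c) (b ≺ᵇ c) (a ≺ᵇ d) (b ≺ᵇ d) (a ≺ᵇ end d qs) (b ≺ᵇ end d qs)))

 path-parity : ∀ a ps c qs → (∀ {p} → p ∈path (a ∷ ps) → ¬ (p ∈path (c ∷ qs))) → PathParity a ps c qs
 path-parity a [] c qs _ = X.solve 3 (λ p q r →
  p X.:+ (p X.:+ (X.con false X.:+ X.con false)) X.:= q X.:+ (q X.:+ (r X.:+ r))) refl
  (pathHits a (c ∷ qs)) (a ≺ᵇ c) (a ≺ᵇ end c qs)
 path-parity a (b ∷ ps) c qs apart = trans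
  (X.solve 7 (λ p q r s t u v →
   p X.:+ (q X.:+ ((r X.:+ s) X.:+ (t X.:+ u)))
   X.:= (p X.:+ (v X.:+ ((r X.:+ X.con false) X.:+ (t X.:+ X.con false)))) X.:+ (v X.:+ (q X.:+ (s X.:+ u)))) refl
   (pathHits a (c ∷ qs)) (pathHits (end b ps) (c ∷ qs)) (hits c a b) (pathHits c (b ∷ ps))
   (hits (end c qs) a b) (pathHits (end c qs) (b ∷ ps)) (pathHits b (c ∷ qs)))
  (trans (cong₂ _xor_ (segment-path-parity a b c qs (λ h → apart (here h)))
            (path-parity b ps c qs (λ h → apart (there h))))
   (X.solve 6 (λ p q r s t u → (p X.:+ (q X.:+ (r X.:+ s))) X.:+ (q X.:+ (t X.:+ (s X.:+ u)))
    X.:= p X.:+ (t X.:+ (r X.:+ u))) refl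
    (a ≺ᵇ c) (b ≺ᵇ c) (a ≺ᵇ end c qs) (b ≺ᵇ end c qs) (end b ps ≺ᵇ c) (end b ps ≺ᵇ end c qs)))

module Parity where
 open import Data.Bool using (_xor_; if_then_else_; T)
 open import Data.Bool.Properties using (T-≡; ∧-comm; ∨-comm; xor-comm)
 open import Data.Bool.Solver using (module xor-∧-Solver)
 open import Data.Fin using (Fin) renaming (_<_ to _<ᶠ_)
 import Data.Fin.Properties as Fin
 open import Data.List.Relation.Unary.All using (All; []; _∷_)
 import Data.Sum.Properties as Sum
 open import Data.Unit using (tt)
 import Data.Unit.Properties as Unit
 open import Data.Vec using (Vec; []; _∷_)
 open import Data.Vec.Relation.Unary.AllPairs using ([]; _∷_)
 import Data.Vec.Relation.Unary.All as V
 open import Function.Bundles using (Equivalence)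
 open import Relation.Binary.PropositionalEquality using (module ≡-Reasoning)
 open import Relation.Nullary.Decidable using (isYes)
 open Geometry

 private module X = xor-∧-Solver

 -- What is retained of a plane drawing: an order of the vertices (by abscissa)
 -- and, for a vertex u and an edge cd, the parity of the number of crossings of cd
 -- with the upward ray from u.
 record ParityGraph (V : Set) : Set where
  field
   adj        : V → V → Bool
   adj-sym    : ∀ x y → adj x y ≡ adj y x
   adj-irrefl : ∀ x → adj x x ≡ false
   before      : V → V → Bool
   before-anti : ∀ {x y} → x ≢ y → before y x ≡ not (before x y)
   ray         : V → V → V → Bool
   ray-sym     : ∀ x c d → ray x c d ≡ ray x d c
   parity      : ∀ {u v c d} → adj u v ≡ true → adj c d ≡ true → u ≢ c → u ≢ d → v ≢ c → v ≢ d →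
    ray u c d xor (ray v c d xor (ray c u v xor ray d u v))
    ≡ before u c xor (before v c xor (before u d xor before v d))

  ~-sym : ∀ {x y} → adj x y ≡ true → adj y x ≡ true
  ~-sym {x} {y} h = trans (adj-sym y x) h

  ~⇒≢ : ∀ {x y} → adj x y ≡ true → x ≢ y
  ~⇒≢ {x} h refl with trans (sym h) (adj-irrefl x)
  ... | ()

 true≢false : ∀ {b} → b ≡ true → b ≢ false
 true≢false refl ()

 module _ {n} (G : Graph (Fin n)) (D : Drawing G) where
  private module G = Graph G
  open Drawing D

  arcHits : ∀ (x u v : Fin n) → Tri (u <ᶠ v) (u ≡ v) (v <ᶠ u) → Bool
  arcHits x u v (tri< _ _ _) = pathHits (pos x) (arc (u , v))
  arcHits x u v (tri≈ _ _ _) = false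
  arcHits x u v (tri> _ _ _) = pathHits (pos x) (arc (v , u))

  arcRay : Fin n → Fin n → Fin n → Bool
  arcRay x u v = arcHits x u v (Fin.<-cmp u v)

  arcRay-sym : ∀ x u v → arcRay x u v ≡ arcRay x v u
  arcRay-sym x u v with Fin.<-cmp u v | Fin.<-cmp v u
  ... | tri< _ _ _ | tri> _ _ _ = refl
  ... | tri> _ _ _ | tri< _ _ _ = refl
  ... | tri≈ _ _ _ | tri≈ _ _ _ = refl
  ... | tri< h _ _ | tri< _ _ k = ⊥-elim (k h)
  ... | tri< h _ _ | tri≈ _ _ k = ⊥-elim (k h)
  ... | tri> _ _ h | tri> k _ _ = ⊥-elim (k h)
  ... | tri> _ _ h | tri≈ k _ _ = ⊥-elim (k h)
  ... | tri≈ _ h _ | tri< _ k _ = ⊥-elim (k (sym h))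
  ... | tri≈ _ h _ | tri> _ k _ = ⊥-elim (k (sym h))

  arcs-apart : ∀ {u v c d} → IsEdge G (u , v) → IsEdge G (c , d) → u ≢ c → u ≢ d → v ≢ c → v ≢ d →
   ∀ {p} → p ∈path arc (u , v) → ¬ (p ∈path arc (c , d))
  arcs-apart {u} {v} {c} {d} e f uc ud vc vd {p} h k = interior-disjoint e f (λ { refl → uc refl })
   (h , (λ { refl → interior-vertex f (k , uc ∘ pos-injective , ud ∘ pos-injective) u refl })
     , (λ { refl → interior-vertex f (k , vc ∘ pos-injective , vd ∘ pos-injective) v refl })) k

  end-arc : ∀ a ps b → end a (ps ++ b ∷ []) ≡ b
  end-arc a []       b = refl
  end-arc a (c ∷ ps) b = end-arc c ps b

  arc-parity : ∀ {u v c d} → IsEdge G (u , v) → IsEdge G (c , d) → u ≢ c → u ≢ d → v ≢ c → v ≢ d →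
   pathHits (pos u) (arc (c , d)) xor (pathHits (pos v) (arc (c , d)) xor
    (pathHits (pos c) (arc (u , v)) xor pathHits (pos d) (arc (u , v))))
   ≡ (pos u ≺ᵇ pos c) xor ((pos v ≺ᵇ pos c) xor ((pos u ≺ᵇ pos d) xor (pos v ≺ᵇ pos d)))
  arc-parity {u} {v} {c} {d} e f uc ud vc vd
   with path-parity (pos u) (bends (u , v) ++ pos v ∷ []) (pos c) (bends (c , d) ++ pos d ∷ []) (arcs-apart e f uc ud vc vd)
  ... | h rewrite end-arc (pos u) (bends (u , v)) (pos v) | end-arc (pos c) (bends (c , d)) (pos d) = h

  swap₂ : ∀ p q r → p xor (q xor r) ≡ q xor (p xor r)
  swap₂ = X.solve 3 (λ p q r → p X.:+ (q X.:+ r) X.:= q X.:+ (p X.:+ r)) refl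

  swap₄ : ∀ p q r s → p xor (q xor (r xor s)) ≡ q xor (p xor (s xor r))
  swap₄ = X.solve 4 (λ p q r s → p X.:+ (q X.:+ (r X.:+ s)) X.:= q X.:+ (p X.:+ (s X.:+ r))) refl

  exchange₄ : ∀ p q r s → p xor (q xor (r xor s)) ≡ r xor (s xor (p xor q))
  exchange₄ = X.solve 4 (λ p q r s → p X.:+ (q X.:+ (r X.:+ s)) X.:= r X.:+ (s X.:+ (p X.:+ q))) refl

  parityGraph : ParityGraph (Fin n)
  parityGraph = record
   { adj = G.adj
   ; adj-sym = adj-sym
   ; adj-irrefl = adj-irrefl
   ; before = λ x y → pos x ≺ᵇ pos y
   ; before-anti = λ h → ≺ᵇ-anti (h ∘ pos-injective)
   ; ray = arcRay
   ; ray-sym = arcRay-sym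
   ; parity = parity
   }
   where
   adj-sym : ∀ x y → G.adj x y ≡ G.adj y x
   adj-sym x y with G.adj x y in e | G.adj y x in f
   ... | true  | true  = refl
   ... | false | false = refl
   ... | true  | false = ⊥-elim (subst T f (G.~-sym (subst T (sym e) tt)))
   ... | false | true  = ⊥-elim (subst T e (G.~-sym (subst T (sym f) tt)))
   adj-irrefl : ∀ x → G.adj x x ≡ false
   adj-irrefl x with G.adj x x in e
   ... | false = refl
   ... | true  = ⊥-elim (G.~-irrefl refl (subst T (sym e) tt))
   irr : ∀ {x y} → G.adj x y ≡ true → x ≢ y
   irr h refl = G.~-irrefl refl (Equivalence.from T-≡ h)
   flip-adj : ∀ {x y} → G.adj x y ≡ true → T (G.adj y x)
   flip-adj h = G.~-sym (Equivalence.from T-≡ h)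
   keep : ∀ {x y} → G.adj x y ≡ true → T (G.adj x y)
   keep = Equivalence.from T-≡
   parity : ∀ {u v c d} → G.adj u v ≡ true → G.adj c d ≡ true → u ≢ c → u ≢ d → v ≢ c → v ≢ d →
    arcRay u c d xor (arcRay v c d xor (arcRay c u v xor arcRay d u v))
    ≡ (pos u ≺ᵇ pos c) xor ((pos v ≺ᵇ pos c) xor ((pos u ≺ᵇ pos d) xor (pos v ≺ᵇ pos d)))
   H : Fin n → Fin n → Fin n → Bool
   H x a b = pathHits (pos x) (arc (a , b))
   parity {u} {v} {c} {d} e f uc ud vc vd with Fin.<-cmp u v | Fin.<-cmp c d
   ... | tri≈ _ h _ | _ = ⊥-elim (irr e h)
   ... | _ | tri≈ _ h _ = ⊥-elim (irr f h)
   ... | tri< h _ _ | tri< k _ _ = arc-parity (h , keep e) (k , keep f) uc ud vc vd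
   ... | tri> _ _ h | tri< k _ _ = trans (swap₂ (H u c d) (H v c d) (H c v u xor H d v u))
    (trans (arc-parity (h , flip-adj e) (k , keep f) vc vd uc ud)
        (swap₄ (pos v ≺ᵇ pos c) (pos u ≺ᵇ pos c) (pos v ≺ᵇ pos d) (pos u ≺ᵇ pos d)))
   ... | tri< h _ _ | tri> _ _ k = trans (cong (λ p → H u d c xor (H v d c xor p)) (xor-comm (H c u v) (H d u v)))
    (trans (arc-parity (h , keep e) (k , flip-adj f) ud uc vd vc)
        (exchange₄ (pos u ≺ᵇ pos d) (pos v ≺ᵇ pos d) (pos u ≺ᵇ pos c) (pos v ≺ᵇ pos c)))
   ... | tri> _ _ h | tri> _ _ k = trans (swap₄ (H u d c) (H v d c) (H c v u) (H d v u))
    (trans (arc-parity (h , flip-adj e) (k , flip-adj f) vd vc ud uc)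
     (trans (exchange₄ (pos v ≺ᵇ pos d) (pos u ≺ᵇ pos d) (pos v ≺ᵇ pos c) (pos u ≺ᵇ pos c))
      (swap₄ (pos v ≺ᵇ pos c) (pos u ≺ᵇ pos c) (pos v ≺ᵇ pos d) (pos u ≺ᵇ pos d))))

 module _ {V : Set} (G : ParityGraph V) where
  open ParityGraph G

  restrict : (b : V → V → Bool) → (∀ x y → b x y ≡ b y x) → (∀ x y → b x y ≡ true → adj x y ≡ true) → ParityGraph V
  restrict b b-sym b⊆ = record
   { adj = b ; adj-sym = b-sym ; adj-irrefl = irrefl
   ; before = before ; before-anti = before-anti ; ray = ray ; ray-sym = ray-sym
   ; parity = λ e f → parity (b⊆ _ _ e) (b⊆ _ _ f) }
   where
   irrefl : ∀ x → b x x ≡ false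
   irrefl x with b x x in e
   ... | false = refl
   ... | true  = ⊥-elim (~⇒≢ (b⊆ x x e) refl)

 ∧ˡ : ∀ {a b} → a ∧ b ≡ true → a ≡ true
 ∧ˡ {true} h = refl

 ∧ʳ : ∀ {a b} → a ∧ b ≡ true → b ≡ true
 ∧ʳ {true} h = h

 ∧-true : ∀ {a b} → a ≡ true → b ≡ true → a ∧ b ≡ true
 ∧-true refl refl = refl

 ∨-true : ∀ {a b} → a ∨ b ≡ true → (a ≡ true) ⊎ (b ≡ true)
 ∨-true {true}  h = inj₁ refl
 ∨-true {false} h = inj₂ h

 not-true : ∀ {a} → not a ≡ true → a ≡ false
 not-true {false} h = refl

 module Contraction {V : Set} (_≟_ : DecidableEquality V) (G : ParityGraph V) (u v : V)
  (uv : ParityGraph.adj G u v ≡ true) where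
  open ParityGraph G

  _==_ : V → V → Bool
  x == y = isYes (x ≟ y)

  ==-sym : ∀ x y → (x == y) ≡ (y == x)
  ==-sym x y with x ≟ y | y ≟ x
  ... | yes _ | yes _ = refl
  ... | no _  | no _  = refl
  ... | yes h | no k  = ⊥-elim (k (sym h))
  ... | no h  | yes k = ⊥-elim (h (sym k))

  ==⇒≡ : ∀ {x y} → (x == y) ≡ true → x ≡ y
  ==⇒≡ {x} {y} h with x ≟ y
  ... | yes k = k

  ≠⇒≢ : ∀ {x y} → (x == y) ≡ false → x ≢ y
  ≠⇒≢ {x} {y} h with x ≟ y
  ... | no k = k

  adj′ : V → V → Bool
  adj′ x y = not (x == y) ∧ ((not (x == v) ∧ not (y == v)) ∧
   (adj x y ∨ (((x == u) ∧ adj v y) ∨ ((y == u) ∧ adj v x))))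

  adj′-sym : ∀ x y → adj′ x y ≡ adj′ y x
  adj′-sym x y rewrite ==-sym x y | adj-sym x y =
   cong₂ (λ p q → not (y == x) ∧ (p ∧ (adj y x ∨ q))) (∧-comm (not (x == v)) _) (∨-comm ((x == u) ∧ adj v y) _)

  adj′-irrefl : ∀ x → adj′ x x ≡ false
  adj′-irrefl x with x ≟ x
  ... | yes _ = refl
  ... | no h  = ⊥-elim (h refl)

  ray′ : V → V → V → Bool
  ray′ x c d = if adj c d then ray x c d else (ray x c v xor ray x v d)

  ray′-sym : ∀ x c d → ray′ x c d ≡ ray′ x d c
  ray′-sym x c d rewrite adj-sym c d with adj d c
  ... | true  = ray-sym x c d
  ... | false = trans (xor-comm (ray x c v) _) (cong₂ _xor_ (ray-sym x v d) (ray-sym x c v))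

  data Edge′ (x y : V) : Set where
   direct : adj x y ≡ true → x ≢ v → y ≢ v → Edge′ x y
   via    : adj x y ≡ false → adj x v ≡ true → adj v y ≡ true → x ≢ v → y ≢ v → (x ≡ u) ⊎ (y ≡ u) → Edge′ x y

  edge′ : ∀ x y → adj′ x y ≡ true → Edge′ x y
  edge′ x y h with adj x y in e
  ... | true  = direct e (≠⇒≢ (not-true (∧ˡ (∧ˡ (∧ʳ {not (x == y)} h)))))
              (≠⇒≢ (not-true (∧ʳ {not (x == v)} (∧ˡ (∧ʳ {not (x == y)} h)))))
  ... | false with ∧ʳ {not (x == y)} h
  ...   | k with ∨-true {(x == u) ∧ adj v y} (∧ʳ {not (x == v) ∧ not (y == v)} k)
  ...     | inj₁ l with ==⇒≡ (∧ˡ l)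
  ...       | refl = via e uv (∧ʳ {x == u} l) (≠⇒≢ (not-true (∧ˡ (∧ˡ k))))
              (≠⇒≢ (not-true (∧ʳ {not (x == v)} (∧ˡ k)))) (inj₁ refl)
  edge′ x y h | false | k | inj₂ l with ==⇒≡ (∧ˡ l)
  ...       | refl = via e (~-sym (∧ʳ {y == u} l)) (~-sym uv) (≠⇒≢ (not-true (∧ˡ (∧ˡ k))))
              (≠⇒≢ (not-true (∧ʳ {not (x == v)} (∧ˡ k)))) (inj₂ refl)

  exchange : ∀ p q r s → p xor (q xor (r xor s)) ≡ r xor (s xor (p xor q))
  exchange = X.solve 4 (λ p q r s → p X.:+ (q X.:+ (r X.:+ s)) X.:= r X.:+ (s X.:+ (p X.:+ q))) refl

  direct-via : ∀ {x y c d} → adj x y ≡ true → x ≢ v → y ≢ v → adj c v ≡ true → adj v d ≡ true →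
   x ≢ c → x ≢ d → y ≢ c → y ≢ d →
   (ray x c v xor ray x v d) xor ((ray y c v xor ray y v d) xor (ray c x y xor ray d x y))
   ≡ before x c xor (before y c xor (before x d xor before y d))
  direct-via {x} {y} {c} {d} e xv yv f g xc xd yc yd = trans
   (X.solve 7 (λ p q r s t w z → (p X.:+ q) X.:+ ((r X.:+ s) X.:+ (t X.:+ w))
    X.:= (p X.:+ (r X.:+ (t X.:+ z))) X.:+ (q X.:+ (s X.:+ (z X.:+ w)))) refl
    (ray x c v) (ray x v d) (ray y c v) (ray y v d) (ray c x y) (ray d x y) (ray v x y))
   (trans (cong₂ _xor_ (parity e f xc xv yc yv) (parity e g xv xd yv yd))
    (X.solve 6 (λ p q r s t w → (p X.:+ (q X.:+ (r X.:+ s))) X.:+ (r X.:+ (s X.:+ (t X.:+ w)))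
     X.:= p X.:+ (q X.:+ (t X.:+ w))) refl
     (before x c) (before y c) (before x v) (before y v) (before x d) (before y d)))

  disjoint-at-u : ∀ {x y c d : V} → x ≢ c → x ≢ d → y ≢ c → y ≢ d → (x ≡ u) ⊎ (y ≡ u) → (c ≡ u) ⊎ (d ≡ u) → ⊥
  disjoint-at-u xc xd yc yd (inj₁ refl) (inj₁ refl) = xc refl
  disjoint-at-u xc xd yc yd (inj₁ refl) (inj₂ refl) = xd refl
  disjoint-at-u xc xd yc yd (inj₂ refl) (inj₁ refl) = yc refl
  disjoint-at-u xc xd yc yd (inj₂ refl) (inj₂ refl) = yd refl

  parity′ : ∀ {x y c d} → adj′ x y ≡ true → adj′ c d ≡ true → x ≢ c → x ≢ d → y ≢ c → y ≢ d →
   ray′ x c d xor (ray′ y c d xor (ray′ c x y xor ray′ d x y))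
   ≡ before x c xor (before y c xor (before x d xor before y d))
  parity′ {x} {y} {c} {d} h k xc xd yc yd with edge′ x y h | edge′ c d k
  ... | direct e _ _ | direct f _ _ rewrite e | f = parity e f xc xd yc yd
  ... | direct e xv yv | via nf f g _ _ _ rewrite e | nf = direct-via e xv yv f g xc xd yc yd
  ... | via ne e f _ _ _ | direct g cv dv rewrite ne | g = trans (exchange (ray x c d) (ray y c d) (ray c x v xor ray c v y) (ray d x v xor ray d v y))
   (trans (direct-via g cv dv e f (xc ∘ sym) (yc ∘ sym) (xd ∘ sym) (yd ∘ sym)) nots)
   where
   nots : before c x xor (before d x xor (before c y xor before d y))
    ≡ before x c xor (before y c xor (before x d xor before y d))
   nots rewrite before-anti xc | before-anti xd | before-anti yc | before-anti yd =
    trans (cancel (before x c) (before x d) (before y c) (before y d))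
     (X.solve 4 (λ p q r s → p X.:+ (q X.:+ (r X.:+ s)) X.:= p X.:+ (r X.:+ (q X.:+ s))) refl
      (before x c) (before x d) (before y c) (before y d))
    where
    pair : ∀ p q r → not p xor (not q xor r) ≡ p xor (q xor r)
    pair false false r = not-involutive′ r
     where
     not-involutive′ : ∀ r → true xor (true xor r) ≡ r
     not-involutive′ false = refl
     not-involutive′ true  = refl
    pair false true  r = refl
    pair true  false r = refl
    pair true  true  false = refl
    pair true  true  true  = refl
    cancel : ∀ p q r s → not p xor (not q xor (not r xor not s)) ≡ p xor (q xor (r xor s))
    cancel p q r s = trans (pair p q (not r xor not s)) (cong (λ z → p xor (q xor z)) (pair₂ r s))
     where
     pair₂ : ∀ r s → not r xor not s ≡ r xor s
     pair₂ false false = refl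
     pair₂ false true  = refl
     pair₂ true  false = refl
     pair₂ true  true  = refl
  ... | via _ _ _ _ _ a | via _ _ _ _ _ b = ⊥-elim (disjoint-at-u xc xd yc yd a b)

  contract : ParityGraph V
  contract = record
   { adj = adj′ ; adj-sym = adj′-sym ; adj-irrefl = adj′-irrefl
   ; before = before ; before-anti = before-anti ; ray = ray′ ; ray-sym = ray′-sym ; parity = parity′ }

module Drawings where
 open import Data.Bool using (if_then_else_)
 open import Data.Fin using (Fin; toℕ)
 import Data.Fin.Properties as Fin
 open import Data.Nat as ℕ using (ℕ; zero; suc; z≤n; s≤s)
 import Data.Nat.Properties as ℕ
 open import Data.Rational using (ℚ; 0ℚ; 1ℚ; _+_; _*_; _-_; -_; _<_; _≤_)
 open import Data.Rational.Properties
 open import Data.Rational.Solver using (module +-*-Solver)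
 open import Function.Definitions using (Injective)
 open import Relation.Nullary.Decidable using (from-yes)
 open Geometry using (0<-; 0≤-; 0≤*; 0<*; 0≤+; 0<+; reverse-segment)

 private module R = +-*-Solver
 open R using (_:=_; _:+_; _:*_; _:-_; :-_; con)

 record Form : Set where
  field
   at     : Point → ℚ
   affine : ∀ x y x′ y′ t → at (x + t * (x′ - x) , y + t * (y′ - y)) ≡ (1ℚ - t) * at (x , y) + t * at (x′ , y′)
 open Form

 ≤0- : ∀ {p q} → p ≤ q → p - q ≤ 0ℚ
 ≤0- {p} {q} h = subst (p - q ≤_) (+-inverseʳ q) (+-monoˡ-≤ (- q) h)

 self : ∀ c → 0ℚ ≤ c - c
 self c = ≤-reflexive (sym (+-inverseʳ c))

 neg-nonneg : ∀ {p} → 0ℚ ≤ - p → p ≤ 0ℚ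
 neg-nonneg {p} h = subst (_≤ 0ℚ) (R.solve 1 (λ p → :- (:- p) := p) refl p) (neg-antimono-≤ h)

 nonneg-neg : ∀ {p} → p ≤ 0ℚ → 0ℚ ≤ - p
 nonneg-neg h = neg-antimono-≤ h

 module _ (f : Form) where

  nonpositive : ∀ {p u v} → p ∈[ u , v ] → at f u ≤ 0ℚ → at f v ≤ 0ℚ → at f p ≤ 0ℚ
  nonpositive {u = x , y} {x′ , y′} (t , 0≤t , t≤1 , refl , refl) hu hv = subst (_≤ 0ℚ) (sym (affine f x y x′ y′ t))
   (neg-nonneg (subst (0ℚ ≤_) (R.solve 3 (λ t a b → (con 1ℚ :- t) :* (:- a) :+ t :* (:- b) := :- ((con 1ℚ :- t) :* a :+ t :* b)) refl t (at f (x , y)) (at f (x′ , y′)))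
    (0≤+ (0≤* (0≤- t≤1) (nonneg-neg hu)) (0≤* 0≤t (nonneg-neg hv)))))

  only-last : ∀ {p u v} → p ∈[ u , v ] → 0ℚ < at f u → 0ℚ ≤ at f v → at f p ≤ 0ℚ → p ≡ v
  only-last {u = x , y} {x′ , y′} (t , 0≤t , t≤1 , refl , refl) hu hv h = by (<-cmp t 1ℚ)
   where
   by : Tri (t < 1ℚ) (t ≡ 1ℚ) (1ℚ < t) → (x + t * (x′ - x) , y + t * (y′ - y)) ≡ (x′ , y′)
   by (tri> _ _ k) = ⊥-elim (<-irrefl refl (<-≤-trans k t≤1))
   by (tri≈ _ refl _) = cong₂ _,_ (end x x′) (end y y′)
    where
    end : ∀ a b → a + 1ℚ * (b - a) ≡ b
    end = R.solve 2 (λ a b → a :+ con 1ℚ :* (b :- a) := b) refl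
   by (tri< k _ _) = ⊥-elim (<-irrefl refl (<-≤-trans (subst₂ _<_ (+-identityʳ 0ℚ) (sym (affine f x y x′ y′ t)) (+-mono-<-≤ (0<* (0<- k) hu) (0≤* 0≤t hv))) h))

 _on_ : Point → Point × Point → Set
 p on (u , v) = p ∈path (u ∷ v ∷ [])

 module _ (f : Form) where

  nonpositive-on : ∀ {p u v} → p on (u , v) → at f u ≤ 0ℚ → at f v ≤ 0ℚ → at f p ≤ 0ℚ
  nonpositive-on {p} {u} {v} (here h) = nonpositive f {p} {u} {v} h
  nonpositive-on (there ())

  last-on : ∀ {p u v} → p on (u , v) → 0ℚ < at f u → 0ℚ ≤ at f v → at f p ≤ 0ℚ → p ≡ v
  last-on {p} {u} {v} (here h) = only-last f {p} {u} {v} h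
  last-on (there ())

  first-on : ∀ {p u v} → p on (u , v) → 0ℚ ≤ at f u → 0ℚ < at f v → at f p ≤ 0ℚ → p ≡ u
  first-on {p} {u} {v} (here h) a b = only-last f {p} {v} {u} (reverse-segment {p} {u} {v} h) b a
  first-on (there ())

 bent : ∀ {p u c v} → p ∈path (u ∷ c ∷ v ∷ []) → p on (u , c) ⊎ p on (c , v)
 bent (here h)  = inj₁ (here h)
 bent (there i) = inj₂ i

 record Scheme : Set₁ where
  field
   Vertex : Point → Set
   Shape  : Point → Point → List Point → Set
   simple : ∀ {u v ps} → Shape u v ps → Simple ps
   ends   : ∀ {u v ps w} → Shape u v ps → Vertex w → w ∈path ps → w ≡ u ⊎ w ≡ v
   meets  : ∀ {u v ps u′ v′ qs p} → Shape u v ps → Shape u′ v′ qs → p ∈path ps → p ∈path qs → (u ≡ u′ × v ≡ v′) ⊎ Vertex p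

  draw : ∀ {n} (G : Graph (Fin n)) (pos : Fin n → Point) → Injective _≡_ _≡_ pos → (∀ u → Vertex (pos u)) →
   (bends : Fin n × Fin n → List Point) → (∀ {u v} → IsEdge G (u , v) → Shape (pos u) (pos v) (pos u ∷ bends (u , v) ++ pos v ∷ [])) → Drawing G
  draw G pos inj vertex bends shape = record
   { pos = pos ; pos-injective = inj ; bends = bends
   ; arc-simple = λ h → simple (shape h)
   ; interior-vertex = λ h i w → λ { refl → not-vertex (shape h) i (vertex w) }
   ; interior-disjoint = λ he hf e≢f i j → disjoint e≢f i (shape he) (meets (shape he) (shape hf) (proj₁ i) j) }
   where
   not-vertex : ∀ {u v ps p} → Shape u v ps → p ∈path ps × p ≢ u × p ≢ v → ¬ Vertex p
   not-vertex s (i , pu , pv) w = by (ends s w i)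
    where
    by : _ ≡ _ ⊎ _ ≡ _ → ⊥
    by (inj₁ e) = pu e
    by (inj₂ e) = pv e
   disjoint : ∀ {e f ps p} → e ≢ f → p ∈path ps × p ≢ pos (proj₁ e) × p ≢ pos (proj₂ e) → Shape (pos (proj₁ e)) (pos (proj₂ e)) ps →
    (pos (proj₁ e) ≡ pos (proj₁ f) × pos (proj₂ e) ≡ pos (proj₂ f)) ⊎ Vertex p → ⊥
   disjoint ne i s (inj₁ (a , b)) = ne (cong₂ _,_ (inj a) (inj b))
   disjoint ne i s (inj₂ w) = not-vertex s i w

 ι : ℕ → ℚ
 ι zero    = 0ℚ
 ι (suc k) = 1ℚ + ι k

 0<1 : 0ℚ < 1ℚ
 0<1 = from-yes (0ℚ <? 1ℚ)

 0≤1 : 0ℚ ≤ 1ℚ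
 0≤1 = <⇒≤ 0<1

 0≤ι : ∀ k → 0ℚ ≤ ι k
 0≤ι zero    = ≤-refl
 0≤ι (suc k) = 0≤+ 0≤1 (0≤ι k)

 ι-< : ∀ {i j} → i ℕ.< j → ι i < ι j
 ι-< {zero}  {suc j} h = subst (_< 1ℚ + ι j) (+-identityˡ 0ℚ) (+-mono-<-≤ 0<1 (0≤ι j))
 ι-< {suc i} {suc j} (s≤s h) = +-monoʳ-< 1ℚ (ι-< h)

 ι-≤ : ∀ {i j} → i ℕ.≤ j → ι i ≤ ι j
 ι-≤ {zero}  {j}     h = 0≤ι j
 ι-≤ {suc i} {suc j} (s≤s h) = +-monoʳ-≤ 1ℚ (ι-≤ h)

 ι-injective : ∀ {i j} → ι i ≡ ι j → i ≡ j
 ι-injective {i} {j} e = by (ℕ.<-cmp i j)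
  where
  by : Tri (i ℕ.< j) (i ≡ j) (j ℕ.< i) → i ≡ j
  by (tri< h _ _) = ⊥-elim (<-irrefl e (ι-< h))
  by (tri≈ _ h _) = h
  by (tri> _ _ h) = ⊥-elim (<-irrefl (sym e) (ι-< h))

 ordinate below-one above-minus-one : Form
 ordinate = record { at = λ p → proj₂ p ; affine = λ x y x′ y′ t → R.solve 3 (λ y y′ t → y :+ t :* (y′ :- y) := (con 1ℚ :- t) :* y :+ t :* y′) refl y y′ t }
 below-one = record { at = λ p → 1ℚ - proj₂ p ; affine = λ x y x′ y′ t → R.solve 3 (λ y y′ t → con 1ℚ :- (y :+ t :* (y′ :- y)) := (con 1ℚ :- t) :* (con 1ℚ :- y) :+ t :* (con 1ℚ :- y′)) refl y y′ t }
 above-minus-one = record { at = λ p → 1ℚ + proj₂ p ; affine = λ x y x′ y′ t → R.solve 3 (λ y y′ t → con 1ℚ :+ (y :+ t :* (y′ :- y)) := (con 1ℚ :- t) :* (con 1ℚ :+ y) :+ t :* (con 1ℚ :+ y′)) refl y y′ t }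

 minus : Form → Form
 minus f = record { at = λ p → - at f p ; affine = λ x y x′ y′ t → trans (cong -_ (affine f x y x′ y′ t))
  (R.solve 3 (λ a b t → :- ((con 1ℚ :- t) :* a :+ t :* b) := (con 1ℚ :- t) :* (:- a) :+ t :* (:- b)) refl (at f (x , y)) (at f (x′ , y′)) t) }

 beyond before : ℚ → Form
 beyond c = record { at = λ p → proj₁ p - c ; affine = λ x y x′ y′ t →
  R.solve 4 (λ x x′ t c → (x :+ t :* (x′ :- x)) :- c := (con 1ℚ :- t) :* (x :- c) :+ t :* (x′ :- c)) refl x x′ t c }
 before c = record { at = λ p → c - proj₁ p ; affine = λ x y x′ y′ t →
  R.solve 4 (λ x x′ t c → c :- (x :+ t :* (x′ :- x)) := (con 1ℚ :- t) :* (c :- x) :+ t :* (c :- x′)) refl x x′ t c }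

 linear : ℚ → ℚ → ℚ → Form
 linear a b c = record { at = λ p → a * proj₁ p + b * proj₂ p + c ; affine = λ x y x′ y′ t →
  R.solve 8 (λ x x′ y y′ t a b c → a :* (x :+ t :* (x′ :- x)) :+ b :* (y :+ t :* (y′ :- y)) :+ c
   := (con 1ℚ :- t) :* (a :* x :+ b :* y :+ c) :+ t :* (a :* x′ :+ b :* y′ :+ c)) refl x x′ y y′ t a b c }

 module Wheel (K : ℕ) (1≤K : 1 ℕ.≤ K) where

  κ : ℚ
  κ = ι K

  0<κ : 0ℚ < κ
  0<κ = <-≤-trans 0<1 (ι-≤ {1} 1≤K)

  R : ℕ → Point
  R i = ι i , 0ℚ

  A B apex : Point
  A    = 1ℚ , 1ℚ
  B    = 1ℚ , - 1ℚ
  apex = 1ℚ , 1ℚ + 1ℚ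

  data Vertex : Point → Set where
   rim  : ∀ i → i ℕ.≤ suc K → Vertex (R i)
   hubA : Vertex A
   hubB : Vertex B

  data Shape : Point → Point → List Point → Set where
   path    : ∀ i → i ℕ.≤ K → Shape (R i) (R (suc i)) (R i ∷ R (suc i) ∷ [])
   toA     : ∀ i → i ℕ.≤ suc K → Shape (R i) A (R i ∷ A ∷ [])
   toB     : ∀ i → i ℕ.≤ suc K → Shape (R i) B (R i ∷ B ∷ [])
   closing : Shape (R 0) (R (suc K)) (R 0 ∷ apex ∷ R (suc K) ∷ [])

  -- The line through A and the point c of the axis, its mirror image, and the lines carrying the two segments of the closing edge.
  throughA throughB : ℚ → Form
  throughA c = linear 1ℚ (c - 1ℚ) (- c)
  throughB c = linear 1ℚ (- (c - 1ℚ)) (- c)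

  leftside rightside diagonal cap : Form
  leftside  = linear (1ℚ + 1ℚ) (- 1ℚ) 0ℚ
  rightside = linear (- (1ℚ + 1ℚ)) (- κ) ((1ℚ + κ) + (1ℚ + κ))
  diagonal  = linear (- 1ℚ) 1ℚ 0ℚ
  cap       = linear 1ℚ κ (- (1ℚ + κ))

  zero≤ : ∀ {q} → q ≡ 0ℚ → q ≤ 0ℚ
  zero≤ refl = ≤-refl

  ≤zero : ∀ {q} → q ≡ 0ℚ → 0ℚ ≤ q
  ≤zero refl = ≤-refl

  throughA-R : ∀ i j → at (throughA (ι i)) (R j) ≡ ι j - ι i
  throughA-R i j = R.solve 2 (λ c x → con 1ℚ :* x :+ (c :- con 1ℚ) :* con 0ℚ :+ :- c := x :- c) refl (ι i) (ι j)

  throughA-A : ∀ i → at (throughA (ι i)) A ≡ 0ℚ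
  throughA-A i = R.solve 1 (λ c → con 1ℚ :* con 1ℚ :+ (c :- con 1ℚ) :* con 1ℚ :+ :- c := con 0ℚ) refl (ι i)

  throughB-R : ∀ i j → at (throughB (ι i)) (R j) ≡ ι j - ι i
  throughB-R i j = R.solve 2 (λ c x → con 1ℚ :* x :+ (:- (c :- con 1ℚ)) :* con 0ℚ :+ :- c := x :- c) refl (ι i) (ι j)

  throughB-B : ∀ i → at (throughB (ι i)) B ≡ 0ℚ
  throughB-B i = R.solve 1 (λ c → con 1ℚ :* con 1ℚ :+ (:- (c :- con 1ℚ)) :* (:- con 1ℚ) :+ :- c := con 0ℚ) refl (ι i)

  left-R : ∀ i → 0ℚ ≤ at leftside (R i)
  left-R i = subst (0ℚ ≤_) (R.solve 1 (λ x → x :+ x := (con 1ℚ :+ con 1ℚ) :* x :+ (:- con 1ℚ) :* con 0ℚ :+ con 0ℚ) refl (ι i)) (0≤+ (0≤ι i) (0≤ι i))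

  right-R : ∀ {i} → i ℕ.≤ suc K → 0ℚ ≤ at rightside (R i)
  right-R {i} h = subst (0ℚ ≤_) (R.solve 2 (λ x k → ((con 1ℚ :+ k) :- x) :+ ((con 1ℚ :+ k) :- x) :=
    (:- (con 1ℚ :+ con 1ℚ)) :* x :+ (:- k) :* con 0ℚ :+ ((con 1ℚ :+ k) :+ (con 1ℚ :+ k))) refl (ι i) κ) (0≤+ (0≤- (ι-≤ h)) (0≤- (ι-≤ h)))

  right-A : 0ℚ < at rightside A
  right-A = subst (0ℚ <_) (R.solve 1 (λ k → k := (:- (con 1ℚ :+ con 1ℚ)) :* con 1ℚ :+ (:- k) :* con 1ℚ :+ ((con 1ℚ :+ k) :+ (con 1ℚ :+ k))) refl κ) 0<κ

  right-apex : at rightside apex ≡ 0ℚ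
  right-apex = R.solve 1 (λ k → (:- (con 1ℚ :+ con 1ℚ)) :* con 1ℚ :+ (:- k) :* (con 1ℚ :+ con 1ℚ) :+ ((con 1ℚ :+ k) :+ (con 1ℚ :+ k)) := con 0ℚ) refl κ

  right-last : at rightside (R (suc K)) ≡ 0ℚ
  right-last = R.solve 1 (λ k → (:- (con 1ℚ :+ con 1ℚ)) :* (con 1ℚ :+ k) :+ (:- k) :* con 0ℚ :+ ((con 1ℚ :+ k) :+ (con 1ℚ :+ k)) := con 0ℚ) refl κ

  cap-apex : 0ℚ < at cap apex
  cap-apex = subst (0ℚ <_) (R.solve 1 (λ k → k := con 1ℚ :* con 1ℚ :+ k :* (con 1ℚ :+ con 1ℚ) :+ :- (con 1ℚ :+ k)) refl κ) 0<κ

  cap-last : at cap (R (suc K)) ≡ 0ℚ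
  cap-last = R.solve 1 (λ k → con 1ℚ :* (con 1ℚ :+ k) :+ k :* con 0ℚ :+ :- (con 1ℚ :+ k) := con 0ℚ) refl κ

  cap-A : at cap A ≡ 0ℚ
  cap-A = R.solve 1 (λ k → con 1ℚ :* con 1ℚ :+ k :* con 1ℚ :+ :- (con 1ℚ :+ k) := con 0ℚ) refl κ

  i<si : ∀ i → ι i < ι (suc i)
  i<si i = ι-< {i} {suc i} ℕ.≤-refl

  0<2 : 0ℚ < 1ℚ + 1ℚ
  0<2 = 0<+ 0<1 0<1

  ends : ∀ {u v ps w} → Shape u v ps → Vertex w → w ∈path ps → w ≡ u ⊎ w ≡ v
  ends (path i _) (rim j _) h = by (ℕ.<-cmp i j)
   where
   by : Tri (i ℕ.< j) (i ≡ j) (j ℕ.< i) → R j ≡ R i ⊎ R j ≡ R (suc i)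
   by (tri< k _ _) = inj₂ (last-on (before (ι (suc i))) h (0<- (i<si i)) (self (ι (suc i))) (≤0- (ι-≤ {suc i} {j} k)))
   by (tri≈ _ refl _) = inj₁ refl
   by (tri> _ _ k) = inj₁ (first-on (beyond (ι i)) h (self (ι i)) (0<- (i<si i)) (≤0- (ι-≤ {j} {i} (ℕ.<⇒≤ k))))
  ends (path i _) hubA h = inj₂ (last-on below-one h 0<1 0≤1 ≤-refl)
  ends (path i _) hubB h = inj₂ (last-on above-minus-one h 0<1 0≤1 ≤-refl)
  ends (toA i _) (rim j _) h = inj₁ (first-on ordinate h ≤-refl 0<1 ≤-refl)
  ends (toA i _) hubA h = inj₂ refl
  ends (toA i _) hubB h = inj₁ (first-on ordinate h ≤-refl 0<1 (from-yes ((- 1ℚ) ≤? 0ℚ)))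
  ends (toB i _) (rim j _) h = inj₁ (first-on (minus ordinate) h ≤-refl 0<1 ≤-refl)
  ends (toB i _) hubA h = inj₁ (first-on (minus ordinate) h ≤-refl 0<1 (from-yes ((- 1ℚ) ≤? 0ℚ)))
  ends (toB i _) hubB h = inj₂ refl
  ends {w = w} closing v h = by v (bent h)
   where
   by : ∀ {w} → Vertex w → w on (R 0 , apex) ⊎ w on (apex , R (suc K)) → w ≡ R 0 ⊎ w ≡ R (suc K)
   by (rim j _) (inj₁ k) = inj₁ (first-on ordinate k ≤-refl 0<2 ≤-refl)
   by (rim j _) (inj₂ k) = inj₂ (last-on ordinate k 0<2 ≤-refl ≤-refl)
   by hubA (inj₁ k) = inj₁ (first-on diagonal k ≤-refl (from-yes (0ℚ <? at diagonal apex)) (from-yes (at diagonal A ≤? 0ℚ)))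
   by hubA (inj₂ k) = inj₂ (last-on cap k cap-apex (≤zero cap-last) (zero≤ cap-A))
   by hubB (inj₁ k) = inj₁ (first-on ordinate k ≤-refl 0<2 (from-yes ((- 1ℚ) ≤? 0ℚ)))
   by hubB (inj₂ k) = inj₂ (last-on ordinate k 0<2 ≤-refl (from-yes ((- 1ℚ) ≤? 0ℚ)))

  simple : ∀ {u v ps} → Shape u v ps → Simple ps
  simple (path i _) = segment λ e → <-irrefl (cong proj₁ e) (i<si i)
  simple (toA i _) = segment λ e → <-irrefl (cong proj₂ e) 0<1
  simple (toB i _) = segment λ e → <-irrefl (sym (cong proj₂ e)) (from-yes ((- 1ℚ) <? 0ℚ))
  simple closing = extend (λ e → <-irrefl (cong proj₁ e) 0<1)
   (λ {p} i j → last-on (before 1ℚ) {p} {R 0} {apex} (here i) 0<1 ≤-refl (nonpositive-on (before 1ℚ) j ≤-refl (≤0- (ι-≤ {1} {suc K} (s≤s z≤n)))))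
   (segment λ e → <-irrefl (sym (cong proj₂ e)) 0<2)

  Verdict : Point → Point → Point → Point → Point → Set
  Verdict u v u′ v′ p = (u ≡ u′ × v ≡ v′) ⊎ Vertex p

  at-vertex : ∀ {p w u v u′ v′} → Vertex w → p ≡ w → Verdict u v u′ v′ p
  at-vertex h refl = inj₂ h

  swapped : ∀ {u v u′ v′ p} → Verdict u′ v′ u v p → Verdict u v u′ v′ p
  swapped (inj₁ (a , b)) = inj₁ (sym a , sym b)
  swapped (inj₂ h) = inj₂ h

  last : Vertex (R (suc K))
  last = rim (suc K) ℕ.≤-refl

  path-path : ∀ {i j p} → i ℕ.≤ K → j ℕ.≤ K → i ℕ.< j → p on (R i , R (suc i)) → p on (R j , R (suc j)) → p ≡ R j
  path-path {i} {j} _ _ k h h′ = first-on (beyond (ι j)) h′ (self (ι j)) (0<- (i<si j)) (nonpositive-on (beyond (ι j)) h (≤0- (ι-≤ {i} {j} (ℕ.<⇒≤ k))) (≤0- (ι-≤ {suc i} {j} k)))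

  A-A : ∀ {i j p} → i ℕ.< j → p on (R i , A) → p on (R j , A) → p ≡ A
  A-A {i} {j} k h h′ = last-on (throughA (ι i)) h′ (subst (0ℚ <_) (sym (throughA-R i j)) (0<- (ι-< k))) (≤zero (throughA-A i))
   (nonpositive-on (throughA (ι i)) h (zero≤ (trans (throughA-R i i) (+-inverseʳ (ι i)))) (zero≤ (throughA-A i)))

  B-B : ∀ {i j p} → i ℕ.< j → p on (R i , B) → p on (R j , B) → p ≡ B
  B-B {i} {j} k h h′ = last-on (throughB (ι i)) h′ (subst (0ℚ <_) (sym (throughB-R i j)) (0<- (ι-< k))) (≤zero (throughB-B i))
   (nonpositive-on (throughB (ι i)) h (zero≤ (trans (throughB-R i i) (+-inverseʳ (ι i)))) (zero≤ (throughB-B i)))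

  -1≤0 : - 1ℚ ≤ 0ℚ
  -1≤0 = from-yes ((- 1ℚ) ≤? 0ℚ)

  flat : ∀ {p} i j → p on (R i , R j) → at ordinate p ≤ 0ℚ
  flat i j h = nonpositive-on ordinate h ≤-refl ≤-refl

  low-B : ∀ {p} i → p on (R i , B) → at ordinate p ≤ 0ℚ
  low-B i h = nonpositive-on ordinate h ≤-refl -1≤0

  closing-low : ∀ {p u v} → p ∈path (R 0 ∷ apex ∷ R (suc K) ∷ []) → at ordinate p ≤ 0ℚ → Verdict u v (R 0) (R (suc K)) p
  closing-low {p} {u} {v} h k = by (bent h)
   where
   by : p on (R 0 , apex) ⊎ p on (apex , R (suc K)) → Verdict u v (R 0) (R (suc K)) p
   by (inj₁ i) = at-vertex (rim 0 z≤n) (first-on ordinate i ≤-refl 0<2 k)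
   by (inj₂ i) = at-vertex last (last-on ordinate i 0<2 ≤-refl k)

  A-closing : ∀ {p i} → i ℕ.≤ suc K → p on (R i , A) → p ∈path (R 0 ∷ apex ∷ R (suc K) ∷ []) → p ≡ R i
  A-closing {p} {i} hi h h′ = by (bent h′)
   where
   by : p on (R 0 , apex) ⊎ p on (apex , R (suc K)) → p ≡ R i
   by (inj₁ k) = first-on leftside h (left-R i) (from-yes (0ℚ <? at leftside A)) (nonpositive-on leftside k ≤-refl ≤-refl)
   by (inj₂ k) = first-on rightside h (right-R hi) right-A (nonpositive-on rightside k (zero≤ right-apex) (zero≤ right-last))

  meets : ∀ {u v ps u′ v′ qs p} → Shape u v ps → Shape u′ v′ qs → p ∈path ps → p ∈path qs → Verdict u v u′ v′ p
  meets {p = p} (path i hi) (path j hj) h h′ = by (ℕ.<-cmp i j)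
   where
   by : Tri (i ℕ.< j) (i ≡ j) (j ℕ.< i) → Verdict (R i) (R (suc i)) (R j) (R (suc j)) p
   by (tri< k _ _) = at-vertex (rim j (ℕ.m≤n⇒m≤1+n hj)) (path-path hi hj k h h′)
   by (tri≈ _ refl _) = inj₁ (refl , refl)
   by (tri> _ _ k) = at-vertex (rim i (ℕ.m≤n⇒m≤1+n hi)) (path-path hj hi k h′ h)
  meets (path i hi) (toA j hj) h h′ = at-vertex (rim j hj) (first-on ordinate h′ ≤-refl 0<1 (flat i (suc i) h))
  meets (toA j hj) (path i hi) h′ h = at-vertex (rim j hj) (first-on ordinate h′ ≤-refl 0<1 (flat i (suc i) h))
  meets (path i hi) (toB j hj) h h′ = at-vertex (rim j hj) (first-on (minus ordinate) h′ ≤-refl 0<1 (nonpositive-on (minus ordinate) h ≤-refl ≤-refl))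
  meets (toB j hj) (path i hi) h′ h = at-vertex (rim j hj) (first-on (minus ordinate) h′ ≤-refl 0<1 (nonpositive-on (minus ordinate) h ≤-refl ≤-refl))
  meets (path i hi) closing h h′ = closing-low h′ (flat i (suc i) h)
  meets closing (path i hi) h′ h = swapped (closing-low h′ (flat i (suc i) h))
  meets {p = p} (toA i hi) (toA j hj) h h′ = by (ℕ.<-cmp i j)
   where
   by : Tri (i ℕ.< j) (i ≡ j) (j ℕ.< i) → Verdict (R i) A (R j) A p
   by (tri< k _ _) = at-vertex hubA (A-A k h h′)
   by (tri≈ _ refl _) = inj₁ (refl , refl)
   by (tri> _ _ k) = at-vertex hubA (A-A k h′ h)
  meets (toA i hi) (toB j hj) h h′ = at-vertex (rim i hi) (first-on ordinate h ≤-refl 0<1 (low-B j h′))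
  meets (toB j hj) (toA i hi) h′ h = at-vertex (rim i hi) (first-on ordinate h ≤-refl 0<1 (low-B j h′))
  meets (toA i hi) closing h h′ = at-vertex (rim i hi) (A-closing hi h h′)
  meets closing (toA i hi) h′ h = at-vertex (rim i hi) (A-closing hi h h′)
  meets {p = p} (toB i hi) (toB j hj) h h′ = by (ℕ.<-cmp i j)
   where
   by : Tri (i ℕ.< j) (i ≡ j) (j ℕ.< i) → Verdict (R i) B (R j) B p
   by (tri< k _ _) = at-vertex hubB (B-B k h h′)
   by (tri≈ _ refl _) = inj₁ (refl , refl)
   by (tri> _ _ k) = at-vertex hubB (B-B k h′ h)
  meets (toB i hi) closing h h′ = closing-low h′ (low-B i h)
  meets closing (toB i hi) h′ h = swapped (closing-low h′ (low-B i h))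
  meets closing closing h h′ = inj₁ (refl , refl)

  scheme : Scheme
  scheme = record { Vertex = Vertex ; Shape = Shape ; simple = simple ; ends = ends ; meets = meets }

  k : ℕ
  k = suc (suc K)

  place : ℕ → Point
  place i with ℕ.<-cmp i k
  ... | tri< _ _ _ = R i
  ... | tri≈ _ _ _ = A
  ... | tri> _ _ _ = B

  place-rim : ∀ {i} → i ℕ.< k → place i ≡ R i
  place-rim {i} h with ℕ.<-cmp i k
  ... | tri< _ _ _ = refl
  ... | tri≈ _ e _ = ⊥-elim (ℕ.<-irrefl e h)
  ... | tri> _ _ l = ⊥-elim (ℕ.<-asym h l)

  place-A : place k ≡ A
  place-A with ℕ.<-cmp k k
  ... | tri< h _ _ = ⊥-elim (ℕ.<-irrefl refl h)
  ... | tri≈ _ _ _ = refl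
  ... | tri> _ _ h = ⊥-elim (ℕ.<-irrefl refl h)

  place-B : place (suc k) ≡ B
  place-B with ℕ.<-cmp (suc k) k
  ... | tri< h _ _ = ⊥-elim (ℕ.<-asym h ℕ.≤-refl)
  ... | tri≈ _ e _ = ⊥-elim (ℕ.<-irrefl (sym e) ℕ.≤-refl)
  ... | tri> _ _ _ = refl

  place-vertex : ∀ i → Vertex (place i)
  place-vertex i with ℕ.<-cmp i k
  ... | tri< h _ _ = rim i (ℕ.≤-pred h)
  ... | tri≈ _ _ _ = hubA
  ... | tri> _ _ _ = hubB

  place-injective : ∀ {i j} → i ℕ.≤ suc k → j ℕ.≤ suc k → place i ≡ place j → i ≡ j
  place-injective {i} {j} hi hj e with ℕ.<-cmp i k | ℕ.<-cmp j k
  ... | tri< _ _ _ | tri< _ _ _ = ι-injective (cong proj₁ e)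
  ... | tri< _ _ _ | tri≈ _ _ _ = ⊥-elim (<-irrefl (cong proj₂ e) 0<1)
  ... | tri< _ _ _ | tri> _ _ _ = ⊥-elim (<-irrefl (sym (cong proj₂ e)) (from-yes ((- 1ℚ) <? 0ℚ)))
  ... | tri≈ _ _ _ | tri< _ _ _ = ⊥-elim (<-irrefl (sym (cong proj₂ e)) 0<1)
  ... | tri≈ _ a _ | tri≈ _ b _ = trans a (sym b)
  ... | tri≈ _ _ _ | tri> _ _ _ = ⊥-elim (<-irrefl (sym (cong proj₂ e)) (from-yes ((- 1ℚ) <? 1ℚ)))
  ... | tri> _ _ _ | tri< _ _ _ = ⊥-elim (<-irrefl (cong proj₂ e) (from-yes ((- 1ℚ) <? 0ℚ)))
  ... | tri> _ _ _ | tri≈ _ _ _ = ⊥-elim (<-irrefl (cong proj₂ e) (from-yes ((- 1ℚ) <? 1ℚ)))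
  ... | tri> _ _ a | tri> _ _ b = trans (ℕ.≤-antisym hi a) (ℕ.≤-antisym b hj)

  data Edge : ℕ → ℕ → Set where
   path    : ∀ {i} → suc i ℕ.< k → Edge i (suc i)
   toA     : ∀ {i} → i ℕ.< k → Edge i k
   toB     : ∀ {i} → i ℕ.< k → Edge i (suc k)
   closing : Edge 0 (suc K)

  corner : ℕ → ℕ → List Point
  corner i j = if (i ℕ.≡ᵇ 0) ∧ (j ℕ.≡ᵇ suc K) then apex ∷ [] else []

  corner-none : ∀ i {j} → i ≢ 0 ⊎ j ≢ suc K → corner i j ≡ []
  corner-none (suc i) h = refl
  corner-none zero (inj₁ h) = ⊥-elim (h refl)
  corner-none zero {j} (inj₂ h) with j ℕ.≡ᵇ suc K in e
  ... | false = refl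
  ... | true  = ⊥-elim (h (ℕ.≡ᵇ⇒≡ j (suc K) (subst T (sym e) _)))
   where open import Data.Bool using (T)

  corner-closing : corner 0 (suc K) ≡ apex ∷ []
  corner-closing = go K
   where
   go : ∀ m → (if m ℕ.≡ᵇ m then apex ∷ [] else []) ≡ apex ∷ []
   go zero    = refl
   go (suc m) = go m

  not-closing : ∀ i → i ≢ 0 ⊎ suc i ≢ suc K
  not-closing zero    = inj₂ λ { refl → ℕ.<-irrefl refl 1≤K }
  not-closing (suc i) = inj₁ λ ()

  shape : ∀ {i j} → Edge i j → Shape (place i) (place j) (place i ∷ corner i j ++ place j ∷ [])
  shape (path {i} h) rewrite place-rim (ℕ.<-trans (ℕ.n<1+n i) h) | place-rim h | corner-none i {suc i} (not-closing i) = path i (ℕ.≤-pred (ℕ.≤-pred h))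
  shape (toA {i} h) rewrite place-rim h | place-A | corner-none i {k} (inj₂ λ e → ℕ.<-irrefl (sym e) ℕ.≤-refl) = toA i (ℕ.≤-pred h)
  shape (toB {i} h) rewrite place-rim h | place-B | corner-none i {suc k} (inj₂ λ e → ℕ.<-irrefl (sym e) (ℕ.n≤1+n k)) = toB i (ℕ.≤-pred h)
  shape closing rewrite place-rim {0} (s≤s z≤n) | place-rim {suc K} ℕ.≤-refl | corner-closing = closing

  draw-wheel : ∀ {n} (G : Graph (Fin n)) → n ℕ.≤ suc (suc k) → (∀ {u v} → IsEdge G (u , v) → Edge (toℕ u) (toℕ v)) → Drawing G
  draw-wheel G h edge = Scheme.draw scheme G (place ∘ toℕ)
   (λ {u} {v} e → Fin.toℕ-injective (place-injective (bound u) (bound v) e)) (place-vertex ∘ toℕ)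
   (λ e → corner (toℕ (proj₁ e)) (toℕ (proj₂ e))) (λ e → shape (edge e))
   where
   bound : ∀ u → toℕ u ℕ.≤ suc k
   bound u = ℕ.≤-pred (ℕ.≤-trans (Fin.toℕ<n u) h)

 module Strips where

  P₀ P₁ P₂ : ℕ → Point
  P₀ i = ι (i ℕ.* 3) , 0ℚ
  P₁ i = ι (1 ℕ.+ i ℕ.* 3) , 1ℚ
  P₂ i = ι (2 ℕ.+ i ℕ.* 3) , 0ℚ

  data Vertex : ℕ → Point → Set where
   v₀ : ∀ i → Vertex i (P₀ i)
   v₁ : ∀ i → Vertex i (P₁ i)
   v₂ : ∀ i → Vertex i (P₂ i)

  data Shape : ℕ → Point → Point → List Point → Set where
   s₀₁ : ∀ i → Shape i (P₀ i) (P₁ i) (P₀ i ∷ P₁ i ∷ [])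
   s₁₂ : ∀ i → Shape i (P₁ i) (P₂ i) (P₁ i ∷ P₂ i ∷ [])
   s₀₂ : ∀ i → Shape i (P₀ i) (P₂ i) (P₀ i ∷ P₂ i ∷ [])

  first-end : ∀ {i u v ps} → Shape i u v ps → Vertex i u
  first-end (s₀₁ i) = v₀ i
  first-end (s₁₂ i) = v₁ i
  first-end (s₀₂ i) = v₀ i

  last-end : ∀ {i u v ps} → Shape i u v ps → Vertex i v
  last-end (s₀₁ i) = v₁ i
  last-end (s₁₂ i) = v₂ i
  last-end (s₀₂ i) = v₂ i

  segment-of : ∀ {i u v ps p} → Shape i u v ps → p ∈path ps → p on (u , v)
  segment-of (s₀₁ i) h = h
  segment-of (s₁₂ i) h = h
  segment-of (s₀₂ i) h = h

  right-of : ∀ {i u} → Vertex i u → ι (i ℕ.* 3) ≤ proj₁ u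
  right-of (v₀ i) = ≤-refl
  right-of (v₁ i) = ι-≤ {i ℕ.* 3} {1 ℕ.+ i ℕ.* 3} (ℕ.m≤n+m _ 1)
  right-of (v₂ i) = ι-≤ {i ℕ.* 3} {2 ℕ.+ i ℕ.* 3} (ℕ.m≤n+m _ 2)

  left-of : ∀ {i u} → Vertex i u → proj₁ u ≤ ι (2 ℕ.+ i ℕ.* 3)
  left-of (v₀ i) = ι-≤ {i ℕ.* 3} {2 ℕ.+ i ℕ.* 3} (ℕ.m≤n+m _ 2)
  left-of (v₁ i) = ι-≤ {1 ℕ.+ i ℕ.* 3} {2 ℕ.+ i ℕ.* 3} (ℕ.m≤n+m _ 1)
  left-of (v₂ i) = ≤-refl

  gap : ∀ {i j} → i ℕ.< j → ι (2 ℕ.+ i ℕ.* 3) < ι (j ℕ.* 3)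
  gap {i} {j} h = ι-< {2 ℕ.+ i ℕ.* 3} {j ℕ.* 3} (ℕ.*-monoˡ-≤ 3 h)

  step : ∀ m → ι m < ι (suc m)
  step m = ι-< {m} {suc m} ℕ.≤-refl

  beyond-strip : ∀ {i j u v p} → i ℕ.< j → Vertex j u → Vertex j v → p on (u , v) → proj₁ p ≤ ι (2 ℕ.+ i ℕ.* 3) → p ≡ v
  beyond-strip {i} k hu hv h l = last-on (beyond (ι (2 ℕ.+ i ℕ.* 3))) h (0<- (<-≤-trans (gap k) (right-of hu))) (0≤- (<⇒≤ (<-≤-trans (gap k) (right-of hv)))) (≤0- l)

  before-strip : ∀ {i j u v p} → i ℕ.< j → Vertex i u → Vertex i v → p on (u , v) → ι (j ℕ.* 3) ≤ proj₁ p → p ≡ v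
  before-strip {i} {j} k hu hv h l = last-on (before (ι (j ℕ.* 3))) h (0<- (≤-<-trans (left-of hu) (gap k))) (0≤- (<⇒≤ (≤-<-trans (left-of hv) (gap k)))) (≤0- l)

  ends-same : ∀ {i u v ps w} → Shape i u v ps → Vertex i w → w on (u , v) → w ≡ u ⊎ w ≡ v
  ends-same (s₀₁ i) (v₀ .i) h = inj₁ refl
  ends-same (s₀₁ i) (v₁ .i) h = inj₂ refl
  ends-same (s₀₁ i) (v₂ .i) h = inj₂ (last-on (before (ι (1 ℕ.+ i ℕ.* 3))) h (0<- (step (i ℕ.* 3))) (self (ι (1 ℕ.+ i ℕ.* 3))) (≤0- (<⇒≤ (step (1 ℕ.+ i ℕ.* 3)))))
  ends-same (s₁₂ i) (v₀ .i) h = inj₁ (first-on (beyond (ι (1 ℕ.+ i ℕ.* 3))) h (self (ι (1 ℕ.+ i ℕ.* 3))) (0<- (step (1 ℕ.+ i ℕ.* 3))) (≤0- (<⇒≤ (step (i ℕ.* 3)))))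
  ends-same (s₁₂ i) (v₁ .i) h = inj₁ refl
  ends-same (s₁₂ i) (v₂ .i) h = inj₂ refl
  ends-same (s₀₂ i) (v₀ .i) h = inj₁ refl
  ends-same (s₀₂ i) (v₁ .i) h = inj₂ (last-on below-one h 0<1 0≤1 ≤-refl)
  ends-same (s₀₂ i) (v₂ .i) h = inj₂ refl

  ends : ∀ {i j u v ps w} → Shape i u v ps → Vertex j w → w ∈path ps → w ≡ u ⊎ w ≡ v
  ends {i} {j} {u} {v} {ps} {w} s h l = by (ℕ.<-cmp i j) h (segment-of s l)
   where
   by : Tri (i ℕ.< j) (i ≡ j) (j ℕ.< i) → Vertex j w → w on (u , v) → w ≡ u ⊎ w ≡ v
   by (tri< k _ _) h l = inj₂ (before-strip k (first-end s) (last-end s) l (right-of h))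
   by (tri≈ _ refl _) h l = ends-same s h l
   by (tri> _ _ k) h l = inj₂ (beyond-strip k (first-end s) (last-end s) l (left-of h))

  Verdict : Point → Point → Point → Point → Point → Set
  Verdict u v u′ v′ p = (u ≡ u′ × v ≡ v′) ⊎ (∃[ m ] Vertex m p)
   where open import Data.Product using (∃-syntax)

  low-high : ∀ i {p} → p on (P₀ i , P₁ i) → p on (P₁ i , P₂ i) → p ≡ P₁ i
  low-high i h h′ = first-on (beyond (ι (1 ℕ.+ i ℕ.* 3))) h′ (self (ι (1 ℕ.+ i ℕ.* 3))) (0<- (step (1 ℕ.+ i ℕ.* 3)))
   (nonpositive-on (beyond (ι (1 ℕ.+ i ℕ.* 3))) h (≤0- (<⇒≤ (step (i ℕ.* 3)))) (≤0- (≤-refl {ι (1 ℕ.+ i ℕ.* 3)})))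

  low-base : ∀ i {p} → p on (P₀ i , P₁ i) → p on (P₀ i , P₂ i) → p ≡ P₀ i
  low-base i h h′ = first-on ordinate h ≤-refl 0<1 (nonpositive-on ordinate h′ ≤-refl ≤-refl)

  high-base : ∀ i {p} → p on (P₁ i , P₂ i) → p on (P₀ i , P₂ i) → p ≡ P₂ i
  high-base i h h′ = last-on ordinate h 0<1 ≤-refl (nonpositive-on ordinate h′ ≤-refl ≤-refl)

  found : ∀ {i p w u v u′ v′} → Vertex i w → p ≡ w → Verdict u v u′ v′ p
  found h refl = inj₂ (_ , h)

  meets-same : ∀ {i u v ps u′ v′ qs p} → Shape i u v ps → Shape i u′ v′ qs → p on (u , v) → p on (u′ , v′) → Verdict u v u′ v′ p
  meets-same (s₀₁ i) (s₀₁ .i) h h′ = inj₁ (refl , refl)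
  meets-same (s₀₁ i) (s₁₂ .i) h h′ = found (v₁ i) (low-high i h h′)
  meets-same (s₀₁ i) (s₀₂ .i) h h′ = found (v₀ i) (low-base i h h′)
  meets-same (s₁₂ i) (s₀₁ .i) h h′ = found (v₁ i) (low-high i h′ h)
  meets-same (s₁₂ i) (s₁₂ .i) h h′ = inj₁ (refl , refl)
  meets-same (s₁₂ i) (s₀₂ .i) h h′ = found (v₂ i) (high-base i h h′)
  meets-same (s₀₂ i) (s₀₁ .i) h h′ = found (v₀ i) (low-base i h′ h)
  meets-same (s₀₂ i) (s₁₂ .i) h h′ = found (v₂ i) (high-base i h′ h)
  meets-same (s₀₂ i) (s₀₂ .i) h h′ = inj₁ (refl , refl)

  meets : ∀ {i j u v ps u′ v′ qs p} → Shape i u v ps → Shape j u′ v′ qs → p ∈path ps → p ∈path qs → Verdict u v u′ v′ p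
  meets {i} {j} {u} {v} {_} {u′} {v′} {_} {p} s s′ h h′ = by (ℕ.<-cmp i j) s′ (segment-of s h) (segment-of s′ h′)
   where
   in-strip : ∀ {i u v ps} → Shape i u v ps → p on (u , v) → proj₁ p - ι (2 ℕ.+ i ℕ.* 3) ≤ 0ℚ
   in-strip {i} s h = nonpositive-on (beyond (ι (2 ℕ.+ i ℕ.* 3))) h (≤0- (left-of (first-end s))) (≤0- (left-of (last-end s)))
   after : ∀ {i j u v ps u′ v′ qs} → Shape i u v ps → Shape j u′ v′ qs → i ℕ.< j → p on (u , v) → p on (u′ , v′) → p ≡ v′
   after {i} s s′ k h h′ = last-on (beyond (ι (2 ℕ.+ i ℕ.* 3))) h′ (0<- (<-≤-trans (gap k) (right-of (first-end s′)))) (0≤- (<⇒≤ (<-≤-trans (gap k) (right-of (last-end s′))))) (in-strip s h)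
   by : ∀ {qs} → Tri (i ℕ.< j) (i ≡ j) (j ℕ.< i) → Shape j u′ v′ qs → p on (u , v) → p on (u′ , v′) → Verdict u v u′ v′ p
   by (tri< k _ _) s′ h h′ = found (last-end s′) (after s s′ k h h′)
   by (tri≈ _ refl _) s′ h h′ = meets-same s s′ h h′
   by (tri> _ _ k) s′ h h′ = found (last-end s) (after s′ s k h′ h)

  simple : ∀ {i u v ps} → Shape i u v ps → Simple ps
  simple (s₀₁ i) = segment λ e → <-irrefl (cong proj₂ e) 0<1
  simple (s₁₂ i) = segment λ e → <-irrefl (sym (cong proj₂ e)) 0<1
  simple (s₀₂ i) = segment λ e → <-irrefl (cong proj₁ e) (<-trans (step (i ℕ.* 3)) (step (1 ℕ.+ i ℕ.* 3)))

  scheme : Scheme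
  scheme = record
   { Vertex = λ p → ∃[ i ] Vertex i p ; Shape = λ u v ps → ∃[ i ] Shape i u v ps
   ; simple = λ s → simple (proj₂ s) ; ends = λ s w h → ends (proj₂ s) (proj₂ w) h ; meets = λ s s′ h h′ → meets (proj₂ s) (proj₂ s′) h h′ }
   where open import Data.Product using (∃-syntax)

module Forbidden where
 open import Data.Bool using (_xor_; if_then_else_)
 open import Data.Bool.Properties using (xor-assoc; xor-same)
 open import Data.Bool.Solver using (module xor-∧-Solver)
 open import Data.Fin using (Fin; toℕ; zero; suc)
 open import Data.Fin.Patterns
 import Data.Fin.Properties as Fin
 open import Data.List.Relation.Unary.All using (All; []; _∷_)
 open import Data.Nat using (ℕ; _≡ᵇ_; _<ᵇ_)
 open import Data.Product.Properties using (≡-dec)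
 import Data.Sum.Properties as Sum
 open import Data.Vec using (Vec; []; _∷_; lookup)
 open import Data.Vec.Relation.Unary.Unique.Propositional using (Unique)
 open import Data.Vec.Relation.Unary.Unique.Propositional.Properties using (lookup-injective)
 open import Data.Vec.Relation.Unary.AllPairs using ([]; _∷_)
 open import Data.Vec.Relation.Unary.All using ([]; _∷_)
 open Parity

 private module X = xor-∧-Solver

 -- Each edge of a subdivision of K₅ or K₃,₃ carries as label the ends of the edge
 -- of K₅ or K₃,₃ that it subdivides.  Summing the parity equations of all pairs of
 -- edges with disjoint labels gives 0 = 1.
 module Cancellation (m : ℕ) where
  LabelledEdge : Set
  LabelledEdge = (Fin m × Fin m) × (ℕ × ℕ)

  Unknown : Set
  Unknown = (Fin m × Fin m × Fin m) ⊎ (Fin m × Fin m)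

  _≟_ : DecidableEquality Unknown
  _≟_ = Sum.≡-dec (≡-dec Fin._≟_ (≡-dec Fin._≟_ Fin._≟_)) (≡-dec Fin._≟_ Fin._≟_)

  Sum₂ : Set
  Sum₂ = Bool × List Unknown

  toggle : Unknown → List Unknown → List Unknown
  toggle x []       = x ∷ []
  toggle x (y ∷ ys) with x ≟ y
  ... | yes _ = ys
  ... | no  _ = y ∷ toggle x ys

  addHit : Fin m → Fin m × Fin m → Sum₂ → Sum₂
  addHit x (c , d) (k , us) = k , toggle (inj₁ (x , c , d)) us

  addOrder : Fin m → Fin m → Sum₂ → Sum₂
  addOrder x y (k , us) =
   if toℕ x <ᵇ toℕ y then (k , toggle (inj₂ (x , y)) us) else (not k , toggle (inj₂ (y , x)) us)

  addEquation : Fin m × Fin m → Fin m × Fin m → Sum₂ → Sum₂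
  addEquation (u , v) (c , d) s =
   addHit u (c , d) (addHit v (c , d) (addHit c (u , v) (addHit d (u , v)
    (addOrder u c (addOrder v c (addOrder u d (addOrder v d s)))))))

  disjointℕ : ℕ × ℕ → ℕ × ℕ → Bool
  disjointℕ (a , b) (c , d) = (not (a ≡ᵇ c) ∧ not (a ≡ᵇ d)) ∧ (not (b ≡ᵇ c) ∧ not (b ≡ᵇ d))

  addPairs : LabelledEdge → List LabelledEdge → Sum₂ → Sum₂
  addPairs _ [] s = s
  addPairs (e , l) ((f , k) ∷ fs) s =
   if disjointℕ l k then addEquation e f (addPairs (e , l) fs s) else addPairs (e , l) fs s

  addAll : List LabelledEdge → Sum₂ → Sum₂
  addAll []       s = s
  addAll (e ∷ es) s = addPairs e es (addAll es s)

  differ : Fin m → Fin m → Bool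
  differ x y = not (toℕ x ≡ᵇ toℕ y)

  separate : LabelledEdge → List LabelledEdge → Bool
  separate _ [] = true
  separate ((u , v) , l) (((c , d) , k) ∷ fs) =
   (not (disjointℕ l k) ∨ ((differ u c ∧ differ u d) ∧ (differ v c ∧ differ v d))) ∧ separate ((u , v) , l) fs

  separateAll : List LabelledEdge → Bool
  separateAll []       = true
  separateAll (e ∷ es) = separate e es ∧ separateAll es

  contradictory : List LabelledEdge → Set
  contradictory es = separateAll es ≡ true × addAll es (false , []) ≡ (true , [])

  module _ {V : Set} (G : ParityGraph V) (f : Fin m → V) (inj : ∀ {i j} → f i ≡ f j → i ≡ j) where
   open ParityGraph G

   value : Unknown → Bool
   value (inj₁ (x , c , d)) = ray (f x) (f c) (f d)
   value (inj₂ (x , y))     = before (f x) (f y)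

   total : List Unknown → Bool
   total []       = false
   total (x ∷ xs) = value x xor total xs

   ⟦_⟧ : Sum₂ → Bool
   ⟦ k , us ⟧ = k xor total us

   total-toggle : ∀ x ys → total (toggle x ys) ≡ value x xor total ys
   total-toggle x [] = refl
   total-toggle x (y ∷ ys) with x ≟ y
   ... | yes refl = sym (X.solve 2 (λ p q → p X.:+ (p X.:+ q) X.:= q) refl (value x) (total ys))
   ... | no _ = trans (cong (value y xor_) (total-toggle x ys))
    (X.solve 3 (λ p q r → p X.:+ (q X.:+ r) X.:= q X.:+ (p X.:+ r)) refl (value y) (value x) (total ys))

   move : ∀ k p q → k xor (p xor q) ≡ p xor (k xor q)
   move = X.solve 3 (λ p q r → p X.:+ (q X.:+ r) X.:= q X.:+ (p X.:+ r)) refl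

   value-addHit : ∀ x c d s → ⟦ addHit x (c , d) s ⟧ ≡ ray (f x) (f c) (f d) xor ⟦ s ⟧
   value-addHit x c d (k , us) = trans (cong (k xor_) (total-toggle (inj₁ (x , c , d)) us)) (move k (ray (f x) (f c) (f d)) (total us))

   differ⇒≢ : ∀ {x y} → differ x y ≡ true → f x ≢ f y
   differ⇒≢ {x} {y} h e with inj e
   ... | refl = true≢false h (go (toℕ x))
    where
    go : ∀ n → not (n ≡ᵇ n) ≡ false
    go ℕ.zero    = refl
    go (ℕ.suc n) = go n

   value-addOrder : ∀ x y s → f x ≢ f y → ⟦ addOrder x y s ⟧ ≡ before (f x) (f y) xor ⟦ s ⟧
   value-addOrder x y (k , us) h with toℕ x <ᵇ toℕ y
   ... | true  = trans (cong (k xor_) (total-toggle (inj₂ (x , y)) us)) (move k (before (f x) (f y)) (total us))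
   ... | false = trans (cong (not k xor_) (total-toggle _ us))
    (trans (cong (λ b → not k xor (b xor total us)) (before-anti h)) (nots k (before (f x) (f y)) (total us)))
    where
    nots : ∀ k b r → not k xor (not b xor r) ≡ b xor (k xor r)
    nots false false false = refl
    nots false false true  = refl
    nots false true  r     = refl
    nots true  false r     = refl
    nots true  true  false = refl
    nots true  true  true  = refl

   record Adds (h : Sum₂ → Sum₂) (b : Bool) : Set where
    constructor adds
    field value-adds : ∀ s → ⟦ h s ⟧ ≡ b xor ⟦ s ⟧
   open Adds

   adds-∘ : ∀ g h {b c} → Adds g b → Adds h c → Adds (λ s → g (h s)) (b xor c)
   adds-∘ g h {b} {c} p q = adds λ s →
    trans (value-adds p (h s)) (trans (cong (b xor_) (value-adds q s)) (sym (xor-assoc b c ⟦ s ⟧)))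

   adds-hit : ∀ x c d → Adds (addHit x (c , d)) (ray (f x) (f c) (f d))
   adds-hit x c d = adds (value-addHit x c d)

   adds-order : ∀ x y → f x ≢ f y → Adds (addOrder x y) (before (f x) (f y))
   adds-order x y h = adds λ s → value-addOrder x y s h

   adds-equation : ∀ u v c d → adj (f u) (f v) ≡ true → adj (f c) (f d) ≡ true →
    f u ≢ f c → f u ≢ f d → f v ≢ f c → f v ≢ f d → ∀ s → ⟦ addEquation (u , v) (c , d) s ⟧ ≡ ⟦ s ⟧
   adds-equation u v c d e g uc ud vc vd s = trans
    (value-adds (adds-∘ (λ s → h₁ (h₂ (h₃ (h₄ s)))) (λ s → o₁ (o₂ (o₃ (o₄ s))))
     (adds-∘ h₁ (λ s → h₂ (h₃ (h₄ s))) (adds-hit u c d)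
      (adds-∘ h₂ (λ s → h₃ (h₄ s)) (adds-hit v c d) (adds-∘ h₃ h₄ (adds-hit c u v) (adds-hit d u v))))
     (adds-∘ o₁ (λ s → o₂ (o₃ (o₄ s))) (adds-order u c uc)
      (adds-∘ o₂ (λ s → o₃ (o₄ s)) (adds-order v c vc)
       (adds-∘ o₃ o₄ (adds-order u d ud) (adds-order v d vd))))) s)
    (cong (_xor ⟦ s ⟧) (trans (cong (_xor o) (parity e g uc ud vc vd)) (xor-same o)))
    where
    h₁ h₂ h₃ h₄ o₁ o₂ o₃ o₄ : Sum₂ → Sum₂
    h₁ = addHit u (c , d)
    h₂ = addHit v (c , d)
    h₃ = addHit c (u , v)
    h₄ = addHit d (u , v)
    o₁ = addOrder u c
    o₂ = addOrder v c
    o₃ = addOrder u d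
    o₄ = addOrder v d
    o = before (f u) (f c) xor (before (f v) (f c) xor (before (f u) (f d) xor before (f v) (f d)))

   Realised : LabelledEdge → Set
   Realised ((u , v) , _) = adj (f u) (f v) ≡ true

   value-addPairs : ∀ e es s → separate e es ≡ true → Realised e → All Realised es → ⟦ addPairs e es s ⟧ ≡ ⟦ s ⟧
   value-addPairs e [] s h r rs = refl
   value-addPairs ((u , v) , l) (((c , d) , k) ∷ es) s h r (r′ ∷ rs) with disjointℕ l k
   ... | false = value-addPairs ((u , v) , l) es s h r rs
   ... | true  = trans
    (adds-equation u v c d r r′ (differ⇒≢ (∧ˡ (∧ˡ (∧ˡ h)))) (differ⇒≢ (∧ʳ {differ u c} (∧ˡ (∧ˡ h))))
     (differ⇒≢ (∧ˡ (∧ʳ {differ u c ∧ differ u d} (∧ˡ h))))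
     (differ⇒≢ (∧ʳ {differ v c} (∧ʳ {differ u c ∧ differ u d} (∧ˡ h)))) (addPairs ((u , v) , l) es s))
    (value-addPairs ((u , v) , l) es s (∧ʳ {(differ u c ∧ differ u d) ∧ (differ v c ∧ differ v d)} h) r rs)

   value-addAll : ∀ es s → separateAll es ≡ true → All Realised es → ⟦ addAll es s ⟧ ≡ ⟦ s ⟧
   value-addAll [] s h [] = refl
   value-addAll (e ∷ es) s h (r ∷ rs) = trans
    (value-addPairs e es (addAll es s) (∧ˡ h) r rs)
    (value-addAll es s (∧ʳ {separate e es} h) rs)

   unrealisable : ∀ es → contradictory es → ¬ All Realised es
   unrealisable es (sep , tot) rs with trans (sym (value-addAll es (false , []) sep rs)) (cong ⟦_⟧ tot)
   ... | ()

 open Cancellation using (unrealisable)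

 module _ {V : Set} (G : ParityGraph V) where
  open ParityGraph G

  private
   _~_ : V → V → Set
   x ~ y = adj x y ≡ true

  K₅-free : ∀ {v w x y z} → v ~ w → v ~ x → v ~ y → v ~ z → w ~ x → w ~ y → w ~ z → x ~ y → x ~ z → y ~ z → ⊥
  K₅-free {v} {w} {x} {y} {z} vw vx vy vz wx wy wz xy xz yz =
   unrealisable 5 G (lookup vs) (λ {i} {j} → lookup-injective unique i j)
    (((0F , 1F) , 0 , 1) ∷ ((0F , 2F) , 0 , 2) ∷ ((0F , 3F) , 0 , 3) ∷ ((0F , 4F) , 0 , 4) ∷ ((1F , 2F) , 1 , 2) ∷
     ((1F , 3F) , 1 , 3) ∷ ((1F , 4F) , 1 , 4) ∷ ((2F , 3F) , 2 , 3) ∷ ((2F , 4F) , 2 , 4) ∷ ((3F , 4F) , 3 , 4) ∷ [])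
    (refl , refl) (vw ∷ vx ∷ vy ∷ vz ∷ wx ∷ wy ∷ wz ∷ xy ∷ xz ∷ yz ∷ [])
   where
   vs : Vec V 5
   vs = v ∷ w ∷ x ∷ y ∷ z ∷ []
   unique : Unique vs
   unique = (~⇒≢ vw ∷ ~⇒≢ vx ∷ ~⇒≢ vy ∷ ~⇒≢ vz ∷ []) ∷ (~⇒≢ wx ∷ ~⇒≢ wy ∷ ~⇒≢ wz ∷ [])
    ∷ (~⇒≢ xy ∷ ~⇒≢ xz ∷ []) ∷ (~⇒≢ yz ∷ []) ∷ [] ∷ []

  -- K₅ on v w x y z, with the edge yz subdivided by s.
  K₅-subdivided-free : ∀ {v w x y z s} → v ~ w → v ~ x → v ~ y → v ~ z → w ~ x → w ~ y → w ~ z → x ~ y → x ~ z →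
   y ~ s → s ~ z → y ≢ z → s ≢ v → s ≢ w → s ≢ x → ⊥
  K₅-subdivided-free {v} {w} {x} {y} {z} {s} vw vx vy vz wx wy wz xy xz ys sz y≢z s≢v s≢w s≢x =
   unrealisable 6 G (lookup vs) (λ {i} {j} → lookup-injective unique i j)
    (((0F , 1F) , 0 , 1) ∷ ((0F , 2F) , 0 , 2) ∷ ((0F , 3F) , 0 , 3) ∷ ((0F , 4F) , 0 , 4) ∷ ((1F , 2F) , 1 , 2) ∷
     ((1F , 3F) , 1 , 3) ∷ ((1F , 4F) , 1 , 4) ∷ ((2F , 3F) , 2 , 3) ∷ ((2F , 4F) , 2 , 4) ∷ ((3F , 5F) , 3 , 4) ∷ ((4F , 5F) , 3 , 4) ∷ [])
    (refl , refl) (vw ∷ vx ∷ vy ∷ vz ∷ wx ∷ wy ∷ wz ∷ xy ∷ xz ∷ ys ∷ ~-sym sz ∷ [])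
   where
   vs : Vec V 6
   vs = v ∷ w ∷ x ∷ y ∷ z ∷ s ∷ []
   unique : Unique vs
   unique = (~⇒≢ vw ∷ ~⇒≢ vx ∷ ~⇒≢ vy ∷ ~⇒≢ vz ∷ (s≢v ∘ sym) ∷ []) ∷ (~⇒≢ wx ∷ ~⇒≢ wy ∷ ~⇒≢ wz ∷ (s≢w ∘ sym) ∷ [])
    ∷ (~⇒≢ xy ∷ ~⇒≢ xz ∷ (s≢x ∘ sym) ∷ []) ∷ (y≢z ∷ ~⇒≢ ys ∷ []) ∷ ((~⇒≢ sz ∘ sym) ∷ []) ∷ [] ∷ []

  K₃₃-free : ∀ {u v w x y z} → u ≢ v → u ≢ w → v ≢ w → x ≢ y → x ≢ z → y ≢ z →
   u ~ x → u ~ y → u ~ z → v ~ x → v ~ y → v ~ z → w ~ x → w ~ y → w ~ z → ⊥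
  K₃₃-free {u} {v} {w} {x} {y} {z} uv uw vw xy xz yz ux uy uz vx vy vz wx wy wz =
   unrealisable 6 G (lookup vs) (λ {i} {j} → lookup-injective unique i j)
    (((0F , 3F) , 0 , 3) ∷ ((0F , 4F) , 0 , 4) ∷ ((0F , 5F) , 0 , 5) ∷ ((1F , 3F) , 1 , 3) ∷ ((1F , 4F) , 1 , 4) ∷
     ((1F , 5F) , 1 , 5) ∷ ((2F , 3F) , 2 , 3) ∷ ((2F , 4F) , 2 , 4) ∷ ((2F , 5F) , 2 , 5) ∷ [])
    (refl , refl) (ux ∷ uy ∷ uz ∷ vx ∷ vy ∷ vz ∷ wx ∷ wy ∷ wz ∷ [])
   where
   vs : Vec V 6
   vs = u ∷ v ∷ w ∷ x ∷ y ∷ z ∷ []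
   unique : Unique vs
   unique = (uv ∷ uw ∷ ~⇒≢ ux ∷ ~⇒≢ uy ∷ ~⇒≢ uz ∷ []) ∷ (vw ∷ ~⇒≢ vx ∷ ~⇒≢ vy ∷ ~⇒≢ vz ∷ [])
    ∷ (~⇒≢ wx ∷ ~⇒≢ wy ∷ ~⇒≢ wz ∷ []) ∷ (xy ∷ xz ∷ []) ∷ (yz ∷ []) ∷ [] ∷ []

open import Data.Bool.Properties using (T-≡) renaming (_≟_ to _≟ᵇ_)
open import Data.List.Relation.Binary.Permutation.Propositional.Properties using (∈-resp-↭; ↭-length)
open import Data.List.Relation.Unary.All as All using (All; []; _∷_)
open import Data.List.Relation.Unary.AllPairs using ([]; _∷_)
open import Data.List.Relation.Unary.Any using (here; there)
open import Data.List.Relation.Unary.Unique.Propositional using (Unique)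
open import Data.Nat hiding (_≟_)
open import Data.Nat using () renaming (_≟_ to _ℕ≟_)
open import Data.Nat.Properties hiding (_≟_)
open import Relation.Nullary using (does)

open Counting
open Parity
open Forbidden

pattern #0 = here refl
pattern #1 = there #0
pattern #2 = there #1
pattern #3 = there #2
pattern #4 = there #3

≥-reflexive : ∀ {m n} → m ≡ n → n ≤ m
≥-reflexive e = ≤-reflexive (sym e)

module Linear where
 open import Data.Bool using (T)
 open import Data.Nat.Solver using (module +-*-Solver)
 open import Algebra.Properties.CommutativeSemigroup +-commutativeSemigroup using (interchange; x∙yz≈y∙xz)

 infixl 6 _⊕_
 infixl 7 _⊛_
 data Lin : Set where
  var lit : ℕ → Lin
  _⊕_ : Lin → Lin → Lin
  _⊛_ : ℕ → Lin → Lin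

 _!_ : List ℕ → ℕ → ℕ
 []       ! i     = 0
 (x ∷ xs) ! zero  = x
 (x ∷ xs) ! suc i = xs ! i

 ⟦_⟧ : Lin → List ℕ → ℕ
 ⟦ var i ⟧   ρ = ρ ! i
 ⟦ lit k ⟧   ρ = k
 ⟦ e ⊕ f ⟧   ρ = ⟦ e ⟧ ρ + ⟦ f ⟧ ρ
 ⟦ k ⊛ e ⟧   ρ = k * ⟦ e ⟧ ρ

 addₗ : List ℕ → List ℕ → List ℕ
 addₗ []       ys       = ys
 addₗ (x ∷ xs) []       = x ∷ xs
 addₗ (x ∷ xs) (y ∷ ys) = x + y ∷ addₗ xs ys

 scaleₗ : ℕ → List ℕ → List ℕ
 scaleₗ k []       = []
 scaleₗ k (x ∷ xs) = k * x ∷ scaleₗ k xs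

 single : ℕ → List ℕ
 single zero    = 1 ∷ []
 single (suc i) = 0 ∷ single i

 coefficients : Lin → List ℕ
 coefficients (var i)   = single (suc i)
 coefficients (lit k)   = k ∷ []
 coefficients (e ⊕ f) = addₗ (coefficients e) (coefficients f)
 coefficients (k ⊛ e) = scaleₗ k (coefficients e)

 dot : List ℕ → List ℕ → ℕ
 dot []       ρ        = 0
 dot (x ∷ xs) []       = 0
 dot (x ∷ xs) (r ∷ ρ)  = x * r + dot xs ρ

 dot-add : ∀ xs ys ρ → dot (addₗ xs ys) ρ ≡ dot xs ρ + dot ys ρ
 dot-add []       ys       ρ       = refl
 dot-add (x ∷ xs) []       ρ       = sym (+-identityʳ _)
 dot-add (x ∷ xs) (y ∷ ys) []      = refl
 dot-add (x ∷ xs) (y ∷ ys) (r ∷ ρ) = trans (cong₂ _+_ (*-distribʳ-+ r x y) (dot-add xs ys ρ))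
  (interchange (x * r) (y * r) (dot xs ρ) (dot ys ρ))

 dot-scale : ∀ k xs ρ → dot (scaleₗ k xs) ρ ≡ k * dot xs ρ
 dot-scale k []       ρ       = sym (*-zeroʳ k)
 dot-scale k (x ∷ xs) []      = sym (*-zeroʳ k)
 dot-scale k (x ∷ xs) (r ∷ ρ) = trans (cong₂ _+_ (*-assoc k x r) (dot-scale k xs ρ)) (sym (*-distribˡ-+ k (x * r) (dot xs ρ)))

 dot-single : ∀ i ρ → dot (single i) ρ ≡ ρ ! i
 dot-single zero    []      = refl
 dot-single (suc i) []      = refl
 dot-single zero    (r ∷ ρ) = trans (+-identityʳ _) (+-identityʳ r)
 dot-single (suc i) (r ∷ ρ) = dot-single i ρ

 dot-coefficients : ∀ e ρ → dot (coefficients e) (1 ∷ ρ) ≡ ⟦ e ⟧ ρ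
 dot-coefficients (var i)   ρ = dot-single i ρ
 dot-coefficients (lit k)   ρ = trans (+-identityʳ _) (*-identityʳ k)
 dot-coefficients (e ⊕ f) ρ = trans (dot-add (coefficients e) (coefficients f) (1 ∷ ρ))
  (cong₂ _+_ (dot-coefficients e ρ) (dot-coefficients f ρ))
 dot-coefficients (k ⊛ e) ρ = trans (dot-scale k (coefficients e) (1 ∷ ρ)) (cong (k *_) (dot-coefficients e ρ))

 dominated : List ℕ → List ℕ → Bool
 dominated []       ys       = true
 dominated (x ∷ xs) []       = (x ≡ᵇ 0) ∧ dominated xs []
 dominated (x ∷ xs) (y ∷ ys) = (x ≤ᵇ y) ∧ dominated xs ys

 dominated-dot : ∀ xs ys ρ → dominated xs ys ≡ true → dot xs ρ ≤ dot ys ρ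
 dominated-dot []       ys       ρ       h = z≤n
 dominated-dot (x ∷ xs) []       []      h = z≤n
 dominated-dot (zero ∷ xs) []    (r ∷ ρ) h = dominated-dot xs [] ρ h
 dominated-dot (x ∷ xs) (y ∷ ys) []      h = z≤n
 dominated-dot (x ∷ xs) (y ∷ ys) (r ∷ ρ) h =
  +-mono-≤ (*-monoˡ-≤ r (≤ᵇ⇒≤ x y (subst T (sym (∧ˡ h)) _))) (dominated-dot xs ys ρ (∧ʳ {x ≤ᵇ y} h))

 infix 5.5 _×[_≤_]
 record Hypothesis : Set where
  constructor _×[_≤_]
  field
   times : ℕ
   lower upper : Lin
 open Hypothesis

 lowers uppers : List Hypothesis → List ℕ
 lowers []       = []
 lowers (h ∷ hs) = addₗ (scaleₗ (times h) (coefficients (lower h))) (lowers hs)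
 uppers []       = []
 uppers (h ∷ hs) = addₗ (scaleₗ (times h) (coefficients (upper h))) (uppers hs)

 Holds : List ℕ → Hypothesis → Set
 Holds ρ h = ⟦ lower h ⟧ ρ ≤ ⟦ upper h ⟧ ρ

 combine : ∀ ρ hs → All (Holds ρ) hs → dot (lowers hs) (1 ∷ ρ) ≤ dot (uppers hs) (1 ∷ ρ)
 combine ρ [] [] = z≤n
 combine ρ (h ∷ hs) (p ∷ ps)
  rewrite dot-add (scaleₗ (times h) (coefficients (lower h))) (lowers hs) (1 ∷ ρ)
     | dot-add (scaleₗ (times h) (coefficients (upper h))) (uppers hs) (1 ∷ ρ)
     | dot-scale (times h) (coefficients (lower h)) (1 ∷ ρ)
     | dot-scale (times h) (coefficients (upper h)) (1 ∷ ρ)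
     | dot-coefficients (lower h) ρ | dot-coefficients (upper h) ρ
  = +-mono-≤ (*-monoʳ-≤ (times h) p) (combine ρ hs ps)

 -- The combination of the hypotheses with the given multipliers reads 0 < 0.
 refute : ∀ ρ hs → All (Holds ρ) hs → dominated (addₗ (1 ∷ []) (uppers hs)) (lowers hs) ≡ true → ⊥
 refute ρ hs ps ok = <⇒≱ (≤-trans (≥-reflexive (dot-add (1 ∷ []) (uppers hs) (1 ∷ ρ)))
  (dominated-dot (addₗ (1 ∷ []) (uppers hs)) (lowers hs) (1 ∷ ρ) ok)) (combine ρ hs ps)

open Linear

module Mader where
 open import Data.Bool.Properties using (∨-identityʳ)
 open import Data.List.Relation.Binary.Permutation.Propositional using (_↭_; ↭-trans; prep)
 open import Data.Nat.Tactic.RingSolver using (solve-∀)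
 open import Relation.Nullary.Decidable using (isYes)

 edgesIn : ∀ {V : Set} → (V → V → Bool) → List V → ℕ
 edgesIn adj []       = 0
 edgesIn adj (x ∷ xs) = count (adj x) xs + edgesIn adj xs

 edgesIn-cong : ∀ {V : Set} {a b : V → V → Bool} (xs : List V) →
  (∀ {x y} → x ∈ xs → y ∈ xs → a x y ≡ b x y) → edgesIn a xs ≡ edgesIn b xs
 edgesIn-cong [] h = refl
 edgesIn-cong (x ∷ xs) h = cong₂ _+_ (∑-cong xs (λ i → cong bit (h #0 (there i))))
  (edgesIn-cong xs (λ i j → h (there i) (there j)))

 module _ {V : Set} (G : ParityGraph V) where
  open ParityGraph G

  ∑-degrees : ∀ xs → ∑ xs (λ x → count (adj x) xs) ≡ 2 * edgesIn adj xs
  ∑-degrees [] = refl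
  ∑-degrees (x ∷ xs) = trans
   (cong₂ _+_ (cong (λ b → bit b + count (adj x) xs) (adj-irrefl x))
    (trans (∑-+ xs (λ y → bit (adj y x)) (λ y → count (adj y) xs))
     (cong₂ _+_ (∑-cong xs (λ {y} _ → cong bit (adj-sym y x))) (∑-degrees xs))))
   (e (count (adj x) xs) (edgesIn adj xs))
   where
   e : ∀ d m → d + (d + 2 * m) ≡ 2 * (d + m)
   e = solve-∀

  edgesIn-↭ : ∀ {xs ys} → xs ↭ ys → edgesIn adj xs ≡ edgesIn adj ys
  edgesIn-↭ {xs} {ys} π = *-cancelˡ-≡ _ _ 2 (trans (sym (∑-degrees xs)) (trans
   (trans (∑-↭ _ π) (∑-cong ys (λ {y} _ → ∑-↭ (λ z → bit (adj y z)) π))) (∑-degrees ys)))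

  extract : ∀ {u xs} → u ∈ xs → ∃[ ys ] (xs ↭ u ∷ ys) × edgesIn adj xs ≡ count (adj u) xs + edgesIn adj ys
  extract {u} {xs} i with front i
  ... | ys , π = ys , π , trans (edgesIn-↭ π) (cong (_+ edgesIn adj ys)
   (sym (trans (∑-↭ (λ z → bit (adj u z)) π) (cong (λ b → bit b + count (adj u) ys) (adj-irrefl u)))))

 module _ {V : Set} (_≟_ : DecidableEquality V) where

  module _ (G : ParityGraph V) where
   open ParityGraph G
   open Contraction _≟_ G using (_==_)

   pairᵇ : V → V → V → V → Bool
   pairᵇ u v x y = (isYes (x ≟ u) ∧ isYes (y ≟ v)) ∨ (isYes (x ≟ v) ∧ isYes (y ≟ u))

   deleteEdge : V → V → ParityGraph V
   deleteEdge u v = restrict G (λ x y → adj x y ∧ not (pairᵇ u v x y))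
    (λ x y → cong₂ _∧_ (adj-sym x y) (cong not (flip (isYes (x ≟ u)) (isYes (y ≟ v)) (isYes (x ≟ v)) (isYes (y ≟ u)))))
    (λ x y h → ∧ˡ h)
    where
    flip : ∀ p q r s → (p ∧ q) ∨ (r ∧ s) ≡ (s ∧ r) ∨ (q ∧ p)
    flip true  true  true  true  = refl
    flip true  true  true  false = refl
    flip true  true  false true  = refl
    flip true  true  false false = refl
    flip true  false true  true  = refl
    flip true  false true  false = refl
    flip true  false false true  = refl
    flip true  false false false = refl
    flip false true  true  true  = refl
    flip false true  true  false = refl
    flip false true  false true  = refl
    flip false true  false false = refl
    flip false false true  true  = refl
    flip false false true  false = refl
    flip false false false true  = refl
    flip false false false false = refl

   some-edge : ∀ xs → 1 ≤ edgesIn adj xs → ∃[ u ] ∃[ v ] (u ∈ xs) × (v ∈ xs) × adj u v ≡ true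
   some-edge (x ∷ xs) h with count (adj x) xs in e
   ... | zero with some-edge xs h
   ...   | u , v , i , j , k = u , v , there i , there j , k
   some-edge (x ∷ xs) h | suc d with count-pos (adj x) xs (≥-reflexive e)
   ...   | v , i , k = x , v , #0 , there i , k

  two-out : ∀ {xs : List V} {u v} → Unique xs → u ∈ xs → v ∈ xs → u ≢ v → ∃[ zs ] xs ↭ u ∷ v ∷ zs
  two-out {u = u} {v} un i j uv with front i
  ... | ys , π with front (tail∈ (∈-resp-↭ π j) (uv ∘ sym))
  ...   | zs , ρ = zs , ↭-trans π (prep u ρ)

  deleteEdge-edges : ∀ G {xs u v} → Unique xs → u ∈ xs → v ∈ xs → ParityGraph.adj G u v ≡ true →
   edgesIn (ParityGraph.adj G) xs ≡ suc (edgesIn (ParityGraph.adj (deleteEdge G u v)) xs)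
  deleteEdge-edges G {xs} {u} {v} un i j uv with two-out un i j (ParityGraph.~⇒≢ G uv)
  ... | zs , π rewrite edgesIn-↭ G π | edgesIn-↭ (deleteEdge G u v) π = shape (unique-↭ π un)
   where
   open ParityGraph G
   adj₁ = ParityGraph.adj (deleteEdge G u v)
   shape : Unique (u ∷ v ∷ zs) → edgesIn adj (u ∷ v ∷ zs) ≡ suc (edgesIn adj₁ (u ∷ v ∷ zs))
   shape ((u≢v ∷ uz) ∷ (vz ∷ uq)) = trans
    (cong₂ (λ b m → bit b + count (adj u) zs + m) uv
     (cong₂ _+_ (∑-cong zs (λ k → cong bit (same (All.lookup uz k ∘ sym) (All.lookup vz k ∘ sym))))
      (edgesIn-cong zs (λ k l → same (All.lookup uz l ∘ sym) (All.lookup vz l ∘ sym)))))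
    (cong₂ (λ b m → suc (bit b + m + (count (adj₁ v) zs + edgesIn adj₁ zs))) gone
     (∑-cong zs (λ k → cong bit (same (All.lookup uz k ∘ sym) (All.lookup vz k ∘ sym)))))
    where
    same : ∀ {x y} → y ≢ u → y ≢ v → adj x y ≡ adj₁ x y
    same {x} {y} yu yv with y ≟ u | y ≟ v
    ... | yes h | _     = ⊥-elim (yu h)
    ... | no _  | yes h = ⊥-elim (yv h)
    ... | no _  | no _ with isYes (x ≟ u) | isYes (x ≟ v) | adj x y
    ...   | true  | true  | true  = refl
    ...   | true  | false | true  = refl
    ...   | false | true  | true  = refl
    ...   | false | false | true  = refl
    ...   | _     | _     | false = refl
    gone : false ≡ adj₁ u v
    gone with u ≟ u | v ≟ v
    ... | no h  | _ = ⊥-elim (h refl)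
    ... | _ | no h = ⊥-elim (h refl)
    ... | yes _ | yes _ with adj u v
    ...   | true  = refl
    ...   | false = refl

  trim : ∀ d G {xs m} → Unique xs → edgesIn (ParityGraph.adj G) xs ≡ d + m →
   ∃[ G′ ] edgesIn (ParityGraph.adj G′) xs ≡ m
  trim zero    G un e = G , e
  trim (suc d) G {xs} un e with some-edge G xs (≤-trans (s≤s z≤n) (≥-reflexive e))
  ... | u , v , i , j , k = trim d (deleteEdge G u v) un
   (suc-injective (trans (sym (deleteEdge-edges G un i j k)) e))

  module _ (G : ParityGraph V) (u v : V) (uv : ParityGraph.adj G u v ≡ true) where
   open ParityGraph G
   open Contraction _≟_ G u v uv using (contract; _==_; adj′)

   ==-false : ∀ {x y} → x ≢ y → (x == y) ≡ false
   ==-false {x} {y} h with x ≟ y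
   ... | yes e = ⊥-elim (h e)
   ... | no _  = refl

   ==-true : ∀ x → (x == x) ≡ true
   ==-true x with x ≟ x
   ... | yes _ = refl
   ... | no h  = ⊥-elim (h refl)

   contract-at : ∀ {z} → z ≢ u → z ≢ v → adj′ u z ≡ adj u z ∨ adj v z
   contract-at {z} zu zv rewrite ==-false (zu ∘ sym) | ==-false (~⇒≢ uv) | ==-false zv | ==-true u | ==-false zu
    = cong (adj u z ∨_) (∨-identityʳ _)

   contract-away : ∀ {x y} → x ≢ u → x ≢ v → y ≢ u → y ≢ v → adj′ x y ≡ adj x y
   contract-away {x} {y} xu xv yu yv with x ≟ y
   ... | yes refl = sym (adj-irrefl x)
   ... | no _ rewrite ==-false xv | ==-false yv | ==-false xu | ==-false yu = ∨-identityʳ _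

   commonIn : List V → ℕ
   commonIn = count (λ z → adj u z ∧ adj v z)

   contract-edges : ∀ zs → Unique (u ∷ v ∷ zs) →
    edgesIn adj (u ∷ v ∷ zs) ≡ suc (edgesIn adj′ (u ∷ zs) + commonIn zs)
   contract-edges zs ((u≢v ∷ uz) ∷ (vz ∷ un)) = trans
    (cong₂ (λ b m → bit b + count (adj u) zs + (count (adj v) zs + m)) uv
     (edgesIn-cong zs (λ i j → sym (contract-away (All.lookup uz i ∘ sym) (All.lookup vz i ∘ sym)
      (All.lookup uz j ∘ sym) (All.lookup vz j ∘ sym)))))
    (trans (cong suc (trans (sym (+-assoc (count (adj u) zs) _ _))
     (cong (_+ edgesIn adj′ zs) (trans (sym (∑-+ zs _ _)) (trans
      (∑-cong zs (λ {z} i → trans (bit-∨∧ (adj u z) (adj v z))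
       (cong (λ b → bit b + bit (adj u z ∧ adj v z)) (sym (contract-at (All.lookup uz i ∘ sym) (All.lookup vz i ∘ sym))))))
      (∑-+ zs _ _))))))
     (cong suc (e (count (adj′ u) zs) (commonIn zs) (edgesIn adj′ zs))))
    where
    e : ∀ a b m → a + b + m ≡ a + m + b
    e = solve-∀

  module _ (G : ParityGraph V) where
   open ParityGraph G

   private
    _~_ : V → V → Set
    x ~ y = adj x y ≡ true

   wheel₄ : ∀ {o a b c d} → o ~ a → o ~ b → o ~ c → o ~ d →
    3 ≤ count (adj a) (a ∷ b ∷ c ∷ d ∷ []) → 3 ≤ count (adj b) (a ∷ b ∷ c ∷ d ∷ []) → 3 ≤ count (adj c) (a ∷ b ∷ c ∷ d ∷ []) → ⊥
   wheel₄ {o} {a} {b} {c} {d} oa ob oc od ha hb hc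
    rewrite adj-irrefl a | adj-irrefl b | adj-irrefl c | adj-sym b a | adj-sym c a | adj-sym c b
    with adj a b in ab | adj a c in ac | adj a d in ad | adj b c in bc | adj b d in bd | adj c d in cd
   ... | true | true | true | true | true | true = K₅-free G oa ob oc od ab ac ad bc bd cd
   ... | false | p | q | _ | _ | _ = bad p q ha
    where
    bad : ∀ p q → ¬ (3 ≤ bit p + (bit q + 0))
    bad p q h = <⇒≱ (s≤s (+-mono-≤ (bit≤1 p) (+-monoˡ-≤ 0 (bit≤1 q)))) h
   ... | true | false | q | _ | _ | _ = <⇒≱ (s≤s (s≤s (+-monoˡ-≤ 0 (bit≤1 q)))) ha
   ... | true | true | false | _ | _ | _ = <⇒≱ (s≤s (s≤s (s≤s z≤n))) ha
   ... | true | true | true | false | q | _ = <⇒≱ (s≤s (s≤s (+-monoˡ-≤ 0 (bit≤1 q)))) hb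
   ... | true | true | true | true | false | _ = <⇒≱ (s≤s (s≤s (s≤s z≤n))) hb
   ... | true | true | true | true | true | false = <⇒≱ (s≤s (s≤s (s≤s z≤n))) hc

   module _ {o : V} {L : List V} (un : Unique L) (|L| : length L ≡ 5) (oL : ∀ {x} → x ∈ L → o ~ x)
    (dense : ∀ {x} → x ∈ L → 3 ≤ count (adj x) L) where

    one-miss : ∀ {x y z} → x ∈ L → y ∈ L → z ∈ L → y ≢ x → z ≢ x → y ≢ z → adj x y ≡ false → x ~ z
    one-miss {x} {y} {z} i j k yx zx yz xy with adj x z in xz
    ... | true  = refl
    ... | false = ⊥-elim (refute (count (adj x) L ∷ count (λ w → not (adj x w)) L ∷ [])
     (1 ×[ lit 3 ≤ var 0 ] ∷ 1 ×[ lit 3 ≤ var 1 ] ∷ 1 ×[ var 0 ⊕ var 1 ≤ lit 5 ] ∷ [])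
     (dense i ∷ three ∷ ≤-reflexive (trans (count-not (adj x) L) |L|) ∷ []) refl)
     where
     three : 3 ≤ count (λ w → not (adj x w)) L
     three = length≤count (λ w → not (adj x w)) {x ∷ y ∷ z ∷ []} (((yx ∘ sym) ∷ (zx ∘ sym) ∷ []) ∷ (yz ∷ []) ∷ [] ∷ [])
      λ { #0 → i , cong not (adj-irrefl x) ; #1 → j , cong not xy
       ; #2 → k , cong not xz }

    apart₅ : ∀ {p q x y z} → p ∈ L → q ∈ L → x ∈ L → y ∈ L → z ∈ L → Unique (p ∷ q ∷ x ∷ y ∷ z ∷ []) → adj p q ≡ false → ⊥
    apart₅ {p} {q} {x} {y} {z} ip iq ix iy iz
     ((pq ∷ px ∷ py ∷ pz ∷ []) ∷ (qx ∷ qy ∷ qz ∷ []) ∷ (xy ∷ xz ∷ []) ∷ (yz ∷ []) ∷ [] ∷ []) h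
     = cases (adj x y) (adj x z) (adj y z) refl refl refl
     where
     p~ : ∀ {w} → w ∈ L → w ≢ p → q ≢ w → p ~ w
     p~ i wp qw = one-miss ip iq i (pq ∘ sym) wp qw h
     q~ : ∀ {w} → w ∈ L → w ≢ q → p ≢ w → q ~ w
     q~ i wq pw = one-miss iq ip i pq wq pw (trans (adj-sym q p) h)
     p~x = p~ ix (px ∘ sym) qx
     p~y = p~ iy (py ∘ sym) qy
     p~z = p~ iz (pz ∘ sym) qz
     q~x = q~ ix (qx ∘ sym) px
     q~y = q~ iy (qy ∘ sym) py
     q~z = q~ iz (qz ∘ sym) pz
     p≢o : p ≢ o
     p≢o = ~⇒≢ (oL ip) ∘ sym
     cases : ∀ a b c → adj x y ≡ a → adj x z ≡ b → adj y z ≡ c → ⊥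
     cases true true true e f g = K₅-free G (oL iq) (oL ix) (oL iy) (oL iz) q~x q~y q~z e f g
     cases false _ _ e _ _ = K₅-subdivided-free G (oL iz) (oL iq) (oL ix) (oL iy) (~-sym q~z)
      (~-sym (one-miss ix iy iz (xy ∘ sym) (xz ∘ sym) yz e)) (~-sym (one-miss iy ix iz xy (yz ∘ sym) xz (trans (adj-sym y x) e))) q~x q~y
      (~-sym p~x) p~y xy p≢o pz pq
     cases true false _ _ f _ = K₅-subdivided-free G (oL iy) (oL iq) (oL ix) (oL iz) (~-sym q~y)
      (~-sym (one-miss ix iz iy (xz ∘ sym) (xy ∘ sym) (yz ∘ sym) f)) (one-miss iz ix iy xz yz xy (trans (adj-sym z x) f) ⁻¹) q~x q~z
      (~-sym p~x) p~z xz p≢o py pq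
      where
      _⁻¹ : ∀ {x y} → x ~ y → y ~ x
      _⁻¹ = ~-sym
     cases true true false e f g = K₅-subdivided-free G (oL ix) (oL iq) (oL iy) (oL iz) (~-sym q~x) e f q~y q~z
      (~-sym p~y) p~z yz p≢o px pq

   wheel₅ : ∀ {o a b c d e} → let L = a ∷ b ∷ c ∷ d ∷ e ∷ [] in Unique L → (∀ {x} → x ∈ L → o ~ x) →
    (∀ {x} → x ∈ L → 3 ≤ count (adj x) L) → ⊥
   wheel₅ {o} {a} {b} {c} {d} {e} un@((ab ∷ ac ∷ ad ∷ ae ∷ []) ∷ (bc ∷ bd ∷ be ∷ []) ∷ (cd ∷ ce ∷ []) ∷ (de ∷ []) ∷ [] ∷ []) oL dense
    with adj a b in Eab | adj a c in Eac | adj a d in Ead | adj b c in Ebc | adj b d in Ebd | adj c d in Ecd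
   ... | true | true | true | true | true | true = K₅-free G (oL ia) (oL ib) (oL ic) (oL id) Eab Eac Ead Ebc Ebd Ecd
    where
    ia : a ∈ a ∷ b ∷ c ∷ d ∷ e ∷ []
    ia = #0
    ib : b ∈ a ∷ b ∷ c ∷ d ∷ e ∷ []
    ib = #1
    ic : c ∈ a ∷ b ∷ c ∷ d ∷ e ∷ []
    ic = #2
    id : d ∈ a ∷ b ∷ c ∷ d ∷ e ∷ []
    id = #3
   ... | false | _ | _ | _ | _ | _ = apart₅ un refl oL dense #0 #1 #2 #3 #4 un Eab
   ... | true | false | _ | _ | _ | _ = apart₅ un refl oL dense #0 #2 #1 #3 #4
    ((ac ∷ ab ∷ ad ∷ ae ∷ []) ∷ ((bc ∘ sym) ∷ cd ∷ ce ∷ []) ∷ (bd ∷ be ∷ []) ∷ (de ∷ []) ∷ [] ∷ []) Eac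
   ... | true | true | false | _ | _ | _ = apart₅ un refl oL dense #0 #3 #1 #2 #4
    ((ad ∷ ab ∷ ac ∷ ae ∷ []) ∷ ((bd ∘ sym) ∷ (cd ∘ sym) ∷ de ∷ []) ∷ (bc ∷ be ∷ []) ∷ (ce ∷ []) ∷ [] ∷ []) Ead
   ... | true | true | true | false | _ | _ = apart₅ un refl oL dense #1 #2 #0 #3 #4
    ((bc ∷ (ab ∘ sym) ∷ bd ∷ be ∷ []) ∷ ((ac ∘ sym) ∷ cd ∷ ce ∷ []) ∷ (ad ∷ ae ∷ []) ∷ (de ∷ []) ∷ [] ∷ []) Ebc
   ... | true | true | true | true | false | _ = apart₅ un refl oL dense #1 #3 #0 #2 #4
    ((bd ∷ (ab ∘ sym) ∷ bc ∷ be ∷ []) ∷ ((ad ∘ sym) ∷ (cd ∘ sym) ∷ de ∷ []) ∷ (ac ∷ ae ∷ []) ∷ (ce ∷ []) ∷ [] ∷ []) Ebd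
   ... | true | true | true | true | true | false = apart₅ un refl oL dense #2 #3 #0 #1 #4
    ((cd ∷ (ac ∘ sym) ∷ (bc ∘ sym) ∷ ce ∷ []) ∷ ((ad ∘ sym) ∷ (bd ∘ sym) ∷ de ∷ []) ∷ (ab ∷ ae ∷ []) ∷ (be ∷ []) ∷ [] ∷ []) Ecd

   small-link : ∀ {o} (L : List V) → Unique L → 4 ≤ length L → length L ≤ 5 → (∀ {x} → x ∈ L → o ~ x) →
    (∀ {x} → x ∈ L → 3 ≤ count (adj x) L) → ⊥
   small-link (a ∷ b ∷ c ∷ d ∷ []) un h k oL dense = wheel₄ (oL #0) (oL #1) (oL #2)
    (oL #3) (dense #0) (dense #1) (dense #2)
   small-link (a ∷ b ∷ c ∷ d ∷ e ∷ []) un h k oL dense = wheel₅ un oL dense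
   small-link (a ∷ b ∷ c ∷ d ∷ e ∷ f ∷ L) un h (s≤s (s≤s (s≤s (s≤s (s≤s ()))))) oL dense
   small-link (a ∷ b ∷ c ∷ []) un (s≤s (s≤s (s≤s ()))) k oL dense
   small-link (a ∷ b ∷ []) un (s≤s (s≤s ())) k oL dense
   small-link (a ∷ []) un (s≤s ()) k oL dense

  edges-bound′ : ∀ k G xs → Unique xs → length xs ≡ 3 + k → edgesIn (ParityGraph.adj G) xs + 6 ≤ 3 * (3 + k)
  edges-bound′ zero G (x ∷ y ∷ z ∷ []) un refl =
   +-monoˡ-≤ 6 (+-mono-≤ (+-mono-≤ (bit≤1 (adj x y)) (+-monoˡ-≤ 0 (bit≤1 (adj x z)))) (+-monoˡ-≤ 0 (+-monoˡ-≤ 0 (bit≤1 (adj y z)))))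
   where open ParityGraph G
  edges-bound′ (suc k) G xs un |xs| with edgesIn (ParityGraph.adj G) xs + 6 ≤? 3 * (4 + k)
  ... | yes h = h
  ... | no h = ⊥-elim (contradiction₁ (trim (e ∸ m) G un (sym (m∸n+n≡m m≤e))))
   where
   e = edgesIn (ParityGraph.adj G) xs
   m = 7 + 3 * k
   m≤e : m ≤ e
   m≤e = ≮⇒≥ (λ l → h (≤-trans (+-monoˡ-≤ 6 (s≤s⁻¹ l)) (≤-reflexive (q k))))
    where
    q : ∀ k → 6 + 3 * k + 6 ≡ 3 * (4 + k)
    q = solve-∀
   contradiction₁ : ¬ (∃[ G′ ] edgesIn (ParityGraph.adj G′) xs ≡ m)
   contradiction₁ (G′ , em) with find-or-none (λ x → count (ParityGraph.adj G′ x) xs ≤? 3) xs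
   ... | inj₁ (x , i , d) with extract G′ i
   ...   | ys , π , q = refute (k ∷ e′ ∷ count (ParityGraph.adj G′ x) xs ∷ [])
     (1 ×[ var 1 ⊕ lit 6 ≤ 3 ⊛ (lit 3 ⊕ var 0) ] ∷ 1 ×[ var 2 ≤ lit 3 ] ∷ 1 ×[ lit 7 ⊕ 3 ⊛ var 0 ≤ var 2 ⊕ var 1 ] ∷ [])
     (edges-bound′ k G′ ys uys (suc-injective (trans (sym (↭-length π)) |xs|)) ∷ d ∷ ≤-reflexive (trans (sym em) q) ∷ []) refl
    where
    e′ = edgesIn (ParityGraph.adj G′) ys
    uys : Unique ys
    uys with unique-↭ π un
    ... | _ ∷ u = u
   contradiction₁ (G′ , em) | inj₂ big with find-pair P? xs
    where
    open ParityGraph G′ using (adj)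
    P? : ∀ x y → Dec (adj x y ≡ true × count (λ z → adj x z ∧ adj y z) xs ≤ 2)
    P? x y = (adj x y ≟ᵇ true) ×-dec (count (λ z → adj x z ∧ adj y z) xs ≤? 2)
   ... | inj₁ (x , y , i , j , xy , few) = contracted (two-out un i j (ParityGraph.~⇒≢ G′ xy))
    where
    open ParityGraph G′ using (adj)
    G″ : ParityGraph V
    G″ = Contraction.contract _≟_ G′ x y xy
    contracted : ¬ (∃[ zs ] xs ↭ x ∷ y ∷ zs)
    contracted (zs , π) = refute (k ∷ edgesIn (ParityGraph.adj G″) (x ∷ zs) ∷ commonIn G′ x y xy zs ∷ [])
     (1 ×[ var 1 ⊕ lit 6 ≤ 3 ⊛ (lit 3 ⊕ var 0) ] ∷ 1 ×[ var 2 ≤ lit 2 ] ∷ 1 ×[ lit 7 ⊕ 3 ⊛ var 0 ≤ lit 1 ⊕ (var 1 ⊕ var 2) ] ∷ [])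
     (edges-bound′ k G″ (x ∷ zs) uzs (suc-injective (trans (sym (↭-length π)) |xs|))
      ∷ ≤-trans (m≤n+m (commonIn G′ x y xy zs) (bit (adj x y ∧ adj y y))) (≤-trans (m≤n+m _ (bit (adj x x ∧ adj y x))) (≤-trans (≥-reflexive (∑-↭ (λ z → bit (adj x z ∧ adj y z)) π)) few))
      ∷ ≤-reflexive (trans (sym em) (trans (edgesIn-↭ G′ π) (contract-edges G′ x y xy zs (unique-↭ π un)))) ∷ []) refl
     where
     uzs : Unique (x ∷ zs)
     uzs with unique-↭ π un
     ... | (_ ∷ a) ∷ (_ ∷ b) = a ∷ b
   ... | inj₂ dense = linked (∑-<⇒∃ xs _ (λ _ → 6) few)
    where
    open ParityGraph G′ using (adj)
    few : ∑ xs (λ x → count (adj x) xs) < ∑ xs (λ _ → 6)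
    few rewrite ∑-degrees G′ xs | em | ∑-const xs 6 | |xs| = ≰⇒> λ h → refute (k ∷ [])
     (1 ×[ 6 ⊛ (lit 4 ⊕ var 0) ≤ 2 ⊛ (lit 7 ⊕ 3 ⊛ var 0) ] ∷ []) (h ∷ []) refl
    linked : ¬ (∃[ x ] (x ∈ xs) × count (adj x) xs < 6)
    linked (x , i , d<6) = small-link G′ {x} (filterᵇ (adj x) xs) (unique-filter (adj x) un)
     (≤-trans (≰⇒> (big i)) (≥-reflexive (length-filter (adj x) xs)))
     (≤-trans (≤-reflexive (length-filter (adj x) xs)) (s≤s⁻¹ d<6))
     (λ j → proj₂ (∈-filter⁻ (adj x) {xs} j))
     (λ {y} j → ≤-trans (≰⇒> (λ few′ → dense i (proj₁ (∈-filter⁻ (adj x) j)) (proj₂ (∈-filter⁻ (adj x) {xs} j) , few′)))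
      (≥-reflexive (count-filter (adj x) (adj y) xs)))

  -- Mader's argument: contract an edge that lies in at most two triangles; if there is none, a vertex of
  -- degree at most 5 and its neighbours contain a forbidden graph.
  edges-bound : ∀ G xs → Unique xs → 3 ≤ length xs → edgesIn (ParityGraph.adj G) xs + 6 ≤ 3 * length xs
  edges-bound G xs un h = subst (λ n → edgesIn (ParityGraph.adj G) xs + 6 ≤ 3 * n) (m+[n∸m]≡n h)
   (edges-bound′ (length xs ∸ 3) G xs un (sym (m+[n∸m]≡n h)))

open Mader

module Stars where
 open import Data.Bool using (T)
 open import Data.Bool.Properties using (∧-comm)
 open import Data.Fin using (Fin; zero; suc; inject≤) renaming (_<_ to _<ᶠ_)
 import Data.Fin.Properties as Fin
 open import Data.List using (filter; lookup; allFin; take; drop; cartesianProduct; map)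
 open import Data.List.Membership.Propositional.Properties using (∈-allFin; ∈-lookup; ∈-++⁻)
 open import Data.List.Properties using (length-tabulate; length-++; length-drop; length-take)
 open import Data.List.Relation.Unary.Unique.Propositional.Properties using (allFin⁺; take⁺; drop⁺; ++⁺)
 open import Relation.Nullary.Decidable using (dec-true; dec-false)
 open import Relation.Unary using (Decidable)

 private variable
  A : Set

 lookup-unique : ∀ {xs : List A} → Unique xs → ∀ {i j} → lookup xs i ≡ lookup xs j → i ≡ j
 lookup-unique {xs = x ∷ xs} (h ∷ u) {zero}  {zero}  e = refl
 lookup-unique {xs = x ∷ xs} (h ∷ u) {zero}  {suc j} e = ⊥-elim (All.lookup h (∈-lookup j) e)
 lookup-unique {xs = x ∷ xs} (h ∷ u) {suc i} {zero}  e = ⊥-elim (All.lookup h (∈-lookup i) (sym e))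
 lookup-unique {xs = x ∷ xs} (h ∷ u) {suc i} {suc j} e = cong suc (lookup-unique u e)

 ∈-take : ∀ k {xs : List A} {x} → x ∈ take k xs → x ∈ xs
 ∈-take (suc k) {y ∷ xs} (here e)  = here e
 ∈-take (suc k) {y ∷ xs} (there i) = there (∈-take k i)

 ∈-drop : ∀ k {xs : List A} {x} → x ∈ drop k xs → x ∈ xs
 ∈-drop zero    i = i
 ∈-drop (suc k) {y ∷ xs} i = there (∈-drop k i)

 take-drop-disjoint : ∀ k {xs : List A} {x} → Unique xs → x ∈ take k xs → x ∉ drop k xs
 take-drop-disjoint (suc k) (h ∷ u) #0 j = All.lookup h (∈-drop k j) refl
 take-drop-disjoint (suc k) (h ∷ u) (there i) j = take-drop-disjoint k u i j

 count-filter-decidable : ∀ {P : A → Set} (P? : Decidable P) xs → length (filter P? xs) ≡ ∑ xs (λ x → bit (does (P? x)))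
 count-filter-decidable P? [] = refl
 count-filter-decidable P? (x ∷ xs) with does (P? x)
 ... | true  = cong suc (count-filter-decidable P? xs)
 ... | false = count-filter-decidable P? xs

 ∑-++ : ∀ (xs ys : List A) f → ∑ (xs ++ ys) f ≡ ∑ xs f + ∑ ys f
 ∑-++ []       ys f = refl
 ∑-++ (x ∷ xs) ys f = trans (cong (f x +_) (∑-++ xs ys f)) (sym (+-assoc (f x) _ _))

 ∑-map : ∀ {B : Set} (g : A → B) xs f → ∑ (map g xs) f ≡ ∑ xs (f ∘ g)
 ∑-map g []       f = refl
 ∑-map g (x ∷ xs) f = cong (f (g x) +_) (∑-map g xs f)

 ∑-product : ∀ {B : Set} (xs : List A) (ys : List B) f → ∑ (cartesianProduct xs ys) f ≡ ∑ xs (λ x → ∑ ys (λ y → f (x , y)))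
 ∑-product []       ys f = refl
 ∑-product (x ∷ xs) ys f = trans (∑-++ (map (x ,_) ys) _ f) (cong₂ _+_ (∑-map (x ,_) ys f) (∑-product xs ys f))

 edgeCount-sum : ∀ {n} (G : Graph (Fin n)) →
  edgeCount G ≡ ∑ (allFin n) (λ x → ∑ (allFin n) (λ y → bit (does (x Fin.<? y) ∧ Graph.adj G x y)))
 edgeCount-sum {n} G = trans (count-filter-decidable (isEdge? G) (cartesianProduct (allFin n) (allFin n)))
  (trans (∑-product (allFin n) (allFin n) _)
   (∑-cong (allFin n) (λ {x} _ → ∑-cong (allFin n) (λ {y} _ → same x y))))
  where
  same : ∀ x y → bit (does (isEdge? G (x , y))) ≡ bit (does (x Fin.<? y) ∧ Graph.adj G x y)
  same x y with x Fin.<? y | Graph.adj G x y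
  ... | yes _ | true  = refl
  ... | yes _ | false = refl
  ... | no _  | _     = refl

 module PlanarGraph {n} (G : Graph (Fin n)) (D : Drawing G) where
  P : ParityGraph (Fin n)
  P = parityGraph G D
  open ParityGraph P public using (adj; adj-sym; adj-irrefl; ~-sym; ~⇒≢)

  Vs : List (Fin n)
  Vs = allFin n

  Vs! : Unique Vs
  Vs! = allFin⁺ n

  ∈V : ∀ {x} → x ∈ Vs
  ∈V = ∈-allFin _

  |V| : length Vs ≡ n
  |V| = length-tabulate (λ x → x)

  _~_ : Fin n → Fin n → Set
  x ~ y = adj x y ≡ true

  deg : Fin n → ℕ
  deg x = count (adj x) Vs

  common : Fin n → Fin n → ℕ
  common x y = count (λ z → adj x z ∧ adj y z) Vs

  degree-sum : ∑ Vs deg ≡ 2 * edgeCount G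
  degree-sum = trans (∑-cong Vs (λ {x} _ → trans (∑-cong Vs (λ {y} _ → split x y)) (∑-+ Vs _ _)))
   (trans (∑-+ Vs _ _) (trans (cong (∑ Vs (λ x → ∑ Vs (up x)) +_) (∑-comm Vs Vs (λ x y → up y x)))
    (trans (cong₂ _+_ (sym (edgeCount-sum G)) (sym (edgeCount-sum G))) (cong (edgeCount G +_) (sym (+-identityʳ _))))))
   where
   up : Fin n → Fin n → ℕ
   up x y = bit (does (x Fin.<? y) ∧ adj x y)
   split : ∀ x y → bit (adj x y) ≡ up x y + up y x
   split x y with Fin.<-cmp x y
   ... | tri< h _ k rewrite dec-true (x Fin.<? y) h | dec-false (y Fin.<? x) k = sym (+-identityʳ _)
   ... | tri> k _ h rewrite dec-false (x Fin.<? y) k | dec-true (y Fin.<? x) h = cong bit (adj-sym x y)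
   ... | tri≈ k refl _ rewrite dec-false (x Fin.<? x) k = cong bit (adj-irrefl x)

  edgesIn-vertices : edgesIn adj Vs ≡ edgeCount G
  edgesIn-vertices = *-cancelˡ-≡ _ _ 2 (trans (sym (∑-degrees P Vs)) degree-sum)

  euler-bound : 3 ≤ n → edgeCount G + 6 ≤ 3 * n
  euler-bound h = subst (λ k → edgeCount G + 6 ≤ 3 * k) |V| (subst (λ e → e + 6 ≤ 3 * length Vs) edgesIn-vertices
   (edges-bound Fin._≟_ P Vs Vs! (subst (3 ≤_) (sym |V|) h)))

  double-star : ∀ {m x y} (L R : List (Fin n)) → x ~ y → m ≤ length L → m ≤ length R → Unique L → Unique R →
   (∀ {z} → z ∈ L → z ∉ R) → (∀ {z} → z ∈ L → (x ~ z) × z ≢ y) → (∀ {z} → z ∈ R → (y ~ z) × z ≢ x) → G Contains S m m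
  double-star {m} {x} {y} L R xy hL hR uL uR disj nL nR = record { embed = embed ; injective = inj _ _ ; preserves = pres _ _ }
   where
   embed : StarVertex m m → Fin n
   embed hubX      = x
   embed hubY      = y
   embed (leafX i) = lookup L (inject≤ i hL)
   embed (leafY i) = lookup R (inject≤ i hR)
   inL : ∀ i → lookup L (inject≤ i hL) ∈ L
   inL i = ∈-lookup (inject≤ i hL)
   inR : ∀ i → lookup R (inject≤ i hR) ∈ R
   inR i = ∈-lookup (inject≤ i hR)
   inj : ∀ a b → embed a ≡ embed b → a ≡ b
   inj hubX hubX e = refl
   inj hubX hubY e = ⊥-elim (~⇒≢ xy e)
   inj hubX (leafX i) e = ⊥-elim (~⇒≢ (proj₁ (nL (inL i))) e)
   inj hubX (leafY i) e = ⊥-elim (proj₂ (nR (inR i)) (sym e))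
   inj hubY hubX e = ⊥-elim (~⇒≢ xy (sym e))
   inj hubY hubY e = refl
   inj hubY (leafX i) e = ⊥-elim (proj₂ (nL (inL i)) (sym e))
   inj hubY (leafY i) e = ⊥-elim (~⇒≢ (proj₁ (nR (inR i))) e)
   inj (leafX i) hubX e = ⊥-elim (~⇒≢ (proj₁ (nL (inL i))) (sym e))
   inj (leafX i) hubY e = ⊥-elim (proj₂ (nL (inL i)) e)
   inj (leafX i) (leafX j) e = cong leafX (Fin.inject≤-injective hL hL i j (lookup-unique uL e))
   inj (leafX i) (leafY j) e = ⊥-elim (disj (inL i) (subst (_∈ R) (sym e) (inR j)))
   inj (leafY i) hubX e = ⊥-elim (proj₂ (nR (inR i)) e)
   inj (leafY i) hubY e = ⊥-elim (~⇒≢ (proj₁ (nR (inR i))) (sym e))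
   inj (leafY i) (leafX j) e = ⊥-elim (disj (inL j) (subst (_∈ R) e (inR i)))
   inj (leafY i) (leafY j) e = cong leafY (Fin.inject≤-injective hR hR i j (lookup-unique uR e))
   t : ∀ {b} → b ≡ true → T b
   t = Equivalence.from T-≡
   pres : ∀ a b → T (starAdj a b) → T (adj (embed a) (embed b))
   pres hubX      hubY      _ = t xy
   pres hubY      hubX      _ = t (~-sym xy)
   pres hubX      (leafX i) _ = t (proj₁ (nL (inL i)))
   pres (leafX i) hubX      _ = t (~-sym (proj₁ (nL (inL i))))
   pres hubY      (leafY i) _ = t (proj₁ (nR (inR i)))
   pres (leafY i) hubY      _ = t (~-sym (proj₁ (nR (inR i))))

  -- The private neighbours of x and of y, topped up with common neighbours, give the two sets of leaves.
  star-free-degrees : ∀ {m} → S m m Free G → ∀ {x y} → x ~ y → suc m ≤ deg x → suc m ≤ deg y →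
   deg x + deg y ≤ suc (2 * m) + common x y
  star-free-degrees {m} free {x} {y} xy dx dy with deg x + deg y ≤? suc (2 * m) + common x y
  ... | yes h = h
  ... | no h = ⊥-elim (free (double-star (A₁ ++ take k C) (B₁ ++ drop k C) xy
   (subst (m ≤_) (sym lengthL) enoughL) (subst (m ≤_) (sym lengthR) enoughR)
   (++⁺ uA (take⁺ k uC) (λ { (i , j) → A#C i (∈-take k j) }))
   (++⁺ uB (drop⁺ k uC) (λ { (i , j) → B#C i (∈-drop k j) })) disj inL inR))
   where
   only : Fin n → Fin n → Fin n → Bool
   only x y z = adj x z ∧ (not (adj y z) ∧ not (isYes′ z y))
    where
    isYes′ : Fin n → Fin n → Bool
    isYes′ z y = does (z Fin.≟ y)
   both : Fin n → Bool
   both z = adj x z ∧ adj y z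
   A₁ = filterᵇ (only x y) Vs
   B₁ = filterᵇ (only y x) Vs
   C = filterᵇ both Vs
   a = count (only x y) Vs
   b = count (only y x) Vs
   k = m ∸ a
   uA : Unique A₁
   uA = unique-filter (only x y) Vs!
   uB : Unique B₁
   uB = unique-filter (only y x) Vs!
   uC : Unique C
   uC = unique-filter both Vs!
   total : ∀ {x y} → x ~ y → deg x ≡ suc (count (only x y) Vs + common x y)
   total {x} {y} xy = trans (trans (∑-cong Vs (λ {z} _ → part z)) (trans (∑-+ Vs _ _)
    (cong₂ _+_ refl (∑-+ Vs _ _)))) (cong (_+ (count (only x y) Vs + common x y)) one)
    where
    part : ∀ z → bit (adj x z) ≡ bit (does (z Fin.≟ y)) + (bit (only x y z) + bit (adj x z ∧ adj y z))
    part z with z Fin.≟ y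
    part z | yes refl rewrite xy | adj-irrefl z = refl
    part z | no _ with adj x z | adj y z
    ... | false | _     = refl
    ... | true  | true  = refl
    ... | true  | false = refl
    one : count (λ z → does (z Fin.≟ y)) Vs ≡ 1
    one = ≤-antisym
     (≤-trans (≥-reflexive (length-filter _ Vs)) (at-most-one (unique-filter _ Vs!) (λ i → yes-≡ (proj₂ (∈-filter⁻ (λ z → does (z Fin.≟ y)) {Vs} i)))))
     (length≤count _ {y ∷ []} ([] ∷ []) λ { #0 → ∈V , ≡-yes y })
     where
     yes-≡ : ∀ {z} → does (z Fin.≟ y) ≡ true → z ≡ y
     yes-≡ {z} h with z Fin.≟ y
     ... | yes e = e
     ≡-yes : ∀ z → does (z Fin.≟ z) ≡ true
     ≡-yes z with z Fin.≟ z
     ... | yes _ = refl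
     ... | no h  = ⊥-elim (h refl)
     at-most-one : ∀ {zs : List (Fin n)} → Unique zs → (∀ {z} → z ∈ zs → z ≡ y) → length zs ≤ 1
     at-most-one {[]} u h = z≤n
     at-most-one {z ∷ []} u h = s≤s z≤n
     at-most-one {z ∷ z′ ∷ zs} ((k ∷ _) ∷ _) h = ⊥-elim (k (trans (h #0) (sym (h #1))))
   common-sym : common y x ≡ common x y
   common-sym = ∑-cong Vs (λ {z} _ → cong bit (∧-comm (adj y z) (adj x z)))
   c₀ = common x y
   da : deg x ≡ suc (a + c₀)
   da = total xy
   db : deg y ≡ suc (b + c₀)
   db = trans (total (~-sym xy)) (cong (λ z → suc (b + z)) common-sym)
   lengthL : length (A₁ ++ take k C) ≡ a + (k ⊓ c₀)
   lengthL = trans (length-++ A₁) (cong₂ _+_ (length-filter _ Vs) (trans (length-take k C) (cong (k ⊓_) (length-filter both Vs))))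
   lengthR : length (B₁ ++ drop k C) ≡ b + (c₀ ∸ k)
   lengthR = trans (length-++ B₁) (cong₂ _+_ (length-filter _ Vs) (trans (length-drop k C) (cong (_∸ k) (length-filter both Vs))))
   m≤a+c : m ≤ a + c₀
   m≤a+c = s≤s⁻¹ (subst (suc m ≤_) da dx)
   m≤b+c : m ≤ b + c₀
   m≤b+c = s≤s⁻¹ (subst (suc m ≤_) db dy)
   enoughL : m ≤ a + (k ⊓ c₀)
   enoughL with ⊓-sel k c₀
   ... | inj₁ e rewrite e = m≤n+m∸n m a
   ... | inj₂ e rewrite e = m≤a+c
   enoughR : m ≤ b + (c₀ ∸ k)
   enoughR with a ≤? m
   ... | no g rewrite m≤n⇒m∸n≡0 (<⇒≤ (≰⇒> g)) = m≤b+c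
   ... | yes g with k ≤? c₀
   ...   | no g′ = ⊥-elim (g′ (+-cancelˡ-≤ a k c₀ (subst (_≤ a + c₀) (sym (m+[n∸m]≡n g)) m≤a+c)))
   ...   | yes g′ = ≮⇒≥ λ l → refute (a ∷ b ∷ c₀ ∷ m ∷ k ∷ c₀ ∸ k ∷ deg x ∷ deg y ∷ [])
    (1 ×[ var 7 ≤ lit 1 ⊕ (var 1 ⊕ var 2) ] ∷ 1 ×[ var 6 ≤ lit 1 ⊕ (var 0 ⊕ var 2) ] ∷ 1 ×[ lit 1 ⊕ (lit 1 ⊕ 2 ⊛ var 3 ⊕ var 2) ≤ var 6 ⊕ var 7 ]
     ∷ 1 ×[ lit 1 ⊕ (var 1 ⊕ var 5) ≤ var 3 ] ∷ 1 ×[ var 2 ≤ var 4 ⊕ var 5 ] ∷ 1 ×[ var 0 ⊕ var 4 ≤ var 3 ] ∷ [])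
    (≤-reflexive db ∷ ≤-reflexive da ∷ ≰⇒> h ∷ l ∷ ≥-reflexive (m+[n∸m]≡n g′) ∷ ≤-reflexive (m+[n∸m]≡n g) ∷ []) refl
   A#C : ∀ {z} → z ∈ A₁ → z ∉ C
   A#C {z} i j = true≢false (∧ʳ {adj x z} (proj₂ (∈-filter⁻ both {Vs} j)))
    (not-true (∧ˡ {not (adj y z)} (∧ʳ {adj x z} (proj₂ (∈-filter⁻ (only x y) {Vs} i)))))
   B#C : ∀ {z} → z ∈ B₁ → z ∉ C
   B#C {z} i j = true≢false (∧ˡ {adj x z} (proj₂ (∈-filter⁻ both {Vs} j)))
    (not-true (∧ˡ {not (adj x z)} (∧ʳ {adj y z} (proj₂ (∈-filter⁻ (only y x) {Vs} i)))))
   disj : ∀ {z} → z ∈ A₁ ++ take k C → z ∉ B₁ ++ drop k C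
   disj {z} i j with ∈-++⁻ A₁ i | ∈-++⁻ B₁ j
   ... | inj₁ p | inj₁ q = true≢false (∧ˡ {adj y z} (proj₂ (∈-filter⁻ (only y x) {Vs} q)))
    (not-true (∧ˡ {not (adj y z)} (∧ʳ {adj x z} (proj₂ (∈-filter⁻ (only x y) {Vs} p)))))
   ... | inj₁ p | inj₂ q = A#C p (∈-drop k q)
   ... | inj₂ p | inj₁ q = B#C q (∈-take k p)
   ... | inj₂ p | inj₂ q = take-drop-disjoint k uC p q
   side : ∀ {x y z} → only x y z ≡ true → (x ~ z) × z ≢ y
   side {x} {y} {z} e with z Fin.≟ y | adj x z | adj y z
   ... | no g | true | false = refl , g
   inL : ∀ {z} → z ∈ A₁ ++ take k C → (x ~ z) × z ≢ y
   inL {z} i with ∈-++⁻ A₁ i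
   ... | inj₁ p = side {x} {y} (proj₂ (∈-filter⁻ (only x y) {Vs} p))
   ... | inj₂ q with ∈-filter⁻ both {Vs} (∈-take k q)
   ...   | _ , e = ∧ˡ {adj x z} e , ~⇒≢ (∧ʳ {adj x z} e) ∘ sym
   inR : ∀ {z} → z ∈ B₁ ++ drop k C → (y ~ z) × z ≢ x
   inR {z} i with ∈-++⁻ B₁ i
   ... | inj₁ p = side {y} {x} (proj₂ (∈-filter⁻ (only y x) {Vs} p))
   ... | inj₂ q with ∈-filter⁻ both {Vs} (∈-drop k q)
   ...   | _ , e = ∧ʳ {adj x z} e , ~⇒≢ (∧ˡ {adj x z} e) ∘ sym

open Stars

module ClawCounting {V : Set} (_≟_ : DecidableEquality V) where
 open import Data.Bool.Properties using (∨-identityʳ)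
 open import Data.Fin.Patterns
 open import Data.List using (take)
 open import Data.List.Properties using (length-take)
 open import Data.List.Relation.Binary.Permutation.Propositional using (_↭_; ↭-sym)
 open import Data.List.Relation.Unary.Unique.Propositional.Properties using (take⁺)
 open import Data.Nat.Tactic.RingSolver using (solve-∀)
 import Data.Vec as Vec
 open import Data.Vec using (Vec; []; _∷_)
 open import Data.Vec.Relation.Unary.All using ([]; _∷_)
 open import Data.Vec.Relation.Unary.AllPairs using ([]; _∷_)
 import Data.Vec.Relation.Unary.Unique.Propositional as VecUnique
 open import Data.Vec.Relation.Unary.Unique.Propositional.Properties using (lookup-injective)
 open import Relation.Nullary using (¬?)

 record Claws (G : ParityGraph V) (bases tips : List V) : Set where
  open ParityGraph G
  field
   bases! : Unique bases
   tips!  : Unique tips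
   outside     : ∀ {w b} → w ∈ tips → b ∈ bases → w ≢ b
   independent : ∀ {w w′} → w ∈ tips → w′ ∈ tips → adj w w′ ≡ false
   three       : ∀ {w} → w ∈ tips → count (adj w) bases ≡ 3

 module _ (G : ParityGraph V) where
  open ParityGraph G

  private
   _~_ : V → V → Set
   x ~ y = adj x y ≡ true

  K₃₃-subdivided-free : ∀ {x y₁ y₂ y₃ w w′ s t u} →
   VecUnique.Unique (x ∷ y₁ ∷ y₂ ∷ y₃ ∷ w ∷ w′ ∷ s ∷ t ∷ u ∷ []) →
   w ~ x → w ~ y₁ → w ~ y₂ → w′ ~ x → w′ ~ y₁ → w′ ~ y₂ → t ~ x → t ~ y₃ → u ~ y₁ → u ~ y₃ → s ~ y₂ → s ~ y₃ → ⊥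
  K₃₃-subdivided-free unique a b c d e f g h i j k l = Cancellation.unrealisable 9 G (Vec.lookup (_ ∷ _ ∷ _ ∷ _ ∷ _ ∷ _ ∷ _ ∷ _ ∷ _ ∷ [])) (λ {i} {j} → lookup-injective unique i j)
   (((4F , 0F) , 3 , 0) ∷ ((4F , 1F) , 3 , 1) ∷ ((4F , 2F) , 3 , 2) ∷ ((5F , 0F) , 4 , 0) ∷ ((5F , 1F) , 4 , 1) ∷ ((5F , 2F) , 4 , 2)
    ∷ ((7F , 0F) , 5 , 0) ∷ ((7F , 3F) , 5 , 0) ∷ ((8F , 1F) , 5 , 1) ∷ ((8F , 3F) , 5 , 1) ∷ ((6F , 2F) , 5 , 2) ∷ ((6F , 3F) , 5 , 2) ∷ [])
   (refl , refl) (a ∷ b ∷ c ∷ d ∷ e ∷ f ∷ g ∷ h ∷ i ∷ j ∷ k ∷ l ∷ [])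

 module _ {G : ParityGraph V} {bases tips : List V} (C : Claws G bases tips) where
  open ParityGraph G
  open Claws C

  over : V → V → ℕ
  over x y = count (λ w → adj w x ∧ adj w y) tips

  over₃ : V → V → V → ℕ
  over₃ x y z = count (λ w → (adj w x ∧ adj w y) ∧ adj w z) tips

  shrink : ∀ {x Bs} → bases ↭ x ∷ Bs → count (λ w → adj w x) tips ≡ 0 → Claws G Bs tips
  shrink {x} {Bs} π none = record
   { bases! = tail! (unique-↭ π bases!) ; tips! = tips!
   ; outside = λ i j → outside i (∈-resp-↭ (↭-sym π) (there j)) ; independent = independent
   ; three = λ {w} i → trans (sym (cong (λ b → bit b + count (adj w) Bs) (zero-at i)))
     (trans (sym (∑-↭ (λ z → bit (adj w z)) π)) (three i)) }
   where
   tail! : ∀ {x : V} {xs} → Unique (x ∷ xs) → Unique xs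
   tail! (_ ∷ u) = u
   zero-at : ∀ {w} → w ∈ tips → adj w x ≡ false
   zero-at {w} i with adj w x in e
   ... | false = refl
   ... | true  = ⊥-elim (<⇒≱ (length≤count (λ w → adj w x) {w ∷ []} ([] ∷ []) λ { #0 → i , e }) (≤-reflexive none))

  -- Contracting a tip over x and y onto x, and then y onto x.
  merge : ∀ {x y w₀ zs} → bases ↭ x ∷ y ∷ zs → w₀ ∈ tips → adj w₀ x ≡ true → adj w₀ y ≡ true →
   ∃[ G′ ] Claws G′ (x ∷ zs) (filterᵇ (λ w → not (adj w x ∧ adj w y)) tips)
  merge {x} {y} {w₀} {zs} π i₀ e₀ f₀ with unique-↭ π bases!
  ... | (x≢y ∷ x≢zs) ∷ (y≢zs ∷ uzs) = G₂ , record
   { bases! = x≢zs ∷ uzs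
   ; tips! = unique-filter _ tips!
   ; outside = λ { i #0 → ≢x (tip i) ; i (there j) → outside (tip i) (in-zs j) }
   ; independent = λ {w} {w′} i j → trans (away₂ (≢x (tip i)) (≢w₀ i) (≢y (tip i)) (≢x (tip j)) (≢w₀ j) (≢y (tip j)))
     (independent (tip i) (tip j))
   ; three = λ {w} i → trans (cong₂ _+_ (at-x i) (∑-cong zs (λ j → cong bit
      (away₂ (≢x (tip i)) (≢w₀ i) (≢y (tip i)) (zs≢x j) (zs≢w₀ j) (zs≢y j)))))
     (trans (+-assoc (bit (adj w x)) _ _) (trans (sym (∑-↭ (λ z → bit (adj w z)) π)) (three (tip i)))) }
   where
   G₁ : ParityGraph V
   G₁ = Contraction.contract _≟_ G x w₀ (~-sym e₀)
   y≢w₀ : y ≢ w₀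
   y≢w₀ = ~⇒≢ f₀ ∘ sym
   adj₁ = ParityGraph.adj G₁
   xy : adj₁ x y ≡ true
   xy = trans (contract-at _≟_ G x w₀ (~-sym e₀) (x≢y ∘ sym) y≢w₀) (or (adj x y) f₀)
    where
    or : ∀ a {b} → b ≡ true → a ∨ b ≡ true
    or true  h = refl
    or false h = h
   G₂ : ParityGraph V
   G₂ = Contraction.contract _≟_ G₁ x y xy
   adj₂ = ParityGraph.adj G₂
   kept : List V
   kept = filterᵇ (λ w → not (adj w x ∧ adj w y)) tips
   tip : ∀ {w} → w ∈ kept → w ∈ tips
   tip i = proj₁ (∈-filter⁻ _ i)
   x∈ : x ∈ bases
   x∈ = ∈-resp-↭ (↭-sym π) #0
   y∈ : y ∈ bases
   y∈ = ∈-resp-↭ (↭-sym π) #1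
   in-zs : ∀ {z} → z ∈ zs → z ∈ bases
   in-zs j = ∈-resp-↭ (↭-sym π) (there (there j))
   ≢x : ∀ {w} → w ∈ tips → w ≢ x
   ≢x i = outside i x∈
   ≢y : ∀ {w} → w ∈ tips → w ≢ y
   ≢y i = outside i y∈
   ≢w₀ : ∀ {w} → w ∈ kept → w ≢ w₀
   ≢w₀ i refl = true≢false (∧-true e₀ f₀) (not-true (proj₂ (∈-filter⁻ (λ w → not (adj w x ∧ adj w y)) {tips} i)))
   zs≢x : ∀ {z} → z ∈ zs → z ≢ x
   zs≢x j = All.lookup x≢zs j ∘ sym
   zs≢y : ∀ {z} → z ∈ zs → z ≢ y
   zs≢y j = All.lookup y≢zs j ∘ sym
   zs≢w₀ : ∀ {z} → z ∈ zs → z ≢ w₀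
   zs≢w₀ j = outside i₀ (in-zs j) ∘ sym
   away₂ : ∀ {p q} → p ≢ x → p ≢ w₀ → p ≢ y → q ≢ x → q ≢ w₀ → q ≢ y → adj₂ p q ≡ adj p q
   away₂ px pw py qx qw qy = trans (contract-away _≟_ G₁ x y xy px py qx qy) (contract-away _≟_ G x w₀ (~-sym e₀) px pw qx qw)
   at-x : ∀ {w} → w ∈ kept → bit (adj₂ w x) ≡ bit (adj w x) + bit (adj w y)
   at-x {w} i = trans (cong bit (trans (ParityGraph.adj-sym G₂ w x) (trans (contract-at _≟_ G₁ x y xy (≢x (tip i)) (≢y (tip i)))
    (cong₂ _∨_ (trans (contract-at _≟_ G x w₀ (~-sym e₀) (≢x (tip i)) (≢w₀ i))
      (trans (cong₂ _∨_ (adj-sym x w) (independent i₀ (tip i))) (∨-identityʳ _)))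
     (trans (contract-away _≟_ G x w₀ (~-sym e₀) (x≢y ∘ sym) y≢w₀ (≢x (tip i)) (≢w₀ i)) (adj-sym y w))))))
    (exclusive (adj w x) (adj w y) (not-true (proj₂ (∈-filter⁻ (λ w → not (adj w x ∧ adj w y)) {tips} i))))
    where
    exclusive : ∀ a b → a ∧ b ≡ false → bit (a ∨ b) ≡ bit a + bit b
    exclusive true  false h = refl
    exclusive false b     h = refl

  covers : V → V → V → V → Bool
  covers x y z w = (adj w x ∧ adj w y) ∧ adj w z

  covered : ∀ {x y z w} → covers x y z w ≡ true → adj w x ≡ true × adj w y ≡ true × adj w z ≡ true
  covered {x} {y} {w = w} h = ∧ˡ (∧ˡ h) , ∧ʳ {adj w x} (∧ˡ h) , ∧ʳ {adj w x ∧ adj w y} h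

  few-over₃ : ∀ {x y z} → x ≢ y → x ≢ z → y ≢ z → over₃ x y z ≤ 2
  few-over₃ {x} {y} {z} xy xz yz = ≮⇒≥ λ h → go (pick₃ (covers x y z) tips! h)
   where
   go : ¬ _
   go (a , b , c , (ab , ac , bc) , (_ , ea) , (_ , eb) , (_ , ec)) with covered {x} ea | covered {x} eb | covered {x} ec
   ... | ax , ay , az | bx , by , bz | cx , cy , cz = K₃₃-free G ab ac bc xy xz yz ax ay az bx by bz cx cy cz

  module Link (sparse : ∀ {x y} → x ∈ bases → y ∈ bases → x ≢ y → ¬ (1 ≤ over x y × over x y ≤ 5))
   {x Bs} (π : bases ↭ x ∷ Bs) (d<15 : count (λ w → adj w x) tips < 15) where

   linked : V → Bool
   linked y = 0 <ᵇ over x y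

   x∈ : x ∈ bases
   x∈ = ∈-resp-↭ (↭-sym π) #0

   base : ∀ {y} → y ∈ Bs → y ∈ bases
   base i = ∈-resp-↭ (↭-sym π) (there i)

   Bs! : Unique Bs
   Bs! with unique-↭ π bases!
   ... | _ ∷ u = u

   x≢ : ∀ {y} → y ∈ Bs → x ≢ y
   x≢ i with unique-↭ π bases!
   ... | h ∷ _ = All.lookup h i

   six : ∀ {y} → y ∈ Bs → linked y ≡ true → 6 ≤ over x y
   six {y} i h with over x y in e
   ... | suc k = ≰⇒> λ l → sparse x∈ (base i) (x≢ i) (subst (1 ≤_) (sym e) (s≤s z≤n) , subst (_≤ 5) (sym e) l)

   zero-unlinked : ∀ {y} → linked y ≡ false → over x y ≡ 0
   zero-unlinked {y} h with over x y
   ... | zero = refl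

   two-more : ∀ {w} → w ∈ tips → adj w x ≡ true → count (adj w) Bs ≡ 2
   two-more {w} i e = suc-injective (trans (sym (cong (λ b → bit b + count (adj w) Bs) e))
    (trans (sym (∑-↭ (λ z → bit (adj w z)) π)) (three i)))

   exchange-count : ∀ (p : V → Bool) k (ys : List V) → (∀ {w} → w ∈ tips → p w ≡ true → count (adj w) ys ≡ k) →
    ∑ ys (λ y → count (λ w → p w ∧ adj w y) tips) ≡ k * count p tips
   exchange-count p k ys h = trans (∑-comm ys tips (λ y w → bit (p w ∧ adj w y))) (trans (∑-cong tips (λ {w} i → each i)) (∑-* tips k _))
    where
    each : ∀ {w} → w ∈ tips → ∑ ys (λ y → bit (p w ∧ adj w y)) ≡ k * bit (p w)
    each {w} i with p w in e
    ... | false = trans (∑-zero ys) (sym (*-zeroʳ k))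
    ... | true  = trans (h i e) (sym (*-identityʳ k))

   few-linked : count linked Bs ≤ 4
   few-linked = ≮⇒≥ λ h → refute (count linked Bs ∷ ∑ Bs (over x) ∷ count (λ w → adj w x) tips ∷ [])
    (6 ×[ lit 5 ≤ var 0 ] ∷ 1 ×[ 6 ⊛ var 0 ≤ var 1 ] ∷ 1 ×[ var 1 ≤ 2 ⊛ var 2 ] ∷ 2 ×[ lit 1 ⊕ var 2 ≤ lit 15 ] ∷ [])
    (h ∷ ≤-trans (≥-reflexive (∑-* Bs 6 _)) (∑-mono Bs (λ {y} i → each i (linked y) refl))
      ∷ ≤-reflexive (exchange-count (λ w → adj w x) 2 Bs two-more) ∷ d<15 ∷ []) refl
    where
    each : ∀ {y} → y ∈ Bs → ∀ b → linked y ≡ b → 6 * bit (linked y) ≤ over x y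
    each i true  e rewrite e = six i e
    each i false e rewrite e = z≤n

   module _ {y Bs′} (y∈ : y ∈ Bs) (ly : linked y ≡ true) (ρ : Bs ↭ y ∷ Bs′) where
    in-Bs : ∀ {z} → z ∈ Bs′ → z ∈ Bs
    in-Bs i = ∈-resp-↭ (↭-sym ρ) (there i)

    y≢ : ∀ {z} → z ∈ Bs′ → y ≢ z
    y≢ i with unique-↭ ρ Bs!
    ... | h ∷ _ = All.lookup h i

    sum₃ : 6 ≤ ∑ Bs′ (over₃ x y)
    sum₃ = subst (6 ≤_) (sym (trans (exchange-count (λ w → adj w x ∧ adj w y) 1 Bs′ one-more) (+-identityʳ _))) (six y∈ ly)
     where
     one-more : ∀ {w} → w ∈ tips → adj w x ∧ adj w y ≡ true → count (adj w) Bs′ ≡ 1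
     one-more {w} i e = suc-injective (trans (sym (cong (λ b → bit b + count (adj w) Bs′) (∧ʳ {adj w x} e)))
      (trans (sym (∑-↭ (λ z → bit (adj w z)) ρ)) (two-more i (∧ˡ e))))

    bound₃ : ∀ {z} → z ∈ Bs′ → over₃ x y z ≤ 2 * bit (linked z)
    bound₃ {z} i with linked z in e
    ... | true  = few-over₃ (x≢ y∈) (x≢ (in-Bs i)) (y≢ i)
    ... | false = ≤-trans (count-mono tips (λ {w} _ h → ∧-true (∧ˡ (∧ˡ h)) (∧ʳ {adj w x ∧ adj w y} h)))
     (≤-reflexive (zero-unlinked e))

    count-linked : count linked Bs ≡ suc (count linked Bs′)
    count-linked = trans (∑-↭ (λ z → bit (linked z)) ρ) (cong (λ b → bit b + count linked Bs′) ly)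

    three-linked : 3 ≤ count linked Bs′
    three-linked = *-cancelˡ-≤ 2 (≤-trans sum₃ (≤-trans (∑-mono Bs′ bound₃) (≤-reflexive (∑-* Bs′ 2 _))))

    double : ∀ {z} → z ∈ Bs′ → linked z ≡ true → 2 ≤ over₃ x y z
    double {z} i lz with front i
    ... | zs , σ = ≮⇒≥ λ few → refute (over₃ x y z ∷ ∑ zs (over₃ x y) ∷ count linked zs ∷ count linked Bs ∷ [])
     (1 ×[ lit 6 ≤ var 0 ⊕ var 1 ] ∷ 1 ×[ lit 1 ⊕ var 0 ≤ lit 2 ] ∷ 1 ×[ var 1 ≤ 2 ⊛ var 2 ]
      ∷ 2 ×[ lit 1 ⊕ (lit 1 ⊕ var 2) ≤ var 3 ] ∷ 2 ×[ var 3 ≤ lit 4 ] ∷ [])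
     (≤-trans sum₃ (≤-reflexive (∑-↭ (over₃ x y) σ)) ∷ few
      ∷ ≤-trans (∑-mono zs (λ j → bound₃ (∈-resp-↭ (↭-sym σ) (there j)))) (≤-reflexive (∑-* zs 2 _))
      ∷ ≥-reflexive (trans count-linked (cong suc (trans (∑-↭ (λ z → bit (linked z)) σ) (cong (λ b → bit b + count linked zs) lz))))
      ∷ few-linked ∷ []) refl

   pair-over : ∀ {y z} → y ∈ Bs → linked y ≡ true → z ∈ Bs → linked z ≡ true → z ≢ y → 2 ≤ over₃ x y z
   pair-over y∈ ly z∈ lz zy with front y∈
   ... | Bs′ , ρ = double y∈ ly ρ (tail∈ (∈-resp-↭ ρ z∈) zy) lz

   TwoTips : V → V → Set
   TwoTips y z = ∃[ w ] ∃[ w′ ] w ≢ w′ × (w ∈ tips) × (w′ ∈ tips) ×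
    (adj w x ≡ true × adj w y ≡ true × adj w z ≡ true) × (adj w′ x ≡ true × adj w′ y ≡ true × adj w′ z ≡ true)

   two-tips : ∀ {y z} → 2 ≤ over₃ x y z → TwoTips y z
   two-tips {y} {z} h with pick₂ (covers x y z) tips! h
   ... | a , b , ab , (ia , ea) , (ib , eb) = a , b , ab , ia , ib , covered {x} ea , covered {x} eb

   not-four : ∀ {w a b c d} → w ∈ tips → a ∈ bases → b ∈ bases → c ∈ bases → d ∈ bases → Unique (a ∷ b ∷ c ∷ d ∷ []) →
    adj w a ≡ true → adj w b ≡ true → adj w c ≡ true → adj w d ≢ true
   not-four {w} i a b c d u ea eb ec ed = <⇒≱ {3} (length≤count (adj w) u
    λ { #0 → a , ea ; #1 → b , eb ; #2 → c , ec
     ; #3 → d , ed }) (≤-reflexive (three i))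

   dense : ∀ {y₁ y₂ y₃} → y₁ ∈ Bs → y₂ ∈ Bs → y₃ ∈ Bs → linked y₁ ≡ true → linked y₂ ≡ true → linked y₃ ≡ true →
    y₁ ≢ y₂ → y₁ ≢ y₃ → y₂ ≢ y₃ → ⊥
   dense {y₁} {y₂} {y₃} i₁ i₂ i₃ l₁ l₂ l₃ n₁₂ n₁₃ n₂₃ =
    spread (two-tips (pair-over i₁ l₁ i₂ l₂ (n₁₂ ∘ sym))) (two-tips (pair-over i₁ l₁ i₃ l₃ (n₁₃ ∘ sym))) (two-tips (pair-over i₂ l₂ i₃ l₃ (n₂₃ ∘ sym)))
    where
    tipx : ∀ {w} → w ∈ tips → x ≢ w
    tipx i = outside i x∈ ∘ sym
    tip : ∀ {w y} → y ∈ Bs → w ∈ tips → y ≢ w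
    tip j i = outside i (base j) ∘ sym
    w-y₃ : ∀ {w t} → w ∈ tips → adj w x ≡ true → adj w y₁ ≡ true → adj w y₂ ≡ true → adj t y₃ ≡ true → w ≢ t
    w-y₃ i a b c d refl = not-four i x∈ (base i₁) (base i₂) (base i₃)
     ((x≢ i₁ ∷ x≢ i₂ ∷ x≢ i₃ ∷ []) ∷ (n₁₂ ∷ n₁₃ ∷ []) ∷ (n₂₃ ∷ []) ∷ [] ∷ []) a b c d
    s≢ : ∀ {s w} → s ∈ tips → adj s x ≡ true → adj s y₂ ≡ true → adj s y₃ ≡ true → adj w y₁ ≡ true → w ≢ s
    s≢ st sx s2 s3 e refl = not-four st x∈ (base i₂) (base i₃) (base i₁)
     ((x≢ i₂ ∷ x≢ i₃ ∷ x≢ i₁ ∷ []) ∷ (n₂₃ ∷ (n₁₂ ∘ sym) ∷ []) ∷ ((n₁₃ ∘ sym) ∷ []) ∷ [] ∷ []) sx s2 s3 e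
    spread : TwoTips y₁ y₂ → TwoTips y₁ y₃ → TwoTips y₂ y₃ → ⊥
    spread (w , w′ , ww′ , wt , w′t , (wx , w1 , w2) , (w′x , w′1 , w′2)) (t , u , tu , tt , ut , (tx , t1 , t3) , (ux , u1 , u3))
        (s , _ , _ , st , _ , (sx , s2 , s3) , _) =
     K₃₃-subdivided-free G
      ((x≢ i₁ ∷ x≢ i₂ ∷ x≢ i₃ ∷ tipx wt ∷ tipx w′t ∷ tipx st ∷ tipx tt ∷ tipx ut ∷ [])
      ∷ (n₁₂ ∷ n₁₃ ∷ tip i₁ wt ∷ tip i₁ w′t ∷ tip i₁ st ∷ tip i₁ tt ∷ tip i₁ ut ∷ [])
      ∷ (n₂₃ ∷ tip i₂ wt ∷ tip i₂ w′t ∷ tip i₂ st ∷ tip i₂ tt ∷ tip i₂ ut ∷ [])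
      ∷ (tip i₃ wt ∷ tip i₃ w′t ∷ tip i₃ st ∷ tip i₃ tt ∷ tip i₃ ut ∷ [])
      ∷ (ww′ ∷ s≢ st sx s2 s3 w1 ∷ w-y₃ wt wx w1 w2 t3 ∷ w-y₃ wt wx w1 w2 u3 ∷ [])
      ∷ (s≢ st sx s2 s3 w′1 ∷ w-y₃ w′t w′x w′1 w′2 t3 ∷ w-y₃ w′t w′x w′1 w′2 u3 ∷ [])
      ∷ ((s≢ st sx s2 s3 t1 ∘ sym) ∷ (s≢ st sx s2 s3 u1 ∘ sym) ∷ [])
      ∷ (tu ∷ []) ∷ [] ∷ [])
      wx w1 w2 w′x w′1 w′2 tx t3 u1 u3 s2 s3

   no-tip : ∀ {w} → w ∈ tips → adj w x ≢ true
   no-tip {w} i wx with count-pos (adj w) Bs (≤-trans (s≤s z≤n) (≥-reflexive (two-more i wx)))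
   ... | y , y∈ , wy with front y∈
   ...   | Bs′ , ρ = finish (pick₂ linked (tail! (unique-↭ ρ Bs!)) (≤-trans (s≤s (s≤s z≤n)) (three-linked y∈ ly ρ)))
    where
    tail! : ∀ {x : V} {xs} → Unique (x ∷ xs) → Unique xs
    tail! (_ ∷ u) = u
    ly : linked y ≡ true
    ly with over x y | length≤count (λ w → adj w x ∧ adj w y) {w ∷ []} {tips} ([] ∷ []) (λ { #0 → i , ∧-true wx wy })
    ... | suc _ | _ = refl
    finish : ¬ _
    finish (a , b , ab , (ia , la) , (ib , lb)) =
     dense y∈ (in-Bs y∈ ly ρ ia) (in-Bs y∈ ly ρ ib) ly la lb (y≢ y∈ ly ρ ia) (y≢ y∈ ly ρ ib) ab

   isolated : count (λ w → adj w x) tips ≡ 0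
   isolated = n≤0⇒n≡0 (≮⇒≥ λ h → let w , i , wx = count-pos (λ w → adj w x) tips h in no-tip i wx)

 claws-bound′ : ∀ k G Bs Ws → Claws G Bs Ws → length Bs ≡ 2 + k → length Ws + 10 ≤ 5 * (2 + k)
 claws-bound′ zero G (a ∷ b ∷ []) [] C e = ≤-refl
 claws-bound′ zero G (a ∷ b ∷ []) (w ∷ Ws) C e = ⊥-elim (<⇒≱ (s≤s (count≤length (ParityGraph.adj G w) (a ∷ b ∷ [])))
  (≥-reflexive (Claws.three C #0)))
 claws-bound′ (suc k) G Bs Ws C |Bs| with length Ws + 10 ≤? 5 * (3 + k)
 ... | yes h = h
 ... | no h = ⊥-elim contradiction₁
  where
  open ParityGraph G
  m = 6 + 5 * k
  tips = take m Ws
  |tips| : length tips ≡ m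
  |tips| = trans (length-take m Ws) (m≤n⇒m⊓n≡m (+-cancelʳ-≤ 10 m (length Ws) (≤-trans (≤-reflexive (q k)) (≰⇒> h))))
   where
   q : ∀ k → 6 + 5 * k + 10 ≡ suc (5 * (3 + k))
   q = solve-∀
  C′ : Claws G Bs tips
  C′ = record { bases! = Claws.bases! C ; tips! = take⁺ m (Claws.tips! C)
   ; outside = λ i → Claws.outside C (∈-take m i) ; independent = λ i j → Claws.independent C (∈-take m i) (∈-take m j)
   ; three = λ i → Claws.three C (∈-take m i) }
  few : ∑ Bs (λ x → count (λ w → adj w x) tips) < ∑ Bs (λ _ → 15)
  few rewrite ∑-comm Bs tips (λ x w → bit (adj w x)) | ∑-cong tips (Claws.three C′) | ∑-const tips 3 | |tips| | ∑-const Bs 15 | |Bs|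
   = ≰⇒> λ h → refute (k ∷ []) (1 ×[ 15 ⊛ (lit 3 ⊕ var 0) ≤ 3 ⊛ (lit 6 ⊕ 5 ⊛ var 0) ] ∷ [])
    (h ∷ []) refl
  P? : ∀ x y → Dec (x ≢ y × (1 ≤ over C′ x y × over C′ x y ≤ 5))
  P? x y = ¬? (x ≟ y) ×-dec ((1 ≤? over C′ x y) ×-dec (over C′ x y ≤? 5))
  smaller : ∀ {G′ Bs′ Ws′} → Claws G′ Bs′ Ws′ → length Bs′ ≡ 2 + k → length tips ≤ length Ws′ + 5 → ⊥
  smaller {G′} {Bs′} {Ws′} D e l = refute (k ∷ length tips ∷ length Ws′ ∷ [])
   (1 ×[ lit 6 ⊕ 5 ⊛ var 0 ≤ var 1 ] ∷ 1 ×[ var 1 ≤ var 2 ⊕ lit 5 ] ∷ 1 ×[ var 2 ⊕ lit 10 ≤ 5 ⊛ (lit 2 ⊕ var 0) ] ∷ [])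
   (≥-reflexive |tips| ∷ l ∷ claws-bound′ k G′ Bs′ Ws′ D e ∷ []) refl
  contradiction₁ : ⊥
  contradiction₁ with find-pair P? Bs
  ... | inj₁ (x , y , i , j , xy , some , few₅) with two-out _≟_ (Claws.bases! C′) i j xy
  ...   | zs , π with count-pos (λ w → adj w x ∧ adj w y) tips some
  ...     | w , l , e with merge C′ π l (∧ˡ e) (∧ʳ {adj w x} e)
  ...       | G′ , D = smaller D (suc-injective (trans (sym (↭-length π)) |Bs|)) (≤-trans (≤-reflexive (sym
    (count-not (λ w → adj w x ∧ adj w y) tips))) (≤-trans (≤-reflexive (+-comm (over C′ x y) _)) (+-mono-≤ (≥-reflexive (length-filter (λ w → not (adj w x ∧ adj w y)) tips)) few₅)))
  contradiction₁ | inj₂ sparse with ∑-<⇒∃ Bs _ _ few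
  ... | x , i , d<15 with front i
  ...   | Bs′ , π = smaller (shrink C′ π (Link.isolated C′ (λ i j xy h → sparse i j (xy , h)) π d<15))
   (suc-injective (trans (sym (↭-length π)) |Bs|)) (m≤m+n _ 5)

 -- The planar incidence bound for vertices of degree three is 2|bases| − 4; this weaker bound suffices.
 claws-bound : ∀ {G Bs Ws} → Claws G Bs Ws → 2 ≤ length Bs → length Ws + 10 ≤ 5 * length Bs
 claws-bound {G} {Bs} {Ws} C h = subst (λ b → length Ws + 10 ≤ 5 * b) (m+[n∸m]≡n h)
  (claws-bound′ (length Bs ∸ 2) G Bs Ws C (sym (m+[n∸m]≡n h)))

module Kinds {n} (G : Graph (Fin n)) (D : Drawing G) where
 open import Data.Fin.Properties using (_≟_)

 open PlanarGraph G D public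

 4≢5 : 4 ≢ 5
 4≢5 ()

 _is_ : Fin n → Fin n → Bool
 x is y = does (x ≟ y)

 is⇒ : ∀ {x y} → x is y ≡ true → x ≡ y
 is⇒ {x} {y} h with x ≟ y
 ... | yes e = e

 is-refl : ∀ x → x is x ≡ true
 is-refl x with x ≟ x
 ... | yes _ = refl
 ... | no h  = ⊥-elim (h refl)

 by-contradiction : ∀ {b} → (b ≡ false → ⊥) → b ≡ true
 by-contradiction {true}  h = refl
 by-contradiction {false} h = ⊥-elim (h refl)

 ≁ : ∀ {x y} → ¬ (x ~ y) → adj x y ≡ false
 ≁ {x} {y} h with adj x y
 ... | true  = ⊥-elim (h refl)
 ... | false = refl

 ≁-sym : ∀ {x y} → adj x y ≡ false → adj y x ≡ false
 ≁-sym {x} {y} h = trans (adj-sym y x) h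

 deg≥ : ∀ {x ys} → Unique ys → All (x ~_) ys → length ys ≤ deg x
 deg≥ u a = length≤count _ u (λ i → ∈V , All.lookup a i)

 too-many : ∀ {x ys} → Unique ys → All (x ~_) ys → ¬ (deg x < length ys)
 too-many u a h = <⇒≱ h (deg≥ u a)

 all-neighbours : ∀ {x ys z} → Unique ys → All (x ~_) ys → deg x ≤ length ys → x ~ z → z ∈ ys
 all-neighbours u a h e = exhaustive _≟_ (adj _) u (λ i → ∈V , All.lookup a i) h ∈V e

 Private : Fin n → Fin n → Fin n → Set
 Private y x z = y ~ z × adj x z ≡ false

 private-bound : ∀ {x y zs} → Unique zs → All (Private y x) zs → length zs + common x y ≤ deg y
 private-bound {x} {y} u a = ≤-trans (+-monoˡ-≤ (common x y) (length≤count (λ z → adj y z ∧ not (adj x z)) u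
   (λ i → ∈V , ∧-true (proj₁ (All.lookup a i)) (cong not (proj₂ (All.lookup a i))))))
  (≤-reflexive (trans (sym (∑-+ Vs _ _)) (∑-cong Vs (λ {z} _ → e (adj x z) (adj y z)))))
  where
  e : ∀ p q → bit (q ∧ not p) + bit (p ∧ q) ≡ bit q
  e true  true  = refl
  e true  false = refl
  e false true  = refl
  e false false = refl

 joins : ∀ {x y a zs} → Unique (a ∷ zs) → y ~ a → All (Private y x) zs → deg y < suc (length zs) + common x y → x ~ a
 joins {x} {y} {a} u ya ps h with adj x a in e
 ... | true  = refl
 ... | false = ⊥-elim (<⇒≱ h (private-bound u ((ya , e) ∷ ps)))

 Common : Fin n → Fin n → Fin n → Set
 Common x y z = x ~ z × y ~ z

 as-common : ∀ {x y z} → adj x z ∧ adj y z ≡ true → Common x y z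
 as-common {x} {y} {z} h = ∧ˡ h , ∧ʳ {adj x z} h

 common₁ : ∀ {x y} → 1 ≤ common x y → ∃[ a ] Common x y a
 common₁ {x} {y} h with count-pos (λ z → adj x z ∧ adj y z) Vs h
 ... | a , _ , e = a , as-common e

 common₂ : ∀ {x y} → 2 ≤ common x y → Two (Common x y)
 common₂ {x} {y} h with pick₂ (λ z → adj x z ∧ adj y z) Vs! h
 ... | a , b , ab , (_ , e) , (_ , f) = a , b , ab , as-common e , as-common f

 common₃ : ∀ {x y} → 3 ≤ common x y →
  Three (Common x y)
 common₃ {x} {y} h with pick₃ (λ z → adj x z ∧ adj y z) Vs! h
 ... | a , b , c , d , (_ , e) , (_ , f) , (_ , g) = a , b , c , d , as-common e , as-common f , as-common g

 count-is : ∀ x → count (_is x) Vs ≡ 1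
 count-is x = ≤-antisym (count≤cover (_is x) {ys = x ∷ []} Vs! (λ _ h → here (is⇒ h)))
  (length≤count (_is x) {x ∷ []} ([] ∷ []) λ { #0 → ∈V , is-refl x })

 members : (Fin n → Bool) → List (Fin n)
 members C = filterᵇ C Vs

 members! : ∀ C → Unique (members C)
 members! C = unique-filter C Vs!

 ∈members : ∀ {C x} → C x ≡ true → x ∈ members C
 ∈members {C} h = ∈-filter⁺ C ∈V h

 members⁻ : ∀ {C x} → x ∈ members C → C x ≡ true
 members⁻ {C} i = proj₂ (∈-filter⁻ C {Vs} i)

 module Split (heavy : Fin n → Bool) where
  lows : Fin n → ℕ
  lows x = count (λ y → adj x y ∧ not (heavy y)) Vs

  links : (Fin n → Bool) → Fin n → ℕ
  links C u = count (adj u) (members C)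

  low : Fin n → Bool
  low v = not (heavy v)

  lows-at : ∀ C → ∑ (members C) lows ≡ ∑ (members low) (links C)
  lows-at C = trans (∑-comm (members C) Vs (λ x u → bit (adj x u ∧ low u)))
   (trans (∑-cong Vs λ {u} _ → each u (heavy u)) (sym (∑-filter low Vs (links C))))
   where
   each : ∀ u b → ∑ (members C) (λ x → bit (adj x u ∧ not b)) ≡ bit (not b) * links C u
   each u true = trans (∑-cong (members C) λ {x} _ → cong bit (e (adj x u))) (∑-zero (members C))
    where
    e : ∀ a → a ∧ false ≡ false
    e true  = refl
    e false = refl
   each u false = trans (∑-cong (members C) λ {x} _ → cong bit (trans (e (adj x u)) (adj-sym x u))) (sym (+-identityʳ (links C u)))
    where
    e : ∀ a → a ∧ true ≡ a
    e true  = refl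
    e false = refl

  beside : (Fin n → Bool) → ℕ
  beside C = count (λ u → 0 <ᵇ links C u) (members low)

  heavies : Fin n → ℕ
  heavies x = count (λ y → adj x y ∧ heavy y) Vs

  lone linked : Fin n → Bool
  lone x = heavy x ∧ (heavies x ≡ᵇ 0)
  linked x = heavy x ∧ not (lone x)

  lone⇒ : ∀ {x} → lone x ≡ true → ∀ {y} → x ~ y → heavy y ≡ false
  lone⇒ {x} h {y} xy = by (heavy y) refl
   where
   nothing : ∀ {k} → (k ≡ᵇ 0) ≡ true → k ≡ 0
   nothing {zero} _ = refl
   by : ∀ b → heavy y ≡ b → heavy y ≡ false
   by false e = e
   by true  e = ⊥-elim (<⇒≱ (s≤s z≤n) (≤-trans (length≤count (λ y → adj x y ∧ heavy y) {y ∷ []} ([] ∷ []) λ { #0 → ∈V , ∧-true xy e })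
    (≤-reflexive (nothing (∧ʳ {heavy x} h)))))

  Lo Al Co : List (Fin n)
  Lo = members low
  Al = members lone
  Co = members linked

  lone⊆ : ∀ {x} → lone x ≡ true → heavy x ≡ true
  lone⊆ h = ∧ˡ h

  ∑-kinds : ∀ f → ∑ Vs f ≡ ∑ Lo f + (∑ Al f + ∑ Co f)
  ∑-kinds f = trans (sym (∑-partition heavy Vs f)) (trans (+-comm (∑ (members heavy) f) (∑ Lo f))
   (cong (∑ Lo f +_) (∑-split heavy lone Vs f lone⊆)))

  kind-sizes : length Lo + (length Al + length Co) ≡ n
  kind-sizes = trans (sym (cong₂ _+_ (∑-one Lo) (cong₂ _+_ (∑-one Al) (∑-one Co)))) (trans (sym (∑-kinds (λ _ → 1))) (trans (∑-one Vs) |V|))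

  lone-degrees : ∑ Al deg ≡ ∑ Lo (links lone)
  lone-degrees = trans (∑-cong Al λ {x} i → ∑-cong Vs λ {y} _ → all-low {x} {y} (members⁻ {lone} i)) (lows-at lone)
   where
   all-low : ∀ {x y} → lone x ≡ true → bit (adj x y) ≡ bit (adj x y ∧ not (heavy y))
   all-low {x} {y} h = by (adj x y) refl
    where
    by : ∀ b → adj x y ≡ b → bit b ≡ bit (b ∧ not (heavy y))
    by false e = refl
    by true  e = cong (bit ∘ not) (sym (lone⇒ {x} h e))

  degree≥ : ∀ u → links lone u + links linked u ≤ deg u
  degree≥ u = ≤-trans (≤-reflexive (trans (sym (∑-split heavy lone Vs (λ x → bit (adj u x)) lone⊆)) (count-filter heavy (adj u) Vs)))
   (count-mono Vs λ {y} _ h → ∧ʳ {heavy y} h)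

  linked-mate : ∀ {x} → linked x ≡ true → ∃[ y ] x ~ y × heavy y ≡ true
  linked-mate {x} h = go (zero-or (heavies x))
   where
   go : heavies x ≡ 0 ⊎ 1 ≤ heavies x → ∃[ y ] x ~ y × heavy y ≡ true
   go (inj₁ e) = ⊥-elim (true≢false (∧-true (∧ˡ h) (cong (_≡ᵇ 0) e)) (not-true (∧ʳ {heavy x} h)))
   go (inj₂ k) = let y , _ , e = count-pos (λ y → adj x y ∧ heavy y) Vs k in y , ∧ˡ e , ∧ʳ {adj x y} e

module ThreeHeavy {n} (G : Graph (Fin n)) (D : Drawing G) (free : S 3 3 Free G) where
 open import Data.Fin.Properties using (_≟_)

 open Kinds G D public

 heavy : Fin n → Bool
 heavy x = 4 ≤ᵇ deg x

 open Split heavy public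

 heavy⇒ : ∀ {x} → heavy x ≡ true → 4 ≤ deg x
 heavy⇒ {x} h = ≤ᵇ⇒≤ 4 (deg x) (Equivalence.from T-≡ h)

 ⇒heavy : ∀ {x} → 4 ≤ deg x → heavy x ≡ true
 ⇒heavy h = Equivalence.to T-≡ (≤⇒≤ᵇ h)

 low⇒ : ∀ {x} → heavy x ≡ false → deg x ≤ 3
 low⇒ {x} h = ≮⇒≥ λ k → true≢false (⇒heavy {x} k) h

 key : ∀ {x y} → x ~ y → 4 ≤ deg x → 4 ≤ deg y → deg x + deg y ≤ 7 + common x y
 key = star-free-degrees free

 joins₅ : ∀ {x y o a} → deg x ≡ 5 → 4 ≤ deg y → x ~ y → y ~ o → adj x o ≡ false → o ≢ x → y ~ a → a ≢ x → a ≢ o → x ~ a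
 joins₅ {x} {y} dx dy xy yo xo ox ya ax ao = joins ((ax ∷ ao ∷ []) ∷ ((ox ∘ sym) ∷ []) ∷ [] ∷ []) ya
  ((~-sym xy , adj-irrefl x) ∷ (yo , xo) ∷ [])
  (s≤s (+-cancelˡ-≤ 5 _ _ (subst (λ d → d + deg y ≤ 7 + common x y) dx (key xy (≤-trans (s≤s (s≤s (s≤s (s≤s z≤n)))) (≥-reflexive dx)) dy))))

 joins₆ : ∀ {x y a} → deg x ≡ 6 → 4 ≤ deg y → x ~ y → y ~ a → a ≢ x → x ~ a
 joins₆ {x} {y} dx dy xy ya ax = joins ((ax ∷ []) ∷ [] ∷ []) ya ((~-sym xy , adj-irrefl x) ∷ [])
  (s≤s (+-cancelˡ-≤ 6 _ _ (subst (λ d → d + deg y ≤ 7 + common x y) dx (key xy (≤-trans (s≤s (s≤s (s≤s (s≤s z≤n)))) (≥-reflexive dx)) dy))))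

 deg≤6 : ∀ {x y} → x ~ y → 4 ≤ deg x → 4 ≤ deg y → deg x ≤ 6
 deg≤6 {x} {y} xy dx dy = ≮⇒≥ λ h → refute (deg x ∷ deg y ∷ common x y ∷ [])
  (1 ×[ var 0 ⊕ var 1 ≤ lit 7 ⊕ var 2 ] ∷ 1 ×[ lit 1 ⊕ var 2 ≤ var 1 ] ∷ 1 ×[ lit 7 ≤ var 0 ] ∷ [])
  (key xy dx dy ∷ private-bound ([] ∷ []) ((~-sym xy , adj-irrefl x) ∷ []) ∷ h ∷ []) refl

 ≥4 : ∀ {x k} → deg x ≡ 4 + k → 4 ≤ deg x
 ≥4 h = ≤-trans (m≤m+n 4 _) (≥-reflexive h)

 common≥ : ∀ {x y i j} → x ~ y → deg x ≡ 4 + i → deg y ≡ 4 + j → suc (i + j) ≤ common x y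
 common≥ {x} {y} {i} {j} xy dx dy = ≮⇒≥ λ h → refute (i ∷ j ∷ common x y ∷ deg x ∷ deg y ∷ [])
  (1 ×[ lit 1 ⊕ var 2 ≤ lit 1 ⊕ (var 0 ⊕ var 1) ] ∷ 1 ×[ lit 4 ⊕ var 0 ≤ var 3 ] ∷ 1 ×[ lit 4 ⊕ var 1 ≤ var 4 ]
   ∷ 1 ×[ var 3 ⊕ var 4 ≤ lit 7 ⊕ var 2 ] ∷ [])
  (h ∷ ≥-reflexive dx ∷ ≥-reflexive dy ∷ key xy (≥4 dx) (≥4 dy) ∷ []) refl

 -- Otherwise x, y, z and the common neighbours of x and y form K₃,₃.
 five-transitive : ∀ {x y z} → deg x ≡ 5 → deg y ≡ 5 → deg z ≡ 5 → x ~ y → y ~ z → x ≢ z → x ~ z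
 five-transitive {x} {y} {z} dx dy dz xy yz xz = by-contradiction λ e → go e (common₃ (common≥ xy dx dy))
  where
  z~ : ∀ {a} → adj x z ≡ false → x ~ a → y ~ a → z ~ a
  z~ e xa ya = joins₅ dz (≥4 dy) (~-sym yz) (~-sym xy) (≁-sym e) xz ya (λ { refl → true≢false xa e }) (~⇒≢ xa ∘ sym)
  go : adj x z ≡ false → Three (Common x y) → ⊥
  go e (a , b , c , (ab , ac , bc) , (xa , ya) , (xb , yb) , (xc , yc)) =
   K₃₃-free P (~⇒≢ xy) xz (~⇒≢ yz) ab ac bc xa xb xc ya yb yc (z~ e xa ya) (z~ e xb yb) (z~ e xc yc)

 record Closed (C : Fin n → Bool) : Set where
  field
   heavy-in : ∀ {x} → C x ≡ true → 4 ≤ deg x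
   step     : ∀ {x y} → C x ≡ true → 4 ≤ deg y → x ~ y → C y ≡ true
   mate     : ∀ {x} → C x ≡ true → ∃[ y ] x ~ y × 4 ≤ deg y

 module Overlap {x z y} (dx : deg x ≡ 5) (dz : deg z ≡ 5) (xz : x ≢ z) (x≁z : adj x z ≡ false)
  (dy : deg y ≡ 4) (xy : x ~ y) (zy : z ~ y) where

  others : Two (Common x y)
  others = common₂ (common≥ xy dx dy)

  to-z : ∀ {g h} → 4 ≤ deg g → x ~ g → z ~ g → g ~ h → h ≢ x → h ≢ z → x ~ h × z ~ h
  to-z dg xg zg gh hx hz = joins₅ dx dg xg (~-sym zg) x≁z (xz ∘ sym) gh hx hz
   , joins₅ dz dg zg (~-sym xg) (≁-sym x≁z) xz gh hz hx

  captured : ∀ {g} → 4 ≤ deg g → x ~ g → z ~ g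
  captured {g} dg xg = by-contradiction λ e → go e others (common₂ (s≤s⁻¹ (s≤s⁻¹ (≤-trans dg (deg≤2+ dg)))))
   where
   deg≤2+ : 4 ≤ deg g → deg g ≤ 2 + common x g
   deg≤2+ dg = +-cancelˡ-≤ 5 _ _ (subst (λ d → d + deg g ≤ 7 + common x g) dx (key xg (≥4 dx) dg))
   g≢z : g ≢ z
   g≢z refl = true≢false xg x≁z
   go : adj z g ≡ false → Two (Common x y) → Two (Common x g) → ⊥
   go e (l₁ , l₂ , l₁≢l₂ , (xl₁ , yl₁) , (xl₂ , yl₂)) (a₁ , a₂ , a₁≢a₂ , (xa₁ , ga₁) , (xa₂ , ga₂)) =
    too-many {x} {y ∷ l₁ ∷ l₂ ∷ g ∷ a₁ ∷ a₂ ∷ []}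
     ((~⇒≢ yl₁ ∷ ~⇒≢ yl₂ ∷ y≢g ∷ (a≢y ga₁ ∘ sym) ∷ (a≢y ga₂ ∘ sym) ∷ []) ∷ (l₁≢l₂ ∷ l≢g yl₁ xl₁ ∷ (a≢l ga₁ yl₁ xl₁ ∘ sym) ∷ (a≢l ga₂ yl₁ xl₁ ∘ sym) ∷ [])
      ∷ (l≢g yl₂ xl₂ ∷ (a≢l ga₁ yl₂ xl₂ ∘ sym) ∷ (a≢l ga₂ yl₂ xl₂ ∘ sym) ∷ []) ∷ (~⇒≢ ga₁ ∷ ~⇒≢ ga₂ ∷ []) ∷ (a₁≢a₂ ∷ []) ∷ [] ∷ [])
     (xy ∷ xl₁ ∷ xl₂ ∷ xg ∷ xa₁ ∷ xa₂ ∷ []) (≤-reflexive (cong suc dx))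
    where
    z~l : ∀ {l} → y ~ l → x ~ l → z ~ l
    z~l yl xl = proj₂ (to-z (≥4 dy) xy zy yl (~⇒≢ xl ∘ sym) (λ { refl → true≢false xl x≁z }))
    y≢g : y ≢ g
    y≢g refl = true≢false zy e
    l≢g : ∀ {l} → y ~ l → x ~ l → l ≢ g
    l≢g yl xl refl = true≢false (z~l yl xl) e
    a≢y : ∀ {a} → g ~ a → a ≢ y
    a≢y ga refl = true≢false (proj₂ (to-z (≥4 dy) xy zy (~-sym ga) (~⇒≢ xg ∘ sym) g≢z)) e
    a≢l : ∀ {a l} → g ~ a → y ~ l → x ~ l → a ≢ l
    a≢l {a} ga yl xl refl with 4 ≤? deg a
    ... | yes da = true≢false (proj₂ (to-z da xl (z~l yl xl) (~-sym ga) (~⇒≢ xg ∘ sym) g≢z)) e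
    ... | no da = too-many {a} {x ∷ z ∷ y ∷ g ∷ []}
     ((xz ∷ ~⇒≢ xy ∷ ~⇒≢ xg ∷ []) ∷ (~⇒≢ zy ∷ (g≢z ∘ sym) ∷ []) ∷ (y≢g ∷ []) ∷ [] ∷ [])
     (~-sym xl ∷ ~-sym (z~l yl xl) ∷ ~-sym yl ∷ ~-sym ga ∷ []) (≰⇒> da)

 module Quad {x p q r} (dx : deg x ≡ 5) (dp : deg p ≡ 5) (dq : deg q ≡ 5) (dr : deg r ≡ 5)
  (xp : x ~ p) (xq : x ~ q) (xr : x ~ r) (pq : p ~ q) (pr : p ~ r) (qr : q ~ r) where

  -- If y missed both q and r then p, y and a common neighbour b of x and y would complete a subdivided K₅.
  misses-one : ∀ {y} → 4 ≤ deg y → x ~ y → y ≢ p → y ≢ q → y ≢ r → adj y q ≡ false → y ~ r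
  misses-one {y} dy xy yp yq yr y≁q = by-contradiction λ y≁r →
   go y≁r (common₂ (s≤s⁻¹ (s≤s⁻¹ (≤-trans dy (+-cancelˡ-≤ 5 _ _ (subst (λ d → d + deg y ≤ 7 + common x y) dx (key xy (≥4 dx) dy)))))))
   where
   module _ (y≁r : adj y r ≡ false) where
    finish : ∀ {a b} → a ≢ b → x ~ a → y ~ a → x ~ b → y ~ b → b ≢ p → ⊥
    finish {a} {b} a≢b xa ya xb yb b≢p = K₅-subdivided-free P xq xr xp xb qr (~-sym pq) q~b (~-sym pr) r~b p~y yb
     (b≢p ∘ sym) (~⇒≢ xy ∘ sym) yq yr
     where
     b≢q : b ≢ q
     b≢q refl = true≢false yb y≁q
     b≢r : b ≢ r
     b≢r refl = true≢false yb y≁r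
     q~b : q ~ b
     q~b = joins₅ dq (≥4 dx) (~-sym xq) xy (≁-sym y≁q) yq xb b≢q (~⇒≢ yb ∘ sym)
     r~b : r ~ b
     r~b = joins₅ dr (≥4 dx) (~-sym xr) xy (≁-sym y≁r) yr xb b≢r (~⇒≢ yb ∘ sym)
     p~y : p ~ y
     p~y with all-neighbours {x} {p ∷ q ∷ r ∷ y ∷ b ∷ []}
      ((~⇒≢ pq ∷ ~⇒≢ pr ∷ (yp ∘ sym) ∷ (b≢p ∘ sym) ∷ []) ∷ (~⇒≢ qr ∷ (yq ∘ sym) ∷ (b≢q ∘ sym) ∷ []) ∷ ((yr ∘ sym) ∷ (b≢r ∘ sym) ∷ []) ∷ (~⇒≢ yb ∷ []) ∷ [] ∷ [])
      (xp ∷ xq ∷ xr ∷ xy ∷ xb ∷ []) (≤-reflexive dx) xa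
     ... | #0 = ~-sym ya
     ... | #1 = ⊥-elim (true≢false ya y≁q)
     ... | #2 = ⊥-elim (true≢false ya y≁r)
     ... | #3 = ⊥-elim (~⇒≢ ya refl)
     ... | #4 = ⊥-elim (a≢b refl)
   go : adj y r ≡ false → Two (Common x y) → ⊥
   go y≁r (a , b , a≢b , (xa , ya) , (xb , yb)) with b ≟ p
   ... | no b≢p   = finish y≁r a≢b xa ya xb yb b≢p
   ... | yes refl = finish y≁r (a≢b ∘ sym) xb yb xa ya a≢b

 private
  module Q = Quad

 module QuadClosed {x p q r} (dx : deg x ≡ 5) (dp : deg p ≡ 5) (dq : deg q ≡ 5) (dr : deg r ≡ 5)
  (xp : x ~ p) (xq : x ~ q) (xr : x ~ r) (pq : p ~ q) (pr : p ~ r) (qr : q ~ r) where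

  core : List (Fin n)
  core = x ∷ p ∷ q ∷ r ∷ []

  core! : Unique core
  core! = (~⇒≢ xp ∷ ~⇒≢ xq ∷ ~⇒≢ xr ∷ []) ∷ (~⇒≢ pq ∷ ~⇒≢ pr ∷ []) ∷ (~⇒≢ qr ∷ []) ∷ [] ∷ []

  Outer : Fin n → Set
  Outer y = (y ≢ x × y ≢ p) × (y ≢ q × y ≢ r)

  three-in-core : ∀ {y} → 4 ≤ deg y → Outer y → 1 ≤ count (adj y) core → 3 ≤ count (adj y) core
  three-in-core {y} dy ((yx , yp) , (yq , yr)) h
   with adj y x in ex | adj y p in ep | adj y q in eq | adj y r in er
  ... | true | true | true | _ = s≤s (s≤s (s≤s z≤n))
  ... | true | true | false | true = ≤-refl
  ... | true | false | true | true = ≤-refl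
  ... | false | true | true | true = ≤-refl
  ... | true | true | false | false = ⊥-elim (true≢false (Q.misses-one dx dp dq dr xp xq xr pq pr qr dy (~-sym ex) yp yq yr eq) er)
  ... | true | false | true | false = ⊥-elim (true≢false (Q.misses-one dx dq dp dr xq xp xr (~-sym pq) qr pr dy (~-sym ex) yq yp yr ep) er)
  ... | true | false | false | _ = ⊥-elim (true≢false (Q.misses-one dx dr dp dq xr xp xq (~-sym pr) (~-sym qr) pq dy (~-sym ex) yr yp yq ep) eq)
  ... | false | true | true | false = ⊥-elim (true≢false (Q.misses-one dp dq dx dr pq (~-sym xp) pr (~-sym xq) qr xr dy (~-sym ep) yq yx yr ex) er)
  ... | false | true | false | _ = ⊥-elim (true≢false (Q.misses-one dp dr dx dq pr (~-sym xp) pq (~-sym xr) (~-sym qr) xq dy (~-sym ep) yr yx yq ex) eq)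
  ... | false | false | true | _ = ⊥-elim (true≢false (Q.misses-one dq dr dx dp qr (~-sym xq) (~-sym pq) (~-sym xr) (~-sym pr) xp dy (~-sym eq) yr yx yp ex) ep)
  ... | false | false | false | true = ⊥-elim (true≢false (Q.misses-one dr dq dx dp (~-sym qr) (~-sym xr) (~-sym pr) (~-sym xq) (~-sym pq) xp dy (~-sym er) yq yx yp ex) ep)
  ... | false | false | false | false = ⊥-elim (<⇒≱ h z≤n)

  touches : Fin n → Bool
  touches y = heavy y ∧ (0 <ᵇ count (adj y) core)

  touches⁺ : ∀ {y z} → 4 ≤ deg y → z ∈ core → y ~ z → touches y ≡ true
  touches⁺ {y} {z} dy i h = ∧-true (⇒heavy dy) (pos (≤-trans (≤-reflexive (cong bit (sym h))) (term≤∑ (λ z → bit (adj y z)) i)))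
   where
   pos : ∀ {k} → 1 ≤ k → (0 <ᵇ k) ≡ true
   pos (s≤s _) = refl

  touches⁻ : ∀ {y} → touches y ≡ true → 4 ≤ deg y × 1 ≤ count (adj y) core
  touches⁻ {y} h = heavy⇒ (∧ˡ h) , pos (∧ʳ {heavy y} h)
   where
   pos : ∀ {k} → (0 <ᵇ k) ≡ true → 1 ≤ k
   pos {suc k} _ = s≤s z≤n

  in-core? : ∀ y → y ∈ core ⊎ Outer y
  in-core? y with y ≟ x | y ≟ p | y ≟ q | y ≟ r
  ... | yes h | _ | _ | _ = inj₁ (here h)
  ... | _ | yes h | _ | _ = inj₁ (there (here h))
  ... | _ | _ | yes h | _ = inj₁ (there (there (here h)))
  ... | _ | _ | _ | yes h = inj₁ (there (there (there (here h))))
  ... | no a | no b | no c | no d = inj₂ ((a , b) , (c , d))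

  five-in-core : ∀ {z} → z ∈ core → deg z ≡ 5
  five-in-core #0 = dx
  five-in-core #1 = dp
  five-in-core #2 = dq
  five-in-core #3 = dr

  -- A fifth vertex of degree 5 would extend the clique to K₅.
  outer-not-five : ∀ {y z} → Outer y → z ∈ core → y ~ z → deg y ≢ 5
  outer-not-five {y} {z} ((yx , yp) , (yq , yr)) i yz dy = K₅-free P (to #0 yx) (to #1 yp) (to #2 yq)
   (to #3 yr) xp xq xr pq pr qr
   where
   clique : ∀ {a b} → a ∈ core → b ∈ core → a ≢ b → a ~ b
   clique #0 #0 h = ⊥-elim (h refl)
   clique #0 #1 h = xp
   clique #0 #2 h = xq
   clique #0 #3 h = xr
   clique #1 #0 h = ~-sym xp
   clique #1 #1 h = ⊥-elim (h refl)
   clique #1 #2 h = pq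
   clique #1 #3 h = pr
   clique #2 #0 h = ~-sym xq
   clique #2 #1 h = ~-sym pq
   clique #2 #2 h = ⊥-elim (h refl)
   clique #2 #3 h = qr
   clique #3 #0 h = ~-sym xr
   clique #3 #1 h = ~-sym pr
   clique #3 #2 h = ~-sym qr
   clique #3 #3 h = ⊥-elim (h refl)
   to : ∀ {a} → a ∈ core → y ≢ a → y ~ a
   to {a} j ya with a ≟ z
   ... | yes refl = yz
   ... | no a≢z = five-transitive dy (five-in-core i) (five-in-core j) yz (clique i j (a≢z ∘ sym)) ya

  core-mate : ∀ {z} → z ∈ core → ∃[ z′ ] z′ ∈ core × z ~ z′
  core-mate #0 = p , #1 , xp
  core-mate #1 = x , #0 , ~-sym xp
  core-mate #2 = x , #0 , ~-sym xq
  core-mate #3 = x , #0 , ~-sym xr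

  module _ (≤5 : ∀ {y} → touches y ≡ true → deg y ≤ 5) where

   outer-four : ∀ {y} → touches y ≡ true → Outer y → deg y ≡ 4
   outer-four {y} t o with touches⁻ t
   ... | dy , h with count-pos (adj y) core h
   ...   | z , i , yz = ≤-antisym (s≤s⁻¹ (≤∧≢⇒< (≤5 t) (outer-not-five o i yz))) dy

   step : ∀ {y w} → touches y ≡ true → 4 ≤ deg w → y ~ w → touches w ≡ true
   step {y} {w} t dw yw with in-core? y
   ... | inj₁ i = touches⁺ dw i (~-sym yw)
   ... | inj₂ o = from-common (common₁ (s≤s⁻¹ (s≤s⁻¹ (s≤s⁻¹ (s≤s⁻¹ (s≤s⁻¹ (s≤s⁻¹ (s≤s⁻¹ (≤-trans (+-monoʳ-≤ 4 dw)
     (subst (λ d → d + deg w ≤ 7 + common y w) dy (key yw (≥4 dy) dw)))))))))))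
    where
    dy : deg y ≡ 4
    dy = outer-four t o
    -- Three neighbours of y are in the clique and w is the fourth.
    from-common : ∃[ a ] Common y w a → touches w ≡ true
    from-common (a , ya , wa) with in-core? a | in-core? w
    ... | inj₁ i | _ = touches⁺ dw i wa
    ... | _ | inj₁ i = let _ , j , h = core-mate i in touches⁺ dw j h
    ... | inj₂ oa | inj₂ ow = ⊥-elim (<⇒≱ {4} (≤-trans (s≤s (s≤s (three-in-core (≥4 dy) o (proj₂ (touches⁻ t)))))
     (subst (λ k → suc (suc k) ≤ deg y) (length-filter (adj y) core) (deg≥ ((~⇒≢ wa ∘ sym ∷ fresh oa) ∷ fresh ow ∷ unique-filter (adj y) core!)
      (ya ∷ yw ∷ All.tabulate (λ i → proj₂ (∈-filter⁻ (adj y) {core} i)))))) (≤-reflexive dy))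
     where
     outer∉ : ∀ {a} → Outer a → ∀ {z} → z ∈ core → a ≢ z
     outer∉ ((ax , ap) , (aq , ar)) #0 = ax
     outer∉ ((ax , ap) , (aq , ar)) #1 = ap
     outer∉ ((ax , ap) , (aq , ar)) #2 = aq
     outer∉ ((ax , ap) , (aq , ar)) #3 = ar
     fresh : ∀ {a} → Outer a → All (a ≢_) (filterᵇ (adj y) core)
     fresh o = All.tabulate (λ i → outer∉ o (proj₁ (∈-filter⁻ (adj y) {core} i)))

   closed : Closed touches
   closed = record { heavy-in = λ t → proj₁ (touches⁻ t) ; step = step ; mate = λ {y} t → mate t }
    where
    mate : ∀ {y} → touches y ≡ true → ∃[ z ] y ~ z × 4 ≤ deg z
    mate {y} t with count-pos (adj y) core (proj₂ (touches⁻ t))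
    ... | z , i , yz = z , yz , ≥4 (five-in-core i)

   outer : Fin n → Bool
   outer y = touches y ∧ not (deg y ≡ᵇ 5)

   outers : List (Fin n)
   outers = filterᵇ outer Vs

   outer⁻ : ∀ {y} → y ∈ outers → touches y ≡ true × Outer y
   outer⁻ {y} i with ∈-filter⁻ outer {Vs} i
   ... | _ , h with in-core? y
   ...   | inj₂ o = ∧ˡ h , o
   ...   | inj₁ j = ⊥-elim (true≢false (five (five-in-core j)) (not-true (∧ʳ {touches y} h)))
    where
    five : ∀ {k} → k ≡ 5 → (k ≡ᵇ 5) ≡ true
    five refl = refl

   two-outer : ∀ {z} → z ∈ core → count (adj z) outers ≤ 2
   two-outer {z} i = +-cancelˡ-≤ 3 _ _ (≤-trans (≤-trans (+-monoˡ-≤ _ (three-mates i))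
    (≥-reflexive (trans (length-++-filter) refl))) (≤-trans (deg≥ distinct (All.tabulate adjacent)) (≤-reflexive (five-in-core i))))
    where
    open import Data.List.Properties using (length-++)
    open import Data.List.Membership.Propositional.Properties using (∈-++⁻)
    open import Data.List.Relation.Unary.Unique.Propositional.Properties using (++⁺)
    L = filterᵇ (adj z) core
    M = filterᵇ (adj z) outers
    length-++-filter : length (L ++ M) ≡ count (adj z) core + count (adj z) outers
    length-++-filter = trans (length-++ L) (cong₂ _+_ (length-filter (adj z) core) (length-filter (adj z) outers))
    three-mates : ∀ {z} → z ∈ core → 3 ≤ count (adj z) core
    three-mates #0 rewrite adj-irrefl x | xp | xq | xr = ≤-refl
    three-mates #1 rewrite adj-irrefl p | ~-sym xp | pq | pr = ≤-refl
    three-mates #2 rewrite adj-irrefl q | ~-sym xq | ~-sym pq | qr = ≤-refl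
    three-mates #3 rewrite adj-irrefl r | ~-sym xr | ~-sym pr | ~-sym qr = ≤-refl
    distinct : Unique (L ++ M)
    distinct = ++⁺ (unique-filter (adj z) core!) (unique-filter (adj z) (unique-filter outer Vs!)) λ { (j , k) →
     clash (proj₁ (∈-filter⁻ (adj z) j)) (proj₂ (outer⁻ (proj₁ (∈-filter⁻ (adj z) k)))) }
     where
     clash : ∀ {a} → a ∈ core → Outer a → ⊥
     clash #0 ((h , _) , _) = h refl
     clash #1 ((_ , h) , _) = h refl
     clash #2 (_ , (h , _)) = h refl
     clash #3 (_ , (_ , h)) = h refl
    adjacent : ∀ {a} → a ∈ L ++ M → z ~ a
    adjacent j with ∈-++⁻ L j
    ... | inj₁ k = proj₂ (∈-filter⁻ (adj z) {core} k)
    ... | inj₂ k = proj₂ (∈-filter⁻ (adj z) {outers} k)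

   few-outers : length outers ≤ 2
   few-outers = ≮⇒≥ λ h → refute (length outers ∷ ∑ outers (λ y → count (adj y) core) ∷ [])
    (3 ×[ lit 3 ≤ var 0 ] ∷ 1 ×[ 3 ⊛ var 0 ≤ var 1 ] ∷ 1 ×[ var 1 ≤ lit 8 ] ∷ [])
    (h ∷ ≤-trans (≥-reflexive (∑-const outers 3))
       (∑-mono outers λ i → let t , o = outer⁻ i in three-in-core (proj₁ (touches⁻ t)) o (proj₂ (touches⁻ t)))
      ∷ ≤-trans (≤-reflexive (trans (∑-comm outers core (λ y z → bit (adj y z))) (∑-cong core (λ {z} _ → ∑-cong outers (λ {y} _ → cong bit (adj-sym y z))))))
        (∑-mono core two-outer) ∷ []) refl

   size : count touches Vs ≤ 6
   size = ≤-trans (count≤cover touches {ys = x ∷ p ∷ q ∷ r ∷ outers} Vs! cover) (s≤s (s≤s (s≤s (s≤s few-outers))))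
    where
    core⊆ : ∀ {y} → y ∈ core → y ∈ x ∷ p ∷ q ∷ r ∷ outers
    core⊆ (here h) = here h
    core⊆ (there (here h)) = there (here h)
    core⊆ (there (there (here h))) = there (there (here h))
    core⊆ (there (there (there (here h)))) = there (there (there (here h)))
    cover : ∀ {y} → y ∈ Vs → touches y ≡ true → y ∈ x ∷ p ∷ q ∷ r ∷ outers
    cover {y} i t with in-core? y
    ... | inj₁ j = core⊆ j
    ... | inj₂ o = there (there (there (there (∈-filter⁺ outer i (∧-true t (cong not (four (outer-four t o))))))))
     where
     four : ∀ {k} → k ≡ 4 → (k ≡ᵇ 5) ≡ false
     four refl = refl

   fives : count (λ y → touches y ∧ (deg y ≡ᵇ 5)) Vs ≤ 4
   fives = count≤cover _ {ys = core} Vs! cover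
    where
    cover : ∀ {y} → y ∈ Vs → touches y ∧ (deg y ≡ᵇ 5) ≡ true → y ∈ core
    cover {y} i h with in-core? y
    ... | inj₁ j = j
    ... | inj₂ o = ⊥-elim (true≢false (∧ʳ {touches y} h) (four (outer-four (∧ˡ h) o)))
     where
     four : ∀ {k} → k ≡ 4 → (k ≡ᵇ 5) ≡ false
     four refl = refl

module ThreeValue {n} (G : Graph (Fin n)) (D : Drawing G) (free : S 3 3 Free G) where
 open import Data.Bool.Properties using (∧-zeroʳ)
 open import Data.Fin.Properties using (_≟_)
 open import Data.Nat.Induction using (<-wellFounded)
 open import Induction.WellFounded using (Acc; acc)
 open ThreeHeavy G D free public

 five : Fin n → Bool
 five x = deg x ≡ᵇ 5

 five⇒ : ∀ {x} → five x ≡ true → deg x ≡ 5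
 five⇒ {x} h = ≡ᵇ⇒≡ (deg x) 5 (Equivalence.from T-≡ h)

 ⇒five : ∀ {x} → deg x ≡ 5 → five x ≡ true
 ⇒five {x} h rewrite h = refl

 -- Three times the value of a set C: a vertex of degree d in C is worth 5 − d, and an edge from C to a vertex of degree at most 3 is worth 2/3.
 Rich : ℕ → (Fin n → Bool) → Set
 Rich k C = ∑ (members C) (λ x → 3 * deg x) + k ≤ ∑ (members C) (λ x → 15 + 2 * lows x)

 +-mono-interchange : ∀ {a b c d} j k → a + j ≤ c → b + k ≤ d → (a + b) + (j + k) ≤ c + d
 +-mono-interchange {a} {b} j k h l = ≤-trans (≤-reflexive (interchange a b j k)) (+-mono-≤ h l)
  where open import Algebra.Properties.CommutativeSemigroup +-commutativeSemigroup using (interchange)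

 rich-+ : ∀ {j k C C₀} → (∀ {x} → C₀ x ≡ true → C x ≡ true) → Rich j C₀ → Rich k (λ x → C x ∧ not (C₀ x)) → Rich (j + k) C
 rich-+ {j} {k} {C} {C₀} h a b rewrite ∑-split C C₀ Vs (λ x → 3 * deg x) h | ∑-split C C₀ Vs (λ x → 15 + 2 * lows x) h =
  +-mono-interchange j k a b

 rich-weaken : ∀ {j k C} → j ≤ k → Rich k C → Rich j C
 rich-weaken {C = C} h = ≤-trans (+-monoʳ-≤ (∑ (members C) (λ x → 3 * deg x)) h)

 closed-minus : ∀ {C C₀} → Closed C → Closed C₀ → Closed (λ x → C x ∧ not (C₀ x))
 closed-minus {C} {C₀} K K₀ = record
  { heavy-in = λ h → Closed.heavy-in K (∧ˡ h)
  ; step = λ {x} {y} h dy xy → ∧-true (Closed.step K (∧ˡ h) dy xy) (notin h dy xy)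
  ; mate = λ h → Closed.mate K (∧ˡ h) }
  where
  notin : ∀ {x y} → C x ∧ not (C₀ x) ≡ true → 4 ≤ deg y → x ~ y → not (C₀ y) ≡ true
  notin {x} {y} h dy xy with C₀ y in e
  ... | false = refl
  ... | true  = ⊥-elim (true≢false (Closed.step K₀ e (Closed.heavy-in K (∧ˡ h)) (~-sym xy)) (not-true (∧ʳ {C x} h)))

 module ClosedCount {C} (K : Closed C) where
  L : List (Fin n)
  L = members C
  size e s : ℕ
  size = length L
  e = edgesIn adj L
  s = ∑ L lows

  degree-split : ∀ {x} → C x ≡ true → deg x ≡ count (adj x) L + lows x
  degree-split {x} cx = trans (∑-cong Vs (λ {y} _ → part y)) (trans (∑-+ Vs _ _)
   (cong (_+ lows x) (sym (count-filter C (adj x) Vs))))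
   where
   part : ∀ y → bit (adj x y) ≡ bit (C y ∧ adj x y) + bit (adj x y ∧ not (heavy y))
   part y with adj x y in xy | C y in cy | heavy y in hy
   ... | false | true  | _ = refl
   ... | false | false | _ = refl
   ... | true | true  | true  = refl
   ... | true | false | false = refl
   ... | true | true  | false = ⊥-elim (<⇒≱ (s≤s (low⇒ {y} hy)) (Closed.heavy-in K cy))
   ... | true | false | true  = ⊥-elim (true≢false (Closed.step K cx (heavy⇒ {y} hy) xy) cy)

  degree-total : ∑ L deg ≡ 2 * e + s
  degree-total = trans (∑-cong L (λ i → degree-split (members⁻ i))) (trans (∑-+ L _ _) (cong (_+ s) (∑-degrees P L)))

  size≥2 : ∀ {x} → C x ≡ true → 2 ≤ size
  size≥2 {x} cx with Closed.mate K cx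
  ... | y , xy , dy = length-⊆ {xs = x ∷ y ∷ []} {ys = L} ((~⇒≢ xy ∷ []) ∷ [] ∷ []) λ
   { #0 → ∈members {C} cx ; #1 → ∈members {C} (Closed.step K cx dy xy) }

  planar : 3 ≤ size → e + 6 ≤ 3 * size
  planar = edges-bound _≟_ P L (members! C)

  pair : size ≡ 2 → e ≤ 1
  pair h = go L h
   where
   go : ∀ L → length L ≡ 2 → edgesIn adj L ≤ 1
   go (a ∷ b ∷ []) _ with adj a b
   ... | true  = ≤-refl
   ... | false = z≤n

  rich-if : ∀ {k} → 6 * e + s + k ≤ 15 * size → Rich k C
  rich-if {k} h = ≮⇒≥ λ l → refute (size ∷ e ∷ s ∷ k ∷ ∑ L deg ∷ ∑ L (λ x → 3 * deg x) ∷ ∑ L (λ x → 15 + 2 * lows x) ∷ [])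
   (1 ×[ 6 ⊛ var 1 ⊕ var 2 ⊕ var 3 ≤ 15 ⊛ var 0 ] ∷ 1 ×[ lit 1 ⊕ var 6 ≤ var 5 ⊕ var 3 ] ∷ 1 ×[ 15 ⊛ var 0 ⊕ 2 ⊛ var 2 ≤ var 6 ]
    ∷ 1 ×[ var 5 ≤ 3 ⊛ var 4 ] ∷ 3 ×[ var 4 ≤ 2 ⊛ var 1 ⊕ var 2 ] ∷ [])
   (h ∷ l ∷ ≥-reflexive (trans (∑-+ L _ _) (cong₂ _+_ (∑-const L 15) (∑-* L 2 lows)))
    ∷ ≤-reflexive (∑-* L 3 deg) ∷ ≤-reflexive degree-total ∷ []) refl

  -- Without vertices of degree 6, with d vertices of degree 5: the value is at least 8 − (c + d)/3 and at least c − d.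
  module _ (≤5 : ∀ {x} → C x ≡ true → deg x ≤ 5) where
   d : ℕ
   d = count five L

   degree-five : ∑ L deg ≡ 4 * size + d
   degree-five = trans (∑-cong L (λ i → part (Closed.heavy-in K (members⁻ i)) (≤5 (members⁻ i))))
    (trans (∑-+ L _ _) (cong (_+ d) (∑-const L 4)))
    where
    part : ∀ {k} → 4 ≤ k → k ≤ 5 → k ≡ 4 + bit (k ≡ᵇ 5)
    part {4} _ _ = refl
    part {5} _ _ = refl
    part {suc (suc (suc (suc (suc (suc k)))))} _ (s≤s (s≤s (s≤s (s≤s (s≤s ())))))
    part {3} (s≤s (s≤s (s≤s ()))) _
    part {2} (s≤s (s≤s ())) _
    part {1} (s≤s ()) _

   both : 2 * e + s ≡ 4 * size + d
   both = trans (sym degree-total) degree-five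

   rich-spread : d + 5 ≤ size → Rich 14 C
   rich-spread h = rich-if (≮⇒≥ λ l → refute (size ∷ d ∷ e ∷ s ∷ [])
    (1 ×[ lit 1 ⊕ 15 ⊛ var 0 ≤ 6 ⊛ var 2 ⊕ var 3 ⊕ lit 14 ] ∷ 3 ×[ 2 ⊛ var 2 ⊕ var 3 ≤ 4 ⊛ var 0 ⊕ var 1 ] ∷ 3 ×[ var 1 ⊕ lit 5 ≤ var 0 ] ∷ [])
    (l ∷ ≤-reflexive both ∷ h ∷ []) refl)

   rich-small : ∀ {x} → C x ≡ true → size + d ≤ 10 → Rich 14 C
   rich-small cx h with size≥2 cx | size ≤? 2
   ... | _ | no big = rich-if (≮⇒≥ λ l → refute (size ∷ d ∷ e ∷ s ∷ [])
    (1 ×[ lit 1 ⊕ 15 ⊛ var 0 ≤ 6 ⊛ var 2 ⊕ var 3 ⊕ lit 14 ] ∷ 1 ×[ 2 ⊛ var 2 ⊕ var 3 ≤ 4 ⊛ var 0 ⊕ var 1 ]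
     ∷ 1 ×[ var 0 ⊕ var 1 ≤ lit 10 ] ∷ 4 ×[ var 2 ⊕ lit 6 ≤ 3 ⊛ var 0 ] ∷ [])
    (l ∷ ≤-reflexive both ∷ h ∷ planar (≰⇒> big) ∷ []) refl)
   ... | two | yes small = rich-if (≮⇒≥ λ l → refute (size ∷ d ∷ e ∷ s ∷ [])
    (1 ×[ lit 1 ⊕ 15 ⊛ var 0 ≤ 6 ⊛ var 2 ⊕ var 3 ⊕ lit 14 ] ∷ 1 ×[ 2 ⊛ var 2 ⊕ var 3 ≤ 4 ⊛ var 0 ⊕ var 1 ]
     ∷ 4 ×[ var 2 ≤ lit 1 ] ∷ 10 ×[ lit 2 ≤ var 0 ] ∷ 1 ×[ var 1 ≤ var 0 ] ∷ [])
    (l ∷ ≤-reflexive both ∷ pair (≤-antisym small two) ∷ two ∷ count≤length five L ∷ []) refl)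

   rich-few-fives : ∀ {x} → C x ≡ true → d ≤ 3 → Rich 14 C
   rich-few-fives cx h with size ≤? 7
   ... | yes k = rich-small cx (+-mono-≤ k h)
   ... | no k  = rich-spread (≤-trans (+-monoˡ-≤ 5 h) (≰⇒> k))

 -- The heavy vertices of the closed neighbourhood of a vertex of degree 6.
 module Six {x} (dx : deg x ≡ 6) (mate : ∃[ y ] x ~ y × 4 ≤ deg y) where
  cluster : Fin n → Bool
  cluster y = heavy y ∧ (y is x ∨ adj x y)

  x∈ : cluster x ≡ true
  x∈ = ∧-true (⇒heavy {x} (≥4 {k = 2} dx)) (cong (_∨ adj x x) (is-refl x))

  near : ∀ {y} → 4 ≤ deg y → x ~ y → cluster y ≡ true
  near {y} dy xy = ∧-true (⇒heavy {y} dy) (∨-introʳ (y is x) xy)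

  cluster⁻ : ∀ {y} → cluster y ≡ true → 4 ≤ deg y × (y ≡ x ⊎ x ~ y)
  cluster⁻ {y} h with ∨-true (∧ʳ {heavy y} h)
  ... | inj₁ e = heavy⇒ {y} (∧ˡ h) , inj₁ (is⇒ e)
  ... | inj₂ a = heavy⇒ {y} (∧ˡ h) , inj₂ a

  neighbour-near : ∀ {y z} → cluster y ≡ true → y ~ z → z ≡ x ⊎ x ~ z
  neighbour-near {y} {z} h yz with cluster⁻ h | z ≟ x
  ... | _ , inj₁ refl | _ = inj₂ yz
  ... | _ , inj₂ xy | yes z≡x = inj₁ z≡x
  ... | dy , inj₂ xy | no z≢x = inj₂ (joins₆ dx dy xy yz z≢x)

  closed : Closed cluster
  closed = record { heavy-in = λ h → proj₁ (cluster⁻ h) ; step = step ; mate = mate′ }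
   where
   step : ∀ {y w} → cluster y ≡ true → 4 ≤ deg w → y ~ w → cluster w ≡ true
   step h dw yw with neighbour-near h yw
   ... | inj₁ refl = x∈
   ... | inj₂ xw = near dw xw
   mate′ : ∀ {y} → cluster y ≡ true → ∃[ z ] y ~ z × 4 ≤ deg z
   mate′ h with cluster⁻ h
   ... | _ , inj₁ refl = mate
   ... | _ , inj₂ xy = x , ~-sym xy , ≥4 {k = 2} dx

  open ClosedCount closed public

  neighbours : size + lows x ≡ 7
  neighbours = trans (cong (_+ lows x) (length-filter cluster Vs)) (trans (sym (∑-+ Vs _ _))
   (trans (∑-cong Vs (λ {y} _ → part y)) (trans (∑-+ Vs _ _) (cong₂ _+_ dx (count-is x)))))
   where
   part : ∀ y → bit (cluster y) + bit (adj x y ∧ not (heavy y)) ≡ bit (adj x y) + bit (y is x)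
   part y with y ≟ x
   ... | yes refl rewrite adj-irrefl x | ⇒heavy {x} (≥4 {k = 2} dx) = refl
   ... | no _ with adj x y | heavy y
   ...   | true  | true  = refl
   ...   | true  | false = refl
   ...   | false | true  = refl
   ...   | false | false = refl

  slots : s ≤ 3 * lows x
  slots = ≤-trans (≤-reflexive (∑-comm (members cluster) Vs (λ y u → bit (adj y u ∧ not (heavy u)))))
   (≤-trans (∑-mono Vs (λ {u} _ → at u)) (≤-reflexive (∑-* Vs 3 (λ u → bit (adj x u ∧ not (heavy u))))))
   where
   at : ∀ u → ∑ (members cluster) (λ y → bit (adj y u ∧ not (heavy u))) ≤ 3 * bit (adj x u ∧ not (heavy u))
   at u with heavy u in hu
   ... | true  = ≤-trans (≤-reflexive (trans (∑-cong (members cluster) (λ {y} _ → cong bit (∧-zeroʳ (adj y u)))) (∑-zero (members cluster)))) z≤n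
   ... | false with adj x u in xu
   ...   | true  = ≤-trans (≤-trans (≤-reflexive (∑-filter cluster Vs _)) (∑-mono Vs (λ {y} _ → drop (cluster y) (adj y u) (adj-sym y u)))) (low⇒ {u} hu)
    where
    drop : ∀ c a {b} → a ≡ b → bit c * bit (a ∧ true) ≤ bit b
    drop true  true  refl = ≤-refl
    drop true  false refl = ≤-refl
    drop false a     h    = z≤n
   ...   | false = ≤-trans (≤-reflexive (trans (∑-cong (members cluster) (λ {y} i → cong bit (apart (members⁻ {cluster} i)))) (∑-zero (members cluster)))) z≤n
    where
    apart : ∀ {y} → cluster y ≡ true → adj y u ∧ true ≡ false
    apart {y} h with adj y u in yu
    ... | false = refl
    ... | true with neighbour-near h yu
    ...   | inj₁ refl = ⊥-elim (<⇒≱ (s≤s (low⇒ {x} hu)) (≥4 {k = 2} dx))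
    ...   | inj₂ xu′ = ⊥-elim (true≢false xu′ xu)

  six-each : ∑ (members cluster) deg ≤ 6 * size
  six-each = ≤-trans (∑-mono (members cluster) λ {y} i → ≤6 (members⁻ {cluster} i))
   (≤-reflexive (∑-const (members cluster) 6))
   where
   ≤6 : ∀ {y} → cluster y ≡ true → deg y ≤ 6
   ≤6 h = let z , yz , dz = Closed.mate closed h in deg≤6 yz (Closed.heavy-in closed h) dz

  rich : Rich 14 cluster
  rich with size≥2 x∈ | size ≤? 2
  ... | _ | no big = rich-if (≮⇒≥ λ l → refute (size ∷ e ∷ s ∷ lows x ∷ [])
   (1 ×[ lit 1 ⊕ 15 ⊛ var 0 ≤ 6 ⊛ var 1 ⊕ var 2 ⊕ lit 14 ] ∷ 6 ×[ var 1 ⊕ lit 6 ≤ 3 ⊛ var 0 ] ∷ 1 ×[ var 2 ≤ 3 ⊛ var 3 ] ∷ 3 ×[ var 0 ⊕ var 3 ≤ lit 7 ] ∷ [])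
   (l ∷ planar (≰⇒> big) ∷ slots ∷ ≤-reflexive neighbours ∷ []) refl)
  ... | two | yes small = rich-if (≮⇒≥ λ l → refute (size ∷ e ∷ s ∷ [])
   (1 ×[ lit 1 ⊕ 15 ⊛ var 0 ≤ 6 ⊛ var 1 ⊕ var 2 ⊕ lit 14 ] ∷ 4 ×[ var 1 ≤ lit 1 ] ∷ 1 ×[ 2 ⊛ var 1 ⊕ var 2 ≤ 6 ⊛ var 0 ]
    ∷ 9 ×[ lit 2 ≤ var 0 ] ∷ [])
   (l ∷ pair (≤-antisym small two) ∷ ≤-trans (≥-reflexive degree-total) six-each ∷ two ∷ []) refl)

 module OverlapClosed {x z y} (dx : deg x ≡ 5) (dz : deg z ≡ 5) (xz : x ≢ z) (x≁z : adj x z ≡ false)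
  (dy : deg y ≡ 4) (xy : x ~ y) (zy : z ~ y) where
  private
   module O = Overlap dx dz xz x≁z dy xy zy
   module O′ = Overlap dz dx (xz ∘ sym) (≁-sym x≁z) dy zy xy

  lens : Fin n → Bool
  lens v = heavy v ∧ ((v is x ∨ v is z) ∨ (adj x v ∧ adj z v))

  lens⁻ : ∀ {v} → lens v ≡ true → 4 ≤ deg v × (v ≡ x ⊎ v ≡ z ⊎ (x ~ v × z ~ v))
  lens⁻ {v} h with ∨-true {v is x ∨ v is z} (∧ʳ {heavy v} h)
  ... | inj₂ k = heavy⇒ {v} (∧ˡ h) , inj₂ (inj₂ (∧ˡ k , ∧ʳ {adj x v} k))
  ... | inj₁ k with ∨-true {v is x} k
  ...   | inj₁ e = heavy⇒ {v} (∧ˡ h) , inj₁ (is⇒ e)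
  ...   | inj₂ e = heavy⇒ {v} (∧ˡ h) , inj₂ (inj₁ (is⇒ e))

  x∈ : lens x ≡ true
  x∈ = ∧-true (⇒heavy {x} (≥4 dx)) (cong (λ b → (b ∨ x is z) ∨ (adj x x ∧ adj z x)) (is-refl x))

  z∈ : lens z ≡ true
  z∈ = ∧-true (⇒heavy {z} (≥4 dz)) (or (z is x) (is-refl z))
   where
   or : ∀ a {b c} → b ≡ true → (a ∨ b) ∨ c ≡ true
   or true  h = refl
   or false refl = refl

  middle : ∀ {v} → 4 ≤ deg v → x ~ v → z ~ v → lens v ≡ true
  middle {v} dv xv zv = ∧-true (⇒heavy {v} dv) (∨-introʳ (v is x ∨ v is z) (∧-true xv zv))

  closed : Closed lens
  closed = record { heavy-in = λ h → proj₁ (lens⁻ h) ; step = step ; mate = mate }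
   where
   step : ∀ {v w} → lens v ≡ true → 4 ≤ deg w → v ~ w → lens w ≡ true
   step {v} {w} h dw vw = by (proj₂ (lens⁻ h)) (w ≟ x) (w ≟ z)
    where
    by : v ≡ x ⊎ v ≡ z ⊎ (x ~ v × z ~ v) → Dec (w ≡ x) → Dec (w ≡ z) → lens w ≡ true
    by _ (yes refl) _ = x∈
    by _ _ (yes refl) = z∈
    by (inj₁ refl) _ _ = middle dw vw (O.captured dw vw)
    by (inj₂ (inj₁ refl)) _ _ = middle dw (O′.captured dw vw) vw
    by (inj₂ (inj₂ (xv , zv))) (no wx) (no wz) = let xw , zw = O.to-z (proj₁ (lens⁻ h)) xv zv vw wx wz in middle dw xw zw
   mate : ∀ {v} → lens v ≡ true → ∃[ w ] v ~ w × 4 ≤ deg w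
   mate h with lens⁻ h
   ... | _ , inj₁ refl = y , xy , ≥4 dy
   ... | _ , inj₂ (inj₁ refl) = y , zy , ≥4 dy
   ... | _ , inj₂ (inj₂ (xv , _)) = x , ~-sym xv , ≥4 dx

  fives : count (λ v → lens v ∧ five v) Vs ≤ 2
  fives = count≤cover _ {ys = x ∷ z ∷ []} Vs! cover
   where
   cover : ∀ {v} → v ∈ Vs → lens v ∧ five v ≡ true → v ∈ x ∷ z ∷ []
   cover {v} _ h with lens⁻ {v} (∧ˡ h)
   ... | _ , inj₁ e = here e
   ... | _ , inj₂ (inj₁ e) = there (here e)
   ... | _ , inj₂ (inj₂ (xv , zv)) = ⊥-elim (true≢false (five-transitive dx (five⇒ (∧ʳ {lens v} h)) dz xv (~-sym zv) xz) x≁z)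

  size : count lens Vs ≤ 7
  size = ≤-trans (count≤cover lens {ys = x ∷ z ∷ filterᵇ (adj x) Vs} Vs! cover)
   (s≤s (s≤s (≤-reflexive (trans (length-filter (adj x) Vs) dx))))
   where
   cover : ∀ {v} → v ∈ Vs → lens v ≡ true → v ∈ x ∷ z ∷ filterᵇ (adj x) Vs
   cover {v} i h with lens⁻ {v} h
   ... | _ , inj₁ e = here e
   ... | _ , inj₂ (inj₁ e) = there (here e)
   ... | _ , inj₂ (inj₂ (xv , zv)) = there (there (∈-filter⁺ (adj x) i xv))

 mono-rich : ∀ {k C C₀} → (∀ {x} → C₀ x ≡ true → C x ≡ true) → (∀ {x} → C x ≡ true → deg x ≤ 5) → Rich k C₀ → Rich k C
 mono-rich {k} {C} {C₀} h ≤5 r = subst (λ j → Rich j C) (+-identityʳ k) (rich-+ {C = C} {C₀} h r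
  (≤-trans (≤-reflexive (+-identityʳ _)) (∑-mono R λ {x} i → ≤-trans (*-monoʳ-≤ 3 (≤5 (∧ˡ (members⁻ {λ x → C x ∧ not (C₀ x)} i)))) (m≤m+n 15 (2 * lows x)))))
  where R = members (λ x → C x ∧ not (C₀ x))

 four : Fin n → Bool
 four x = deg x ≡ᵇ 4

 four⇒ : ∀ {x} → four x ≡ true → deg x ≡ 4
 four⇒ {x} h = ≡ᵇ⇒≡ (deg x) 4 (Equivalence.from T-≡ h)

 ⇒four : ∀ {x} → deg x ≡ 4 → four x ≡ true
 ⇒four {x} h rewrite h = refl

 Overlapping : Fin n → Fin n → Set
 Overlapping x z = (deg x ≡ 5 × deg z ≡ 5) × ((x ≢ z × adj x z ≡ false) × 1 ≤ count (λ y → (adj x y ∧ adj z y) ∧ four y) Vs)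

 overlapping? : ∀ x z → Dec (Overlapping x z)
 overlapping? x z = ((deg x ℕ≟ 5) ×-dec (deg z ℕ≟ 5)) ×-dec ((¬? (x ≟ z) ×-dec (adj x z ≟ᵇ false)) ×-dec (1 ≤? _))

 overlapping : ∀ {x y z} → deg x ≡ 5 → deg z ≡ 5 → x ≢ z → adj x z ≡ false → deg y ≡ 4 → x ~ y → z ~ y → Overlapping x z
 overlapping {y = y} dx dz xz x≁z dy xy zy = (dx , dz) , ((xz , x≁z) ,
  length≤count _ {y ∷ []} ([] ∷ []) λ { #0 → ∈V , ∧-true (∧-true xy zy) (⇒four {y} dy) })

 overlap-witness : ∀ {x z} → Overlapping x z → ∃[ y ] deg y ≡ 4 × x ~ y × z ~ y
 overlap-witness {x} {z} (_ , (_ , h)) with count-pos (λ y → (adj x y ∧ adj z y) ∧ four y) Vs h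
 ... | y , _ , e = y , four⇒ {y} (∧ʳ {adj x y ∧ adj z y} e) , ∧ˡ (∧ˡ e) , ∧ʳ {adj x y} (∧ˡ e)

 fives-at : Fin n → ℕ
 fives-at x = count (λ y → adj x y ∧ five y) Vs

 module ClosedFive {C} (K : Closed C) (≤5 : ∀ {x} → C x ≡ true → deg x ≤ 5) where
  open ClosedCount K

  four-or-five : ∀ {x} → C x ≡ true → deg x ≡ 4 ⊎ deg x ≡ 5
  four-or-five {x} cx with deg x ℕ≟ 5
  ... | yes h = inj₂ h
  ... | no h  = inj₁ (≤-antisym (s≤s⁻¹ (≤∧≢⇒< (≤5 cx) h)) (Closed.heavy-in K cx))

  rich-overlapping : ∀ {x z} → C x ≡ true → C z ≡ true → Overlapping x z → Rich 14 C
  rich-overlapping {x} {z} cx cz o@((dx , dz) , ((xz , x≁z) , _)) = mono-rich {C = C} {O.lens} ⊆C ≤5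
   (ClosedCount.rich-few-fives O.closed (≤5 ∘ ⊆C) O.x∈
    (≤-trans (≤-reflexive (count-filter O.lens five Vs)) (≤-trans O.fives (s≤s (s≤s z≤n)))))
   where
   w = overlap-witness o
   module O = OverlapClosed dx dz xz x≁z (proj₁ (proj₂ w)) (proj₁ (proj₂ (proj₂ w))) (proj₂ (proj₂ (proj₂ w)))
   ⊆C : ∀ {v} → O.lens v ≡ true → C v ≡ true
   ⊆C h with O.lens⁻ h
   ... | _ , inj₁ refl = cx
   ... | _ , inj₂ (inj₁ refl) = cz
   ... | dv , inj₂ (inj₂ (xv , _)) = Closed.step K cx dv xv

  module _ {x p q r} (dx : deg x ≡ 5) (dp : deg p ≡ 5) (dq : deg q ≡ 5) (dr : deg r ≡ 5)
   (xp : x ~ p) (xq : x ~ q) (xr : x ~ r) (pq : p ~ q) (pr : p ~ r) (qr : q ~ r) (cx : C x ≡ true) where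
   private module Q = QuadClosed dx dp dq dr xp xq xr pq pr qr

   core⊆ : ∀ {z} → z ∈ Q.core → C z ≡ true
   core⊆ #0 = cx
   core⊆ #1 = Closed.step K cx (≥4 dp) xp
   core⊆ #2 = Closed.step K cx (≥4 dq) xq
   core⊆ #3 = Closed.step K cx (≥4 dr) xr

   quad⊆ : ∀ {v} → Q.touches v ≡ true → C v ≡ true
   quad⊆ {v} t = let dv , k = Q.touches⁻ t ; z , i , vz = count-pos (adj v) Q.core k in Closed.step K (core⊆ i) dv (~-sym vz)

   rich-around-quad : Rich 14 C
   rich-around-quad = mono-rich {C = C} {Q.touches} quad⊆ ≤5
    (ClosedCount.rich-small (Q.closed ≤5′) ≤5′ {x} (Q.touches⁺ (≥4 dx) #1 xp)
     (+-mono-≤ (≤-trans (≤-reflexive (length-filter Q.touches Vs)) (Q.size ≤5′))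
      (≤-trans (≤-reflexive (count-filter Q.touches five Vs)) (Q.fives ≤5′))))
    where
    ≤5′ : ∀ {v} → Q.touches v ≡ true → deg v ≤ 5
    ≤5′ t = ≤5 (quad⊆ t)

  rich-quad : ∀ {x} → C x ≡ true → deg x ≡ 5 → 3 ≤ fives-at x → Rich 14 C
  rich-quad {x} cx dx h = go (pick₃ (λ y → adj x y ∧ five y) Vs! h)
   where
   Mate : Fin n → Set
   Mate p = (p ∈ Vs) × adj x p ∧ five p ≡ true
   go : Three Mate → Rich 14 C
   go (p , q , r , (pq , pr , qr) , (_ , ep) , (_ , eq) , (_ , er)) = rich-around-quad dx dp dq dr xp xq xr
    (five-transitive dp dx dq (~-sym xp) xq pq) (five-transitive dp dx dr (~-sym xp) xr pr) (five-transitive dq dx dr (~-sym xq) xr qr) cx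
    where
    xp : x ~ p
    xp = ∧ˡ ep
    xq : x ~ q
    xq = ∧ˡ eq
    xr : x ~ r
    xr = ∧ˡ er
    dp : deg p ≡ 5
    dp = five⇒ {p} (∧ʳ {adj x p} ep)
    dq : deg q ≡ 5
    dq = five⇒ {q} (∧ʳ {adj x q} eq)
    dr : deg r ≡ 5
    dr = five⇒ {r} (∧ʳ {adj x r} er)

  module _ (free-of-overlaps : ∀ {x z} → C x ≡ true → C z ≡ true → ¬ Overlapping x z)
   (small-cliques : ∀ {x} → C x ≡ true → deg x ≡ 5 → fives-at x ≤ 2) where

   fours-at : Fin n → ℕ
   fours-at x = count (λ y → adj x y ∧ four y) Vs

   neighbour-kinds : ∀ {x} → C x ≡ true → deg x ≡ fours-at x + (fives-at x + lows x)
   neighbour-kinds {x} cx = trans (∑-cong Vs (λ {y} _ → part y))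
    (trans (∑-+ Vs _ _) (cong (fours-at x +_) (∑-+ Vs _ _)))
    where
    part : ∀ y → bit (adj x y) ≡ bit (adj x y ∧ four y) + (bit (adj x y ∧ five y) + bit (adj x y ∧ not (heavy y)))
    part y with adj x y in xy
    ... | false = refl
    ... | true with heavy y in hy
    ...   | true with four-or-five (Closed.step K cx (heavy⇒ {y} hy) xy)
    ...     | inj₁ h rewrite h = refl
    ...     | inj₂ h rewrite h = refl
    part y | true | false with deg y | low⇒ {y} hy
    ...     | 0 | _ = refl
    ...     | 1 | _ = refl
    ...     | 2 | _ = refl
    ...     | 3 | _ = refl
    ...     | suc (suc (suc (suc _))) | s≤s (s≤s (s≤s ()))

   -- The part of the value of C that is found around x.
   share : Fin n → Fin n → ℕ
   share x v = bit (v is x) * (2 * lows v) + (3 * bit (adj x v ∧ four v) + bit (adj x v ∧ five v) * (2 * lows v))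

   share≥7 : ∀ {x} → C x ≡ true → deg x ≡ 5 → 7 ≤ ∑ L (share x)
   share≥7 {x} cx dx = ≤-trans cases (≥-reflexive (trans (∑-+ L _ _) (cong₂ _+_ refl (∑-+ L _ _))))
    where
    A B F : ℕ
    A = ∑ L (λ v → bit (v is x) * (2 * lows v))
    B = ∑ L (λ v → 3 * bit (adj x v ∧ four v))
    F = ∑ L (λ v → bit (adj x v ∧ five v) * (2 * lows v))
    A≥ : 2 * lows x ≤ A
    A≥ = ≤-trans (≥-reflexive (trans (cong (λ b → bit b * (2 * lows x)) (is-refl x)) (+-identityʳ _))) (term≤∑ _ (∈members {C} cx))
    B≥ : 3 * fours-at x ≤ B
    B≥ = ≤-trans (*-monoʳ-≤ 3 (≤-trans (count-mono Vs (λ {v} _ h → ∧-true (in-C h) h)) (≥-reflexive (count-filter C (λ v → adj x v ∧ four v) Vs))))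
     (≥-reflexive (∑-* L 3 _))
     where
     in-C : ∀ {v} → adj x v ∧ four v ≡ true → C v ≡ true
     in-C {v} h = Closed.step K cx (≥4 {k = 0} (four⇒ {v} (∧ʳ {adj x v} h))) (∧ˡ h)
    kinds : 5 ≤ fours-at x + (fives-at x + lows x)
    kinds = ≤-reflexive (trans (sym dx) (neighbour-kinds cx))
    cases : 7 ≤ A + (B + F)
    cases with 1 ≤? fours-at x
    ... | yes k = ≮⇒≥ λ l → refute (A ∷ B ∷ F ∷ lows x ∷ fours-at x ∷ fives-at x ∷ [])
     (1 ×[ lit 1 ⊕ (var 0 ⊕ (var 1 ⊕ var 2)) ≤ lit 7 ] ∷ 1 ×[ 2 ⊛ var 3 ≤ var 0 ] ∷ 1 ×[ 3 ⊛ var 4 ≤ var 1 ]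
      ∷ 1 ×[ lit 1 ≤ var 4 ] ∷ 2 ×[ lit 5 ≤ var 4 ⊕ (var 5 ⊕ var 3) ] ∷ 2 ×[ var 5 ≤ lit 2 ] ∷ [])
     (l ∷ A≥ ∷ B≥ ∷ k ∷ kinds ∷ small-cliques cx dx ∷ []) refl
    ... | no k with 4 ≤? lows x
    ...   | yes l = ≤-trans (≤-trans (n≤1+n 7) (*-monoʳ-≤ 2 l)) (≤-trans A≥ (m≤m+n A _))
    ...   | no l = ≮⇒≥ λ m → refute (A ∷ B ∷ F ∷ lows x ∷ fours-at x ∷ fives-at x ∷ [])
     (1 ×[ lit 1 ⊕ (var 0 ⊕ (var 1 ⊕ var 2)) ≤ lit 7 ] ∷ 1 ×[ 2 ⊛ var 3 ≤ var 0 ] ∷ 1 ×[ lit 2 ≤ var 2 ]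
      ∷ 2 ×[ var 4 ≤ lit 0 ] ∷ 2 ×[ lit 5 ≤ var 4 ⊕ (var 5 ⊕ var 3) ] ∷ 2 ×[ var 5 ≤ lit 2 ] ∷ [])
     (m ∷ A≥ ∷ mate (count-pos (λ y → adj x y ∧ five y) Vs some-five) ∷ s≤s⁻¹ (≰⇒> k) ∷ kinds ∷ small-cliques cx dx ∷ []) refl
     where
     some-five : 1 ≤ fives-at x
     some-five = ≮⇒≥ λ m → refute (lows x ∷ fours-at x ∷ fives-at x ∷ [])
      (1 ×[ lit 1 ⊕ var 2 ≤ lit 1 ] ∷ 1 ×[ var 1 ≤ lit 0 ] ∷ 1 ×[ lit 5 ≤ var 1 ⊕ (var 2 ⊕ var 0) ] ∷ 1 ×[ lit 1 ⊕ var 0 ≤ lit 4 ] ∷ [])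
      (m ∷ s≤s⁻¹ (≰⇒> k) ∷ kinds ∷ ≰⇒> l ∷ []) refl
     -- Some common neighbour of x and its mate p has degree at most 3.
     mate : ∃[ p ] (p ∈ Vs) × adj x p ∧ five p ≡ true → 2 ≤ F
     mate (p , _ , ep) = ≤-trans low-at-p (≤-trans (≥-reflexive (trans (cong (λ b → bit b * (2 * lows p)) ep) (+-identityʳ _))) (term≤∑ _ (∈members {C} cp)))
      where
      xp = ∧ˡ ep
      dp : deg p ≡ 5
      dp = five⇒ {p} (∧ʳ {adj x p} ep)
      cp : C p ≡ true
      cp = Closed.step K cx (≥4 dp) xp
      low-neighbour : ∀ {u} → p ~ u → heavy u ≡ false → 2 ≤ 2 * lows p
      low-neighbour {u} pu h = *-monoʳ-≤ 2 (length≤count _ {u ∷ []} ([] ∷ []) λ { #0 → ∈V , ∧-true pu (cong not h) })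
      five-unless : ∀ {u} → x ~ u → heavy u ≡ true → five u ≡ true
      five-unless {u} xu h with four-or-five (Closed.step K cx (heavy⇒ {u} h) xu)
      ... | inj₁ d = ⊥-elim (k (length≤count _ {u ∷ []} ([] ∷ []) λ { #0 → ∈V , ∧-true xu (⇒four {u} d) }))
      ... | inj₂ d = ⇒five {u} d
      low-at-p : 2 ≤ 2 * lows p
      low-at-p = go (common₂ (≤-trans (s≤s (s≤s z≤n)) (common≥ xp dx dp)))
       where
       go : Two (Common x p) → 2 ≤ 2 * lows p
       go (a , b , ab , (xa , pa) , (xb , pb)) = by (heavy a) (heavy b) refl refl
        where
        by : ∀ s t → heavy a ≡ s → heavy b ≡ t → 2 ≤ 2 * lows p
        by false _ e f = low-neighbour pa e
        by true false e f = low-neighbour pb f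
        by true true e f = ⊥-elim (<⇒≱ {2} (length≤count _ {p ∷ a ∷ b ∷ []} ((~⇒≢ pa ∷ ~⇒≢ pb ∷ []) ∷ (ab ∷ []) ∷ [] ∷ [])
         λ { #0 → ∈V , ep ; #1 → ∈V , ∧-true xa (five-unless xa e)
          ; #2 → ∈V , ∧-true xb (five-unless xb f) }) (small-cliques cx dx))

   rich-two-cliques : ∀ {x z} → C x ≡ true → C z ≡ true → deg x ≡ 5 → deg z ≡ 5 → x ≢ z → adj x z ≡ false → Rich 14 C
   rich-two-cliques {x} {z} cx cz dx dz xz x≁z = ≤-trans (+-monoʳ-≤ (∑ L (λ v → 3 * deg v)) (+-mono-≤ (share≥7 cx dx) (share≥7 cz dz)))
    (≤-trans (≤-reflexive (trans (cong (∑ L (λ v → 3 * deg v) +_) (sym (∑-+ L _ _))) (sym (∑-+ L _ _)))) (∑-mono L λ i → at (members⁻ {C} i)))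
    where
    at : ∀ {v} → C v ≡ true → 3 * deg v + (share x v + share z v) ≤ 15 + 2 * lows v
    at {v} cv with four-or-five cv
    ... | inj₁ d rewrite d with v ≟ x | v ≟ z
    ...   | yes refl | _ = ⊥-elim (4≢5 (trans (sym d) dx))
    ...   | _ | yes refl = ⊥-elim (4≢5 (trans (sym d) dz))
    ...   | no _ | no _ with adj x v in xv | adj z v in zv
    ...     | true  | true  = ⊥-elim (free-of-overlaps cx cz (overlapping dx dz xz x≁z d xv zv))
    ...     | true  | false = m≤m+n 15 (2 * lows v)
    ...     | false | true  = m≤m+n 15 (2 * lows v)
    ...     | false | false = +-monoˡ-≤ (2 * lows v) {12} {15} (s≤s (s≤s (s≤s (s≤s (s≤s (s≤s (s≤s (s≤s (s≤s (s≤s (s≤s (s≤s z≤n)))))))))))) |>ᵇ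
     where
     _|>ᵇ : 12 + 2 * lows v ≤ 15 + 2 * lows v → 12 ≤ 15 + 2 * lows v
     h |>ᵇ = ≤-trans (m≤m+n 12 _) h
    at {v} cv | inj₂ d rewrite d with v ≟ x | v ≟ z
    ...   | yes refl | yes refl = ⊥-elim (xz refl)
    ...   | yes refl | no _ rewrite adj-irrefl x | ≁-sym x≁z = ≤-reflexive (cong (15 +_) (trans (+-identityʳ _) (trans (+-identityʳ _) (+-identityʳ _))))
    ...   | no _ | yes refl rewrite adj-irrefl z | x≁z = ≤-reflexive (cong (15 +_) (trans (+-identityʳ _) (+-identityʳ _)))
    ...   | no vx | no vz with adj x v in xv | adj z v in zv
    ...     | true  | true  = ⊥-elim (true≢false (five-transitive dx d dz xv (~-sym zv) xz) x≁z)
    ...     | true  | false = ≤-reflexive (cong (15 +_) (trans (+-identityʳ _) (+-identityʳ _)))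
    ...     | false | true  = ≤-reflexive (cong (15 +_) (+-identityʳ _))
    ...     | false | false = m≤m+n 15 (2 * lows v)

  rich-five : ∀ {x} → C x ≡ true → Rich 14 C
  rich-five {x₀} cx₀ with d ≤5 ≤? 3 | find-pair overlapping? L | find-or-none (λ x → (deg x ℕ≟ 5) ×-dec (3 ≤? fives-at x)) L
  ... | yes h | _ | _ = rich-few-fives ≤5 cx₀ h
  ... | no _ | inj₁ (x , z , i , j , o) | _ = rich-overlapping (members⁻ {C} i) (members⁻ {C} j) o
  ... | no _ | inj₂ _ | inj₁ (x , i , dx , h) = rich-quad (members⁻ {C} i) dx h
  ... | no many | inj₂ none | inj₂ small = first (count-pos five L (≤-trans (s≤s z≤n) (≰⇒> many)))
   where
   first : ∃[ x ] (x ∈ L) × five x ≡ true → Rich 14 C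
   first (x , i , ex) = second (find-or-none (λ z → (five z ≟ᵇ true) ×-dec (¬? (x ≟ z) ×-dec (adj x z ≟ᵇ false))) L)
    where
    dx = five⇒ {x} ex
    cx = members⁻ {C} i
    small′ : ∀ {x} → C x ≡ true → deg x ≡ 5 → fives-at x ≤ 2
    small′ cx dx = s≤s⁻¹ (≰⇒> λ h → small (∈members {C} cx) (dx , h))
    second : (∃[ z ] (z ∈ L) × five z ≡ true × x ≢ z × adj x z ≡ false) ⊎ (∀ {z} → z ∈ L → ¬ (five z ≡ true × x ≢ z × adj x z ≡ false)) → Rich 14 C
    second (inj₁ (z , j , ez , xz , x≁z)) = rich-two-cliques (λ a b → none (∈members {C} a) (∈members {C} b)) small′
     cx (members⁻ {C} j) dx (five⇒ {z} ez) xz x≁z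
    second (inj₂ no-other) = ⊥-elim (many (≤-trans (count≤cover five {ys = x ∷ filterᵇ (λ y → adj x y ∧ five y) Vs} (members! C) cover)
     (s≤s (≤-trans (≤-reflexive (length-filter _ Vs)) (small′ cx dx)))))
     where
     cover : ∀ {z} → z ∈ L → five z ≡ true → z ∈ x ∷ filterᵇ (λ y → adj x y ∧ five y) Vs
     cover {z} j ez with x ≟ z
     ... | yes e = here (sym e)
     ... | no xz = there (∈-filter⁺ _ ∈V (∧-true (by-contradiction λ x≁z → no-other j (ez , xz , x≁z)) ez))

 rich-closed : ∀ {C} → Closed C → ∀ {x} → C x ≡ true → Rich 14 C
 rich-closed {C} K = go C K (<-wellFounded _)
  where
  go : ∀ C → Closed C → Acc _<_ (length (members C)) → ∀ {x} → C x ≡ true → Rich 14 C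
  go C K (acc rec) cx with find-or-none (λ x → deg x ℕ≟ 6) (members C)
  ... | inj₂ none = ClosedFive.rich-five K (λ {x} cx → s≤s⁻¹ (≤∧≢⇒< (≤6 cx) (none (∈members {C} cx)))) cx
   where
   ≤6 : ∀ {y} → C y ≡ true → deg y ≤ 6
   ≤6 h = let z , yz , dz = Closed.mate K h in deg≤6 yz (Closed.heavy-in K h) dz
  ... | inj₁ (x , i , dx) = rest (find-or-none (λ y → (C y ∧ not (X.cluster y)) ≟ᵇ true) Vs)
   where
   module X = Six dx (Closed.mate K (members⁻ {C} i))
   R : Fin n → Bool
   R y = C y ∧ not (X.cluster y)
   ⊆C : ∀ {y} → X.cluster y ≡ true → C y ≡ true
   ⊆C h with X.cluster⁻ h
   ... | _ , inj₁ refl = members⁻ {C} i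
   ... | dy , inj₂ xy = Closed.step K (members⁻ {C} i) dy xy
   smaller : length (members R) < length (members C)
   smaller = ≤-trans (+-monoˡ-≤ (length (members R)) {1} (length≤count X.cluster {x ∷ []} ([] ∷ []) λ { #0 → ∈V , X.x∈ }))
    (≤-reflexive (trans (cong₂ _+_ refl (length-filter R Vs)) (trans (sym (∑-+ Vs _ _)) (trans
     (∑-cong Vs (λ {y} _ → part (C y) (X.cluster y) (⊆C {y}))) (sym (length-filter C Vs))))))
    where
    part : ∀ a b → (b ≡ true → a ≡ true) → bit b + bit (a ∧ not b) ≡ bit a
    part true  true  h = refl
    part true  false h = refl
    part false false h = refl
    part false true  h with h refl
    ... | ()
   rest : (∃[ y ] (y ∈ Vs) × R y ≡ true) ⊎ (∀ {y} → y ∈ Vs → R y ≢ true) → Rich 14 C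
   rest (inj₁ (y , _ , ry)) = rich-weaken {C = C} (m≤m+n 14 14) (rich-+ {C = C} {X.cluster} ⊆C X.rich (go R (closed-minus K X.closed) (rec smaller) ry))
   rest (inj₂ empty) = rich-+ {j = 14} {0} {C} {X.cluster} ⊆C X.rich
    (≤-trans (≤-reflexive (+-identityʳ _)) (∑-mono (members R) λ j → ⊥-elim (empty ∈V (members⁻ {R} j))))

module ThreeClique {n} (G : Graph (Fin n)) (D : Drawing G) (free : S 3 3 Free G) where
 open import Data.Fin.Properties using (_≟_)
 open ThreeValue G D free public

 record Tame : Set where
  field
   ≤5             : ∀ v → deg v ≤ 5
   small-cliques  : ∀ {x} → deg x ≡ 5 → fives-at x ≤ 2
   no-overlap     : ∀ {x z} → ¬ Overlapping x z
   mate           : ∀ {x} → 4 ≤ deg x → ∃[ y ] x ~ y × 4 ≤ deg y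
   connected      : ∀ {C v u} → Closed C → C v ≡ true → 4 ≤ deg u → C u ≡ true

 module _ (tame : Tame) where
  open Tame tame

  four-of : ∀ {v} → 4 ≤ deg v → deg v ≢ 5 → deg v ≡ 4
  four-of {v} h k = ≤-antisym (s≤s⁻¹ (≤∧≢⇒< (≤5 v) k)) h

  not-five : ∀ {v} → five v ≡ false → deg v ≢ 5
  not-five {v} h k = true≢false (⇒five {v} k) h

  -- The clique of vertices of degree 5 that contains x.
  module Clique {x} (dx : deg x ≡ 5) where
   Q : Fin n → Bool
   Q p = five p ∧ (p is x ∨ adj x p)

   x∈Q : Q x ≡ true
   x∈Q = ∧-true (⇒five {x} dx) (∨-introˡ (is-refl x))

   Q⁻ : ∀ {p} → Q p ≡ true → deg p ≡ 5 × (p ≡ x ⊎ x ~ p)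
   Q⁻ {p} h with ∨-true (∧ʳ {five p} h)
   ... | inj₁ e = five⇒ {p} (∧ˡ h) , inj₁ (is⇒ e)
   ... | inj₂ e = five⇒ {p} (∧ˡ h) , inj₂ e

   Q⁺ : ∀ {p} → deg p ≡ 5 → x ~ p → Q p ≡ true
   Q⁺ {p} dp xp = ∧-true (⇒five {p} dp) (∨-introʳ (p is x) xp)

   Q-clique : ∀ {p p′} → Q p ≡ true → Q p′ ≡ true → p ≢ p′ → p ~ p′
   Q-clique h k pp′ with Q⁻ h | Q⁻ k
   ... | _ , inj₁ refl | _ , inj₁ refl = ⊥-elim (pp′ refl)
   ... | _ , inj₁ refl | _ , inj₂ xp′ = xp′
   ... | _ , inj₂ xp | _ , inj₁ refl = ~-sym xp
   ... | dp , inj₂ xp | dp′ , inj₂ xp′ = five-transitive dp dx dp′ (~-sym xp) xp′ pp′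

   Q-step : ∀ {p v} → Q p ≡ true → deg v ≡ 5 → p ~ v → Q v ≡ true
   Q-step {p} {v} h dv pv = by (Q⁻ h) (v ≟ x)
    where
    by : deg p ≡ 5 × (p ≡ x ⊎ x ~ p) → Dec (v ≡ x) → Q v ≡ true
    by _ (yes refl) = x∈Q
    by (_ , inj₁ refl) _ = Q⁺ dv pv
    by (dp , inj₂ xp) (no vx) = Q⁺ dv (five-transitive dx dp dv xp pv (vx ∘ sym))

   nq : Fin n → ℕ
   nq v = count (λ p → Q p ∧ adj v p) Vs

   NQ : Fin n → Bool
   NQ v = not (five v) ∧ (0 <ᵇ nq v)

   NQ⁺ : ∀ {v p} → deg v ≢ 5 → Q p ≡ true → v ~ p → NQ v ≡ true
   NQ⁺ {v} {p} dv h vp = ∧-true (nf (five v) refl)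
    (positive (length≤count _ {p ∷ []} ([] ∷ []) λ { #0 → ∈V , ∧-true h vp }))
    where
    nf : ∀ b → five v ≡ b → not (five v) ≡ true
    nf true  e = ⊥-elim (dv (five⇒ {v} e))
    nf false e = cong not e

   NQ⁻ : ∀ {v} → NQ v ≡ true → deg v ≢ 5 × ∃[ p ] Q p ≡ true × v ~ p
   NQ⁻ {v} h = not-five {v} (not-true (∧ˡ h)) , pick (count-pos (λ p → Q p ∧ adj v p) Vs (positive⁻ (∧ʳ {not (five v)} h)))
    where
    pick : ∃[ p ] (p ∈ Vs) × Q p ∧ adj v p ≡ true → ∃[ p ] Q p ≡ true × v ~ p
    pick (p , _ , e) = p , ∧ˡ e , ∧ʳ {Q p} e

   ν : ℕ
   ν = count NQ Vs

   non-fives : Fin n → ℕ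
   non-fives p = count (λ v → adj p v ∧ not (five v)) Vs

   non-fives-sum : ∀ {p} → deg p ≡ 5 → non-fives p + fives-at p ≡ 5
   non-fives-sum {p} dp = trans (sym (∑-+ Vs _ _)) (trans (∑-cong Vs (λ {v} _ → e (adj p v) (five v))) dp)
    where
    e : ∀ a b → bit (a ∧ not b) + bit (a ∧ b) ≡ bit a
    e true  true  = refl
    e true  false = refl
    e false b     = refl

   non-five-near : ∀ {p v} → Q p ≡ true → adj p v ∧ not (five v) ≡ true → NQ v ≡ true
   non-five-near {p} {v} h e = NQ⁺ (not-five {v} (not-true (∧ʳ {adj p v} e))) h (~-sym (∧ˡ e))

   ν≥ : non-fives x ≤ ν
   ν≥ = count-mono Vs (λ _ → non-five-near x∈Q)

   two-mates : fives-at x ≡ 2 → ∀ {p} → Q p ≡ true → fives-at p ≡ 2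
   two-mates h {p} qp = ≤-antisym (small-cliques (proj₁ (Q⁻ qp))) (go (pick₂ (λ y → adj x y ∧ five y) Vs! (≥-reflexive h)) (p ≟ x))
    where
    Mate : Fin n → Set
    Mate a = (a ∈ Vs) × adj x a ∧ five a ≡ true
    go : Two Mate → Dec (p ≡ x) → 2 ≤ fives-at p
    go _ (yes refl) = ≥-reflexive h
    go (a , b , ab , (_ , ea) , (_ , eb)) (no px) with p ≟ a
    ... | yes refl = length≤count _ {x ∷ b ∷ []} ((~⇒≢ (∧ˡ eb) ∷ []) ∷ [] ∷ []) λ
     { #0 → ∈V , ∧-true (~-sym (∧ˡ ea)) (⇒five {x} dx)
     ; #1 → ∈V , ∧-true (Q-clique qp (Q⁺ (five⇒ {b} (∧ʳ {adj x b} eb)) (∧ˡ eb)) ab) (∧ʳ {adj x b} eb) }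
    ... | no pa = length≤count _ {x ∷ a ∷ []} ((~⇒≢ (∧ˡ ea) ∷ []) ∷ [] ∷ []) λ
     { #0 → ∈V , ∧-true (Q-clique qp x∈Q px) (⇒five {x} dx)
     ; #1 → ∈V , ∧-true (Q-clique qp (Q⁺ (five⇒ {a} (∧ʳ {adj x a} ea)) (∧ˡ ea)) pa) (∧ʳ {adj x a} ea) }

   -- A clique of three vertices with only three neighbours outside would give K₃,₃.
   ν≥4 : 4 ≤ ν
   ν≥4 with fives-at x ≤? 1
   ... | yes h = ≤-trans (+-cancelʳ-≤ 1 4 _ (≤-trans (≥-reflexive (non-fives-sum dx)) (+-monoʳ-≤ (non-fives x) h))) ν≥
   ... | no h = ≮⇒≥ λ l → mates (pick₂ (λ y → adj x y ∧ five y) Vs! (≰⇒> h)) l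
    where
    two : fives-at x ≡ 2
    two = ≤-antisym (small-cliques dx) (≰⇒> h)
    three : ∀ {p} → Q p ≡ true → non-fives p ≡ 3
    three {p} qp = +-cancelʳ-≡ 2 _ 3 (trans (cong (non-fives p +_) (sym (two-mates two qp))) (non-fives-sum (proj₁ (Q⁻ qp))))
    Mate NonFive : Fin n → Set
    Mate a = (a ∈ Vs) × adj x a ∧ five a ≡ true
    NonFive a = (a ∈ Vs) × adj x a ∧ not (five a) ≡ true
    mates : Two Mate → ν < 4 → ⊥
    mates (p , q , pq , (_ , ep) , (_ , eq)) l = nbrs (pick₃ (λ y → adj x y ∧ not (five y)) Vs! (≥-reflexive (three x∈Q)))
     where
     qp : Q p ≡ true
     qp = Q⁺ (five⇒ {p} (∧ʳ {adj x p} ep)) (∧ˡ ep)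
     qq : Q q ≡ true
     qq = Q⁺ (five⇒ {q} (∧ʳ {adj x q} eq)) (∧ˡ eq)
     nbrs : Three NonFive → ⊥
     nbrs (a , b , c , (ab , ac , bc) , (_ , ea) , (_ , eb) , (_ , ec)) =
      K₃₃-free P (~⇒≢ (∧ˡ ep)) (~⇒≢ (∧ˡ eq)) pq ab ac bc (∧ˡ ea) (∧ˡ eb) (∧ˡ ec)
       (to qp #0) (to qp #1) (to qp #2)
       (to qq #0) (to qq #1) (to qq #2)
      where
      abc : List (Fin n)
      abc = a ∷ b ∷ c ∷ []
      abc! : Unique abc
      abc! = (ab ∷ ac ∷ []) ∷ (bc ∷ []) ∷ [] ∷ []
      near : ∀ {v} → v ∈ abc → adj x v ∧ not (five v) ≡ true
      near #0 = ea
      near #1 = eb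
      near #2 = ec
      all : ∀ {v} → NQ v ≡ true → v ∈ abc
      all = exhaustive _≟_ NQ abc! (λ i → ∈V , non-five-near x∈Q (near i)) (s≤s⁻¹ l) ∈V
      to : ∀ {p} → Q p ≡ true → ∀ {v} → v ∈ abc → p ~ v
      to {p} qp {v} i = by-contradiction λ p≁v → <⇒≱ (≥-reflexive (three qp))
       (≤-trans (count≤cover (λ v → adj p v ∧ not (five v)) {ys = filterᵇ (λ u → not (u is v)) abc} Vs!
        (λ {u} _ e → ∈-filter⁺ (λ u → not (u is v)) (all (non-five-near qp e)) (differs p≁v e)))
        (≤-trans (≤-reflexive (length-filter (λ u → not (u is v)) abc)) (+-cancelˡ-≤ 1 _ 2 (≤-trans
         (+-monoˡ-≤ _ (≤-trans (≤-reflexive (cong bit (sym (is-refl v)))) (term≤∑ (λ u → bit (u is v)) i)))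
         (≤-reflexive (count-not (λ u → u is v) abc))))))
       where
       differs : ∀ {u} → adj p v ≡ false → adj p u ∧ not (five u) ≡ true → not (u is v) ≡ true
       differs {u} p≁v e with u ≟ v
       ... | yes refl = ⊥-elim (true≢false (∧ˡ {adj p u} e) p≁v)
       ... | no _ = refl

   stays : ∀ {y p z} → deg y ≡ 4 → Q p ≡ true → y ~ p → deg z ≡ 5 → y ~ z → Q z ≡ true
   stays {y} {p} {z} dy qp yp dz yz = by-contradiction λ z∉ → no-overlap (overlapping (proj₁ (Q⁻ qp)) dz
    (λ { refl → true≢false qp z∉ }) (≁ λ pz → true≢false (Q-step qp dz pz) z∉) dy (~-sym yp) (~-sym yz))

   module Exit {y p w} (qp : Q p ≡ true) (yp : y ~ p) (dy : deg y ≡ 4) (dw : 4 ≤ deg w) (yw : y ~ w)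
    (w∉Q : Q w ≡ false) (w∉NQ : NQ w ≡ false) where

    dp : deg p ≡ 5
    dp = proj₁ (Q⁻ qp)

    w-four : deg w ≡ 4
    w-four = four-of dw λ w5 → true≢false (stays dy qp yp w5 yw) w∉Q

    w≁Q : ∀ {p} → Q p ≡ true → adj w p ≡ false
    w≁Q h = ≁ λ wp → true≢false (NQ⁺ (λ w5 → 4≢5 (trans (sym w-four) w5)) h wp) w∉NQ

    back : ∀ {a} → y ~ a → a ≢ p → a ≢ w → p ~ a
    back ya ap aw = joins₅ dp (≥4 dy) (~-sym yp) yw (≁-sym (w≁Q qp)) (λ { refl → true≢false qp w∉Q }) ya ap aw

    companion : ∃[ b ] y ~ b × w ~ b × p ~ b × deg b ≢ 5
    companion = go (common₁ (common≥ yw dy w-four))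
     where
     go : ∃[ b ] Common y w b → ∃[ b ] y ~ b × w ~ b × p ~ b × deg b ≢ 5
     go (b , yb , wb) = b , yb , wb , back yb bp (~⇒≢ wb ∘ sym) , λ b5 → true≢false wb (w≁Q (stays dy qp yp b5 yb))
      where
      bp : b ≢ p
      bp refl = true≢false wb (w≁Q qp)

    -- The companion of y and w has no room for a neighbour z of degree 5 outside the clique.
    not-near : ∀ {z} → deg z ≡ 5 → Q z ≡ false → adj w z ≡ false
    not-near {z} dz z∉Q = ≁ λ wz → go wz companion (common₂ (common≥ (~-sym wz) dz w-four))
     where
     y≁z : adj y z ≡ false
     y≁z = ≁ λ yz → true≢false (stays dy qp yp dz yz) z∉Q
     go : w ~ z → ∃[ b ] y ~ b × w ~ b × p ~ b × deg b ≢ 5 → Two (Common z w) → ⊥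
     go wz (b , yb , wb , pb , b≢5) (g , h , gh , (zg , wg) , (zh , wh)) =
      too-many {w} {y ∷ b ∷ z ∷ g ∷ h ∷ []}
       ((~⇒≢ yb ∷ y≢z ∷ y≢ zg ∷ y≢ zh ∷ []) ∷ (b≢z ∷ b≢ zg ∷ b≢ zh ∷ []) ∷ (~⇒≢ zg ∷ ~⇒≢ zh ∷ []) ∷ (gh ∷ []) ∷ [] ∷ [])
       (~-sym yw ∷ wb ∷ wz ∷ wg ∷ wh ∷ []) (≤-reflexive (cong suc w-four))
      where
      y≢z : y ≢ z
      y≢z refl with trans (sym dy) dz
      ... | ()
      b≢z : b ≢ z
      b≢z refl = b≢5 dz
      y≢ : ∀ {g} → z ~ g → y ≢ g
      y≢ zg refl = true≢false (~-sym zg) y≁z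
      z≢p : z ≢ p
      z≢p refl = true≢false qp z∉Q
      b≢ : ∀ {g} → z ~ g → b ≢ g
      b≢ zg refl with 4 ≤? deg b
      ... | yes db = true≢false (stays (four-of db b≢5) qp (~-sym pb) dz (~-sym zg)) z∉Q
      ... | no db = too-many {b} {p ∷ y ∷ w ∷ z ∷ []}
       ((~⇒≢ yp ∘ sym ∷ (λ { refl → true≢false qp w∉Q }) ∷ (z≢p ∘ sym) ∷ []) ∷ (~⇒≢ yw ∷ y≢z ∷ []) ∷ (~⇒≢ wz ∷ []) ∷ [] ∷ [])
       (~-sym pb ∷ ~-sym yb ∷ ~-sym wb ∷ ~-sym zg ∷ []) (≰⇒> db)

   S_Q : Fin n → Bool
   S_Q v = Q v ∨ (NQ v ∧ heavy v)

   record Way-out : Set where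
    field
     {y p w} : Fin n
     qp   : Q p ≡ true
     yp   : y ~ p
     dy   : deg y ≡ 4
     dw   : 4 ≤ deg w
     yw   : y ~ w
     w∉Q  : Q w ≡ false
     w∉NQ : NQ w ≡ false
    open Exit qp yp dy dw yw w∉Q w∉NQ public

   way-out : ∀ {z} → deg z ≡ 5 → Q z ≡ false → Way-out
   way-out {z} dz z∉ = go (find-pair (λ v w → ((S_Q v ≟ᵇ true) ×-dec (heavy w ≟ᵇ true)) ×-dec ((adj v w ≟ᵇ true) ×-dec (S_Q w ≟ᵇ false))) Vs)
    where
    Leaves : Fin n → Fin n → Set
    Leaves v w = (S_Q v ≡ true × heavy w ≡ true) × (adj v w ≡ true × S_Q w ≡ false)
    false-∨ : ∀ a {b} → a ∨ b ≡ false → a ≡ false × b ≡ false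
    false-∨ false h = refl , h
    exit : ∀ {v w} → Leaves v w → Way-out
    exit {v} {w} ((sv , hw) , (vw , w∉)) with ∨-true {Q v} sv
    ... | inj₁ qv = ⊥-elim (case (deg w ℕ≟ 5))
     where
     case : Dec (deg w ≡ 5) → ⊥
     case (yes d) = true≢false (Q-step qv d vw) (proj₁ (false-∨ (Q w) w∉))
     case (no d) = true≢false (∧-true (NQ⁺ d qv (~-sym vw)) hw) (proj₂ (false-∨ (Q w) w∉))
    ... | inj₂ nv = let d , p , qp , vp = NQ⁻ {v} (∧ˡ nv) in record
     { qp = qp ; yp = vp ; dy = four-of (heavy⇒ {v} (∧ʳ {NQ v} nv)) d ; dw = heavy⇒ {w} hw ; yw = vw
     ; w∉Q = proj₁ (false-∨ (Q w) w∉) ; w∉NQ = ≁NQ (NQ w) refl }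
     where
     ≁NQ : ∀ b → NQ w ≡ b → NQ w ≡ false
     ≁NQ true e = ⊥-elim (true≢false (∧-true e hw) (proj₂ (false-∨ (Q w) w∉)))
     ≁NQ false e = e
    go : (∃[ v ] ∃[ w ] (v ∈ Vs) × (w ∈ Vs) × Leaves v w) ⊎ (∀ {v w} → v ∈ Vs → w ∈ Vs → ¬ Leaves v w) → Way-out
    go (inj₁ (v , w , _ , _ , l)) = exit l
    go (inj₂ none) = ⊥-elim (in-Q (∨-true {Q z} (connected closed (∨-introˡ x∈Q) (≥4 dz))))
     where
     heavy-of : ∀ {v} → S_Q v ≡ true → 4 ≤ deg v
     heavy-of {v} h with ∨-true {Q v} h
     ... | inj₁ qv = ≥4 (proj₁ (Q⁻ qv))
     ... | inj₂ nv = heavy⇒ {v} (∧ʳ {NQ v} nv)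
     closed : Closed S_Q
     closed = record { heavy-in = heavy-of
      ; step = λ {v} {w} sv dw vw → by-contradiction λ w∉ → none ∈V ∈V ((sv , ⇒heavy {w} dw) , (vw , w∉))
      ; mate = λ h → mate (heavy-of h) }
     in-Q : Q z ≡ true ⊎ NQ z ∧ heavy z ≡ true → ⊥
     in-Q (inj₁ h) = true≢false h z∉
     in-Q (inj₂ h) = proj₁ (NQ⁻ {z} (∧ˡ h)) dz

module ThreePair {n} (G : Graph (Fin n)) (D : Drawing G) (free : S 3 3 Free G) where
 open import Data.Bool.Properties using (∧-zeroʳ; ∧-identityʳ)
 open import Data.Fin.Properties using (_≟_)
 open ThreeClique G D free public

 weight : Fin n → ℕ
 weight v = bit (not (five v)) + bit (not (heavy v))

 module _ (tame : Tame) where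
  open Tame tame

  module Half {x z} (dx : deg x ≡ 5) (dz : deg z ≡ 5)
   (z∉ : Clique.Q tame dx z ≡ false) (x∉ : Clique.Q tame dz x ≡ false) where
   module X = Clique tame dx
   module Z = Clique tame dz

   disjoint : ∀ {p} → Z.Q p ≡ true → X.Q p ≡ false
   disjoint {p} h = by (X.Q p) refl
    where
    by : ∀ b → X.Q p ≡ b → X.Q p ≡ false
    by false e = e
    by true  e with Z.Q⁻ h
    ... | _ , inj₁ refl = ⊥-elim (true≢false e z∉)
    ... | dp , inj₂ zp = ⊥-elim (true≢false (X.Q-step e dz (~-sym zp)) z∉)

   N4 : Fin n → Bool
   N4 v = X.NQ v ∧ heavy v

   N4-four : ∀ {v} → N4 v ≡ true → deg v ≡ 4
   N4-four {v} h = four-of tame (heavy⇒ {v} (∧ʳ {X.NQ v} h)) (proj₁ (X.NQ⁻ {v} (∧ˡ h)))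

   not-both : ∀ {v} → 4 ≤ deg v → X.NQ v ≡ true → Z.NQ v ≡ true → ⊥
   not-both {v} dv a b = go (X.NQ⁻ {v} a) (Z.NQ⁻ {v} b)
    where
    go : deg v ≢ 5 × ∃[ p ] X.Q p ≡ true × v ~ p → deg v ≢ 5 × ∃[ p ] Z.Q p ≡ true × v ~ p → ⊥
    go (d , p , qp , vp) (_ , r , qr , vr) = true≢false (X.stays (four-of tame dv d) qp vp (proj₁ (Z.Q⁻ qr)) vr) (disjoint qr)

   out-not-near : ∀ {y p w} → X.Q p ≡ true → y ~ p → deg y ≡ 4 → 4 ≤ deg w → y ~ w → X.Q w ≡ false → X.NQ w ≡ false → Z.NQ w ≡ false
   out-not-near {w = w} qp yp dy dw yw a b = by (Z.NQ w) refl
    where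
    by : ∀ c → Z.NQ w ≡ c → Z.NQ w ≡ false
    by false e = e
    by true e = let _ , r , qr , wr = Z.NQ⁻ {w} e in
     ⊥-elim (true≢false wr (X.Exit.not-near qp yp dy dw yw a b (proj₁ (Z.Q⁻ qr)) (disjoint qr)))

   exit : X.Way-out
   exit = X.way-out dz z∉

   module Tight {w} (w-four : deg w ≡ 4) (w∉X : X.NQ w ≡ false) (ν4 : X.ν ≡ 4)
    (shared : ∀ {v} → heavy v ≡ false → X.NQ v ≡ true × Z.NQ v ≡ true)
    (only-w : ∀ {v} → 4 ≤ deg v → deg v ≢ 5 → X.NQ v ≡ false → Z.NQ v ≡ false → v ≡ w) where

    w∉Q : X.Q w ≡ false
    w∉Q = by (X.Q w) refl
     where
     by : ∀ b → X.Q w ≡ b → X.Q w ≡ false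
     by false e = e
     by true e with trans (sym w-four) (proj₁ (X.Q⁻ e))
     ... | ()

    companion : ∀ {v} → N4 v ≡ true → v ~ w → ∃[ b ] v ~ b × w ~ b × N4 b ≡ true
    companion {v} h vw = go (X.NQ⁻ {v} (∧ˡ h))
     where
     go : deg v ≢ 5 × ∃[ p ] X.Q p ≡ true × v ~ p → ∃[ b ] v ~ b × w ~ b × N4 b ≡ true
     go (d , p , qp , vp) = use E.companion
      where
      module E = X.Exit qp vp (N4-four {v} h) (≥4 {k = 0} w-four) vw w∉Q w∉X
      use : ∃[ b ] v ~ b × w ~ b × p ~ b × deg b ≢ 5 → ∃[ b ] v ~ b × w ~ b × N4 b ≡ true
      use (b , vb , wb , pb , b≢5) = b , vb , wb , ∧-true (X.NQ⁺ b≢5 qp (~-sym pb)) (big (heavy b) refl)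
       where
       big : ∀ c → heavy b ≡ c → heavy b ≡ true
       big true e = e
       big false e = ⊥-elim (crowd (Z.NQ⁻ {b} (proj₂ (shared e))))
        where
        crowd : deg b ≢ 5 × ∃[ r ] Z.Q r ≡ true × b ~ r → ⊥
        crowd (_ , r , qr , br) = too-many {b} {p ∷ r ∷ v ∷ w ∷ []}
         (((λ { refl → true≢false qp (disjoint qr) }) ∷ (~⇒≢ vp ∘ sym) ∷ (λ { refl → true≢false qp w∉Q }) ∷ [])
          ∷ ((λ { refl → d (proj₁ (Z.Q⁻ qr)) }) ∷ (λ { refl → 4≢5 (trans (sym w-four) (proj₁ (Z.Q⁻ qr))) }) ∷ []) ∷ (~⇒≢ vw ∷ []) ∷ [] ∷ [])
         (~-sym pb ∷ br ∷ ~-sym vb ∷ ~-sym wb ∷ []) (s≤s (low⇒ {b} e))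

    attached : ℕ
    attached = count (λ v → N4 v ∧ adj w v) Vs

    exit-is-w : X.Way-out.w exit ≡ w
    exit-is-w = only-w E.dw (λ d → true≢false (X.stays E.dy E.qp E.yp d E.yw) E.w∉Q) E.w∉NQ
     (out-not-near E.qp E.yp E.dy E.dw E.yw E.w∉Q E.w∉NQ)
     where module E = X.Way-out exit

    attached≥2 : 2 ≤ attached
    attached≥2 = pair (companion y∈ yw)
     where
     module E = X.Way-out exit
     yw : E.y ~ w
     yw = subst (E.y ~_) exit-is-w E.yw
     y∈ : N4 E.y ≡ true
     y∈ = ∧-true (X.NQ⁺ (λ d → 4≢5 (trans (sym E.dy) d)) E.qp E.yp) (⇒heavy {E.y} (≥4 {k = 0} E.dy))
     pair : ∃[ b ] E.y ~ b × w ~ b × N4 b ≡ true → 2 ≤ attached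
     pair (b , yb , wb , b∈) = length≤count (λ v → N4 v ∧ adj w v) {E.y ∷ b ∷ []} ((~⇒≢ yb ∷ []) ∷ [] ∷ []) λ
      { #0 → ∈V , ∧-true y∈ (~-sym yw) ; #1 → ∈V , ∧-true b∈ wb }

    L₄ : List (Fin n)
    L₄ = members N4

    degree-parts : ∀ {v} → N4 v ≡ true → 4 ≡ X.nq v + (count (adj v) L₄ + (bit (adj w v) + lows v))
    degree-parts {v} h = trans (sym (N4-four {v} h)) (trans (∑-cong Vs (λ {u} _ → part u)) (trans (∑-+ Vs _ _)
     (cong (X.nq v +_) (trans (∑-+ Vs _ _) (cong₂ _+_ (sym (count-filter N4 (adj v) Vs))
      (trans (∑-+ Vs _ _) (cong (_+ lows v) at-w)))))))
     where
     at-w : ∑ Vs (λ u → bit (u is w ∧ adj v u)) ≡ bit (adj w v)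
     at-w = ≤-antisym (up (adj w v) refl) (down (adj w v) refl)
      where
      up : ∀ b → adj w v ≡ b → ∑ Vs (λ u → bit (u is w ∧ adj v u)) ≤ bit (adj w v)
      up true e rewrite e = count≤cover (λ u → u is w ∧ adj v u) {ys = w ∷ []} Vs! (λ _ k → here (is⇒ (∧ˡ k)))
      up false e rewrite e = count≤cover (λ u → u is w ∧ adj v u) {ys = []} Vs!
       (λ {u} _ k → ⊥-elim (true≢false (subst (v ~_) (is⇒ (∧ˡ k)) (∧ʳ {u is w} k)) (≁-sym e)))
      down : ∀ b → adj w v ≡ b → bit (adj w v) ≤ ∑ Vs (λ u → bit (u is w ∧ adj v u))
      down false e rewrite e = z≤n
      down true e rewrite e = length≤count (λ u → u is w ∧ adj v u) {w ∷ []} ([] ∷ []) λ { #0 → ∈V , ∧-true (is-refl w) (~-sym e) }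
     part : ∀ u → bit (adj v u) ≡ bit (X.Q u ∧ adj v u) + (bit (N4 u ∧ adj v u) + (bit (u is w ∧ adj v u) + bit (adj v u ∧ not (heavy u))))
     part u = go (adj v u) (heavy u) (five u) (X.NQ u) refl refl refl refl
      where
      is-w : u ≢ w → u is w ≡ false
      is-w k with u ≟ w
      ... | yes e = ⊥-elim (k e)
      ... | no _  = refl
      is-w-true : u ≡ w → u is w ≡ true
      is-w-true k = trans (cong (_is w) k) (is-refl w)
      not-Q : five u ≡ false → X.Q u ≡ false
      not-Q e rewrite e = refl
      go : ∀ a b c d → adj v u ≡ a → heavy u ≡ b → five u ≡ c → X.NQ u ≡ d →
       bit a ≡ bit (X.Q u ∧ a) + (bit ((d ∧ b) ∧ a) + (bit (u is w ∧ a) + bit (a ∧ not b)))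
      go false b c d _ _ _ _ = sym (trans (cong₂ _+_ (none (X.Q u)) (cong₂ _+_ (none (d ∧ b)) (cong₂ _+_ (none (u is w)) refl))) refl)
       where
       none : ∀ a → bit (a ∧ false) ≡ 0
       none true  = refl
       none false = refl
      go true b true d ea eb ec ed rewrite X.stays (N4-four {v} h) (proj₁ (proj₂ (proj₂ (X.NQ⁻ {v} (∧ˡ h))))) (proj₂ (proj₂ (proj₂ (X.NQ⁻ {v} (∧ˡ h))))) (five⇒ {u} ec) ea
       | is-w (λ { refl → 4≢5 (trans (sym w-four) (five⇒ {u} ec)) }) = rest
       where
       b-true : b ≡ true
       b-true = trans (sym eb) (⇒heavy {u} (≥4 (five⇒ {u} ec)))
       d-false : d ≡ false
       d-false = trans (sym ed) (nf ec)
        where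
        nf : five u ≡ true → X.NQ u ≡ false
        nf e rewrite e = refl
       rest : 1 ≡ 1 + (bit ((d ∧ b) ∧ true) + (0 + bit (true ∧ not b)))
       rest rewrite b-true | d-false = refl
      go true false false d ea eb ec ed rewrite not-Q ec | is-w (λ { refl → <⇒≱ (s≤s (low⇒ {u} eb)) (≥4 {k = 0} w-four) }) = f d
       where
       f : ∀ d → 1 ≡ bit ((d ∧ false) ∧ true) + 1
       f true  = refl
       f false = refl
      go true true false true ea eb ec ed rewrite not-Q ec | is-w (λ { refl → true≢false ed w∉X }) = refl
      go true true false false ea eb ec ed rewrite not-Q ec | is-w-true (only-w (heavy⇒ {u} eb) (not-five tame {u} ec) ed
       (out-not-near (proj₁ (proj₂ (proj₂ (X.NQ⁻ {v} (∧ˡ h))))) (proj₂ (proj₂ (proj₂ (X.NQ⁻ {v} (∧ˡ h))))) (N4-four {v} h) (heavy⇒ {u} eb) ea (not-Q ec) ed)) = refl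

    Lₗ : List (Fin n)
    Lₗ = members (λ v → not (heavy v))

    sizes : length L₄ + length Lₗ ≡ 4
    sizes = trans (cong₂ _+_ (length-filter N4 Vs) (length-filter (λ v → not (heavy v)) Vs))
     (trans (sym (∑-+ Vs _ _)) (trans (∑-cong Vs (λ {v} _ → part v (heavy v) refl)) ν4))
     where
     part : ∀ v b → heavy v ≡ b → bit (X.NQ v ∧ heavy v) + bit (not (heavy v)) ≡ bit (X.NQ v)
     part v true  e rewrite e = trans (+-identityʳ _) (cong bit (∧-identityʳ (X.NQ v)))
     part v false e rewrite proj₁ (shared e) | e = refl

    module Triangle (two : fives-at x ≡ 2) (att : attached ≡ 2) where

     count-Q : count X.Q Vs ≤ 3
     count-Q = ≤-trans (count≤cover X.Q {ys = x ∷ filterᵇ (λ p → adj x p ∧ five p) Vs} Vs! cover)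
      (s≤s (≤-reflexive (trans (length-filter (λ p → adj x p ∧ five p) Vs) two)))
      where
      cover : ∀ {p} → p ∈ Vs → X.Q p ≡ true → p ∈ x ∷ filterᵇ (λ p → adj x p ∧ five p) Vs
      cover {p} i h with X.Q⁻ h
      ... | _ , inj₁ e = here e
      ... | dp , inj₂ xp = there (∈-filter⁺ (λ p → adj x p ∧ five p) i (∧-true xp (⇒five {p} dp)))

     count-Q≥ : 3 ≤ count X.Q Vs
     count-Q≥ = ≤-trans (s≤s (≥-reflexive (trans (length-filter (λ p → adj x p ∧ five p) Vs) two)))
      (length≤count X.Q {x ∷ filterᵇ (λ p → adj x p ∧ five p) Vs}
       (All.tabulate (λ i e → ~⇒≢ (∧ˡ (proj₂ (∈-filter⁻ (λ p → adj x p ∧ five p) {Vs} i))) e) ∷ unique-filter _ Vs!)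
       λ { #0 → ∈V , X.x∈Q ; (there {y} i) → ∈V , in-Q i })
      where
      in-Q : ∀ {p} → p ∈ filterᵇ (λ p → adj x p ∧ five p) Vs → X.Q p ≡ true
      in-Q {p} i = let e = proj₂ (∈-filter⁻ (λ p → adj x p ∧ five p) {Vs} i) in X.Q⁺ (five⇒ {p} (∧ʳ {adj x p} e)) (∧ˡ e)

     Eₕ Eₗ Λ e : ℕ
     Eₕ = ∑ L₄ X.nq
     Eₗ = ∑ Lₗ X.nq
     Λ = ∑ L₄ lows
     e = edgesIn adj L₄

     nine : Eₕ + Eₗ ≡ 9
     nine = trans (trans (cong₂ _+_ (∑-filter N4 Vs X.nq) (∑-filter _ Vs X.nq)) (sym (∑-+ Vs _ _)))
      (trans (∑-cong Vs (λ {v} _ → sym (at v))) (trans (∑-comm Vs Vs _) (trans three-each (cong (3 *_) (≤-antisym count-Q count-Q≥)))))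
      where
      three-each : ∑ Vs (λ p → ∑ Vs (λ v → bit (X.Q p) * bit (adj p v ∧ not (five v)))) ≡ 3 * count X.Q Vs
      three-each = trans (∑-cong Vs (λ {p} _ → trans (∑-* Vs (bit (X.Q p)) _) (each p (X.Q p) refl))) (∑-* Vs 3 _)
       where
       each : ∀ p b → X.Q p ≡ b → bit (X.Q p) * X.non-fives p ≡ 3 * bit (X.Q p)
       each p false h rewrite h = refl
       each p true h rewrite h = trans (+-identityʳ _) (+-cancelʳ-≡ 2 (X.non-fives p) 3
        (trans (cong (X.non-fives p +_) (sym (X.two-mates two h))) (X.non-fives-sum (proj₁ (X.Q⁻ h)))))
      at : ∀ v → ∑ Vs (λ p → bit (X.Q p) * bit (adj p v ∧ not (five v))) ≡ bit (N4 v) * X.nq v + bit (not (heavy v)) * X.nq v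
      at v = by (five v) (heavy v) refl refl
       where
       by : ∀ a b → five v ≡ a → heavy v ≡ b → ∑ Vs (λ p → bit (X.Q p) * bit (adj p v ∧ not (five v))) ≡ bit (N4 v) * X.nq v + bit (not (heavy v)) * X.nq v
       by true b h _ = trans (trans (∑-cong Vs (λ {p} _ → zero-term p)) (∑-zero Vs)) (sym (right (⇒heavy {v} (≥4 (five⇒ {v} h)))))
        where
        zero-term : ∀ p → bit (X.Q p) * bit (adj p v ∧ not (five v)) ≡ 0
        zero-term p rewrite h with adj p v
        ... | true  = *-zeroʳ (bit (X.Q p))
        ... | false = *-zeroʳ (bit (X.Q p))
        right : heavy v ≡ true → bit (N4 v) * X.nq v + bit (not (heavy v)) * X.nq v ≡ 0
        right k rewrite h | k = refl
       by false b h k = trans (∑-cong Vs (λ {p} _ → same p)) (big b k (zero-or (X.nq v)))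
        where
        same : ∀ p → bit (X.Q p) * bit (adj p v ∧ not (five v)) ≡ bit (X.Q p ∧ adj v p)
        same p rewrite h | adj-sym p v with adj v p
        ... | true  = trans (*-identityʳ _) (cong bit (sym (∧-identityʳ (X.Q p))))
        ... | false = trans (*-zeroʳ (bit (X.Q p))) (cong bit (sym (∧-zeroʳ (X.Q p))))
        big : ∀ b → heavy v ≡ b → X.nq v ≡ 0 ⊎ 1 ≤ X.nq v → X.nq v ≡ bit (N4 v) * X.nq v + bit (not (heavy v)) * X.nq v
        big _ _ (inj₁ z) = vanish (bit (N4 v)) (bit (not (heavy v))) z
         where
         vanish : ∀ {k} i j → k ≡ 0 → k ≡ i * k + j * k
         vanish i j refl = sym (cong₂ _+_ (*-zeroʳ i) (*-zeroʳ j))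
        big b k (inj₂ p) = rest b k (∧-true (cong not h) (positive p))
         where
         rest : ∀ b → heavy v ≡ b → X.NQ v ≡ true → X.nq v ≡ bit (N4 v) * X.nq v + bit (not (heavy v)) * X.nq v
         rest true  k nqv = sym (trans (cong₂ (λ i j → bit i * X.nq v + bit (not j) * X.nq v) (∧-true nqv k) k) (trans (+-identityʳ _) (+-identityʳ _)))
         rest false k nqv = sym (trans (cong₂ (λ i j → bit i * X.nq v + bit (not j) * X.nq v) (trans (cong (X.NQ v ∧_) k) (∧-zeroʳ (X.NQ v))) k) (+-identityʳ _))

     degrees : 4 * length L₄ ≡ Eₕ + (2 * e + (2 + Λ))
     degrees = trans (sym (∑-const L₄ 4)) (trans (∑-cong L₄ (λ i → degree-parts (members⁻ {N4} i)))
      (trans (∑-+ L₄ _ _) (cong (Eₕ +_) (trans (∑-+ L₄ _ _) (cong₂ _+_ (∑-degrees P L₄)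
       (trans (∑-+ L₄ _ _) (cong (_+ Λ) (trans (count-filter N4 (adj w) Vs) att))))))))

     heavy-bound : Eₕ + 2 ≤ 3 * length L₄
     heavy-bound = ≤-trans (≤-reflexive (trans (cong (Eₕ +_) (sym (trans (count-filter N4 (adj w) Vs) att))) (sym (∑-+ L₄ _ _))))
      (≤-trans (∑-mono L₄ (λ i → at (members⁻ {N4} i))) (≤-reflexive (∑-const L₄ 3)))
      where
      at : ∀ {v} → N4 v ≡ true → X.nq v + bit (adj w v) ≤ 3
      at {v} h = by (adj w v) refl
       where
       by : ∀ b → adj w v ≡ b → X.nq v + bit (adj w v) ≤ 3
       by false k rewrite k = ≤-trans (≤-reflexive (+-identityʳ _)) (≤-trans (count-mono Vs (λ _ → ∧ˡ)) count-Q)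
       by true k = step (companion h (~-sym k))
        where
        step : ∃[ b ] v ~ b × w ~ b × N4 b ≡ true → X.nq v + bit (adj w v) ≤ 3
        step (b , vb , wb , b∈) rewrite k = +-cancelʳ-≤ 1 _ 3 (≤-trans (≤-reflexive (+-assoc (X.nq v) 1 1))
         (≤-trans (+-monoʳ-≤ (X.nq v) (+-mono-≤ {1} {count (adj v) L₄} (≤-trans (≤-reflexive (cong bit (sym vb))) (term≤∑ (λ u → bit (adj v u)) (∈members {N4} b∈)))
          (≤-trans (≤-reflexive (cong bit (sym k))) (m≤m+n (bit (adj w v)) (lows v))))) (≥-reflexive (degree-parts h))))

     low-bound : Eₗ + Λ ≤ 2 * length Lₗ
     low-bound = ≤-trans (≤-reflexive (trans (cong (Eₗ +_) swap) (sym (∑-+ Lₗ _ _))))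
      (≤-trans (∑-mono Lₗ (λ i → at (members⁻ {λ v → not (heavy v)} i))) (≤-reflexive (∑-const Lₗ 2)))
      where
      swap : Λ ≡ ∑ Lₗ (λ u → count (λ v → N4 v ∧ adj u v) Vs)
      swap = trans (∑-filter N4 Vs lows) (trans (∑-cong Vs (λ {v} _ → sym (∑-* Vs (bit (N4 v)) _)))
       (trans (∑-comm Vs Vs _) (trans (∑-cong Vs (λ {u} _ → trans (∑-cong Vs (λ {v} _ → term v u)) (∑-* Vs (bit (not (heavy u))) _)))
        (sym (∑-filter (λ v → not (heavy v)) Vs _)))))
       where
       term : ∀ v u → bit (N4 v) * bit (adj v u ∧ not (heavy u)) ≡ bit (not (heavy u)) * bit (N4 v ∧ adj u v)
       term v u rewrite adj-sym v u with adj u v | heavy u | N4 v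
       ... | true  | true  | true  = refl
       ... | true  | true  | false = refl
       ... | true  | false | true  = refl
       ... | true  | false | false = refl
       ... | false | true  | true  = refl
       ... | false | true  | false = refl
       ... | false | false | true  = refl
       ... | false | false | false = refl
      at : ∀ {u} → not (heavy u) ≡ true → X.nq u + count (λ v → N4 v ∧ adj u v) Vs ≤ 2
      at {u} h = +-cancelʳ-≤ 1 _ 2 (≤-trans (+-monoʳ-≤ _ one-z) (≤-trans (≤-reflexive (trans (cong (_+ count (λ p → Z.Q p ∧ adj u p) Vs) (sym (∑-+ Vs _ _))) (sym (∑-+ Vs _ _))))
       (≤-trans (∑-mono Vs (λ {v} _ → part v)) (low⇒ {u} (not-true h)))))
       where
       one-z : 1 ≤ count (λ p → Z.Q p ∧ adj u p) Vs
       one-z = positive⁻ (∧ʳ {not (five u)} (proj₂ (shared (not-true h))))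
       part : ∀ v → (bit (X.Q v ∧ adj u v) + bit (N4 v ∧ adj u v)) + bit (Z.Q v ∧ adj u v) ≤ bit (adj u v)
       part v = go (adj u v) (X.Q v) (N4 v) (Z.Q v) refl refl refl
        where
        go : ∀ a b c d → X.Q v ≡ b → N4 v ≡ c → Z.Q v ≡ d → (bit (b ∧ a) + bit (c ∧ a)) + bit (d ∧ a) ≤ bit a
        go false b c d _ _ _ rewrite ∧-zeroʳ b | ∧-zeroʳ c | ∧-zeroʳ d = z≤n
        go true true true d eb ec ed = ⊥-elim (proj₁ (X.NQ⁻ {v} (∧ˡ ec)) (proj₁ (X.Q⁻ eb)))
        go true true false true eb ec ed = ⊥-elim (true≢false eb (disjoint ed))
        go true true false false eb ec ed = ≤-refl
        go true false true true eb ec ed = ⊥-elim (proj₁ (X.NQ⁻ {v} (∧ˡ ec)) (proj₁ (Z.Q⁻ ed)))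
        go true false true false eb ec ed = ≤-refl
        go true false false true eb ec ed = ≤-refl
        go true false false false eb ec ed = z≤n

     not-odd : ∀ k → 2 * k ≢ 5 × 2 * k ≢ 3
     not-odd zero = (λ ()) , (λ ())
     not-odd (suc zero) = (λ ()) , (λ ())
     not-odd (suc (suc zero)) = (λ ()) , (λ ())
     not-odd (suc (suc (suc k))) = (λ h → <⇒≱ {5} (*-monoʳ-≤ 2 {3} (s≤s (s≤s (s≤s z≤n)))) (≤-reflexive h))
      , (λ h → <⇒≱ {3} (≤-trans (s≤s (s≤s (s≤s (s≤s z≤n)))) (*-monoʳ-≤ 2 {3} {3 + k} (s≤s (s≤s (s≤s z≤n))))) (≤-reflexive h))

     impossible : ⊥
     impossible = cases (length Lₗ) refl
      where
      ρ : ℕ → List ℕ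
      ρ l = length L₄ ∷ l ∷ Eₕ ∷ Eₗ ∷ Λ ∷ e ∷ []
      cases : ∀ l → length Lₗ ≡ l → ⊥
      cases zero h = proj₁ (not-odd e) (≤-antisym
       (≮⇒≥ λ g → refute (ρ 0) (1 ×[ lit 6 ≤ 2 ⊛ var 5 ] ∷ 1 ×[ lit 9 ≤ var 2 ⊕ var 3 ] ∷ 1 ×[ var 2 ⊕ (2 ⊛ var 5 ⊕ (lit 2 ⊕ var 4)) ≤ 4 ⊛ var 0 ]
         ∷ 4 ×[ var 0 ≤ lit 4 ] ∷ 1 ×[ var 3 ⊕ var 4 ≤ lit 0 ] ∷ [])
        (g ∷ ≥-reflexive nine ∷ ≥-reflexive degrees ∷ ≤-reflexive L4 ∷ low0 ∷ []) refl)
       (≮⇒≥ λ g → refute (ρ 0) (1 ×[ lit 1 ⊕ 2 ⊛ var 5 ≤ lit 5 ] ∷ 1 ×[ var 2 ⊕ var 3 ≤ lit 9 ] ∷ 1 ×[ 4 ⊛ var 0 ≤ var 2 ⊕ (2 ⊛ var 5 ⊕ (lit 2 ⊕ var 4)) ]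
         ∷ 4 ×[ lit 4 ≤ var 0 ] ∷ 1 ×[ var 3 ⊕ var 4 ≤ lit 0 ] ∷ [])
        (g ∷ ≤-reflexive nine ∷ ≤-reflexive degrees ∷ ≥-reflexive L4 ∷ low0 ∷ []) refl))
       where
       L4 : length L₄ ≡ 4
       L4 = trans (sym (+-identityʳ _)) (trans (cong (length L₄ +_) (sym h)) sizes)
       low0 : Eₗ + Λ ≤ 0
       low0 = ≤-trans low-bound (≤-reflexive (cong (2 *_) h))
      cases (suc zero) h = proj₂ (not-odd e) (≤-antisym
       (≮⇒≥ λ g → refute (ρ 1) (1 ×[ lit 4 ≤ 2 ⊛ var 5 ] ∷ 1 ×[ lit 9 ≤ var 2 ⊕ var 3 ] ∷ 1 ×[ var 2 ⊕ (2 ⊛ var 5 ⊕ (lit 2 ⊕ var 4)) ≤ 4 ⊛ var 0 ]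
         ∷ 4 ×[ var 0 ≤ lit 3 ] ∷ 1 ×[ var 3 ⊕ var 4 ≤ lit 2 ] ∷ [])
        (g ∷ ≥-reflexive nine ∷ ≥-reflexive degrees ∷ ≤-reflexive L3 ∷ low2 ∷ []) refl)
       (≮⇒≥ λ g → refute (ρ 1) (1 ×[ lit 1 ⊕ 2 ⊛ var 5 ≤ lit 3 ] ∷ 1 ×[ 4 ⊛ var 0 ≤ var 2 ⊕ (2 ⊛ var 5 ⊕ (lit 2 ⊕ var 4)) ]
         ∷ 2 ×[ var 2 ⊕ lit 2 ≤ 3 ⊛ var 0 ] ∷ 2 ×[ var 0 ≤ lit 3 ] ∷ 1 ×[ var 3 ⊕ var 4 ≤ lit 2 ] ∷ 1 ×[ lit 9 ≤ var 2 ⊕ var 3 ] ∷ [])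
        (g ∷ ≤-reflexive degrees ∷ heavy-bound ∷ ≤-reflexive L3 ∷ low2 ∷ ≥-reflexive nine ∷ []) refl))
       where
       L3 : length L₄ ≡ 3
       L3 = +-cancelʳ-≡ 1 _ 3 (trans (cong (length L₄ +_) (sym h)) sizes)
       low2 : Eₗ + Λ ≤ 2
       low2 = ≤-trans low-bound (≤-reflexive (cong (2 *_) h))
      cases (suc (suc l)) h = refute (ρ (length Lₗ))
       (1 ×[ lit 9 ≤ var 2 ⊕ var 3 ] ∷ 1 ×[ var 2 ⊕ lit 2 ≤ 3 ⊛ var 0 ] ∷ 1 ×[ var 3 ⊕ var 4 ≤ 2 ⊛ var 1 ] ∷ 3 ×[ var 0 ⊕ var 1 ≤ lit 4 ] ∷ 1 ×[ lit 2 ≤ var 1 ] ∷ [])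
       (≥-reflexive nine ∷ heavy-bound ∷ low-bound ∷ ≤-reflexive sizes ∷ ≤-trans (s≤s (s≤s z≤n)) (≥-reflexive h) ∷ []) refl

    module Couple (one : fives-at x ≡ 1) where
     private
      found : ∃[ p ] (p ∈ Vs) × adj x p ∧ five p ≡ true
      found = count-pos (λ p → adj x p ∧ five p) Vs (≥-reflexive one)

     p : Fin n
     p = proj₁ found
     xp : x ~ p
     xp = ∧ˡ (proj₂ (proj₂ found))
     dp : deg p ≡ 5
     dp = five⇒ {p} (∧ʳ {adj x p} (proj₂ (proj₂ found)))
     qp : X.Q p ≡ true
     qp = X.Q⁺ dp xp

     only : ∀ {v} → X.Q v ≡ true → v ∈ x ∷ p ∷ []
     only {v} h with X.Q⁻ h
     ... | _ , inj₁ e = here e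
     ... | dv , inj₂ xv = there (exhaustive _≟_ (λ p → adj x p ∧ five p) {p ∷ []} ([] ∷ [])
      (λ { #0 → ∈V , proj₂ (proj₂ found) }) (≤-reflexive one) ∈V (∧-true xv (⇒five {v} dv)))

     adjacent : ∀ {s v} → deg s ≡ 5 → X.Q s ≡ true → fives-at s ≤ 1 → X.NQ v ≡ true → s ~ v
     adjacent {s} ds qs le h = ∧ˡ (proj₂ (∈-filter⁻ (λ v → adj s v ∧ not (five v)) {Vs}
      (exhaustive _≟_ X.NQ (unique-filter _ Vs!) (λ i → ∈V , X.non-five-near qs (proj₂ (∈-filter⁻ (λ v → adj s v ∧ not (five v)) {Vs} i)))
       (≤-trans (≤-reflexive ν4) (≤-trans (+-cancelʳ-≤ 1 4 _ (≤-trans (≥-reflexive (X.non-fives-sum ds)) (+-monoʳ-≤ (X.non-fives s) le)))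
        (≥-reflexive (length-filter (λ v → adj s v ∧ not (five v)) Vs)))) ∈V h)))

     x~ : ∀ {v} → X.NQ v ≡ true → x ~ v
     x~ = adjacent dx X.x∈Q (≤-reflexive one)

     p~ : ∀ {v} → X.NQ v ≡ true → p ~ v
     p~ = adjacent dp qp (count≤cover (λ v → adj p v ∧ five v) {ys = x ∷ []} Vs! λ {v} _ e →
      not-p (~⇒≢ (∧ˡ e)) (only (X.Q-step qp (five⇒ {v} (∧ʳ {adj p v} e)) (∧ˡ e))))
      where
      not-p : ∀ {v} → p ≢ v → v ∈ x ∷ p ∷ [] → v ∈ x ∷ []
      not-p h (here e) = here e
      not-p h (there (here e)) = ⊥-elim (h (sym e))

     -- The vertices outside N[w] would have to be joined among themselves.
     impossible : attached ≡ 2 → (∀ v → heavy v ≡ true) → ⊥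
     impossible att all-heavy = start (count-pos unattached Vs (≤-trans (s≤s z≤n) (≥-reflexive two)))
      where
      unattached : Fin n → Bool
      unattached v = N4 v ∧ not (adj w v)
      two : count unattached Vs ≡ 2
      two = +-cancelˡ-≡ 2 _ 2 (trans (cong (_+ count unattached Vs) (sym att)) (trans (sym (∑-+ Vs _ _))
       (trans (∑-cong Vs (λ {v} _ → part v)) ν4)))
       where
       part : ∀ v → bit (N4 v ∧ adj w v) + bit (N4 v ∧ not (adj w v)) ≡ bit (X.NQ v)
       part v rewrite all-heavy v | ∧-identityʳ (X.NQ v) with X.NQ v | adj w v
       ... | true  | true  = refl
       ... | true  | false = refl
       ... | false | _     = refl
      no-lows : ∀ v → lows v ≡ 0
      no-lows v = trans (∑-cong Vs (λ {u} _ → cong bit (trans (cong (λ b → adj v u ∧ not b) (all-heavy u)) (∧-zeroʳ (adj v u))))) (∑-zero Vs)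
      Near : Fin n → Fin n → Set
      Near c g = (g ∈ L₄) × c ~ g
      start : ∃[ c ] (c ∈ Vs) × unattached c ≡ true → ⊥
      start (c , _ , hc) = finish (pick₂ (adj c) (members! N4) two-near)
       where
       c∈ : N4 c ≡ true
       c∈ = ∧ˡ hc
       w≁c : adj w c ≡ false
       w≁c = not-true (∧ʳ {N4 c} hc)
       few : X.nq c ≤ 2
       few = ≤-trans (count≤cover (λ v → X.Q v ∧ adj c v) {ys = x ∷ p ∷ []} Vs! (λ _ e → only (∧ˡ e))) ≤-refl
       two-near : 2 ≤ count (adj c) L₄
       two-near = ≮⇒≥ λ l → refute (X.nq c ∷ count (adj c) L₄ ∷ bit (adj w c) ∷ lows c ∷ [])
        (1 ×[ lit 1 ⊕ var 1 ≤ lit 2 ] ∷ 1 ×[ var 0 ≤ lit 2 ] ∷ 1 ×[ lit 4 ≤ var 0 ⊕ (var 1 ⊕ (var 2 ⊕ var 3)) ] ∷ 1 ×[ var 2 ≤ lit 0 ] ∷ 1 ×[ var 3 ≤ lit 0 ] ∷ [])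
        (l ∷ few ∷ ≤-reflexive (degree-parts c∈) ∷ ≤-reflexive (cong bit w≁c) ∷ ≤-reflexive (no-lows c) ∷ []) refl
       away : ∀ {g} → Near c g → unattached g ≡ true
       away {g} (i , cg) = ∧-true g∈ (cong not (≁ λ wg → crowd wg (companion g∈ (~-sym wg))))
        where
        g∈ : N4 g ≡ true
        g∈ = members⁻ {N4} i
        dg : deg g ≡ 4
        dg = N4-four {g} g∈
        crowd : w ~ g → ∃[ b ] g ~ b × w ~ b × N4 b ≡ true → ⊥
        crowd wg (b , gb , wb , b∈) = too-many {g} {x ∷ p ∷ w ∷ b ∷ c ∷ []}
         ((~⇒≢ xp ∷ ≢-five dx w-four ∷ ≢-five dx (N4-four {b} b∈) ∷ ≢-five dx (N4-four {c} c∈) ∷ [])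
          ∷ (≢-five dp w-four ∷ ≢-five dp (N4-four {b} b∈) ∷ ≢-five dp (N4-four {c} c∈) ∷ [])
          ∷ (~⇒≢ wb ∷ (λ { refl → true≢false (∧ˡ c∈) w∉X }) ∷ []) ∷ ((λ { refl → true≢false wb w≁c }) ∷ []) ∷ [] ∷ [])
         (~-sym (x~ (∧ˡ g∈)) ∷ ~-sym (p~ (∧ˡ g∈)) ∷ ~-sym wg ∷ gb ∷ ~-sym cg ∷ []) (≤-reflexive (cong suc dg))
         where
         ≢-five : ∀ {a b} → deg a ≡ 5 → deg b ≡ 4 → a ≢ b
         ≢-five h k refl = 4≢5 (trans (sym k) h)
       finish : Two (Near c) → ⊥
       finish (g , h , gh , ng , nh) = <⇒≱ {2} (length≤count unattached {c ∷ g ∷ h ∷ []}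
        ((~⇒≢ (proj₂ ng) ∷ ~⇒≢ (proj₂ nh) ∷ []) ∷ (gh ∷ []) ∷ [] ∷ [])
        λ { #0 → ∈V , hc ; #1 → ∈V , away ng ; #2 → ∈V , away nh }) (≤-reflexive two)

  -- Two cliques have at least eight neighbours outside, and the vertex w leading out of the first is a ninth.
  two-cliques : ∀ {x z} (dx : deg x ≡ 5) (dz : deg z ≡ 5) → Clique.Q tame dx z ≡ false → ∑ Vs weight ≤ 9 → ⊥
  two-cliques {x} {z} dx dz z∉ budget = final (zero-or (fives-at x)) (zero-or (fives-at z))
   where
   x∉ : Clique.Q tame dz x ≡ false
   x∉ = by (Clique.Q tame dz x) refl
    where
    by : ∀ b → Clique.Q tame dz x ≡ b → Clique.Q tame dz x ≡ false
    by false e = e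
    by true e with Clique.Q⁻ tame dz e
    ... | _ , inj₁ refl = ⊥-elim (true≢false (Clique.x∈Q tame dx) z∉)
    ... | _ , inj₂ zx = ⊥-elim (true≢false (Clique.Q⁺ tame dx dz (~-sym zx)) z∉)
   module A = Half dx dz z∉ x∉
   module B = Half dz dx x∉ z∉
   module E = Clique.Way-out A.exit
   w : Fin n
   w = E.w
   w∉B : B.X.NQ w ≡ false
   w∉B = A.out-not-near E.qp E.yp E.dy E.dw E.yw E.w∉Q E.w∉NQ
   value : Fin n → ℕ
   value v = bit (A.X.NQ v) + (bit (B.X.NQ v) + bit (v is w))
   is-w : ∀ {v} → v ≢ w → v is w ≡ false
   is-w {v} k with v ≟ w
   ... | yes e = ⊥-elim (k e)
   ... | no _  = refl
   weight≥1 : ∀ {v} → deg v ≢ 5 → 1 ≤ weight v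
   weight≥1 {v} h = by (five v) refl
    where
    by : ∀ b → five v ≡ b → 1 ≤ weight v
    by true e = ⊥-elim (h (five⇒ {v} e))
    by false e = ≤-trans (≤-reflexive (cong (λ b → bit (not b)) (sym e))) (m≤m+n _ _)
   low-weight : ∀ {v} → heavy v ≡ false → weight v ≡ 2
   low-weight {v} h = cong₂ (λ a b → bit (not a) + bit (not b)) (nf (five v) refl) h
    where
    nf : ∀ b → five v ≡ b → five v ≡ false
    nf false e = e
    nf true e = ⊥-elim (<⇒≱ (s≤s (low⇒ {v} h)) (≥4 {k = 1} (five⇒ {v} e)))
   value≤ : ∀ v → value v ≤ weight v
   value≤ v = by (v ≟ w) (A.X.NQ v) (B.X.NQ v) refl refl
    where
    by : Dec (v ≡ w) → ∀ a b → A.X.NQ v ≡ a → B.X.NQ v ≡ b → value v ≤ weight v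
    by (yes refl) _ _ _ _ = ≤-trans (≤-reflexive (cong₂ (λ a b → bit a + b) E.w∉NQ (cong₂ (λ a b → bit a + bit b) w∉B (is-refl w)))) (weight≥1 {w} (λ d → 4≢5 (trans (sym E.w-four) d)))
    by (no k) true true ea eb = ≤-trans (≤-reflexive (cong₂ (λ a b → bit a + b) ea (cong₂ (λ a b → bit a + bit b) eb (is-w k))))
     (≥-reflexive (low-weight {v} (is-low (heavy v) refl)))
     where
     is-low : ∀ b → heavy v ≡ b → heavy v ≡ false
     is-low false e = e
     is-low true e = ⊥-elim (A.not-both (heavy⇒ {v} e) ea eb)
    by (no k) true false ea eb = ≤-trans (≤-reflexive (cong₂ (λ a b → bit a + b) ea (cong₂ (λ a b → bit a + bit b) eb (is-w k)))) (weight≥1 {v} (proj₁ (A.X.NQ⁻ {v} ea)))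
    by (no k) false true ea eb = ≤-trans (≤-reflexive (cong₂ (λ a b → bit a + b) ea (cong₂ (λ a b → bit a + bit b) eb (is-w k)))) (weight≥1 {v} (proj₁ (B.X.NQ⁻ {v} eb)))
    by (no k) false false ea eb = ≤-trans (≤-reflexive (cong₂ (λ a b → bit a + b) ea (cong₂ (λ a b → bit a + bit b) eb (is-w k)))) z≤n
   total : ∑ Vs value ≡ A.X.ν + (B.X.ν + 1)
   total = trans (∑-+ Vs _ _) (cong (A.X.ν +_) (trans (∑-+ Vs _ _) (cong (B.X.ν +_) (count-is w))))
   sum≤9 : A.X.ν + (B.X.ν + 1) ≤ 9
   sum≤9 = ≤-trans (≥-reflexive total) (≤-trans (∑-mono Vs (λ {v} _ → value≤ v)) budget)
   νA : A.X.ν ≡ 4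
   νA = ≤-antisym (+-cancelʳ-≤ 5 _ 4 (≤-trans (+-monoʳ-≤ A.X.ν (+-monoˡ-≤ 1 B.X.ν≥4)) sum≤9)) A.X.ν≥4
   νB : B.X.ν ≡ 4
   νB = ≤-antisym (+-cancelʳ-≤ 1 _ 4 (+-cancelˡ-≤ 4 _ 5 (≤-trans (+-monoˡ-≤ (B.X.ν + 1) A.X.ν≥4) sum≤9))) B.X.ν≥4
   tight : ∀ v → weight v ≤ value v
   tight v = ≮⇒≥ λ l → <⇒≱ (≤-trans (s≤s (≥-reflexive (trans total (cong₂ (λ a b → a + (b + 1)) νA νB))))
    (≤-trans (∑-strict Vs (λ {v} _ → value≤ v) (∈V {v}) l) budget)) ≤-refl
   sharedA : ∀ {v} → heavy v ≡ false → A.X.NQ v ≡ true × B.X.NQ v ≡ true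
   sharedA {v} h = by (A.X.NQ v) (B.X.NQ v) refl refl (≤-trans (≥-reflexive (low-weight {v} h)) (tight v))
    where
    v≢w : v ≢ w
    v≢w refl = <⇒≱ (s≤s (low⇒ {v} h)) E.dw
    by : ∀ a b → A.X.NQ v ≡ a → B.X.NQ v ≡ b → 2 ≤ value v → A.X.NQ v ≡ true × B.X.NQ v ≡ true
    by true true ea eb _ = ea , eb
    by true false ea eb l = ⊥-elim (<⇒≱ l (≤-reflexive (cong₂ (λ a b → bit a + b) ea (cong₂ (λ a b → bit a + bit b) eb (is-w v≢w)))))
    by false true ea eb l = ⊥-elim (<⇒≱ l (≤-reflexive (cong₂ (λ a b → bit a + b) ea (cong₂ (λ a b → bit a + bit b) eb (is-w v≢w)))))
    by false false ea eb l = ⊥-elim (<⇒≱ (≤-trans (s≤s z≤n) l) (≤-reflexive (cong₂ (λ a b → bit a + b) ea (cong₂ (λ a b → bit a + bit b) eb (is-w v≢w)))))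
   onlyA : ∀ {v} → 4 ≤ deg v → deg v ≢ 5 → A.X.NQ v ≡ false → B.X.NQ v ≡ false → v ≡ w
   onlyA {v} _ d ea eb = by (v ≟ w)
    where
    by : Dec (v ≡ w) → v ≡ w
    by (yes e) = e
    by (no k) = ⊥-elim (<⇒≱ (≤-trans (weight≥1 {v} d) (tight v)) (≤-reflexive (cong₂ (λ a b → bit a + b) ea (cong₂ (λ a b → bit a + bit b) eb (is-w k)))))
   module TA = A.Tight E.w-four E.w∉NQ νA sharedA onlyA
   module TB = B.Tight E.w-four w∉B νB (λ h → proj₂ (sharedA h) , proj₁ (sharedA h)) (λ a b c d → onlyA a b d c)
   sum-attached : TA.attached + TB.attached ≤ 4
   sum-attached = ≤-trans (≥-reflexive (∑-+ Vs _ _)) (≤-trans (∑-mono Vs (λ {v} _ → part v)) (≤-reflexive E.w-four))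
    where
    part : ∀ v → bit (A.N4 v ∧ adj w v) + bit (B.N4 v ∧ adj w v) ≤ bit (adj w v)
    part v = by (A.N4 v) (B.N4 v) (adj w v) refl refl
     where
     by : ∀ a b c → A.N4 v ≡ a → B.N4 v ≡ b → bit (a ∧ c) + bit (b ∧ c) ≤ bit c
     by true true c ea eb = ⊥-elim (A.not-both (heavy⇒ {v} (∧ʳ {A.X.NQ v} ea)) (∧ˡ ea) (∧ˡ eb))
     by true false true ea eb = ≤-refl
     by true false false ea eb = z≤n
     by false b c ea eb = bit∧ b c
      where
      bit∧ : ∀ b c → bit (b ∧ c) ≤ bit c
      bit∧ true  c = ≤-refl
      bit∧ false c = z≤n
   attA : TA.attached ≡ 2
   attA = ≤-antisym (+-cancelʳ-≤ 2 _ 2 (≤-trans (+-monoʳ-≤ TA.attached TB.attached≥2) sum-attached)) TA.attached≥2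
   attB : TB.attached ≡ 2
   attB = ≤-antisym (+-cancelˡ-≤ 2 _ 2 (≤-trans (+-monoˡ-≤ TB.attached TA.attached≥2) sum-attached)) TB.attached≥2
   one-or-two : ∀ {k} → 1 ≤ k → k ≤ 2 → k ≡ 1 ⊎ k ≡ 2
   one-or-two {1} _ _ = inj₁ refl
   one-or-two {2} _ _ = inj₂ refl
   one-or-two {suc (suc (suc k))} _ (s≤s (s≤s ()))
   alone : ∀ {x} (dx : deg x ≡ 5) → Clique.ν tame dx ≡ 4 → fives-at x ≡ 0 → ⊥
   alone {x} dx e z = <⇒≱ (≤-trans (≥-reflexive (trans (sym (+-identityʳ _)) (trans (cong (Clique.non-fives tame dx x +_) (sym z)) (Clique.non-fives-sum tame dx dx))))
    (Clique.ν≥ tame dx)) (≤-reflexive e)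
   final : fives-at x ≡ 0 ⊎ 1 ≤ fives-at x → fives-at z ≡ 0 ⊎ 1 ≤ fives-at z → ⊥
   final (inj₁ h) _ = alone dx νA h
   final _ (inj₁ h) = alone dz νB h
   final (inj₂ h) (inj₂ k) = cases (one-or-two h (small-cliques dx)) (one-or-two k (small-cliques dz))
    where
    cases : fives-at x ≡ 1 ⊎ fives-at x ≡ 2 → fives-at z ≡ 1 ⊎ fives-at z ≡ 2 → ⊥
    cases (inj₂ h) _ = TA.Triangle.impossible h attA
    cases _ (inj₂ k) = TB.Triangle.impossible k attB
    cases (inj₁ h) (inj₁ k) = TA.Couple.impossible h attA all-heavy
     where
     module CA = TA.Couple h
     module CB = TB.Couple k
     all-heavy : ∀ v → heavy v ≡ true
     all-heavy v = by-contradiction λ e → let a , b = sharedA {v} e in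
      too-many {v} {x ∷ CA.p ∷ z ∷ CB.p ∷ []}
       ((~⇒≢ CA.xp ∷ apart A.X.x∈Q B.X.x∈Q ∷ apart A.X.x∈Q CB.qp ∷ []) ∷ (apart CA.qp B.X.x∈Q ∷ apart CA.qp CB.qp ∷ []) ∷ (~⇒≢ CB.xp ∷ []) ∷ [] ∷ [])
       (~-sym (CA.x~ a) ∷ ~-sym (CA.p~ a) ∷ ~-sym (CB.x~ b) ∷ ~-sym (CB.p~ b) ∷ []) (s≤s (low⇒ {v} e))
      where
      apart : ∀ {a b} → A.X.Q a ≡ true → B.X.Q b ≡ true → a ≢ b
      apart h k refl = true≢false h (A.disjoint k)

module ThreeAround {n} (G : Graph (Fin n)) (D : Drawing G) (free : S 3 3 Free G) where
 open import Data.Fin.Properties using (_≟_)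
 open import Data.Vec.Relation.Unary.All using ([]; _∷_)
 open import Data.Vec.Relation.Unary.AllPairs using ([]; _∷_)
 open ClawCounting (_≟_ {n}) using (K₃₃-subdivided-free)
 open ThreePair G D free public

 module Away {x} (dx : deg x ≡ 5) (fives-near : ∀ {v} → deg v ≡ 5 → v ≡ x ⊎ x ~ v) (≤5 : ∀ v → deg v ≤ 5)
  (low-inside : ∀ {y v} → x ~ y → deg y ≤ 3 → y ~ v → v ≡ x ⊎ x ~ v) where

  Z : Fin n → Bool
  Z v = not (v is x) ∧ not (adj x v)

  Z⁻ : ∀ {v} → Z v ≡ true → v ≢ x × adj x v ≡ false
  Z⁻ {v} h = (λ { refl → true≢false (is-refl x) (not-true (∧ˡ h)) }) , not-true (∧ʳ {not (v is x)} h)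

  ζ : ℕ
  ζ = count Z Vs

  ζ+6 : ζ + 6 ≡ n
  ζ+6 = trans (cong₂ _+_ refl (sym (cong₂ _+_ (count-is x) dx))) (trans (cong (ζ +_) (sym (∑-+ Vs _ _))) (trans (sym (∑-+ Vs _ _))
   (trans (∑-cong Vs (λ {v} _ → part v)) (trans (∑-one Vs) |V|))))
   where
   part : ∀ v → bit (Z v) + (bit (v is x) + bit (adj x v)) ≡ 1
   part v with v ≟ x
   ... | yes refl rewrite adj-irrefl x = refl
   ... | no _ with adj x v
   ...   | true  = refl
   ...   | false = refl

  Zs : List (Fin n)
  Zs = members Z

  out : Fin n → ℕ
  out v = count (adj v) Zs

  out-common : ∀ {w} → Z w ≡ true → deg w ≡ common x w + out w
  out-common {w} zw = trans (∑-cong Vs (λ {v} _ → part v)) (trans (∑-+ Vs _ _) (cong (common x w +_) (sym (count-filter Z (adj w) Vs))))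
   where
   part : ∀ v → bit (adj w v) ≡ bit (adj x v ∧ adj w v) + bit (Z v ∧ adj w v)
   part v with v ≟ x
   ... | yes refl rewrite adj-irrefl x | ≁-sym (proj₂ (Z⁻ {w} zw)) = refl
   ... | no _ with adj x v
   ...   | true  = sym (+-identityʳ _)
   ...   | false = refl

  one-out : ∀ {y} → x ~ y → out y ≤ 1
  one-out {y} xy = ≮⇒≥ λ h → go (pick₂ (adj y) (members! Z) h)
   where
   Out : Fin n → Set
   Out v = (v ∈ Zs) × y ~ v
   go : Two Out → ⊥
   go (a , b , ab , (i , ya) , (j , yb)) = by (Z⁻ {a} (members⁻ {Z} i)) (Z⁻ {b} (members⁻ {Z} j)) (4 ≤? deg y)
    where
    by : a ≢ x × adj x a ≡ false → b ≢ x × adj x b ≡ false → Dec (4 ≤ deg y) → ⊥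
    by (ax , xa) (bx , xb) (yes dy) = true≢false (joins₅ dx dy xy ya xa ax yb bx (ab ∘ sym)) xb
    by (ax , xa) _ (no dy) with low-inside xy (≮⇒≥ dy) ya
    ... | inj₁ e = ax e
    ... | inj₂ e = true≢false e xa

  same-out : ∀ {y a b} → x ~ y → Z a ≡ true → Z b ≡ true → y ~ a → y ~ b → a ≡ b
  same-out {y} {a} {b} xy za zb ya yb = by (a ≟ b)
   where
   by : Dec (a ≡ b) → a ≡ b
   by (yes e) = e
   by (no ab) = ⊥-elim (<⇒≱ {1} (length≤count (adj y) {a ∷ b ∷ []} ((ab ∷ []) ∷ [] ∷ [])
    λ { #0 → ∈members {Z} za , ya ; #1 → ∈members {Z} zb , yb }) (one-out xy))

  few-common : ∑ Zs (common x) ≤ 5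
  few-common = ≤-trans (≤-reflexive (∑-comm Zs Vs (λ w y → bit (adj x y ∧ adj w y))))
   (≤-trans (∑-mono Vs λ {y} _ → at y (adj x y) refl) (≤-reflexive dx))
   where
   at : ∀ y b → adj x y ≡ b → ∑ Zs (λ w → bit (adj x y ∧ adj w y)) ≤ bit (adj x y)
   at y false e rewrite e = ≤-reflexive (∑-zero Zs)
   at y true  e rewrite e = ≤-trans (≤-reflexive (∑-cong Zs λ {w} _ → cong bit (adj-sym w y))) (one-out e)

  Z-four : ∀ {w} → Z w ≡ true → heavy w ≡ true → deg w ≡ 4
  Z-four {w} zw hw = ≤-antisym (s≤s⁻¹ (≤∧≢⇒< (≤5 w) λ d → by (fives-near d) (Z⁻ {w} zw))) (heavy⇒ {w} hw)
   where
   by : w ≡ x ⊎ x ~ w → w ≢ x × adj x w ≡ false → ⊥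
   by (inj₁ e) (k , _) = k e
   by (inj₂ e) (_ , k) = true≢false e k

  attached : Fin n → Bool
  attached w = 0 <ᵇ common x w

  attached-twice : ∀ {w} → Z w ≡ true → heavy w ≡ true → 1 ≤ common x w → 2 ≤ common x w
  attached-twice {w} zw hw h = go (common₁ h) (Z⁻ {w} zw)
   where
   go : ∃[ y ] Common x w y → w ≢ x × adj x w ≡ false → 2 ≤ common x w
   go (y , xy , wy) (wx , xw) = by (4 ≤? deg y)
    where
    by : Dec (4 ≤ deg y) → 2 ≤ common x w
    by (no dy) with low-inside xy (≮⇒≥ dy) (~-sym wy)
    ... | inj₁ e = ⊥-elim (wx e)
    ... | inj₂ e = ⊥-elim (true≢false e xw)
    by (yes dy) = second (common₁ (+-cancelˡ-≤ 7 1 (common y w) (≤-trans (+-mono-≤ dy (≥-reflexive (Z-four {w} zw hw)))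
     (key (~-sym wy) dy (heavy⇒ {w} hw)))))
     where
     second : ∃[ a ] Common y w a → 2 ≤ common x w
     second (a , ya , wa) = length≤count (λ z → adj x z ∧ adj w z) {y ∷ a ∷ []} ((~⇒≢ ya ∷ []) ∷ [] ∷ [])
      λ { #0 → ∈V , ∧-true xy wy ; #1 → ∈V , ∧-true (joins₅ dx dy xy (~-sym wy) xw wx ya a≢x (~⇒≢ wa ∘ sym)) wa }
      where
      a≢x : a ≢ x
      a≢x refl = true≢false wa (≁-sym xw)

  out-complement : ∀ w → out w + count (λ v → not (adj w v)) Zs ≡ ζ
  out-complement w = trans (count-not (adj w) Zs) (length-filter Z Vs)

  self-missed : ∀ {w} → Z w ≡ true → 1 ≤ count (λ v → not (adj w v)) Zs
  self-missed {w} zw = length≤count (λ v → not (adj w v)) {w ∷ []} ([] ∷ []) λ { #0 → ∈members {Z} zw , cong not (adj-irrefl w) }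

  ten : n ≡ 10 → count heavy Zs ≤ 2
  ten n10 = ≮⇒≥ λ h → refute (count heavy Zs ∷ ∑ Zs (common x) ∷ []) (2 ×[ lit 3 ≤ var 0 ] ∷ 1 ×[ var 1 ≤ lit 5 ] ∷ 1 ×[ 2 ⊛ var 0 ≤ var 1 ] ∷ [])
   (h ∷ few-common ∷ ≤-trans (≥-reflexive (∑-* Zs 2 (λ w → bit (heavy w)))) (∑-mono Zs λ {w} i → at w (heavy w) refl (members⁻ {Z} i)) ∷ []) refl
   where
   at : ∀ w b → heavy w ≡ b → Z w ≡ true → 2 * bit (heavy w) ≤ common x w
   at w false e zw rewrite e = z≤n
   at w true e zw rewrite e = attached-twice zw e (≮⇒≥ λ l → refute (common x w ∷ out w ∷ count (λ v → not (adj w v)) Zs ∷ ζ ∷ deg w ∷ n ∷ [])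
    (1 ×[ lit 1 ⊕ var 0 ≤ lit 1 ] ∷ 1 ×[ lit 4 ≤ var 4 ] ∷ 1 ×[ var 4 ≤ var 0 ⊕ var 1 ] ∷ 1 ×[ var 1 ⊕ var 2 ≤ var 3 ] ∷ 1 ×[ lit 1 ≤ var 2 ]
     ∷ 1 ×[ var 3 ⊕ lit 6 ≤ var 5 ] ∷ 1 ×[ var 5 ≤ lit 10 ] ∷ [])
    (l ∷ heavy⇒ {w} e ∷ ≤-reflexive (out-common zw) ∷ ≤-reflexive (out-complement w) ∷ self-missed zw ∷ ≤-reflexive ζ+6 ∷ ≤-reflexive n10 ∷ []) refl)

  module Eleven (n11 : n ≡ 11) (h≥4 : 4 ≤ count heavy Zs) (low-three : ∀ {u} → Z u ≡ true → heavy u ≡ false → deg u ≡ 3) where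
   tied loose : Fin n → Bool
   tied w = heavy w ∧ attached w
   loose w = heavy w ∧ not (attached w)

   ζ≡5 : ζ ≡ 5
   ζ≡5 = +-cancelʳ-≡ 6 ζ 5 (trans ζ+6 n11)

   |Zs| : length Zs ≡ 5
   |Zs| = trans (length-filter Z Vs) ζ≡5

   tied+loose : count tied Zs + count loose Zs ≡ count heavy Zs
   tied+loose = trans (sym (∑-+ Zs _ _)) (∑-cong Zs λ {w} _ → e (heavy w) (attached w))
    where
    e : ∀ a b → bit (a ∧ b) + bit (a ∧ not b) ≡ bit a
    e true  true  = refl
    e true  false = refl
    e false b     = refl

   tied-twice : ∀ {w} → Z w ≡ true → tied w ≡ true → 2 ≤ common x w
   tied-twice {w} zw h = attached-twice zw (∧ˡ h) (positive⁻ (∧ʳ {heavy w} h))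

   tied≤2 : count tied Zs ≤ 2
   tied≤2 = ≮⇒≥ λ h → refute (count tied Zs ∷ ∑ Zs (common x) ∷ []) (2 ×[ lit 3 ≤ var 0 ] ∷ 1 ×[ var 1 ≤ lit 5 ] ∷ 1 ×[ 2 ⊛ var 0 ≤ var 1 ] ∷ [])
    (h ∷ few-common ∷ ≤-trans (≥-reflexive (∑-* Zs 2 (λ w → bit (tied w)))) (∑-mono Zs λ {w} i → at w (tied w) refl (members⁻ {Z} i)) ∷ []) refl
    where
    at : ∀ w b → tied w ≡ b → Z w ≡ true → 2 * bit (tied w) ≤ common x w
    at w false e zw rewrite e = z≤n
    at w true e zw = ≤-trans (≤-reflexive (cong (λ b → 2 * bit b) e)) (tied-twice zw e)

   loose-joined : ∀ {w v} → Z w ≡ true → loose w ≡ true → Z v ≡ true → v ≢ w → w ~ v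
   loose-joined {w} {v} zw lw zv vw = by-contradiction λ e → refute (common x w ∷ out w ∷ count (λ v → not (adj w v)) Zs ∷ deg w ∷ [])
    (1 ×[ lit 2 ≤ var 2 ] ∷ 1 ×[ var 1 ⊕ var 2 ≤ lit 5 ] ∷ 1 ×[ var 0 ≤ lit 0 ] ∷ 1 ×[ var 3 ≤ var 0 ⊕ var 1 ] ∷ 1 ×[ lit 4 ≤ var 3 ] ∷ [])
    (length≤count (λ v → not (adj w v)) {w ∷ v ∷ []} (((vw ∘ sym) ∷ []) ∷ [] ∷ []) (λ { #0 → ∈members {Z} zw , cong not (adj-irrefl w)
      ; #1 → ∈members {Z} zv , cong not e })
     ∷ ≤-reflexive (trans (out-complement w) ζ≡5) ∷ none (zero-or (common x w)) ∷ ≤-reflexive (out-common zw) ∷ heavy⇒ {w} (∧ˡ lw) ∷ []) refl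
    where
    none : common x w ≡ 0 ⊎ 1 ≤ common x w → common x w ≤ 0
    none (inj₁ e) = ≤-reflexive e
    none (inj₂ e) = ⊥-elim (true≢false (positive e) (not-true (∧ʳ {heavy w} lw)))

   Tied Loose : Fin n → Set
   Tied v = (v ∈ Zs) × tied v ≡ true
   Loose v = (v ∈ Zs) × loose v ≡ true

   tied≢loose : ∀ {a b} → Tied a → Loose b → a ≢ b
   tied≢loose {a} (_ , t) (_ , l) refl = true≢false (∧ʳ {heavy a} t) (not-true (∧ʳ {heavy a} l))

   tied-out : ∀ {w} → Tied w → out w ≤ 2
   tied-out {w} (i , t) = +-cancelˡ-≤ 2 _ _ (≤-trans (+-monoˡ-≤ (out w) (tied-twice (members⁻ {Z} i) t))
    (≤-reflexive (trans (sym (out-common (members⁻ {Z} i))) (Z-four (members⁻ {Z} i) (∧ˡ t)))))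

   joined : ∀ {a b} → Loose a → b ∈ Zs → b ≢ a → a ~ b
   joined (i , l) j = loose-joined (members⁻ {Z} i) l (members⁻ {Z} j)

   four-loose : 4 ≤ count loose Zs → ⊥
   four-loose h = go (filterᵇ loose Zs) (unique-filter loose (members! Z)) (∈-filter⁻ loose) (subst (4 ≤_) (sym (length-filter loose Zs)) h)
    where
    go : ∀ zs → Unique zs → (∀ {z} → z ∈ zs → Loose z) → 4 ≤ length zs → ⊥
    go (a ∷ []) _ _ (s≤s ())
    go (a ∷ b ∷ []) _ _ (s≤s (s≤s ()))
    go (a ∷ b ∷ c ∷ []) _ _ (s≤s (s≤s (s≤s ())))
    go (a ∷ b ∷ c ∷ d ∷ zs) ((ab ∷ ac ∷ ad ∷ _) ∷ (bc ∷ bd ∷ _) ∷ (cd ∷ _) ∷ _) s _ = fifth (find-or-none (λ v → notin v) Zs)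
     where
     open import Relation.Nullary.Decidable using (decidable-stable)
     notin : ∀ v → Dec (¬ (v ∈ a ∷ b ∷ c ∷ d ∷ []))
     notin v = ¬? (member? _≟_ v (a ∷ b ∷ c ∷ d ∷ []))
     la = s #0
     lb = s #1
     lc = s #2
     ld = s #3
     fifth : (∃[ v ] (v ∈ Zs) × ¬ (v ∈ a ∷ b ∷ c ∷ d ∷ [])) ⊎ (∀ {v} → v ∈ Zs → ¬ ¬ (v ∈ a ∷ b ∷ c ∷ d ∷ [])) → ⊥
     fifth (inj₁ (v , i , v∉)) = K₅-free P (joined la i (λ e → v∉ (here e))) (joined la (proj₁ lb) (ab ∘ sym)) (joined la (proj₁ lc) (ac ∘ sym)) (joined la (proj₁ ld) (ad ∘ sym))
      (~-sym (joined lb i (λ e → v∉ (there (here e))))) (~-sym (joined lc i (λ e → v∉ (there (there (here e)))))) (~-sym (joined ld i (λ e → v∉ (there (there (there (here e)))))))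
      (joined lb (proj₁ lc) (bc ∘ sym)) (joined lb (proj₁ ld) (bd ∘ sym)) (joined lc (proj₁ ld) (cd ∘ sym))
     fifth (inj₂ all) = <⇒≱ {4} (≥-reflexive |Zs|) (length-⊆ (members! Z) λ {v} i → decidable-stable (member? _≟_ v (a ∷ b ∷ c ∷ d ∷ [])) (all i))

   three-loose : 3 ≤ count loose Zs → ⊥
   three-loose h = go (pick₃ loose (members! Z) h) (zero-or (count tied Zs))
    where
    go : Three Loose → count tied Zs ≡ 0 ⊎ 1 ≤ count tied Zs → ⊥
    go _ (inj₁ e) = four-loose (≤-trans h≥4 (≤-reflexive (trans (sym tied+loose) (cong (_+ count loose Zs) e))))
    go (a , b , c , (ab , ac , bc) , la , lb , lc) (inj₂ e) = clash (count-pos tied Zs e)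
     where
     clash : ∃[ w ] Tied w → ⊥
     clash (w , t) = <⇒≱ {2} (length≤count (adj w) {a ∷ b ∷ c ∷ []} ((ab ∷ ac ∷ []) ∷ (bc ∷ []) ∷ [] ∷ []) λ
      { #0 → proj₁ la , near la ; #1 → proj₁ lb , near lb ; #2 → proj₁ lc , near lc }) (tied-out t)
      where
      near : ∀ {a} → Loose a → w ~ a
      near l = ~-sym (joined l (proj₁ t) (tied≢loose t l))

   two-two : Two Tied → Two Loose →
    ∃[ u ] (u ∈ Zs) × not (heavy u) ≡ true → ⊥
   two-two (a , b , ab , ta , tb) (c , d , cd , lc , ld) (u , iu , hu) =
    meet (common₁ (≤-trans (n≤1+n 1) (tied-twice za (proj₂ ta)))) (common₁ (≤-trans (n≤1+n 1) (tied-twice zb (proj₂ tb)))) (common₁ u-attached)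
    where
    za = members⁻ {Z} (proj₁ ta)
    zb = members⁻ {Z} (proj₁ tb)
    zc = members⁻ {Z} (proj₁ lc)
    zd = members⁻ {Z} (proj₁ ld)
    zu = members⁻ {Z} iu
    tied≢u : ∀ {a} → Tied a → a ≢ u
    tied≢u {a} (_ , t) refl = true≢false (∧ˡ t) (not-true hu)
    loose≢u : ∀ {a} → Loose a → a ≢ u
    loose≢u {a} (_ , t) refl = true≢false (∧ˡ t) (not-true hu)
    near : ∀ {a c} → Tied a → Loose c → a ~ c
    near t l = ~-sym (joined l (proj₁ t) (tied≢loose t l))
    near-u : ∀ {c} → Loose c → u ~ c
    near-u l = ~-sym (joined l iu (loose≢u l ∘ sym))
    u≁ : ∀ {a} → Tied a → adj u a ≡ false
    u≁ {a} t = ≁ λ ua → <⇒≱ {2} (length≤count (adj a) {c ∷ d ∷ u ∷ []} ((cd ∷ loose≢u lc ∷ []) ∷ (loose≢u ld ∷ []) ∷ [] ∷ []) λ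
      { #0 → proj₁ lc , near t lc ; #1 → proj₁ ld , near t ld ; #2 → iu , ~-sym ua }) (tied-out t)
    every : ∀ {v} → v ∈ Zs → v ∈ a ∷ b ∷ c ∷ d ∷ u ∷ []
    every i = exhaustive _≟_ (λ _ → true) {a ∷ b ∷ c ∷ d ∷ u ∷ []} {Zs}
     ((ab ∷ tied≢loose ta lc ∷ tied≢loose ta ld ∷ tied≢u ta ∷ []) ∷ (tied≢loose tb lc ∷ tied≢loose tb ld ∷ tied≢u tb ∷ []) ∷ (cd ∷ loose≢u lc ∷ []) ∷ (loose≢u ld ∷ []) ∷ [] ∷ [])
     (λ { #0 → proj₁ ta , refl ; #1 → proj₁ tb , refl ; #2 → proj₁ lc , refl
       ; #3 → proj₁ ld , refl ; #4 → iu , refl })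
     (≤-trans (count≤length (λ _ → true) Zs) (≤-reflexive |Zs|)) i refl
    u-out : out u ≤ 2
    u-out = count≤cover (adj u) {ys = c ∷ d ∷ []} (members! Z) λ i uv → cover (every i) uv
     where
     cover : ∀ {v} → v ∈ a ∷ b ∷ c ∷ d ∷ u ∷ [] → u ~ v → v ∈ c ∷ d ∷ []
     cover #0 uv = ⊥-elim (true≢false uv (u≁ ta))
     cover #1 uv = ⊥-elim (true≢false uv (u≁ tb))
     cover (there (there (here e))) uv = here e
     cover (there (there (there (here e)))) uv = there (here e)
     cover #4 uv = ⊥-elim (~⇒≢ uv refl)
    u-attached : 1 ≤ common x u
    u-attached = +-cancelʳ-≤ 2 1 _ (≤-trans (≤-reflexive (trans (sym (low-three zu (not-true hu))) (out-common zu))) (+-monoʳ-≤ (common x u) u-out))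
    zy : ∀ {w y} → Z w ≡ true → x ~ y → w ≢ y
    zy {w} zw xy refl = true≢false xy (proj₂ (Z⁻ {w} zw))
    zx : ∀ {w} → Z w ≡ true → w ≢ x
    zx {w} zw = proj₁ (Z⁻ {w} zw)
    meet : ∃[ y ] Common x a y → ∃[ y ] Common x b y → ∃[ y ] Common x u y → ⊥
    meet (y , xy , ay) (z , xz , bz) (v , xv , uv) = K₃₃-subdivided-free P
     ((ab ∷ tied≢u ta ∷ zx za ∷ tied≢loose ta lc ∷ tied≢loose ta ld ∷ zy za xv ∷ zy za xy ∷ zy za xz ∷ [])
      ∷ (tied≢u tb ∷ zx zb ∷ tied≢loose tb lc ∷ tied≢loose tb ld ∷ zy zb xv ∷ zy zb xy ∷ zy zb xz ∷ [])
      ∷ (zx zu ∷ (loose≢u lc ∘ sym) ∷ (loose≢u ld ∘ sym) ∷ zy zu xv ∷ zy zu xy ∷ zy zu xz ∷ [])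
      ∷ ((zx zc ∘ sym) ∷ (zx zd ∘ sym) ∷ ~⇒≢ xv ∷ ~⇒≢ xy ∷ ~⇒≢ xz ∷ [])
      ∷ (cd ∷ zy zc xv ∷ zy zc xy ∷ zy zc xz ∷ [])
      ∷ (zy zd xv ∷ zy zd xy ∷ zy zd xz ∷ [])
      ∷ ((λ { refl → tied≢u ta (same-out xv za zu (~-sym ay) (~-sym uv)) }) ∷ (λ { refl → tied≢u tb (same-out xv zb zu (~-sym bz) (~-sym uv)) }) ∷ [])
      ∷ ((λ { refl → ab (same-out xy za zb (~-sym ay) (~-sym bz)) }) ∷ [])
      ∷ [] ∷ [])
     (~-sym (near ta lc)) (~-sym (near tb lc)) (~-sym (near-u lc)) (~-sym (near ta ld)) (~-sym (near tb ld)) (~-sym (near-u ld))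
     (~-sym ay) (~-sym xy) (~-sym bz) (~-sym xz) (~-sym uv) (~-sym xv)

   eleven : ⊥
   eleven = by (3 ≤? count loose Zs)
    where
    by : Dec (3 ≤ count loose Zs) → ⊥
    by (yes h) = three-loose h
    by (no h) = two-two (pick₂ tied (members! Z) (≮⇒≥ λ l → refute (count tied Zs ∷ count loose Zs ∷ count heavy Zs ∷ [])
      (1 ×[ lit 1 ⊕ var 0 ≤ lit 2 ] ∷ 1 ×[ lit 1 ⊕ var 1 ≤ lit 3 ] ∷ 1 ×[ lit 4 ≤ var 2 ] ∷ 1 ×[ var 2 ≤ var 0 ⊕ var 1 ] ∷ [])
      (l ∷ ≰⇒> h ∷ h≥4 ∷ ≥-reflexive tied+loose ∷ []) refl))
     (pick₂ loose (members! Z) (≮⇒≥ λ l → refute (count tied Zs ∷ count loose Zs ∷ count heavy Zs ∷ [])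
      (1 ×[ lit 1 ⊕ var 1 ≤ lit 2 ] ∷ 1 ×[ var 0 ≤ lit 2 ] ∷ 1 ×[ lit 4 ≤ var 2 ] ∷ 1 ×[ var 2 ≤ var 0 ⊕ var 1 ] ∷ [])
      (l ∷ tied≤2 ∷ h≥4 ∷ ≥-reflexive tied+loose ∷ []) refl))
     (count-pos (λ u → not (heavy u)) Zs (≮⇒≥ λ l → refute (count tied Zs ∷ count loose Zs ∷ count heavy Zs ∷ count (λ u → not (heavy u)) Zs ∷ [])
      (1 ×[ lit 1 ⊕ var 3 ≤ lit 1 ] ∷ 1 ×[ var 0 ≤ lit 2 ] ∷ 1 ×[ lit 1 ⊕ var 1 ≤ lit 3 ] ∷ 1 ×[ var 2 ≤ var 0 ⊕ var 1 ] ∷ 1 ×[ lit 5 ≤ var 2 ⊕ var 3 ] ∷ [])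
      (l ∷ tied≤2 ∷ ≰⇒> h ∷ ≥-reflexive tied+loose ∷ ≥-reflexive (trans (count-not heavy Zs) |Zs|) ∷ []) refl))

module ThreeDense {n} (G : Graph (Fin n)) (D : Drawing G) (free : S 3 3 Free G) where
 open import Data.Fin.Properties using (_≟_)
 open ThreeAround G D free public

 module Dense (mate : ∀ {x} → 4 ≤ deg x → ∃[ y ] x ~ y × 4 ≤ deg y) (big : 10 ≤ n) (many : 5 * n < ∑ Vs deg + 10) where

  all-heavy : Closed heavy
  all-heavy = record { heavy-in = λ {x} → heavy⇒ {x} ; step = λ {_} {y} _ d _ → ⇒heavy {y} d ; mate = λ {x} h → mate (heavy⇒ {x} h) }

  not-rich : Rich 28 heavy → ⊥
  not-rich r = refute (∑ Vs deg ∷ ∑ Hs deg ∷ ∑ Ls deg ∷ ∑ Hs lows ∷ length Hs ∷ length Ls ∷ n ∷ ∑ Hs (λ x → 3 * deg x) ∷ ∑ Hs (λ x → 15 + 2 * lows x) ∷ [])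
   (3 ×[ lit 1 ⊕ 5 ⊛ var 6 ≤ var 0 ⊕ lit 10 ] ∷ 3 ×[ var 0 ≤ var 1 ⊕ var 2 ] ∷ 1 ×[ var 7 ⊕ lit 28 ≤ var 8 ] ∷ 1 ×[ 3 ⊛ var 1 ≤ var 7 ]
    ∷ 1 ×[ var 8 ≤ 15 ⊛ var 4 ⊕ 2 ⊛ var 3 ] ∷ 2 ×[ var 3 ≤ var 2 ] ∷ 5 ×[ var 2 ≤ 3 ⊛ var 5 ] ∷ 15 ×[ var 4 ⊕ var 5 ≤ var 6 ] ∷ [])
   (many ∷ ≥-reflexive (∑-partition heavy Vs deg) ∷ r ∷ ≥-reflexive (∑-* Hs 3 deg)
    ∷ ≤-reflexive (trans (∑-+ Hs _ _) (cong₂ _+_ (∑-const Hs 15) (∑-* Hs 2 lows)))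
    ∷ slots ∷ ≤-trans (∑-mono Ls λ {u} i → low⇒ {u} (not-true (members⁻ {λ v → not (heavy v)} i))) (≤-reflexive (∑-const Ls 3))
    ∷ ≤-reflexive (trans (cong₂ _+_ (length-filter heavy Vs) (length-filter _ Vs)) (trans (count-not heavy Vs) |V|)) ∷ []) refl
   where
   Hs = members heavy
   Ls = members (λ v → not (heavy v))
   slots : ∑ Hs lows ≤ ∑ Ls deg
   slots = ≤-trans (≤-reflexive (∑-comm Hs Vs (λ x u → bit (adj x u ∧ not (heavy u)))))
    (≤-trans (∑-mono Vs λ {u} _ → at u (heavy u)) (≥-reflexive (∑-filter (λ v → not (heavy v)) Vs deg)))
    where
    at : ∀ u b → ∑ Hs (λ x → bit (adj x u ∧ not b)) ≤ bit (not b) * deg u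
    at u true = ≤-reflexive (trans (∑-cong Hs (λ {x} _ → cong bit (e (adj x u)))) (∑-zero Hs))
     where
     e : ∀ a → a ∧ false ≡ false
     e true  = refl
     e false = refl
    at u false = ≤-trans (≤-trans (≤-reflexive (∑-filter heavy Vs _)) (∑-mono Vs λ {x} _ → e (heavy x) (adj x u) (adj-sym x u))) (≥-reflexive (+-identityʳ (deg u)))
     where
     e : ∀ h a {b} → a ≡ b → bit h * bit (a ∧ true) ≤ bit b
     e true  true  refl = ≤-refl
     e true  false refl = ≤-refl
     e false a     _    = z≤n

  connected : ∀ {C v u} → Closed C → C v ≡ true → 4 ≤ deg u → C u ≡ true
  connected {C} {v} {u} K cv du = by-contradiction λ e → not-rich (rich-+ {C = heavy} {C} (λ {x} h → ⇒heavy {x} (Closed.heavy-in K h))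
   (rich-closed K cv) (rich-closed (closed-minus all-heavy K) {u} (∧-true (⇒heavy {u} du) (cong not e))))

  not-small : ∀ {C v} → Closed C → C v ≡ true → ∑ (members C) deg ≤ 3 * count C Vs + 10 → ⊥
  not-small {C} {v} K cv h = refute (∑ Vs deg ∷ ∑ (members C) deg ∷ ∑ Rs deg ∷ count C Vs ∷ count (λ v → not (C v)) Vs ∷ n ∷ [])
   (1 ×[ lit 1 ⊕ 5 ⊛ var 5 ≤ var 0 ⊕ lit 10 ] ∷ 1 ×[ var 0 ≤ var 1 ⊕ var 2 ] ∷ 1 ×[ var 1 ≤ 3 ⊛ var 3 ⊕ lit 10 ]
    ∷ 1 ×[ var 2 ≤ 3 ⊛ var 4 ] ∷ 3 ×[ var 3 ⊕ var 4 ≤ var 5 ] ∷ 2 ×[ lit 10 ≤ var 5 ] ∷ [])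
   (many ∷ ≥-reflexive (∑-partition C Vs deg) ∷ h
    ∷ ≤-trans (∑-mono Rs λ {u} i → ≮⇒≥ λ d → true≢false (connected K cv d) (not-true (members⁻ {λ v → not (C v)} i)))
      (≤-reflexive (trans (∑-const Rs 3) (cong (3 *_) (length-filter _ Vs))))
    ∷ ≤-reflexive (trans (count-not C Vs) |V|) ∷ big ∷ []) refl
   where Rs = members (λ v → not (C v))

  no-six : ∀ {x} → deg x ≢ 6
  no-six {x} dx = not-small X.closed X.x∈ (by (X.size ≤? 2))
   where
   module X = Six dx (mate (≥4 {k = 2} dx))
   by : Dec (X.size ≤ 2) → ∑ (members X.cluster) deg ≤ 3 * count X.cluster Vs + 10
   by (yes h) = ≮⇒≥ λ l → refute (∑ (members X.cluster) deg ∷ count X.cluster Vs ∷ X.size ∷ [])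
    (1 ×[ lit 11 ⊕ 3 ⊛ var 1 ≤ var 0 ] ∷ 1 ×[ var 0 ≤ 6 ⊛ var 2 ] ∷ 3 ×[ var 2 ≤ var 1 ] ∷ 3 ×[ var 2 ≤ lit 2 ] ∷ [])
    (≤-trans (≤-reflexive (cong suc (+-comm 10 (3 * count X.cluster Vs)))) l ∷ X.six-each ∷ ≤-reflexive (length-filter X.cluster Vs) ∷ h ∷ []) refl
   by (no h) = ≮⇒≥ λ l → refute (∑ (members X.cluster) deg ∷ count X.cluster Vs ∷ X.size ∷ X.e ∷ X.s ∷ lows x ∷ [])
    (1 ×[ lit 11 ⊕ 3 ⊛ var 1 ≤ var 0 ] ∷ 1 ×[ var 0 ≤ 2 ⊛ var 3 ⊕ var 4 ] ∷ 2 ×[ var 3 ⊕ lit 6 ≤ 3 ⊛ var 2 ]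
     ∷ 1 ×[ var 4 ≤ 3 ⊛ var 5 ] ∷ 3 ×[ var 2 ⊕ var 5 ≤ lit 7 ] ∷ 3 ×[ var 2 ≤ var 1 ] ∷ [])
    (≤-trans (≤-reflexive (cong suc (+-comm 10 (3 * count X.cluster Vs)))) l ∷ ≤-reflexive X.degree-total ∷ X.planar (≰⇒> h) ∷ X.slots ∷ ≤-reflexive X.neighbours ∷ ≤-reflexive (length-filter X.cluster Vs) ∷ []) refl

  ≤5 : ∀ v → deg v ≤ 5
  ≤5 v = ≮⇒≥ λ h → go h (mate (≤-trans (m≤n+m 4 2) h))
   where
   go : 5 < deg v → ∃[ y ] v ~ y × 4 ≤ deg y → ⊥
   go h (y , vy , dy) = no-six {v} (≤-antisym (deg≤6 vy (≤-trans (m≤n+m 4 2) h) dy) h)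

  not-five-closed : ∀ {C v} → (K : Closed C) → C v ≡ true → count C Vs + count (λ v → C v ∧ five v) Vs ≤ 10 → ⊥
  not-five-closed {C} K cv h = not-small K cv (≮⇒≥ λ l → refute (∑ (members C) deg ∷ count C Vs ∷ count (λ v → C v ∧ five v) Vs ∷ X.size ∷ count five (members C) ∷ [])
    (1 ×[ lit 11 ⊕ 3 ⊛ var 1 ≤ var 0 ] ∷ 1 ×[ var 0 ≤ 4 ⊛ var 3 ⊕ var 4 ] ∷ 1 ×[ var 1 ⊕ var 2 ≤ lit 10 ] ∷ 4 ×[ var 3 ≤ var 1 ] ∷ 1 ×[ var 4 ≤ var 2 ] ∷ [])
    (≤-trans (≤-reflexive (cong suc (+-comm 10 (3 * count C Vs)))) l ∷ ≤-reflexive (X.degree-five (λ {v} _ → ≤5 v)) ∷ h ∷ ≤-reflexive (length-filter C Vs)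
     ∷ ≤-reflexive (count-filter C five Vs) ∷ []) refl)
   where module X = ClosedCount K

  tame : Tame
  tame = record { ≤5 = ≤5 ; small-cliques = small-cliques ; no-overlap = no-overlap ; mate = mate ; connected = connected }
   where
   no-overlap : ∀ {x z} → ¬ Overlapping x z
   no-overlap {x} {z} o@((dx , dz) , ((xz , x≁z) , _)) = not-five-closed O.closed O.x∈ (≤-trans (+-mono-≤ O.size O.fives) (n≤1+n 9))
    where
    w = overlap-witness o
    module O = OverlapClosed dx dz xz x≁z (proj₁ (proj₂ w)) (proj₁ (proj₂ (proj₂ w))) (proj₂ (proj₂ (proj₂ w)))
   small-cliques : ∀ {x} → deg x ≡ 5 → fives-at x ≤ 2
   small-cliques {x} dx = ≮⇒≥ λ h → go (pick₃ (λ y → adj x y ∧ five y) Vs! h)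
    where
    Mate : Fin n → Set
    Mate p = (p ∈ Vs) × adj x p ∧ five p ≡ true
    go : Three Mate → ⊥
    go (p , q , r , (pq , pr , qr) , (_ , ep) , (_ , eq) , (_ , er)) =
     not-five-closed {v = x} (Q.closed λ {v} _ → ≤5 v) (Q.touches⁺ (≥4 dx) #1 xp) (+-mono-≤ (Q.size λ {v} _ → ≤5 v) (Q.fives λ {v} _ → ≤5 v))
     where
     xp : x ~ p
     xp = ∧ˡ ep
     xq : x ~ q
     xq = ∧ˡ eq
     xr : x ~ r
     xr = ∧ˡ er
     dp : deg p ≡ 5
     dp = five⇒ {p} (∧ʳ {adj x p} ep)
     dq : deg q ≡ 5
     dq = five⇒ {q} (∧ʳ {adj x q} eq)
     dr : deg r ≡ 5
     dr = five⇒ {r} (∧ʳ {adj x r} er)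
     module Q = QuadClosed dx dp dq dr xp xq xr (five-transitive dp dx dq (~-sym xp) xq pq) (five-transitive dp dx dr (~-sym xp) xr pr) (five-transitive dq dx dr (~-sym xq) xr qr)

  weight-at : ∀ v → deg v + weight v ≤ 5
  weight-at v = bound (five v) (heavy v) refl refl
   where
   bound : ∀ a b → five v ≡ a → heavy v ≡ b → deg v + (bit (not a) + bit (not b)) ≤ 5
   bound a false ea eb = ≤-trans (+-mono-≤ (low⇒ {v} eb) (+-monoˡ-≤ 1 (bit≤1 (not a)))) ≤-refl
   bound true true ea eb = ≤-reflexive (trans (+-identityʳ _) (five⇒ {v} ea))
   bound false true ea eb = +-monoˡ-≤ 1 (≤-reflexive (four-of tame (heavy⇒ {v} eb) (not-five tame {v} ea)))

  five-each : ∑ Vs (λ _ → 5) ≡ 5 * n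
  five-each = trans (∑-const Vs 5) (cong (5 *_) |V|)

  W q l e : ℕ
  W = ∑ Vs weight
  q = count five Vs
  l = count (λ v → not (heavy v)) Vs
  e = edgeCount G

  W-value : W + q ≡ n + l
  W-value = trans (cong (_+ q) (∑-+ Vs _ _)) (trans (+-assoc (count (λ v → not (five v)) Vs) l q) (trans (cong (count (λ v → not (five v)) Vs +_) (+-comm l q))
   (trans (sym (+-assoc (count (λ v → not (five v)) Vs) q l)) (cong (_+ l) (trans (+-comm (count (λ v → not (five v)) Vs) q) (trans (count-not five Vs) |V|))))))

  total : 2 * e + W ≤ 5 * n
  total = ≤-trans (≤-reflexive (trans (cong (_+ W) (sym degree-sum)) (sym (∑-+ Vs _ _)))) (≤-trans (∑-mono Vs λ {v} _ → weight-at v) (≤-reflexive five-each))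

  many-edges : 5 * n < 2 * e + 10
  many-edges = ≤-trans many (≤-reflexive (cong (_+ 10) degree-sum))

  budget : W ≤ 9
  budget = ≮⇒≥ λ h → refute (W ∷ n ∷ e ∷ []) (1 ×[ lit 10 ≤ var 0 ] ∷ 1 ×[ 2 ⊛ var 2 ⊕ var 0 ≤ 5 ⊛ var 1 ] ∷ 1 ×[ lit 1 ⊕ 5 ⊛ var 1 ≤ 2 ⊛ var 2 ⊕ lit 10 ] ∷ [])
   (h ∷ total ∷ many-edges ∷ []) refl

  some-five : 1 ≤ q
  some-five = ≮⇒≥ λ h → refute (W ∷ q ∷ n ∷ l ∷ []) (1 ×[ lit 1 ⊕ var 1 ≤ lit 1 ] ∷ 1 ×[ var 0 ≤ lit 9 ] ∷ 1 ×[ var 2 ⊕ var 3 ≤ var 0 ⊕ var 1 ] ∷ 1 ×[ lit 10 ≤ var 2 ] ∷ [])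
   (h ∷ budget ∷ ≥-reflexive W-value ∷ big ∷ []) refl

  one-clique : ∀ {x z} → deg x ≡ 5 → deg z ≡ 5 → z ≡ x ⊎ x ~ z
  one-clique {x} {z} dx dz = proj₂ (Clique.Q⁻ tame dx {z} (by-contradiction λ z∉ → two-cliques tame dx dz z∉ budget))

  fives≤3 : q ≤ 3
  fives≤3 = go (count-pos five Vs some-five)
   where
   go : ∃[ x ] (x ∈ Vs) × five x ≡ true → q ≤ 3
   go (x , _ , h) = ≤-trans (count≤cover five {ys = x ∷ filterᵇ (λ y → adj x y ∧ five y) Vs} Vs! λ {z} _ k → cover k (one-clique (five⇒ {x} h) (five⇒ {z} k)))
    (s≤s (≤-trans (≤-reflexive (length-filter (λ y → adj x y ∧ five y) Vs)) (Tame.small-cliques tame (five⇒ {x} h))))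
    where
    cover : ∀ {z} → five z ≡ true → z ≡ x ⊎ x ~ z → z ∈ x ∷ filterᵇ (λ y → adj x y ∧ five y) Vs
    cover k (inj₁ e) = here e
    cover k (inj₂ xz) = there (∈-filter⁺ (λ y → adj x y ∧ five y) ∈V (∧-true xz k))

  n≤12 : n ≤ 12
  n≤12 = ≮⇒≥ λ h → refute (W ∷ q ∷ n ∷ l ∷ []) (1 ×[ lit 13 ≤ var 2 ] ∷ 1 ×[ var 0 ≤ lit 9 ] ∷ 1 ×[ var 2 ⊕ var 3 ≤ var 0 ⊕ var 1 ] ∷ 1 ×[ var 1 ≤ lit 3 ] ∷ [])
   (h ∷ budget ∷ ≥-reflexive W-value ∷ fives≤3 ∷ []) refl

  edges-ten : n ≡ 10 → 21 ≤ e
  edges-ten h = ≮⇒≥ λ k → refute (n ∷ e ∷ []) (5 ×[ lit 10 ≤ var 0 ] ∷ 1 ×[ lit 1 ⊕ 5 ⊛ var 0 ≤ 2 ⊛ var 1 ⊕ lit 10 ] ∷ 2 ×[ lit 1 ⊕ var 1 ≤ lit 21 ] ∷ [])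
   (≥-reflexive h ∷ many-edges ∷ k ∷ []) refl

  module Clique-alone (ten-or-eleven : (n ≡ 10 × 21 ≤ e) ⊎ (n ≡ 11 × 23 ≤ e)) where

   few-lows : l + 2 ≤ q
   few-lows = by ten-or-eleven
    where
    by : (n ≡ 10 × 21 ≤ e) ⊎ (n ≡ 11 × 23 ≤ e) → l + 2 ≤ q
    by (inj₁ (h , k)) = ≮⇒≥ λ m → refute (W ∷ q ∷ n ∷ l ∷ e ∷ [])
     (1 ×[ lit 1 ⊕ var 1 ≤ var 3 ⊕ lit 2 ] ∷ 2 ×[ lit 21 ≤ var 4 ] ∷ 1 ×[ 2 ⊛ var 4 ⊕ var 0 ≤ 5 ⊛ var 2 ] ∷ 1 ×[ var 2 ⊕ var 3 ≤ var 0 ⊕ var 1 ] ∷ 4 ×[ var 2 ≤ lit 10 ] ∷ [])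
     (m ∷ k ∷ total ∷ ≥-reflexive W-value ∷ ≤-reflexive h ∷ []) refl
    by (inj₂ (h , k)) = ≮⇒≥ λ m → refute (W ∷ q ∷ n ∷ l ∷ e ∷ [])
     (1 ×[ lit 1 ⊕ var 1 ≤ var 3 ⊕ lit 2 ] ∷ 1 ×[ lit 11 ≤ var 2 ] ∷ 1 ×[ var 0 ≤ lit 9 ] ∷ 1 ×[ var 2 ⊕ var 3 ≤ var 0 ⊕ var 1 ] ∷ [])
     (m ∷ ≥-reflexive h ∷ budget ∷ ≥-reflexive W-value ∷ []) refl

   one-low : l ≤ 1
   one-low = +-cancelʳ-≤ 2 l 1 (≤-trans few-lows fives≤3)

   unique-low : ∀ {u v} → heavy u ≡ false → heavy v ≡ false → u ≡ v
   unique-low {u} {v} hu hv = by (u ≟ v)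
    where
    by : Dec (u ≡ v) → u ≡ v
    by (yes h) = h
    by (no h) = ⊥-elim (<⇒≱ {1} (length≤count (λ v → not (heavy v)) {u ∷ v ∷ []} ((h ∷ []) ∷ [] ∷ [])
     λ { #0 → ∈V , cong not hu ; #1 → ∈V , cong not hv }) one-low)

   some-low : ∀ {u} → heavy u ≡ false → 1 ≤ l
   some-low {u} hu = length≤count (λ v → not (heavy v)) {u ∷ []} ([] ∷ []) λ { #0 → ∈V , cong not hu }

   low-three : ∀ {u} → heavy u ≡ false → deg u ≡ 3
   low-three {u} hu = ≤-antisym (low⇒ {u} hu) (≮⇒≥ λ h → by (strict h) ten-or-eleven)
    where
    strict : deg u < 3 → 2 * e + W < 5 * n
    strict h = ≤-trans (s≤s (≤-reflexive (trans (cong (_+ W) (sym degree-sum)) (sym (∑-+ Vs _ _)))))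
     (≤-trans (∑-strict Vs (λ {v} _ → weight-at v) ∈V (s≤s (+-mono-≤ (s≤s⁻¹ h) (+-mono-≤ (bit≤1 (not (five u))) (bit≤1 (not (heavy u)))))))
      (≤-reflexive five-each))
    by : 2 * e + W < 5 * n → (n ≡ 10 × 21 ≤ e) ⊎ (n ≡ 11 × 23 ≤ e) → ⊥
    by h (inj₁ (k , m)) = refute (W ∷ q ∷ n ∷ l ∷ e ∷ [])
     (1 ×[ lit 1 ⊕ (2 ⊛ var 4 ⊕ var 0) ≤ 5 ⊛ var 2 ] ∷ 4 ×[ var 2 ≤ lit 10 ] ∷ 2 ×[ lit 21 ≤ var 4 ] ∷ 1 ×[ var 2 ⊕ var 3 ≤ var 0 ⊕ var 1 ] ∷ 1 ×[ lit 1 ≤ var 3 ] ∷ 1 ×[ var 1 ≤ lit 3 ] ∷ [])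
     (h ∷ ≤-reflexive k ∷ m ∷ ≥-reflexive W-value ∷ some-low hu ∷ fives≤3 ∷ []) refl
    by h (inj₂ (k , m)) = refute (W ∷ q ∷ n ∷ l ∷ e ∷ [])
     (1 ×[ lit 1 ⊕ (2 ⊛ var 4 ⊕ var 0) ≤ 5 ⊛ var 2 ] ∷ 4 ×[ var 2 ≤ lit 11 ] ∷ 2 ×[ lit 23 ≤ var 4 ] ∷ 1 ×[ var 2 ⊕ var 3 ≤ var 0 ⊕ var 1 ] ∷ 1 ×[ lit 1 ≤ var 3 ] ∷ 1 ×[ var 1 ≤ lit 3 ] ∷ [])
     (h ∷ ≤-reflexive k ∷ m ∷ ≥-reflexive W-value ∷ some-low hu ∷ fives≤3 ∷ []) refl

   Fives : List (Fin n)
   Fives = members five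

   LowInside : Fin n → Set
   LowInside x = ∀ {y v} → x ~ y → deg y ≤ 3 → y ~ v → v ≡ x ⊎ x ~ v

   low-of : ∀ {y} → deg y ≤ 3 → heavy y ≡ false
   low-of {y} h = by (heavy y) refl
    where
    by : ∀ b → heavy y ≡ b → heavy y ≡ false
    by false e = e
    by true  e = ⊥-elim (<⇒≱ (s≤s h) (heavy⇒ {y} e))

   centre : ∃[ x ] deg x ≡ 5 × LowInside x
   centre = choose (find-or-none (λ p → lows p ℕ≟ 0) Fives)
    where
    choose : (∃[ p ] (p ∈ Fives) × lows p ≡ 0) ⊎ (∀ {p} → p ∈ Fives → lows p ≢ 0) → ∃[ x ] deg x ≡ 5 × LowInside x
    choose (inj₁ (p , i , z)) = p , five⇒ {p} (members⁻ {five} i) , λ {y} xy dy _ → ⊥-elim (<⇒≱ (s≤s z≤n) (≤-trans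
     (length≤count (λ y → adj p y ∧ not (heavy y)) {y ∷ []} ([] ∷ []) λ { #0 → ∈V , ∧-true xy (cong not (low-of {y} dy)) }) (≤-reflexive z)))
    choose (inj₂ none) = any (count-pos five Vs some-five)
     where
     any : ∃[ x ] (x ∈ Vs) × five x ≡ true → ∃[ x ] deg x ≡ 5 × LowInside x
     any (x , _ , h) = x , five⇒ {x} h , inside
      where
      inside : LowInside x
      inside {y} {v} xy dy yv = one-clique (five⇒ {x} h) (five⇒ {v} (members⁻ {five} (exhaustive _≟_ (adj y) (members! five) sees enough ∈V yv)))
       where
       sees : ∀ {p} → p ∈ Fives → (p ∈ Vs) × adj y p ≡ true
       sees {p} i = ∈V , go (zero-or (lows p))
        where
        go : lows p ≡ 0 ⊎ 1 ≤ lows p → y ~ p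
        go (inj₁ e) = ⊥-elim (none i e)
        go (inj₂ k) = via (count-pos (λ u → adj p u ∧ not (heavy u)) Vs k)
         where
         via : ∃[ u ] (u ∈ Vs) × adj p u ∧ not (heavy u) ≡ true → y ~ p
         via (u , _ , e) = subst (_~ p) (unique-low {u} {y} (not-true (∧ʳ {adj p u} e)) (low-of {y} dy)) (~-sym (∧ˡ e))
       enough : count (adj y) Vs ≤ length Fives
       enough = ≤-trans dy (≤-trans (≤-trans (+-monoˡ-≤ 2 (some-low {y} (low-of {y} dy))) few-lows) (≥-reflexive (length-filter five Vs)))

   alone : ⊥
   alone = from centre
    where
    from : ∃[ x ] deg x ≡ 5 × LowInside x → ⊥
    from (x , dx , inside) = by ten-or-eleven
     where
     module A = Away dx (λ dv → one-clique dx dv) ≤5 inside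
     lows-in-Z : count (λ v → not (heavy v)) A.Zs ≤ 1
     lows-in-Z = ≤-trans (≤-reflexive (count-filter A.Z (λ v → not (heavy v)) Vs))
      (≤-trans (count-mono Vs λ {v} _ h → ∧ʳ {A.Z v} h) one-low)
     sizes : count heavy A.Zs + count (λ v → not (heavy v)) A.Zs ≡ A.ζ
     sizes = trans (count-not heavy A.Zs) (length-filter A.Z Vs)
     by : (n ≡ 10 × 21 ≤ e) ⊎ (n ≡ 11 × 23 ≤ e) → ⊥
     by (inj₁ (h , _)) = refute (count heavy A.Zs ∷ count (λ v → not (heavy v)) A.Zs ∷ A.ζ ∷ n ∷ [])
      (1 ×[ var 0 ≤ lit 2 ] ∷ 1 ×[ var 1 ≤ lit 1 ] ∷ 1 ×[ var 2 ≤ var 0 ⊕ var 1 ] ∷ 1 ×[ var 3 ≤ var 2 ⊕ lit 6 ] ∷ 1 ×[ lit 10 ≤ var 3 ] ∷ [])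
      (A.ten h ∷ lows-in-Z ∷ ≥-reflexive sizes ∷ ≥-reflexive A.ζ+6 ∷ ≥-reflexive h ∷ []) refl
     by (inj₂ (h , _)) = A.Eleven.eleven h (≮⇒≥ λ k → refute (count heavy A.Zs ∷ count (λ v → not (heavy v)) A.Zs ∷ A.ζ ∷ n ∷ [])
      (1 ×[ lit 1 ⊕ var 0 ≤ lit 4 ] ∷ 1 ×[ var 1 ≤ lit 1 ] ∷ 1 ×[ var 2 ≤ var 0 ⊕ var 1 ] ∷ 1 ×[ var 3 ≤ var 2 ⊕ lit 6 ] ∷ 1 ×[ lit 11 ≤ var 3 ] ∷ [])
      (k ∷ lows-in-Z ∷ ≥-reflexive sizes ∷ ≥-reflexive A.ζ+6 ∷ ≥-reflexive h ∷ []) refl)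
      (λ {u} _ hu → low-three {u} hu)

  impossible : ⊥
  impossible = by (n ℕ≟ 10) (n ℕ≟ 11)
   where
   by : Dec (n ≡ 10) → Dec (n ≡ 11) → ⊥
   by (yes h) _ = Clique-alone.alone (inj₁ (h , edges-ten h))
   by (no _) (yes h) = Clique-alone.alone (inj₂ (h , ≮⇒≥ λ k → refute (n ∷ e ∷ [])
    (5 ×[ lit 11 ≤ var 0 ] ∷ 1 ×[ lit 1 ⊕ 5 ⊛ var 0 ≤ 2 ⊛ var 1 ⊕ lit 10 ] ∷ 2 ×[ lit 1 ⊕ var 1 ≤ lit 23 ] ∷ [])
    (≥-reflexive h ∷ many-edges ∷ k ∷ []) refl))
   by (no h) (no k) = refute (W ∷ q ∷ n ∷ l ∷ e ∷ [])
    (1 ×[ lit 26 ≤ var 4 ] ∷ 1 ×[ lit 26 ≤ var 4 ] ∷ 1 ×[ 2 ⊛ var 4 ⊕ var 0 ≤ 5 ⊛ var 2 ] ∷ 1 ×[ var 2 ⊕ var 3 ≤ var 0 ⊕ var 1 ] ∷ 4 ×[ var 2 ≤ lit 12 ] ∷ 1 ×[ var 1 ≤ lit 3 ] ∷ [])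
    (edges-twelve ∷ edges-twelve ∷ total ∷ ≥-reflexive W-value ∷ n≤12 ∷ fives≤3 ∷ []) refl
    where
    twelve : 12 ≤ n
    twelve = ≤∧≢⇒< (≤∧≢⇒< big (h ∘ sym)) (k ∘ sym)
    edges-twelve : 26 ≤ e
    edges-twelve = ≮⇒≥ λ m → refute (n ∷ e ∷ [])
     (5 ×[ lit 12 ≤ var 0 ] ∷ 1 ×[ lit 1 ⊕ 5 ⊛ var 0 ≤ 2 ⊛ var 1 ⊕ lit 10 ] ∷ 2 ×[ lit 1 ⊕ var 1 ≤ lit 26 ] ∷ [])
     (twelve ∷ many-edges ∷ m ∷ []) refl

 dense-bound : (∀ {x} → 4 ≤ deg x → ∃[ y ] x ~ y × 4 ≤ deg y) → 10 ≤ n → ∑ Vs deg + 10 ≤ 5 * n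
 dense-bound mate big = ≮⇒≥ λ many → Dense.impossible mate big many

module ThreeBound {n} (G : Graph (Fin n)) (D : Drawing G) (free : S 3 3 Free G) where
 open import Data.Fin.Properties using (_≟_)
 open ClawCounting (_≟_ {n}) using (Claws; claws-bound)
 open ThreeDense G D free public

 -- A set C is paid for, with k to spare, if its vertices of degree above 5 are compensated by the edges to vertices of low degree,
 -- after each vertex of low degree next to C has taken one unit.
 Paid : ℕ → (Fin n → Bool) → Set
 Paid k C = ∑ (members C) deg + (beside C + k) ≤ ∑ (members C) (λ x → 5 + lows x)

 at-+ : ∀ {C C₀} → (∀ {x} → C₀ x ≡ true → C x ≡ true) → ∀ u → links C u ≡ links C₀ u + links (λ x → C x ∧ not (C₀ x)) u
 at-+ {C} {C₀} h u = ∑-split C C₀ Vs (λ x → bit (adj u x)) h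

 positive-+ : ∀ a b → bit (0 <ᵇ a + b) ≤ bit (0 <ᵇ a) + bit (0 <ᵇ b)
 positive-+ zero    b = ≤-refl
 positive-+ (suc a) b = s≤s z≤n

 paid-+ : ∀ {j k C C₀} → (∀ {x} → C₀ x ≡ true → C x ≡ true) → Paid j C₀ → Paid k (λ x → C x ∧ not (C₀ x)) → Paid (j + k) C
 paid-+ {j} {k} {C} {C₀} h a b = ≮⇒≥ λ l → refute
  (∑ (members C₀) deg ∷ ∑ (members R) deg ∷ beside C₀ ∷ beside R ∷ beside C ∷ j ∷ k ∷ ∑ (members C₀) (λ x → 5 + lows x) ∷ ∑ (members R) (λ x → 5 + lows x)
   ∷ ∑ (members C) deg ∷ ∑ (members C) (λ x → 5 + lows x) ∷ [])
  (1 ×[ lit 1 ⊕ var 10 ≤ var 9 ⊕ (var 4 ⊕ (var 5 ⊕ var 6)) ] ∷ 1 ×[ var 0 ⊕ (var 2 ⊕ var 5) ≤ var 7 ] ∷ 1 ×[ var 1 ⊕ (var 3 ⊕ var 6) ≤ var 8 ]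
   ∷ 1 ×[ var 4 ≤ var 2 ⊕ var 3 ] ∷ 1 ×[ var 9 ≤ var 0 ⊕ var 1 ] ∷ 1 ×[ var 7 ⊕ var 8 ≤ var 10 ] ∷ [])
  (l ∷ a ∷ b ∷ beside-+ ∷ ≤-reflexive (∑-split C C₀ Vs deg h) ∷ ≥-reflexive (∑-split C C₀ Vs (λ x → 5 + lows x) h) ∷ []) refl
  where
  R : Fin n → Bool
  R x = C x ∧ not (C₀ x)
  beside-+ : beside C ≤ beside C₀ + beside R
  beside-+ = ≤-trans (∑-mono (members low) λ {u} _ → subst (λ i → bit (0 <ᵇ i) ≤ bit (0 <ᵇ links C₀ u) + bit (0 <ᵇ links R u)) (sym (at-+ {C} {C₀} h u)) (positive-+ (links C₀ u) (links R u)))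
   (≤-reflexive (∑-+ (members low) (λ u → bit (0 <ᵇ links C₀ u)) (λ u → bit (0 <ᵇ links R u))))

 paid-five : ∀ {C} → (∀ {x} → C x ≡ true → deg x ≤ 5) → Paid 0 C
 paid-five {C} ≤5 = ≤-trans (+-mono-≤ (∑-mono (members C) λ {x} i → ≤5 (members⁻ {C} i))
   (≤-trans (≤-reflexive (+-identityʳ (beside C))) (≤-trans (∑-mono (members low) λ {u} _ → b≤ (links C u)) (≥-reflexive (lows-at C)))))
  (≥-reflexive (∑-+ (members C) (λ _ → 5) lows))
  where
  b≤ : ∀ k → bit (0 <ᵇ k) ≤ k
  b≤ zero    = z≤n
  b≤ (suc k) = s≤s z≤n

 module SixPaid {x} (dx : deg x ≡ 6) (mate : ∃[ y ] x ~ y × 4 ≤ deg y) where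
  module X = Six dx mate

  beside≤ : beside X.cluster ≤ lows x
  beside≤ = ≤-trans (≤-reflexive (count-filter low (λ u → 0 <ᵇ links X.cluster u) Vs)) (count-mono Vs λ {u} _ h → go u (∧ˡ h)
    (count-pos (adj u) (members X.cluster) (positive⁻ (∧ʳ {low u} h))))
   where
   go : ∀ u → low u ≡ true → ∃[ y ] (y ∈ members X.cluster) × u ~ y → adj x u ∧ low u ≡ true
   go u lu (y , i , uy) = by (X.neighbour-near (members⁻ {X.cluster} i) (~-sym uy))
    where
    by : u ≡ x ⊎ x ~ u → adj x u ∧ low u ≡ true
    by (inj₁ refl) = ⊥-elim (<⇒≱ (s≤s (low⇒ {u} (not-true lu))) (≥4 {k = 2} dx))
    by (inj₂ xu) = ∧-true xu lu

  total : ∑ (members X.cluster) (λ y → 5 + lows y) ≡ 5 * X.size + X.s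
  total = trans (∑-+ (members X.cluster) _ _) (cong (_+ X.s) (∑-const (members X.cluster) 5))

  paid-large : 3 ≤ X.size → Paid 5 X.cluster
  paid-large h = ≮⇒≥ λ l → refute (∑ (members X.cluster) deg ∷ beside X.cluster ∷ ∑ (members X.cluster) (λ y → 5 + lows y) ∷ X.size ∷ X.s ∷ X.e ∷ lows x ∷ [])
   (1 ×[ lit 1 ⊕ var 2 ≤ var 0 ⊕ (var 1 ⊕ lit 5) ] ∷ 1 ×[ var 0 ≤ 2 ⊛ var 5 ⊕ var 4 ] ∷ 2 ×[ var 5 ⊕ lit 6 ≤ 3 ⊛ var 3 ]
    ∷ 1 ×[ var 1 ≤ var 6 ] ∷ 1 ×[ var 3 ⊕ var 6 ≤ lit 7 ] ∷ 1 ×[ 5 ⊛ var 3 ⊕ var 4 ≤ var 2 ] ∷ [])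
   (l ∷ ≤-reflexive X.degree-total ∷ X.planar h ∷ beside≤ ∷ ≤-reflexive X.neighbours ∷ ≥-reflexive total ∷ []) refl

  paid-pair : X.size ≡ 2 → Paid 3 X.cluster
  paid-pair h = ≮⇒≥ λ l → refute (∑ (members X.cluster) deg ∷ beside X.cluster ∷ ∑ (members X.cluster) (λ y → 5 + lows y) ∷ X.size ∷ X.s ∷ X.e ∷ lows x ∷ [])
   (1 ×[ lit 1 ⊕ var 2 ≤ var 0 ⊕ (var 1 ⊕ lit 3) ] ∷ 1 ×[ var 0 ≤ 2 ⊛ var 5 ⊕ var 4 ] ∷ 2 ×[ var 5 ≤ lit 1 ]
    ∷ 1 ×[ var 1 ≤ var 6 ] ∷ 1 ×[ var 3 ⊕ var 6 ≤ lit 7 ] ∷ 6 ×[ lit 2 ≤ var 3 ] ∷ 1 ×[ 5 ⊛ var 3 ⊕ var 4 ≤ var 2 ] ∷ [])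
   (l ∷ ≤-reflexive X.degree-total ∷ X.pair h ∷ beside≤ ∷ ≤-reflexive X.neighbours ∷ ≥-reflexive h ∷ ≥-reflexive total ∷ []) refl

  paid-six : Paid 3 X.cluster
  paid-six = by (X.size ≤? 2)
   where
   by : Dec (X.size ≤ 2) → Paid 3 X.cluster
   by (yes h) = paid-pair (≤-antisym h (X.size≥2 X.x∈))
   by (no h) = ≤-trans (+-monoʳ-≤ (∑ (members X.cluster) deg) (+-monoʳ-≤ (beside X.cluster) (m≤m+n 3 2))) (paid-large (≰⇒> h))

 heavy-mate : ∀ {C} → Closed C → ∀ {y} → C y ≡ true → deg y ≤ 6
 heavy-mate K h = let z , yz , dz = Closed.mate K h in deg≤6 yz (Closed.heavy-in K h) dz

 paid-closed : ∀ {C} → Closed C → Paid 0 C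
 paid-closed {C} K = go C K (<-wellFounded _)
  where
  open import Data.Nat.Induction using (<-wellFounded)
  open import Induction.WellFounded using (Acc; acc)
  go : ∀ C → Closed C → Acc _<_ (length (members C)) → Paid 0 C
  go C K (acc rec) = by (find-or-none (λ x → deg x ℕ≟ 6) (members C))
   where
   by : (∃[ x ] (x ∈ members C) × deg x ≡ 6) ⊎ (∀ {x} → x ∈ members C → deg x ≢ 6) → Paid 0 C
   by (inj₂ none) = paid-five {C} (λ {x} cx → s≤s⁻¹ (≤∧≢⇒< (heavy-mate K cx) (none (∈members {C} cx))))
   by (inj₁ (x , i , dx)) = ≤-trans (+-monoʳ-≤ (∑ (members C) deg) (+-monoʳ-≤ (beside C) (z≤n {3 + 0})))
     (paid-+ {3} {0} {C} {X.cluster} ⊆C (SixPaid.paid-six dx mate) (go R (closed-minus K X.closed) (rec smaller)))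
    where
    mate = Closed.mate K (members⁻ {C} i)
    module X = Six dx mate
    R : Fin n → Bool
    R y = C y ∧ not (X.cluster y)
    ⊆C : ∀ {y} → X.cluster y ≡ true → C y ≡ true
    ⊆C {y} h = in-C (X.cluster⁻ h)
     where
     in-C : 4 ≤ deg y × (y ≡ x ⊎ x ~ y) → C y ≡ true
     in-C (_ , inj₁ refl) = members⁻ {C} i
     in-C (dy , inj₂ xy) = Closed.step K (members⁻ {C} i) dy xy
    smaller : length (members R) < length (members C)
    smaller = ≤-trans (+-monoˡ-≤ (length (members R)) {1} (≤-trans (n≤1+n 1) (X.size≥2 X.x∈)))
     (≥-reflexive (lengths (∑-split C X.cluster Vs (λ _ → 1) ⊆C)))
     where
     lengths : ∑ (members C) (λ _ → 1) ≡ ∑ (members X.cluster) (λ _ → 1) + ∑ (members R) (λ _ → 1) → length (members C) ≡ X.size + length (members R)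
     lengths e = trans (sym (∑-one (members C))) (trans e (cong₂ _+_ (∑-one (members X.cluster)) (∑-one (members R))))

 linked⁺ : ∀ {x y} → 4 ≤ deg x → x ~ y → 4 ≤ deg y → linked x ≡ true
 linked⁺ {x} {y} dx xy dy = ∧-true (⇒heavy {x} dx) (by (lone x) refl)
  where
  by : ∀ b → lone x ≡ b → not (lone x) ≡ true
  by false e = cong not e
  by true  e = ⊥-elim (true≢false (⇒heavy {y} dy) (lone⇒ {x} e xy))

 strong-mate : ∀ {x} → linked x ≡ true → ∃[ y ] x ~ y × 4 ≤ deg y
 strong-mate h = let y , xy , hy = linked-mate h in y , xy , heavy⇒ {y} hy

 linked-closed : Closed linked
 linked-closed = record
  { heavy-in = λ {x} h → heavy⇒ {x} (∧ˡ h)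
  ; step = λ {x} h dy xy → linked⁺ dy (~-sym xy) (heavy⇒ {x} (∧ˡ h))
  ; mate = strong-mate }

 Lo-three : ∀ {u} → u ∈ Lo → deg u ≤ 3
 Lo-three {u} i = low⇒ {u} (not-true (members⁻ {low} i))

 many-lone : 2 ≤ length Al → ∑ Vs deg + 10 ≤ 5 * n
 many-lone two = ≮⇒≥ λ l → refute
  (∑ Vs deg ∷ n ∷ ∑ Lo deg ∷ ∑ Al deg ∷ ∑ Co deg ∷ ∑ Lo (links linked) ∷ beside linked ∷ length Ws ∷ length Lo ∷ length Al ∷ length Co ∷ ∑ Co (λ x → 5 + lows x) ∷ [])
  (1 ×[ lit 1 ⊕ 5 ⊛ var 1 ≤ var 0 ⊕ lit 10 ] ∷ 1 ×[ var 0 ≤ var 2 ⊕ (var 3 ⊕ var 4) ] ∷ 1 ×[ var 2 ⊕ (var 3 ⊕ var 5) ≤ 5 ⊛ var 8 ⊕ (var 6 ⊕ var 7) ]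
   ∷ 1 ×[ var 7 ⊕ lit 10 ≤ 5 ⊛ var 9 ] ∷ 1 ×[ var 4 ⊕ (var 6 ⊕ lit 0) ≤ var 11 ] ∷ 1 ×[ var 11 ≤ 5 ⊛ var 10 ⊕ var 5 ] ∷ 5 ×[ var 8 ⊕ (var 9 ⊕ var 10) ≤ var 1 ] ∷ [])
  (l ∷ ≤-reflexive (∑-kinds deg) ∷ low-side ∷ claws-bound claws two ∷ paid-closed linked-closed
   ∷ ≤-reflexive (trans (∑-+ Co _ _) (cong₂ _+_ (∑-const Co 5) (lows-at linked))) ∷ ≤-reflexive kind-sizes ∷ []) refl
  where
  Ws : List (Fin n)
  Ws = filterᵇ (λ u → links lone u ≡ᵇ 3) Lo
  tip : ∀ {w} → w ∈ Ws → (w ∈ Lo) × links lone w ≡ 3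
  tip {w} i = proj₁ (∈-filter⁻ (λ u → links lone u ≡ᵇ 3) i) , three (proj₂ (∈-filter⁻ (λ u → links lone u ≡ᵇ 3) {Lo} i))
   where
   three : ∀ {k} → (k ≡ᵇ 3) ≡ true → k ≡ 3
   three {3} _ = refl
  claws : Claws P Al Ws
  claws = record
   { bases! = members! lone ; tips! = unique-filter (λ u → links lone u ≡ᵇ 3) (members! low)
   ; outside = λ i j → λ { refl → true≢false (lone⊆ (members⁻ {lone} j)) (not-true (members⁻ {low} (proj₁ (tip i)))) }
   ; independent = λ {w} {w′} i j → ≁ λ ww′ → true≢false
     (lone⊆ {w′} (members⁻ {lone} (exhaustive _≟_ (adj w) (unique-filter (adj w) (members! lone)) (λ k → ∈V , proj₂ (∈-filter⁻ (adj w) {Al} k))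
      (≤-trans (Lo-three (proj₁ (tip i))) (≥-reflexive (trans (length-filter (adj w) Al) (proj₂ (tip i)))) ) ∈V ww′ |> λ k → proj₁ (∈-filter⁻ (adj w) {Al} k))))
     (not-true (members⁻ {low} (proj₁ (tip j))))
   ; three = λ i → proj₂ (tip i) }
   where
   infixl 0 _|>_
   _|>_ : ∀ {A B : Set} → A → (A → B) → B
   a |> f = f a
  low-side : ∑ Lo deg + (∑ Al deg + ∑ Lo (links linked)) ≤ 5 * length Lo + (beside linked + length Ws)
  low-side = ≤-trans (≤-reflexive (trans (cong (λ k → ∑ Lo deg + (k + ∑ Lo (links linked))) lone-degrees) (trans (cong (∑ Lo deg +_) (sym (∑-+ Lo _ _))) (sym (∑-+ Lo _ _)))))
   (≤-trans (∑-mono Lo λ {u} i → each (deg u) (links lone u) (links linked u) (Lo-three i) (degree≥ u))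
    (≤-reflexive (trans (∑-+ Lo _ _) (cong₂ _+_ (∑-const Lo 5)
     (trans (∑-+ Lo _ _) (cong (beside linked +_) (sym (length-filter (λ u → links lone u ≡ᵇ 3) Lo))))))))
   where
   each : ∀ d a c → d ≤ 3 → a + c ≤ d → d + (a + c) ≤ 5 + (bit (0 <ᵇ c) + bit (a ≡ᵇ 3))
   each d a (suc c) h k = ≤-trans (+-mono-≤ h (≤-trans k h)) (m≤m+n 6 _)
   each d 0 zero h k = ≤-trans (+-mono-≤ h z≤n) (s≤s (s≤s (s≤s z≤n)))
   each d 1 zero h k = ≤-trans (+-monoˡ-≤ 1 h) (s≤s (s≤s (s≤s (s≤s z≤n))))
   each d 2 zero h k = +-monoˡ-≤ 2 h
   each d 3 zero h k = +-monoˡ-≤ 3 h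
   each d (suc (suc (suc (suc a)))) zero h k = ⊥-elim (<⇒≱ {3} (≤-trans (m≤m+n 4 _) (≤-trans k h)) ≤-refl)

 module OneLone {z} (only : Al ≡ z ∷ []) (big : 10 ≤ n) where
  at-lone≤1 : ∀ u → links lone u ≤ 1
  at-lone≤1 u = ≤-trans (count≤length (adj u) Al) (≤-reflexive (cong length only))

  z-lone : lone z ≡ true
  z-lone = members⁻ {lone} (subst (z ∈_) (sym only) #0)

  at-lone : ∀ {u} → 1 ≤ links lone u → z ~ u
  at-lone {u} h = ~-sym (go (count-pos (adj u) Al h))
   where
   go : ∃[ y ] (y ∈ Al) × u ~ y → u ~ z
   go (y , i , uy) = use (subst (y ∈_) only i)
    where
    use : y ∈ z ∷ [] → u ~ z
    use #0 = uy

  n-sizes : length Lo + (1 + length Co) ≡ n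
  n-sizes = trans (cong (λ k → length Lo + (k + length Co)) (sym (cong length only))) kind-sizes

  z-degree : 4 ≤ ∑ Lo (links lone)
  z-degree = ≤-trans (heavy⇒ {z} (lone⊆ z-lone)) (≤-trans (≥-reflexive (trans (cong (λ xs → ∑ xs deg) only) (+-identityʳ (deg z)))) (≤-reflexive lone-degrees))

  lows≥4 : 4 ≤ length Lo
  lows≥4 = ≤-trans z-degree (≤-trans (∑-mono Lo λ {u} _ → at-lone≤1 u) (≤-reflexive (∑-one Lo)))

  module NoSix (≤5 : ∀ {x} → linked x ≡ true → deg x ≤ 5) where

   low-side : ∑ Lo deg + (∑ Al deg + length Lo) ≤ 5 * length Lo
   low-side = ≤-trans (≤-reflexive (trans (cong₂ (λ j k → ∑ Lo deg + (j + k)) lone-degrees (sym (∑-one Lo)))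
     (trans (cong (∑ Lo deg +_) (sym (∑-+ Lo _ _))) (sym (∑-+ Lo _ _)))))
    (≤-trans (∑-mono Lo λ {u} i → +-mono-≤ (Lo-three i) (+-monoˡ-≤ 1 (at-lone≤1 u))) (≤-reflexive (∑-const Lo 5)))

   linked-side : ∑ Co deg ≤ 5 * length Co
   linked-side = ≤-trans (∑-mono Co λ i → ≤5 (members⁻ {linked} i)) (≤-reflexive (∑-const Co 5))

   module Tight (many : 5 * n < ∑ Vs deg + 10) where

    four-lows : length Lo ≤ 4
    four-lows = ≮⇒≥ λ h → refute (∑ Vs deg ∷ n ∷ ∑ Lo deg ∷ ∑ Al deg ∷ ∑ Co deg ∷ length Lo ∷ length Co ∷ [])
     (1 ×[ lit 1 ⊕ 5 ⊛ var 1 ≤ var 0 ⊕ lit 10 ] ∷ 1 ×[ var 0 ≤ var 2 ⊕ (var 3 ⊕ var 4) ] ∷ 1 ×[ var 2 ⊕ (var 3 ⊕ var 5) ≤ 5 ⊛ var 5 ]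
      ∷ 1 ×[ var 4 ≤ 5 ⊛ var 6 ] ∷ 5 ×[ var 5 ⊕ (lit 1 ⊕ var 6) ≤ var 1 ] ∷ 1 ×[ lit 5 ≤ var 5 ] ∷ [])
     (many ∷ ≤-reflexive (∑-kinds deg) ∷ low-side ∷ linked-side ∷ ≤-reflexive n-sizes ∷ h ∷ []) refl

    all-five : ∀ {x} → linked x ≡ true → deg x ≡ 5
    all-five {x} cx = ≤-antisym (≤5 cx) (≮⇒≥ λ h → refute (∑ Vs deg ∷ n ∷ ∑ Lo deg ∷ ∑ Al deg ∷ ∑ Co deg ∷ length Lo ∷ length Co ∷ ∑ Co (λ _ → 5) ∷ [])
     (1 ×[ lit 1 ⊕ 5 ⊛ var 1 ≤ var 0 ⊕ lit 10 ] ∷ 1 ×[ var 0 ≤ var 2 ⊕ (var 3 ⊕ var 4) ] ∷ 1 ×[ var 2 ⊕ (var 3 ⊕ var 5) ≤ 5 ⊛ var 5 ]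
      ∷ 1 ×[ lit 1 ⊕ var 4 ≤ var 7 ] ∷ 1 ×[ var 7 ≤ 5 ⊛ var 6 ] ∷ 5 ×[ var 5 ⊕ (lit 1 ⊕ var 6) ≤ var 1 ] ∷ 1 ×[ lit 4 ≤ var 5 ] ∷ [])
     (many ∷ ≤-reflexive (∑-kinds deg) ∷ low-side ∷ ∑-strict Co (λ i → ≤5 (members⁻ {linked} i)) (∈members {linked} cx) h
      ∷ ≤-reflexive (∑-const Co 5) ∷ ≤-reflexive n-sizes ∷ lows≥4 ∷ []) refl)

    two-lows : ∀ {x} → linked x ≡ true → 2 ≤ lows x
    two-lows {x} cx = ≮⇒≥ λ h → four-fives (+-cancelʳ-≤ 1 4 _ (≤-trans (≥-reflexive (trans kinds (all-five cx))) (+-monoʳ-≤ (fives-at x) (s≤s⁻¹ h))))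
     where
     linked-of : ∀ {y} → x ~ y → heavy y ≡ true → linked y ≡ true
     linked-of {y} xy h = Closed.step linked-closed cx (heavy⇒ {y} h) xy
     kinds : fives-at x + lows x ≡ deg x
     kinds = trans (sym (∑-+ Vs _ _)) (∑-cong Vs λ {y} _ → by y (adj x y) (heavy y) refl refl)
      where
      by : ∀ y a b → adj x y ≡ a → heavy y ≡ b → bit (a ∧ five y) + bit (a ∧ not b) ≡ bit a
      by y false b _ _ = refl
      by y true true e f rewrite ⇒five {y} (all-five (linked-of e f)) = refl
      by y true false e f = cong (_+ 1) (cong bit (nf (five y) refl))
       where
       nf : ∀ c → five y ≡ c → five y ≡ false
       nf false g = g
       nf true  g = ⊥-elim (true≢false (⇒heavy {y} (≥4 (five⇒ {y} g))) f)
     Mate : Fin n → Set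
     Mate y = (y ∈ Vs) × adj x y ∧ five y ≡ true
     four-fives : 4 ≤ fives-at x → ⊥
     four-fives h = go (filterᵇ (λ y → adj x y ∧ five y) Vs) (unique-filter _ Vs!) (∈-filter⁻ (λ y → adj x y ∧ five y))
      (≤-trans h (≥-reflexive (length-filter (λ y → adj x y ∧ five y) Vs)))
      where
      near-x : ∀ {y} → Mate y → x ~ y
      near-x (_ , e) = ∧ˡ e
      meet : ∀ {y y′} → Mate y → Mate y′ → y ≢ y′ → y ~ y′
      meet {y} {y′} m@(_ , e) m′@(_ , e′) ne = five-transitive (five⇒ {y} (∧ʳ {adj x y} e)) (all-five cx) (five⇒ {y′} (∧ʳ {adj x y′} e′)) (~-sym (near-x m)) (near-x m′) ne
      go : ∀ zs → Unique zs → (∀ {y} → y ∈ zs → Mate y) → 4 ≤ length zs → ⊥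
      go (a ∷ []) _ _ (s≤s ())
      go (a ∷ b ∷ []) _ _ (s≤s (s≤s ()))
      go (a ∷ b ∷ c ∷ []) _ _ (s≤s (s≤s (s≤s ())))
      go (a ∷ b ∷ c ∷ d ∷ zs) ((ab ∷ ac ∷ ad ∷ _) ∷ (bc ∷ bd ∷ _) ∷ (cd ∷ _) ∷ _) s _ =
       K₅-free P (near-x ma) (near-x mb) (near-x mc) (near-x md) (meet ma mb ab) (meet ma mc ac) (meet ma md ad) (meet mb mc bc) (meet mb md bd) (meet mc md cd)
       where
       ma = s #0
       mb = s #1
       mc = s #2
       md = s #3

    impossible : ⊥
    impossible = refute (length Lo ∷ length Co ∷ n ∷ ∑ Lo (links linked) ∷ ∑ Lo (links lone) ∷ [])
     (2 ×[ lit 10 ≤ var 2 ] ∷ 2 ×[ var 2 ≤ var 0 ⊕ (lit 1 ⊕ var 1) ] ∷ 5 ×[ var 0 ≤ lit 4 ] ∷ 1 ×[ 2 ⊛ var 1 ≤ var 3 ] ∷ 1 ×[ var 4 ⊕ var 3 ≤ 3 ⊛ var 0 ] ∷ 1 ×[ lit 4 ≤ var 4 ] ∷ [])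
     (big ∷ ≥-reflexive n-sizes ∷ four-lows
      ∷ ≤-trans (≥-reflexive (∑-const Co 2)) (≤-trans (∑-mono Co λ i → two-lows (members⁻ {linked} i)) (≤-reflexive (lows-at linked)))
      ∷ ≤-trans (≥-reflexive (∑-+ Lo _ _)) (≤-trans (∑-mono Lo λ {u} i → ≤-trans (degree≥ u) (Lo-three i)) (≤-reflexive (∑-const Lo 3)))
      ∷ z-degree ∷ []) refl

  module WithSix {x} (cx : linked x ≡ true) (dx : deg x ≡ 6) where
   mate : ∃[ y ] x ~ y × 4 ≤ deg y
   mate = strong-mate cx
   module S = SixPaid dx mate
   module X = Six dx mate
   R : Fin n → Bool
   R v = linked v ∧ not (X.cluster v)

   ⊆linked : ∀ {v} → X.cluster v ≡ true → linked v ≡ true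
   ⊆linked {v} h = go (X.cluster⁻ h)
    where
    go : 4 ≤ deg v × (v ≡ x ⊎ x ~ v) → linked v ≡ true
    go (_ , inj₁ refl) = cx
    go (dv , inj₂ xv) = Closed.step linked-closed cx dv xv

   degree≥′ : ∀ u → links lone u + (links X.cluster u + links R u) ≤ deg u
   degree≥′ u = ≤-trans (≤-reflexive (cong (links lone u +_) (sym (at-+ {linked} {X.cluster} ⊆linked u)))) (degree≥ u)

   finish : ∀ {k} (σ : Fin n → ℕ) → Paid k X.cluster → (∀ {u} → u ∈ Lo → deg u + (links lone u + (links X.cluster u + (links R u + σ u))) ≤ 5 + (bit (0 <ᵇ links X.cluster u) + bit (0 <ᵇ links R u))) →
    5 ≤ k + ∑ Lo σ → ∑ Vs deg + 10 ≤ 5 * n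
   finish {k} σ paid each enough = ≮⇒≥ λ l → refute
    (∑ Vs deg ∷ n ∷ ∑ Lo deg ∷ ∑ Al deg ∷ ∑ Co deg ∷ ∑ (members X.cluster) deg ∷ ∑ (members R) deg ∷ beside X.cluster ∷ beside R ∷ length Lo ∷ length Co
     ∷ ∑ Lo (links X.cluster) ∷ ∑ Lo (links R) ∷ ∑ Lo σ ∷ k ∷ length (members X.cluster) ∷ length (members R) ∷ ∑ (members X.cluster) (λ x → 5 + lows x) ∷ ∑ (members R) (λ x → 5 + lows x) ∷ [])
    (1 ×[ lit 1 ⊕ 5 ⊛ var 1 ≤ var 0 ⊕ lit 10 ] ∷ 1 ×[ var 0 ≤ var 2 ⊕ (var 3 ⊕ var 4) ] ∷ 1 ×[ var 4 ≤ var 5 ⊕ var 6 ]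
     ∷ 1 ×[ var 2 ⊕ (var 3 ⊕ (var 11 ⊕ (var 12 ⊕ var 13))) ≤ 5 ⊛ var 9 ⊕ (var 7 ⊕ var 8) ]
     ∷ 1 ×[ var 5 ⊕ (var 7 ⊕ var 14) ≤ var 17 ] ∷ 1 ×[ var 6 ⊕ (var 8 ⊕ lit 0) ≤ var 18 ] ∷ 1 ×[ var 17 ≤ 5 ⊛ var 15 ⊕ var 11 ] ∷ 1 ×[ var 18 ≤ 5 ⊛ var 16 ⊕ var 12 ]
     ∷ 5 ×[ var 15 ⊕ var 16 ≤ var 10 ] ∷ 5 ×[ var 9 ⊕ (lit 1 ⊕ var 10) ≤ var 1 ] ∷ 1 ×[ lit 5 ≤ var 14 ⊕ var 13 ] ∷ [])
    (l ∷ ≤-reflexive (∑-kinds deg) ∷ ≤-reflexive (∑-split linked X.cluster Vs deg ⊆linked) ∷ low-side ∷ paid ∷ paid-closed (closed-minus linked-closed X.closed)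
     ∷ split X.cluster ∷ split R ∷ ≤-reflexive (trans (sym (cong₂ _+_ (∑-one (members X.cluster)) (∑-one (members R)))) (trans (sym (∑-split linked X.cluster Vs (λ _ → 1) ⊆linked)) (∑-one Co)))
     ∷ ≤-reflexive n-sizes ∷ enough ∷ []) refl
    where
    split : ∀ C → ∑ (members C) (λ x → 5 + lows x) ≤ 5 * length (members C) + ∑ Lo (links C)
    split C = ≤-reflexive (trans (∑-+ (members C) _ _) (cong₂ _+_ (∑-const (members C) 5) (lows-at C)))
    low-side : ∑ Lo deg + (∑ Al deg + (∑ Lo (links X.cluster) + (∑ Lo (links R) + ∑ Lo σ))) ≤ 5 * length Lo + (beside X.cluster + beside R)
    low-side = ≤-trans (≤-reflexive (trans (cong (λ k → ∑ Lo deg + (k + (∑ Lo (links X.cluster) + (∑ Lo (links R) + ∑ Lo σ)))) lone-degrees)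
      (trans (cong (λ k → ∑ Lo deg + (∑ Lo (links lone) + (∑ Lo (links X.cluster) + k))) (sym (∑-+ Lo _ _)))
      (trans (cong (λ k → ∑ Lo deg + (∑ Lo (links lone) + k)) (sym (∑-+ Lo _ _))) (trans (cong (∑ Lo deg +_) (sym (∑-+ Lo _ _))) (sym (∑-+ Lo _ _)))))))
     (≤-trans (∑-mono Lo each) (≤-reflexive (trans (∑-+ Lo _ _) (cong₂ _+_ (∑-const Lo 5) (∑-+ Lo _ _)))))

   plain : ∀ d a p r → d ≤ 3 → a ≤ 1 → a + (p + r) ≤ d → d + (a + (p + (r + 0))) ≤ 5 + (bit (0 <ᵇ p) + bit (0 <ᵇ r))
   plain d a zero zero h k l = ≤-trans (+-mono-≤ h (+-monoˡ-≤ 0 k)) (n≤1+n 4)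
   plain d a zero (suc r) h k l = ≤-trans (+-mono-≤ h (≤-trans (≤-reflexive (cong (a +_) (+-identityʳ (suc r)))) (≤-trans l h))) ≤-refl
   plain d a (suc p) r h k l = ≤-trans (+-mono-≤ h (≤-trans (≤-reflexive (cong (λ i → a + (suc p + i)) (+-identityʳ r))) (≤-trans l h))) (m≤m+n 6 _)

   large : 3 ≤ X.size → ∑ Vs deg + 10 ≤ 5 * n
   large h = finish {5} (λ _ → 0) (S.paid-large h) (λ {u} i → plain (deg u) (links lone u) (links X.cluster u) (links R u) (Lo-three i) (at-lone≤1 u) (degree≥′ u)) (m≤m+n 5 _)

   module Pair (two : X.size ≡ 2) where
    y : Fin n
    y = proj₁ mate

    xy : x ~ y
    xy = proj₁ (proj₂ mate)

    y∈ : X.cluster y ≡ true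
    y∈ = X.near (proj₂ (proj₂ mate)) xy

    spare : Fin n → Bool
    spare u = adj x u ∧ not ((2 ≤ᵇ links X.cluster u) ∧ (1 ≤ᵇ links lone u))

    bounded : ∀ u → links X.cluster u ≤ 2
    bounded u = ≤-trans (count≤length (adj u) (members X.cluster)) (≤-reflexive two)

    x∈links : ∀ {u} → x ~ u → 1 ≤ links X.cluster u
    x∈links {u} xu = length≤count (adj u) {x ∷ []} ([] ∷ []) λ { #0 → ∈members {X.cluster} X.x∈ , ~-sym xu }

    each : ∀ {u} → u ∈ Lo → deg u + (links lone u + (links X.cluster u + (links R u + bit (spare u)))) ≤ 5 + (bit (0 <ᵇ links X.cluster u) + bit (0 <ᵇ links R u))
    each {u} i = by (adj x u) refl
     where
     careful : ∀ d a p r → d ≤ 3 → a ≤ 1 → a + (p + r) ≤ d → 1 ≤ p → p ≤ 2 → d + (a + (p + (r + bit (not ((2 ≤ᵇ p) ∧ (1 ≤ᵇ a)))))) ≤ 5 + (bit (0 <ᵇ p) + bit (0 <ᵇ r))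
     careful d a (suc p) (suc r) h k l _ _ = ≤-trans (≤-trans (≤-reflexive (shuffle d a p r (bit (not ((2 ≤ᵇ suc p) ∧ (1 ≤ᵇ a))))))
       (+-mono-≤ (+-mono-≤ h (≤-trans l h)) (bit≤1 (not ((2 ≤ᵇ suc p) ∧ (1 ≤ᵇ a)))))) ≤-refl
      where
      shuffle : ∀ d a p r b → d + (a + (suc p + (suc r + b))) ≡ (d + (a + (suc p + suc r))) + b
      shuffle d a p r b = trans (cong (λ k → d + (a + k)) (sym (+-assoc (suc p) (suc r) b))) (trans (cong (d +_) (sym (+-assoc a (suc p + suc r) b))) (sym (+-assoc d _ b)))
     careful d 0 1 0 h k l _ _ = ≤-trans (+-monoˡ-≤ 2 h) (n≤1+n 5)
     careful d 1 1 0 h k l _ _ = +-monoˡ-≤ 3 h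
     careful d 0 2 0 h k l _ _ = +-monoˡ-≤ 3 h
     careful d 1 2 0 h k l _ _ = +-monoˡ-≤ 3 h
     careful d (suc (suc a)) p 0 h (s≤s ()) l _ _
     careful d a (suc (suc (suc p))) 0 h k l _ (s≤s (s≤s ()))
     by : ∀ b → adj x u ≡ b → deg u + (links lone u + (links X.cluster u + (links R u + bit (b ∧ not ((2 ≤ᵇ links X.cluster u) ∧ (1 ≤ᵇ links lone u)))))) ≤ 5 + (bit (0 <ᵇ links X.cluster u) + bit (0 <ᵇ links R u))
     by false e = plain (deg u) (links lone u) (links X.cluster u) (links R u) (Lo-three i) (at-lone≤1 u) (degree≥′ u)
     by true e = careful (deg u) (links lone u) (links X.cluster u) (links R u) (Lo-three i) (at-lone≤1 u) (degree≥′ u) (x∈links e) (bounded u)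

    spares : 3 ≤ count spare Lo
    spares = ≮⇒≥ λ h → go (pick₃ full (members! low) (+-cancelˡ-≤ 2 3 _ (≤-trans (≤-reflexive five-lows) (≤-trans split (+-monoˡ-≤ _ (s≤s⁻¹ h))))))
     where
     full : Fin n → Bool
     full u = adj x u ∧ ((2 ≤ᵇ links X.cluster u) ∧ (1 ≤ᵇ links lone u))
     five-lows : 5 ≡ lows x
     five-lows = sym (+-cancelˡ-≡ 2 _ _ (trans (cong (_+ lows x) (sym two)) X.neighbours))
     split : lows x ≤ count spare Lo + count full Lo
     split = ≤-trans (≤-trans (∑-mono Vs λ {u} _ → flip (adj x u) (low u)) (≥-reflexive (count-filter low (adj x) Vs)))
      (≤-reflexive (trans (∑-cong Lo λ {u} _ → e (adj x u) ((2 ≤ᵇ links X.cluster u) ∧ (1 ≤ᵇ links lone u))) (∑-+ Lo _ _)))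
      where
      flip : ∀ a b → bit (a ∧ b) ≤ bit (b ∧ a)
      flip true  true  = ≤-refl
      flip true  false = z≤n
      flip false b     = z≤n
      e : ∀ a b → bit a ≡ bit (a ∧ not b) + bit (a ∧ b)
      e true  true  = refl
      e true  false = refl
      e false b     = refl
     Full : Fin n → Set
     Full u = (u ∈ Lo) × full u ≡ true
     x~ : ∀ {u} → Full u → x ~ u
     x~ (_ , e) = ∧ˡ e
     y~ : ∀ {u} → Full u → y ~ u
     y~ {u} (_ , e) = ~-sym (proj₂ (∈-filter⁻ (adj u) {members X.cluster} (exhaustive _≟_ X.cluster (unique-filter (adj u) (members! X.cluster))
      (λ j → ∈V , members⁻ {X.cluster} (proj₁ (∈-filter⁻ (adj u) {members X.cluster} j)))
      (≤-trans (≤-reflexive (trans (sym (length-filter X.cluster Vs)) two)) (≤-trans (two≤ (∧ˡ (∧ʳ {adj x u} e))) (≥-reflexive (length-filter (adj u) (members X.cluster)))))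
      ∈V y∈)))
      where
      two≤ : ∀ {k} → (2 ≤ᵇ k) ≡ true → 2 ≤ k
      two≤ {suc (suc k)} _ = s≤s (s≤s z≤n)
     z~ : ∀ {u} → Full u → z ~ u
     z~ {u} (_ , e) = at-lone {u} (positive⁻ (∧ʳ {2 ≤ᵇ links X.cluster u} (∧ʳ {adj x u} e)))
     ≢z : ∀ {v} → linked v ≡ true → v ≢ z
     ≢z {v} cv refl = true≢false z-lone (not-true (∧ʳ {heavy v} cv))
     go : Three Full → ⊥
     go (a , b , c , (ab , ac , bc) , fa , fb , fc) = K₃₃-free P (~⇒≢ xy) (≢z cx) (≢z (⊆linked y∈)) ab ac bc
      (x~ fa) (x~ fb) (x~ fc) (y~ fa) (y~ fb) (y~ fc) (z~ fa) (z~ fb) (z~ fc)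

    small : ∑ Vs deg + 10 ≤ 5 * n
    small = finish {3} (λ u → bit (spare u)) (S.paid-pair two) each (≤-trans (n≤1+n 5) (+-monoʳ-≤ 3 spares))

   with-six : ∑ Vs deg + 10 ≤ 5 * n
   with-six = by (X.size ≤? 2)
    where
    by : Dec (X.size ≤ 2) → ∑ Vs deg + 10 ≤ 5 * n
    by (yes h) = Pair.small (≤-antisym h (X.size≥2 X.x∈))
    by (no h) = large (≰⇒> h)

  one-lone : ∑ Vs deg + 10 ≤ 5 * n
  one-lone = by (find-or-none (λ x → deg x ℕ≟ 6) Co)
   where
   by : (∃[ x ] (x ∈ Co) × deg x ≡ 6) ⊎ (∀ {x} → x ∈ Co → deg x ≢ 6) → ∑ Vs deg + 10 ≤ 5 * n
   by (inj₁ (x , i , dx)) = WithSix.with-six (members⁻ {linked} i) dx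
   by (inj₂ none) = ≮⇒≥ λ many → NoSix.Tight.impossible (λ {x} cx → s≤s⁻¹ (≤∧≢⇒< (heavy-mate linked-closed cx) (none (∈members {linked} cx)))) many

 degree-bound : 10 ≤ n → ∑ Vs deg + 10 ≤ 5 * n
 degree-bound big = by Al refl
  where
  by : ∀ xs → Al ≡ xs → ∑ Vs deg + 10 ≤ 5 * n
  by [] none = dense-bound (λ {x} dx → strong-mate {x} (∧-true (⇒heavy {x} dx) (no-lone (lone x) refl))) big
   where
   no-lone : ∀ {x} b → lone x ≡ b → not b ≡ true
   no-lone false e = refl
   no-lone {x} true  e = ⊥-elim (empty (subst (x ∈_) none (∈members {lone} e)))
    where
    empty : ¬ (x ∈ [])
    empty ()
  by (z ∷ []) only = OneLone.one-lone only big
  by (z ∷ z′ ∷ zs) e = many-lone (≤-trans (s≤s (s≤s z≤n)) (≥-reflexive (cong length e)))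

module TwoBound {n} (G : Graph (Fin n)) (D : Drawing G) (free : S 2 2 Free G) where
 open import Data.Fin.Properties using (_≟_)
 open Kinds G D

 heavy : Fin n → Bool
 heavy x = 3 ≤ᵇ deg x

 heavy⇒ : ∀ {x} → heavy x ≡ true → 3 ≤ deg x
 heavy⇒ {x} h = ≤ᵇ⇒≤ 3 (deg x) (Equivalence.from T-≡ h)

 ⇒heavy : ∀ {x} → 3 ≤ deg x → heavy x ≡ true
 ⇒heavy h = Equivalence.to T-≡ (≤⇒≤ᵇ h)

 open Split heavy

 key : ∀ {x y} → x ~ y → 3 ≤ deg x → 3 ≤ deg y → deg x + deg y ≤ 5 + common x y
 key = star-free-degrees free

 linked≤4 : ∀ {x} → linked x ≡ true → deg x ≤ 4
 linked≤4 {x} h = go (linked-mate h)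
  where
  go : ∃[ y ] x ~ y × heavy y ≡ true → deg x ≤ 4
  go (y , xy , hy) = +-cancelʳ-≤ (deg y) _ 4 (≤-trans (key xy (heavy⇒ {x} (∧ˡ h)) (heavy⇒ {y} hy))
   (+-monoʳ-≤ 4 (private-bound {x} {y} ([] ∷ []) ((~-sym xy , adj-irrefl x) ∷ []))))

 Lo-two : ∀ {u} → u ∈ Lo → deg u ≤ 2
 Lo-two {u} i = ≮⇒≥ λ k → true≢false (⇒heavy {u} k) (not-true (members⁻ {low} i))

 Co-four : ∑ Co deg ≤ 4 * length Co
 Co-four = ≤-trans (∑-mono Co λ i → linked≤4 (members⁻ {linked} i)) (≤-reflexive (∑-const Co 4))

 low-side : ∀ k → (∀ {u} → u ∈ Lo → deg u + links lone u ≤ k) → ∑ Lo deg + ∑ Al deg ≤ k * length Lo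
 low-side k h = ≤-trans (≤-reflexive (trans (cong (∑ Lo deg +_) lone-degrees) (sym (∑-+ Lo _ _))))
  (≤-trans (∑-mono Lo h) (≤-reflexive (∑-const Lo k)))

 many-lone : 2 ≤ length Al → ∑ Vs deg + 7 ≤ 4 * n
 many-lone two = ≮⇒≥ λ l → refute (∑ Vs deg ∷ n ∷ ∑ Lo deg ∷ ∑ Al deg ∷ ∑ Co deg ∷ length Lo ∷ length Al ∷ length Co ∷ [])
  (1 ×[ lit 1 ⊕ 4 ⊛ var 1 ≤ var 0 ⊕ lit 7 ] ∷ 1 ×[ var 0 ≤ var 2 ⊕ (var 3 ⊕ var 4) ] ∷ 1 ×[ var 2 ⊕ var 3 ≤ 4 ⊛ var 5 ] ∷ 1 ×[ var 4 ≤ 4 ⊛ var 7 ]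
   ∷ 4 ×[ lit 2 ≤ var 6 ] ∷ 4 ×[ var 5 ⊕ (var 6 ⊕ var 7) ≤ var 1 ] ∷ [])
  (l ∷ ≤-reflexive (∑-kinds deg) ∷ low-side 4 (λ {u} i → +-mono-≤ (Lo-two i) (≤-trans (≤-trans (m≤m+n (links lone u) _) (degree≥ u)) (Lo-two i))) ∷ Co-four ∷ two ∷ ≤-reflexive kind-sizes ∷ []) refl

 one-lone : length Al ≡ 1 → ∑ Vs deg + 7 ≤ 4 * n
 one-lone one = go (count-pos lone Vs (≥-reflexive (trans (sym (length-filter lone Vs)) one)))
  where
  go : ∃[ z ] (z ∈ Vs) × lone z ≡ true → ∑ Vs deg + 7 ≤ 4 * n
  go (z , _ , lz) = ≮⇒≥ λ l → refute (∑ Vs deg ∷ n ∷ ∑ Lo deg ∷ ∑ Al deg ∷ ∑ Co deg ∷ length Lo ∷ length Al ∷ length Co ∷ [])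
   (1 ×[ lit 1 ⊕ 4 ⊛ var 1 ≤ var 0 ⊕ lit 7 ] ∷ 1 ×[ var 0 ≤ var 2 ⊕ (var 3 ⊕ var 4) ] ∷ 1 ×[ var 2 ⊕ var 3 ≤ 3 ⊛ var 5 ] ∷ 1 ×[ var 4 ≤ 4 ⊛ var 7 ]
    ∷ 4 ×[ lit 1 ≤ var 6 ] ∷ 1 ×[ lit 3 ≤ var 5 ] ∷ 4 ×[ var 5 ⊕ (var 6 ⊕ var 7) ≤ var 1 ] ∷ [])
   (l ∷ ≤-reflexive (∑-kinds deg) ∷ low-side 3 (λ {u} i → +-mono-≤ (Lo-two i) (≤-trans (count≤length (adj u) Al) (≤-reflexive one))) ∷ Co-four ∷ ≥-reflexive one
    ∷ ≤-trans (heavy⇒ {z} (∧ˡ lz)) (≤-trans (count-mono Vs λ {u} _ zu → cong not (lone⇒ {z} lz zu)) (≥-reflexive (length-filter low Vs)))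
    ∷ ≤-reflexive kind-sizes ∷ []) refl

 module NoLone (≤4 : ∀ v → deg v ≤ 4) (mate : ∀ {x} → 3 ≤ deg x → ∃[ y ] x ~ y × heavy y ≡ true) where
  four : Fin n → Bool
  four x = deg x ≡ᵇ 4

  four⇒ : ∀ {x} → four x ≡ true → deg x ≡ 4
  four⇒ {x} h = ≡ᵇ⇒≡ (deg x) 4 (Equivalence.from T-≡ h)

  fours others : Fin n → ℕ
  fours v = count (λ w → adj v w ∧ four w) Vs
  others v = count (λ w → adj v w ∧ not (four w)) Vs

  fours+others : ∀ v → fours v + others v ≡ deg v
  fours+others v = trans (sym (∑-+ Vs _ _)) (∑-cong Vs λ {w} _ → e (adj v w) (four w))
   where
   e : ∀ a b → bit (a ∧ b) + bit (a ∧ not b) ≡ bit a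
   e true  true  = refl
   e true  false = refl
   e false b     = refl

  twins : ∀ {x y a} → deg x ≡ 4 → deg y ≡ 4 → x ~ y → x ~ a → a ≢ y → y ~ a
  twins {x} {y} {a} dx dy xy xa ay = by-contradiction λ ya → <⇒≱
   (private-bound {y} {x} {y ∷ a ∷ []} (((ay ∘ sym) ∷ []) ∷ [] ∷ []) ((xy , adj-irrefl y) ∷ (xa , ya) ∷ []))
   (≤-trans (≤-reflexive dx) (≤-trans (s≤s 3≤) ≤-refl))
   where
   3≤ : 3 ≤ common y x
   3≤ = +-cancelˡ-≤ 5 3 _ (≤-trans (≥-reflexive (cong₂ _+_ dy dx)) (key (~-sym xy) (≤-trans (n≤1+n 3) (≥-reflexive dy)) (≤-trans (n≤1+n 3) (≥-reflexive dx))))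

  two-others : ∀ {x} → deg x ≡ 4 → 2 ≤ others x
  two-others {x} dx = ≮⇒≥ λ h → go (pick₃ (λ w → adj x w ∧ four w) Vs!
    (+-cancelʳ-≤ 1 3 _ (≤-trans (≥-reflexive (trans (fours+others x) dx)) (+-monoʳ-≤ (fours x) (s≤s⁻¹ h)))))
   where
   Mate : Fin n → Set
   Mate w = (w ∈ Vs) × adj x w ∧ four w ≡ true
   go : Three Mate → ⊥
   go (a , b , c , (ab , ac , bc) , (_ , ea) , (_ , eb) , (_ , ec)) =
    fourth (find-or-none (λ d → dec d) Vs)
    where
    open import Relation.Nullary.Decidable using (decidable-stable)
    abc = a ∷ b ∷ c ∷ []
    dec : ∀ d → Dec (adj x d ≡ true × ¬ (d ∈ abc))
    dec d = (adj x d ≟ᵇ true) ×-dec ¬? (member? _≟_ d abc)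
    xa = ∧ˡ ea
    xb = ∧ˡ eb
    xc = ∧ˡ ec
    da = four⇒ {a} (∧ʳ {adj x a} ea)
    db = four⇒ {b} (∧ʳ {adj x b} eb)
    dc = four⇒ {c} (∧ʳ {adj x c} ec)
    fourth : (∃[ d ] (d ∈ Vs) × adj x d ≡ true × ¬ (d ∈ abc)) ⊎ (∀ {d} → d ∈ Vs → ¬ (adj x d ≡ true × ¬ (d ∈ abc))) → ⊥
    fourth (inj₁ (d , _ , xd , d∉)) = K₅-free P xa xb xc xd (twins dx da xa xb (ab ∘ sym)) (twins dx da xa xc (ac ∘ sym)) (twins dx da xa xd λ e → d∉ (here e))
     (twins dx db xb xc (bc ∘ sym)) (twins dx db xb xd λ e → d∉ (there (here e))) (twins dx dc xc xd λ e → d∉ (there (there (here e))))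
    fourth (inj₂ none) = <⇒≱ {3} (≥-reflexive dx) (count≤cover (adj x) {ys = abc} Vs! λ {d} i xd → decidable-stable (member? _≟_ d abc) (λ k → none i (xd , k)))

  sent received : Fin n → ℕ
  sent v = bit (not (four v)) * fours v
  received v = bit (four v) * others v

  balance : ∑ Vs sent ≡ ∑ Vs received
  balance = trans (∑-cong Vs λ {v} _ → sym (∑-* Vs (bit (not (four v))) _)) (trans (∑-comm Vs Vs _)
   (∑-cong Vs λ {w} _ → trans (∑-cong Vs λ {v} _ → e (four v) (four w) (adj-sym v w)) (∑-* Vs (bit (four w)) _)))
   where
   e : ∀ a b {c d} → c ≡ d → bit (not a) * bit (c ∧ b) ≡ bit b * bit (d ∧ not a)
   e true  true  {true}  refl = refl
   e true  true  {false} refl = refl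
   e true  false {c}     refl = refl
   e false true  {true}  refl = refl
   e false true  {false} refl = refl
   e false false {true}  refl = refl
   e false false {false} refl = refl

  charge : ∀ v → 5 * deg v + (sent v + 2) ≤ 20 + received v
  charge v = by (four v) refl
   where
   by : ∀ b → four v ≡ b → 5 * deg v + (bit (not b) * fours v + 2) ≤ 20 + bit b * others v
   by true e = +-mono-≤ (*-monoʳ-≤ 5 (≤4 v)) (≤-trans (two-others (four⇒ {v} e)) (m≤m+n _ _))
   by false e = ≮⇒≥ λ l → refute (deg v ∷ fours v ∷ others v ∷ bit false * others v ∷ []) 
    (1 ×[ lit 21 ⊕ var 3 ≤ 5 ⊛ var 0 ⊕ (1 ⊛ var 1 ⊕ lit 2) ] ∷ 6 ×[ var 0 ≤ lit 3 ] ∷ 1 ×[ var 1 ⊕ var 2 ≤ var 0 ] ∷ [])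
    (l ∷ s≤s⁻¹ (≤∧≢⇒< (≤4 v) (λ d → true≢false (f d) e)) ∷ ≤-reflexive (fours+others v) ∷ []) refl
    where
    f : deg v ≡ 4 → four v ≡ true
    f d = Equivalence.to T-≡ (≡⇒≡ᵇ (deg v) 4 d)

  sparse : 16 ≤ n → ∑ Vs deg + 7 ≤ 4 * n
  sparse big = ≮⇒≥ λ l → refute (∑ Vs deg ∷ n ∷ ∑ Vs sent ∷ ∑ Vs received ∷ length Vs ∷ ∑ Vs (λ v → 5 * deg v + (sent v + 2)) ∷ ∑ Vs (λ v → 20 + received v) ∷ [])
   (5 ×[ lit 1 ⊕ 4 ⊛ var 1 ≤ var 0 ⊕ lit 7 ] ∷ 1 ×[ var 5 ≤ var 6 ] ∷ 1 ×[ 5 ⊛ var 0 ⊕ (var 2 ⊕ 2 ⊛ var 4) ≤ var 5 ] ∷ 1 ×[ var 6 ≤ 20 ⊛ var 4 ⊕ var 3 ]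
    ∷ 1 ×[ var 3 ≤ var 2 ] ∷ 18 ×[ var 4 ≤ var 1 ] ∷ 2 ×[ lit 16 ≤ var 1 ] ∷ [])
   (l ∷ ∑-mono Vs (λ {v} _ → charge v)
    ∷ ≥-reflexive (trans (∑-+ Vs _ _) (cong₂ _+_ (∑-* Vs 5 deg) (trans (∑-+ Vs _ _) (cong (∑ Vs sent +_) (∑-const Vs 2)))))
    ∷ ≤-reflexive (trans (∑-+ Vs _ _) (cong (_+ ∑ Vs received) (∑-const Vs 20)))
    ∷ ≥-reflexive balance ∷ ≤-reflexive |V| ∷ big ∷ []) refl

 degree-bound : 16 ≤ n → ∑ Vs deg + 7 ≤ 4 * n
 degree-bound big = by (length Al) refl
  where
  by : ∀ k → length Al ≡ k → ∑ Vs deg + 7 ≤ 4 * n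
  by 0 e = NoLone.sparse ≤4 mate big
   where
   all-linked : ∀ {x} → heavy x ≡ true → linked x ≡ true
   all-linked {x} h = ∧-true h (no-lone (lone x) refl)
    where
    no-lone : ∀ b → lone x ≡ b → not (lone x) ≡ true
    no-lone false f = cong not f
    no-lone true  f = ⊥-elim (<⇒≱ (s≤s z≤n) (≤-trans (length-⊆ {xs = x ∷ []} ([] ∷ []) λ { #0 → ∈members {lone} f }) (≤-reflexive e)))
   mate : ∀ {x} → 3 ≤ deg x → ∃[ y ] x ~ y × heavy y ≡ true
   mate {x} dx = linked-mate (all-linked (⇒heavy {x} dx))
   ≤4 : ∀ v → deg v ≤ 4
   ≤4 v = ≮⇒≥ λ h → <⇒≱ h (linked≤4 (all-linked (⇒heavy {v} (≤-trans (m≤n+m 3 2) h))))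
  by 1 e = one-lone e
  by (suc (suc k)) e = many-lone (≤-trans (s≤s (s≤s z≤n)) (≥-reflexive e))

 edge-bound : 16 ≤ n → edgeCount G + 4 ≤ 2 * n
 edge-bound big = ≮⇒≥ λ l → refute (edgeCount G ∷ n ∷ ∑ Vs deg ∷ [])
  (2 ×[ lit 1 ⊕ 2 ⊛ var 1 ≤ var 0 ⊕ lit 4 ] ∷ 1 ×[ 2 ⊛ var 0 ≤ var 2 ] ∷ 1 ×[ var 2 ⊕ lit 7 ≤ 4 ⊛ var 1 ] ∷ [])
  (l ∷ ≥-reflexive degree-sum ∷ degree-bound big ∷ []) refl

module OneBound {n} (G : Graph (Fin n)) (D : Drawing G) (free : S 1 1 Free G) where
 open import Data.Fin.Properties using (_≟_)
 open import Data.Nat.Divisibility using (_∣_; ∣m∣n⇒∣m+n; ∣-refl; _∣0)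
 open import Data.List.Relation.Binary.Permutation.Propositional using (_↭_; ↭-sym)
 open Kinds G D

 heavy : Fin n → Bool
 heavy x = 2 ≤ᵇ deg x

 heavy⇒ : ∀ {x} → heavy x ≡ true → 2 ≤ deg x
 heavy⇒ {x} h = ≤ᵇ⇒≤ 2 (deg x) (Equivalence.from T-≡ h)

 ⇒heavy : ∀ {x} → 2 ≤ deg x → heavy x ≡ true
 ⇒heavy h = Equivalence.to T-≡ (≤⇒≤ᵇ h)

 open Split heavy

 key : ∀ {x y} → x ~ y → 2 ≤ deg x → 2 ≤ deg y → deg x + deg y ≤ 3 + common x y
 key = star-free-degrees free

 linked-two : ∀ {x} → linked x ≡ true → deg x ≡ 2
 linked-two {x} h = ≤-antisym (go (linked-mate h)) (heavy⇒ {x} (∧ˡ h))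
  where
  go : ∃[ y ] x ~ y × heavy y ≡ true → deg x ≤ 2
  go (y , xy , hy) = +-cancelʳ-≤ (deg y) _ 2 (≤-trans (key xy (heavy⇒ {x} (∧ˡ h)) (heavy⇒ {y} hy))
   (+-monoʳ-≤ 2 (private-bound {x} {y} ([] ∷ []) ((~-sym xy , adj-irrefl x) ∷ []))))

 Lo-one : ∀ {u} → u ∈ Lo → deg u ≤ 1
 Lo-one {u} i = ≮⇒≥ λ k → true≢false (⇒heavy {u} k) (not-true (members⁻ {low} i))

 Co-two : ∑ Co deg ≤ 2 * length Co
 Co-two = ≤-trans (∑-mono Co λ i → ≤-reflexive (linked-two (members⁻ {linked} i))) (≤-reflexive (∑-const Co 2))

 low-side : ∀ k → (∀ {u} → u ∈ Lo → deg u + links lone u ≤ k) → ∑ Lo deg + ∑ Al deg ≤ k * length Lo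
 low-side k h = ≤-trans (≤-reflexive (trans (cong (∑ Lo deg +_) lone-degrees) (sym (∑-+ Lo _ _))))
  (≤-trans (∑-mono Lo h) (≤-reflexive (∑-const Lo k)))

 general-bound : ∑ Vs deg + 2 * length Al ≤ 2 * n
 general-bound = ≮⇒≥ λ l → refute (∑ Vs deg ∷ n ∷ ∑ Lo deg ∷ ∑ Al deg ∷ ∑ Co deg ∷ length Lo ∷ length Al ∷ length Co ∷ [])
  (1 ×[ lit 1 ⊕ 2 ⊛ var 1 ≤ var 0 ⊕ 2 ⊛ var 6 ] ∷ 1 ×[ var 0 ≤ var 2 ⊕ (var 3 ⊕ var 4) ] ∷ 1 ×[ var 2 ⊕ var 3 ≤ 2 ⊛ var 5 ] ∷ 1 ×[ var 4 ≤ 2 ⊛ var 7 ]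
   ∷ 2 ×[ var 5 ⊕ (var 6 ⊕ var 7) ≤ var 1 ] ∷ [])
  (l ∷ ≤-reflexive (∑-kinds deg) ∷ low-side 2 (λ {u} i → +-mono-≤ (Lo-one i) (≤-trans (≤-trans (m≤m+n (links lone u) _) (degree≥ u)) (Lo-one i)))
   ∷ Co-two ∷ ≤-reflexive kind-sizes ∷ []) refl

 no-lone-bound : length Al ≡ 0 → ∑ Vs deg + length Lo ≤ 2 * n
 no-lone-bound none = ≮⇒≥ λ l → refute (∑ Vs deg ∷ n ∷ ∑ Lo deg ∷ ∑ Al deg ∷ ∑ Co deg ∷ length Lo ∷ length Al ∷ length Co ∷ [])
  (1 ×[ lit 1 ⊕ 2 ⊛ var 1 ≤ var 0 ⊕ var 5 ] ∷ 1 ×[ var 0 ≤ var 2 ⊕ (var 3 ⊕ var 4) ] ∷ 1 ×[ var 2 ⊕ var 3 ≤ 1 ⊛ var 5 ] ∷ 1 ×[ var 4 ≤ 2 ⊛ var 7 ]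
   ∷ 2 ×[ var 5 ⊕ (var 6 ⊕ var 7) ≤ var 1 ] ∷ [])
  (l ∷ ≤-reflexive (∑-kinds deg) ∷ low-side 1 (λ {u} i → ≤-trans (+-mono-≤ (Lo-one i) (≤-trans (count≤length (adj u) Al) (≤-reflexive none))) ≤-refl)
   ∷ Co-two ∷ ≤-reflexive kind-sizes ∷ []) refl

 module Triangles (all-linked : ∀ v → linked v ≡ true) where

  two : ∀ v → deg v ≡ 2
  two v = linked-two (all-linked v)

  triangle : ∀ x → ∃[ y ] ∃[ z ] x ~ y × x ~ z × y ~ z
  triangle x = go (linked-mate (all-linked x))
   where
   go : ∃[ y ] x ~ y × heavy y ≡ true → ∃[ y ] ∃[ z ] x ~ y × x ~ z × y ~ z
   go (y , xy , hy) = third (common₁ (+-cancelˡ-≤ 3 1 (common x y) (≤-trans (≥-reflexive (cong₂ _+_ (two x) (two y)))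
     (key xy (≥-reflexive (two x)) (≥-reflexive (two y))))))
    where
    third : ∃[ z ] Common x y z → ∃[ y ] ∃[ z ] x ~ y × x ~ z × y ~ z
    third (z , xz , yz) = y , z , xy , xz , yz

  only : ∀ {x y z w} → x ~ y → x ~ z → y ≢ z → x ~ w → w ∈ y ∷ z ∷ []
  only {x} xy xz yz xw = all-neighbours ((yz ∷ []) ∷ [] ∷ []) (xy ∷ xz ∷ []) (≤-reflexive (two x)) xw

  IsClosed : List (Fin n) → Set
  IsClosed xs = ∀ {x y} → x ∈ xs → x ~ y → y ∈ xs

  divisible : ∀ k xs → length xs ≤ k → Unique xs → IsClosed xs → 3 ∣ length xs
  divisible k [] h u c = 3 ∣0
  divisible zero (x ∷ xs) () u c
  divisible (suc k) (x ∷ xs) (s≤s h) (x∉ ∷ u) c = go (triangle x)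
   where
   go : ∃[ y ] ∃[ z ] x ~ y × x ~ z × y ~ z → 3 ∣ suc (length xs)
   go (y , z , xy , xz , yz) = rest (two-out _≟_ u (tail∈ (c #0 xy) (~⇒≢ xy ∘ sym)) (tail∈ (c #0 xz) (~⇒≢ xz ∘ sym)) (~⇒≢ yz))
    where
    rest : ∃[ zs ] xs ↭ y ∷ z ∷ zs → 3 ∣ suc (length xs)
    rest (zs , π) = remove (unique-↭ π u)
     where
     remove : Unique (y ∷ z ∷ zs) → 3 ∣ suc (length xs)
     remove ((_ ∷ y∉) ∷ z∉ ∷ uzs) = subst (3 ∣_) (sym (cong suc (↭-length π))) (∣m∣n⇒∣m+n ∣-refl
       (divisible k zs (≤-trans (≤-trans (n≤1+n _) (n≤1+n _)) (≤-trans (≥-reflexive (↭-length π)) h)) uzs closed))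
      where
      x≢ : ∀ {a} → a ∈ zs → x ≢ a
      x≢ i = All.lookup x∉ (∈-resp-↭ (↭-sym π) (there (there i)))
      y≢ : ∀ {a} → a ∈ zs → y ≢ a
      y≢ i = All.lookup y∉ i
      z≢ : ∀ {a} → a ∈ zs → z ≢ a
      z≢ i = All.lookup z∉ i
      absent : ∀ {a b c} → a ≢ c → b ≢ c → ¬ (c ∈ a ∷ b ∷ [])
      absent h k (here e) = h (sym e)
      absent h k (there (here e)) = k (sym e)
      closed : IsClosed zs
      closed {a} {b} i ab = tail∈ (tail∈ (∈-resp-↭ π (tail∈ (c (there (∈-resp-↭ (↭-sym π) (there (there i)))) ab)
        λ { refl → absent (y≢ i) (z≢ i) (only xy xz (~⇒≢ yz) (~-sym ab)) }))
        λ { refl → absent (x≢ i) (z≢ i) (only (~-sym xy) yz (~⇒≢ xz) (~-sym ab)) })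
       λ { refl → absent (x≢ i) (y≢ i) (only (~-sym xz) (~-sym yz) (~⇒≢ xy) (~-sym ab)) }

  three∣n : 3 ∣ n
  three∣n = subst (3 ∣_) |V| (divisible _ Vs ≤-refl Vs! (λ _ _ → ∈V))

 edges≤n : edgeCount G ≤ n
 edges≤n = *-cancelˡ-≤ 2 (≤-trans (≥-reflexive degree-sum) (≤-trans (m≤m+n _ _) general-bound))

 edge-bound : edgeCount G < n ⊎ 3 ∣ n
 edge-bound = by (zero-or (length Al)) (zero-or (length Lo))
  where
  no-member : ∀ {C} → length (members C) ≡ 0 → ∀ {x} → C x ≡ true → ⊥
  no-member {C} e {x} cx = <⇒≱ (s≤s z≤n) (≤-trans (length-⊆ {xs = x ∷ []} ([] ∷ []) λ { #0 → ∈members {C} cx }) (≤-reflexive e))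
  by : length Al ≡ 0 ⊎ 1 ≤ length Al → length Lo ≡ 0 ⊎ 1 ≤ length Lo → edgeCount G < n ⊎ 3 ∣ n
  by (inj₂ h) _ = inj₁ (≮⇒≥ λ l → refute (edgeCount G ∷ n ∷ ∑ Vs deg ∷ length Al ∷ [])
   (2 ×[ lit 1 ⊕ var 1 ≤ lit 1 ⊕ var 0 ] ∷ 1 ×[ 2 ⊛ var 0 ≤ var 2 ] ∷ 1 ×[ var 2 ⊕ 2 ⊛ var 3 ≤ 2 ⊛ var 1 ] ∷ 2 ×[ lit 1 ≤ var 3 ] ∷ [])
   (l ∷ ≥-reflexive degree-sum ∷ general-bound ∷ h ∷ []) refl)
  by (inj₁ e) (inj₂ h) = inj₁ (≮⇒≥ λ l → refute (edgeCount G ∷ n ∷ ∑ Vs deg ∷ length Lo ∷ [])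
   (2 ×[ lit 1 ⊕ var 1 ≤ lit 1 ⊕ var 0 ] ∷ 1 ×[ 2 ⊛ var 0 ≤ var 2 ] ∷ 1 ×[ var 2 ⊕ var 3 ≤ 2 ⊛ var 1 ] ∷ 1 ×[ lit 1 ≤ var 3 ] ∷ [])
   (l ∷ ≥-reflexive degree-sum ∷ no-lone-bound e ∷ h ∷ []) refl)
  by (inj₁ e) (inj₁ f) = inj₂ (Triangles.three∣n λ v → ∧-true (is-heavy v (heavy v) refl) (not-lone v (lone v) refl))
   where
   is-heavy : ∀ v b → heavy v ≡ b → heavy v ≡ true
   is-heavy v true  k = k
   is-heavy v false k = ⊥-elim (no-member {low} f (cong not k))
   not-lone : ∀ v b → lone v ≡ b → not (lone v) ≡ true
   not-lone v false k = cong not k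
   not-lone v true  k = ⊥-elim (no-member {lone} e k)

module Examples where
 open import Data.Bool using (T)
 open import Data.Bool.Properties using (∨-comm)
 open import Data.Fin using (Fin; toℕ)
 import Data.Fin.Properties as Fin
 open import Data.List using (map; tabulate; applyUpTo)
 open import Data.List.Membership.Propositional.Properties using (∈-map⁺; ∈-++⁻; ∈-applyUpTo⁻; ∈-cartesianProduct⁺; ∈-allFin; ∈-tabulate⁻) renaming (∈-filter⁺ to ∈-filter-dec⁺)
 open import Data.List.Properties using (length-map; length-++; length-applyUpTo; length-tabulate)
 open import Data.List.Relation.Unary.Unique.Propositional.Properties using (++⁺; applyUpTo⁺₁; tabulate⁺)
 open import Data.Nat using (_≟_)
 open import Data.Nat.Divisibility using (n∣m*n)
 open import Data.Nat.DivMod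
 open Drawings

 T⇒ : ∀ {b} → T b → b ≡ true
 T⇒ = Equivalence.to T-≡

 ⇒T : ∀ {b} → b ≡ true → T b
 ⇒T = Equivalence.from T-≡

 <ᵇ⇒ : ∀ {i j} → (i <ᵇ j) ≡ true → i < j
 <ᵇ⇒ {i} {j} h = <ᵇ⇒< i j (⇒T h)

 ⇒<ᵇ : ∀ {i j} → i < j → (i <ᵇ j) ≡ true
 ⇒<ᵇ h = T⇒ (<⇒<ᵇ h)

 ≡ᵇ⇒ : ∀ {i j} → (i ≡ᵇ j) ≡ true → i ≡ j
 ≡ᵇ⇒ {i} {j} h = ≡ᵇ⇒≡ i j (⇒T h)

 ⇒≡ᵇ : ∀ {i j} → i ≡ j → (i ≡ᵇ j) ≡ true
 ⇒≡ᵇ {i} {j} h = T⇒ (≡⇒≡ᵇ i j h)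

 ofRelation : ∀ n → (ℕ → ℕ → Bool) → Graph (Fin n)
 ofRelation n E = record { adj = a ; ~-sym = λ {u} {v} → subst T (∨-comm (up u v) (up v u)) ; ~-irrefl = λ { {u} refl h → no-loop u (∨-true (T⇒ h)) } }
  where
  up : Fin n → Fin n → Bool
  up u v = (toℕ u <ᵇ toℕ v) ∧ E (toℕ u) (toℕ v)
  a : Fin n → Fin n → Bool
  a u v = up u v ∨ up v u
  no-loop : ∀ u → up u u ≡ true ⊎ up u u ≡ true → ⊥
  no-loop u (inj₁ h) = <-irrefl refl (<ᵇ⇒ {toℕ u} (∧ˡ h))
  no-loop u (inj₂ h) = <-irrefl refl (<ᵇ⇒ {toℕ u} (∧ˡ h))

 module Relation (n : ℕ) (E : ℕ → ℕ → Bool) where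
  G : Graph (Fin n)
  G = ofRelation n E

  _~_ : Fin n → Fin n → Set
  u ~ v = Graph._~_ G u v

  Below : ℕ → ℕ → Set
  Below i j = i < j × E i j ≡ true

  adjacent⁻ : ∀ {u v} → u ~ v → Below (toℕ u) (toℕ v) ⊎ Below (toℕ v) (toℕ u)
  adjacent⁻ {u} {v} h = by (∨-true {(toℕ u <ᵇ toℕ v) ∧ E (toℕ u) (toℕ v)} (T⇒ h))
   where
   by : (toℕ u <ᵇ toℕ v) ∧ E (toℕ u) (toℕ v) ≡ true ⊎ (toℕ v <ᵇ toℕ u) ∧ E (toℕ v) (toℕ u) ≡ true → Below (toℕ u) (toℕ v) ⊎ Below (toℕ v) (toℕ u)
   by (inj₁ e) = inj₁ (<ᵇ⇒ (∧ˡ e) , ∧ʳ {toℕ u <ᵇ toℕ v} e)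
   by (inj₂ e) = inj₂ (<ᵇ⇒ (∧ˡ e) , ∧ʳ {toℕ v <ᵇ toℕ u} e)

  edge⁻ : ∀ {u v} → IsEdge G (u , v) → Below (toℕ u) (toℕ v)
  edge⁻ {u} {v} (l , h) = by (adjacent⁻ {u} {v} h)
   where
   by : Below (toℕ u) (toℕ v) ⊎ Below (toℕ v) (toℕ u) → Below (toℕ u) (toℕ v)
   by (inj₁ e) = e
   by (inj₂ (k , _)) = ⊥-elim (<-asym l k)

  edge⁺ : ∀ {u v} → Below (toℕ u) (toℕ v) → IsEdge G (u , v)
  edge⁺ {u} {v} (l , e) = l , ⇒T (∨-introˡ (∧-true (⇒<ᵇ l) e))

  count≥ : ∀ {zs} → Unique zs → (∀ {i j} → (i , j) ∈ zs → Below i j × j < n) → length zs ≤ edgeCount G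
  count≥ {zs} u h = ≤-trans (length-⊆ u (λ {z} → covered z)) (≤-reflexive (length-map _ (edges G)))
   where
   both : Fin n × Fin n → ℕ × ℕ
   both (u , v) = toℕ u , toℕ v
   covered : ∀ z → z ∈ zs → z ∈ map both (edges G)
   covered (i , j) m = subst (_∈ map both (edges G)) (cong₂ _,_ (Fin.toℕ-fromℕ< i<n) (Fin.toℕ-fromℕ< j<n))
     (∈-map⁺ both (∈-filter-dec⁺ (isEdge? G) (∈-cartesianProduct⁺ (∈-allFin _) (∈-allFin _)) (edge⁺ (subst₂ Below (sym (Fin.toℕ-fromℕ< i<n)) (sym (Fin.toℕ-fromℕ< j<n)) (proj₁ (h m))))))
    where
    j<n = proj₂ (h m)
    i<n = <-trans (proj₁ (proj₁ (h m))) j<n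

  Few : ℕ → Fin n → Set
  Few m x = ∃[ ys ] length ys ≤ m × (∀ {z} → x ~ z → toℕ z ∈ ys)

  spokes : ∀ {m x} (nbr : Fin (suc m) → Fin n) → (∀ {i j} → nbr i ≡ nbr j → i ≡ j) → (∀ i → x ~ nbr i) → ¬ Few m x
  spokes {m} nbr inj near (ys , short , all) = <⇒≱ (≥-reflexive (length-tabulate (toℕ ∘ nbr)))
   (≤-trans (length-⊆ {xs = tabulate (toℕ ∘ nbr)} (tabulate⁺ λ e → inj (Fin.toℕ-injective e)) (λ i → inside (∈-tabulate⁻ i))) short)
   where
   inside : ∀ {k} → ∃[ i ] k ≡ toℕ (nbr i) → k ∈ ys
   inside (i , refl) = all (near i)

  free : ∀ {m} → (∀ {x y} → x ~ y → Few m x ⊎ Few m y) → S m m Free G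
  free {m} h C = by (h (preserves {hubX} {hubY} _))
   where
   open _Contains_ C
   armsX : Fin (suc m) → StarVertex m m
   armsX Fin.zero    = hubY
   armsX (Fin.suc i) = leafX i
   armsY : Fin (suc m) → StarVertex m m
   armsY Fin.zero    = hubX
   armsY (Fin.suc i) = leafY i
   injX : ∀ {i j} → armsX i ≡ armsX j → i ≡ j
   injX {Fin.zero}  {Fin.zero}  refl = refl
   injX {Fin.suc i} {Fin.suc j} refl = refl
   injY : ∀ {i j} → armsY i ≡ armsY j → i ≡ j
   injY {Fin.zero}  {Fin.zero}  refl = refl
   injY {Fin.suc i} {Fin.suc j} refl = refl
   nearX : ∀ i → embed hubX ~ embed (armsX i)
   nearX Fin.zero    = preserves {hubX} {hubY} _
   nearX (Fin.suc i) = preserves {hubX} {leafX i} _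
   nearY : ∀ i → embed hubY ~ embed (armsY i)
   nearY Fin.zero    = preserves {hubY} {hubX} _
   nearY (Fin.suc i) = preserves {hubY} {leafY i} _
   by : Few m (embed hubX) ⊎ Few m (embed hubY) → ⊥
   by (inj₁ f) = spokes (embed ∘ armsX) (λ e → injX (injective e)) nearX f
   by (inj₂ f) = spokes (embed ∘ armsY) (λ e → injY (injective e)) nearY f

  free-below : ∀ {m} → (∀ {x y} → Below (toℕ x) (toℕ y) → Few m x) → S m m Free G
  free-below h = free λ {x} {y} xy → by {x} {y} (adjacent⁻ {x} {y} xy)
   where
   by : ∀ {x y} → Below (toℕ x) (toℕ y) ⊎ Below (toℕ y) (toℕ x) → Few _ x ⊎ Few _ y
   by {x} {y} (inj₁ b) = inj₁ (h {x} {y} b)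
   by {x} {y} (inj₂ b) = inj₂ (h {y} {x} b)

 module Star (K : ℕ) (1≤K : 1 ≤ K) where
  k = suc (suc K)
  module E = Relation (suc k) (λ i j → j ≡ᵇ k)

  drawing : Drawing E.G
  drawing = Wheel.draw-wheel K 1≤K E.G (n≤1+n (suc k)) λ {u} {v} h → edge (toℕ u) (toℕ v) (E.edge⁻ {u} {v} h)
   where
   edge : ∀ i j → i < j × (j ≡ᵇ k) ≡ true → Wheel.Edge K 1≤K i j
   edge i j (l , e) with ≡ᵇ⇒ {j} e
   ... | refl = Wheel.toA l

  is-free : S 1 1 Free E.G
  is-free = E.free-below λ {x} {y} b → (k ∷ []) , ≤-refl , λ {z} xz → only x z (proj₁ b) (≡ᵇ⇒ (proj₂ b)) (E.adjacent⁻ {x} {z} xz)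
   where
   only : ∀ (x z : Fin (suc k)) {j} → toℕ x < j → j ≡ k → E.Below (toℕ x) (toℕ z) ⊎ E.Below (toℕ z) (toℕ x) → toℕ z ∈ k ∷ []
   only x z l e (inj₁ (_ , f)) = here (≡ᵇ⇒ f)
   only x z l refl (inj₂ (_ , f)) = ⊥-elim (<-irrefl (≡ᵇ⇒ f) l)

  size : k ≤ edgeCount E.G
  size = ≤-trans (≥-reflexive (length-applyUpTo (λ i → i , k) k))
   (E.count≥ (applyUpTo⁺₁ (λ i → i , k) k (λ i<j _ → λ { refl → <-irrefl refl i<j })) λ m → in-list (∈-applyUpTo⁻ (λ i → i , k) m))
   where
   in-list : ∀ {i j} → ∃[ t ] t < k × (i , j) ≡ (t , k) → E.Below i j × j < suc k
   in-list (t , l , refl) = (l , ⇒≡ᵇ {k} refl) , ≤-refl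

 family-unique : ∀ {a b : ℕ → ℕ} m → (∀ {i j} → a i ≡ a j → i ≡ j) → Unique (applyUpTo (λ i → a i , b i) m)
 family-unique {a} {b} m inj = applyUpTo⁺₁ (λ i → a i , b i) m λ i<j _ e → <-irrefl (inj (cong proj₁ e)) i<j

 -- The complete bipartite graph between two hubs and k rim vertices, together with further edges between rim vertices.
 module Hubs (K : ℕ) (1≤K : 1 ≤ K) (Extra : ℕ → ℕ → Bool)
  (extra : ∀ {i j} → i < j → Extra i j ≡ true → Wheel.Edge K 1≤K i j × j < suc (suc K)) where
  k n : ℕ
  k = suc (suc K)
  n = suc (suc k)

  E : ℕ → ℕ → Bool
  E i j = ((i <ᵇ k) ∧ (k ≤ᵇ j)) ∨ Extra i j

  open module R = Relation n E public using (G; Below; Few; _~_; adjacent⁻)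

  spoke : ∀ {i j} → i < k → k ≤ j → E i j ≡ true
  spoke {i} {j} h l = ∨-introˡ (∧-true (⇒<ᵇ h) (T⇒ (≤⇒≤ᵇ l)))

  E⁻ : ∀ {i j} → i < j → E i j ≡ true → (i < k × k ≤ j) ⊎ (Extra i j ≡ true × j < k)
  E⁻ {i} {j} l h = by (∨-true {(i <ᵇ k) ∧ (k ≤ᵇ j)} h)
   where
   by : (i <ᵇ k) ∧ (k ≤ᵇ j) ≡ true ⊎ Extra i j ≡ true → (i < k × k ≤ j) ⊎ (Extra i j ≡ true × j < k)
   by (inj₁ e) = inj₁ (<ᵇ⇒ (∧ˡ e) , ≤ᵇ⇒≤ k j (⇒T (∧ʳ {i <ᵇ k} e)))
   by (inj₂ e) = inj₂ (e , proj₂ (extra l e))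

  hub : ∀ {j} → k ≤ j → j < n → j ≡ k ⊎ j ≡ suc k
  hub {j} h l = by (m≤n⇒m<n∨m≡n h)
   where
   by : k < j ⊎ k ≡ j → j ≡ k ⊎ j ≡ suc k
   by (inj₁ g) = inj₂ (≤-antisym (≤-pred l) g)
   by (inj₂ e) = inj₁ (sym e)

  drawing : Drawing G
  drawing = Wheel.draw-wheel K 1≤K G ≤-refl λ {u} {v} h → edge (Fin.toℕ<n v) (R.edge⁻ {u} {v} h)
   where
   edge : ∀ {i j} → j < n → Below i j → Wheel.Edge K 1≤K i j
   edge {i} {j} j<n (l , e) = by (E⁻ l e)
    where
    at-hub : i < k → j ≡ k ⊎ j ≡ suc k → Wheel.Edge K 1≤K i j
    at-hub h (inj₁ refl) = Wheel.toA h
    at-hub h (inj₂ refl) = Wheel.toB h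
    by : (i < k × k ≤ j) ⊎ (Extra i j ≡ true × j < k) → Wheel.Edge K 1≤K i j
    by (inj₁ (h , g)) = at-hub h (hub g j<n)
    by (inj₂ (h , _)) = proj₁ (extra l h)

  is-free : ∀ {m} (partners : ℕ → List ℕ) → (∀ x → suc (suc (length (partners x))) ≤ m) →
   (∀ {x z} → x < z → Extra x z ≡ true → z ∈ partners x) → (∀ {x z} → z < x → Extra z x ≡ true → z ∈ partners x) → S m m Free G
  is-free {m} partners short up down = R.free-below λ {x} {y} b → (k ∷ suc k ∷ partners (toℕ x)) , short (toℕ x) , λ {z} xz → inside {x} {z} (rim b) (adjacent⁻ {x} {z} xz)
   where
   rim : ∀ {i j} → Below i j → i < k
   rim {i} {j} (l , e) = by (E⁻ l e)
    where
    by : (i < k × k ≤ j) ⊎ (Extra i j ≡ true × j < k) → i < k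
    by (inj₁ (h , _)) = h
    by (inj₂ (_ , h)) = <-trans l h
   inside : ∀ {x z : Fin n} → toℕ x < k → Below (toℕ x) (toℕ z) ⊎ Below (toℕ z) (toℕ x) → toℕ z ∈ k ∷ suc k ∷ partners (toℕ x)
   inside {x} {z} h (inj₁ (l , e)) = by (E⁻ l e)
    where
    by : (toℕ x < k × k ≤ toℕ z) ⊎ (Extra (toℕ x) (toℕ z) ≡ true × toℕ z < k) → toℕ z ∈ k ∷ suc k ∷ partners (toℕ x)
    by (inj₂ (f , _)) = there (there (up l f))
    by (inj₁ (_ , g)) = at-hub (hub g (Fin.toℕ<n z))
     where
     at-hub : toℕ z ≡ k ⊎ toℕ z ≡ suc k → toℕ z ∈ k ∷ suc k ∷ partners (toℕ x)
     at-hub (inj₁ e) = here e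
     at-hub (inj₂ e) = there (here e)
   inside {x} {z} h (inj₂ (l , e)) = by (E⁻ l e)
    where
    by : (toℕ z < k × k ≤ toℕ x) ⊎ (Extra (toℕ z) (toℕ x) ≡ true × toℕ x < k) → toℕ z ∈ k ∷ suc k ∷ partners (toℕ x)
    by (inj₁ (_ , g)) = ⊥-elim (<⇒≱ h g)
    by (inj₂ (f , _)) = there (there (down l f))

  size : ∀ {zs} → Unique zs → (∀ {i j} → (i , j) ∈ zs → i < j × Extra i j ≡ true) → k + (k + length zs) ≤ edgeCount G
  size {zs} u h = ≤-trans (≤-reflexive lengths) (R.count≥ (++⁺ (family-unique {λ i → i} {λ _ → k} k λ e → e) (++⁺ (family-unique {λ i → i} {λ _ → suc k} k λ e → e) u disjoint₂) disjoint₁) inside)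
   where
   toA toB : List (ℕ × ℕ)
   toA = applyUpTo (λ i → i , k) k
   toB = applyUpTo (λ i → i , suc k) k
   lengths : k + (k + length zs) ≡ length (toA ++ (toB ++ zs))
   lengths = sym (trans (length-++ toA) (cong₂ _+_ (length-applyUpTo (λ i → i , k) k) (trans (length-++ toB) (cong (_+ length zs) (length-applyUpTo (λ i → i , suc k) k)))))
   small : ∀ {i j} → (i , j) ∈ zs → j < k
   small m = proj₂ (extra (proj₁ (h m)) (proj₂ (h m)))
   disjoint₂ : ∀ {z} → ¬ (z ∈ toB × z ∈ zs)
   disjoint₂ (m , m′) with ∈-applyUpTo⁻ (λ i → i , suc k) m
   ... | _ , _ , refl = <⇒≱ (small m′) (n≤1+n k)
   disjoint₁ : ∀ {z} → ¬ (z ∈ toA × z ∈ toB ++ zs)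
   disjoint₁ (m , m′) with ∈-applyUpTo⁻ (λ i → i , k) m | ∈-++⁻ toB m′
   ... | _ , _ , refl | inj₂ r = <-irrefl refl (small r)
   ... | _ , _ , refl | inj₁ r with ∈-applyUpTo⁻ (λ i → i , suc k) r
   ...   | _ , _ , e = <-irrefl (cong proj₂ e) ≤-refl
   inside : ∀ {i j} → (i , j) ∈ toA ++ (toB ++ zs) → Below i j × j < n
   inside m with ∈-++⁻ toA m
   ... | inj₁ r with ∈-applyUpTo⁻ (λ i → i , k) r
   ...   | _ , l , refl = (l , spoke l ≤-refl) , s≤s (n≤1+n k)
   inside m | inj₂ r with ∈-++⁻ toB r
   ... | inj₁ r with ∈-applyUpTo⁻ (λ i → i , suc k) r
   ...   | _ , l , refl = (<-trans l ≤-refl , spoke l (n≤1+n k)) , ≤-refl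
   inside m | inj₂ r | inj₂ r′ = (proj₁ (h r′) , ∨-introʳ _ (proj₂ (h r′))) , ≤-trans (small r′) (≤-trans (n≤1+n k) (n≤1+n (suc k)))

 module TwoHubs (K : ℕ) (1≤K : 1 ≤ K) where
  open Hubs K 1≤K (λ _ _ → false) (λ _ ()) public

  free₂ : S 2 2 Free G
  free₂ = is-free (λ _ → []) (λ _ → ≤-refl) (λ _ ()) (λ _ ())

  size₂ : k + k ≤ edgeCount G
  size₂ = ≤-trans (≤-reflexive (cong (k +_) (sym (+-identityʳ k)))) (size [] λ ())

 even : ℕ → Bool
 even zero    = true
 even (suc i) = not (even i)

 even-double : ∀ i → even (i * 2) ≡ true
 even-double zero    = refl
 even-double (suc i) rewrite even-double i = refl

 module Matched (K : ℕ) (1≤K : 1 ≤ K) where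
  Mate : ℕ → ℕ → Bool
  Mate i j = even i ∧ ((j ≡ᵇ suc i) ∧ (j <ᵇ suc (suc K)))

  mate⁻ : ∀ {i j} → Mate i j ≡ true → even i ≡ true × j ≡ suc i × j < suc (suc K)
  mate⁻ {i} {j} h = ∧ˡ h , ≡ᵇ⇒ {j} {suc i} (∧ˡ (∧ʳ {even i} h)) , <ᵇ⇒ (∧ʳ {j ≡ᵇ suc i} (∧ʳ {even i} h))

  extra : ∀ {i j} → i < j → Mate i j ≡ true → Wheel.Edge K 1≤K i j × j < suc (suc K)
  extra {i} {j} _ h with mate⁻ {i} {j} h
  ... | _ , refl , l = Wheel.path l , l

  open Hubs K 1≤K Mate extra public

  partner : ℕ → List ℕ
  partner zero    = 1 ∷ []
  partner (suc i) = (if even i then i else suc (suc i)) ∷ []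
   where open import Data.Bool using (if_then_else_)

  one-partner : ∀ x → length (partner x) ≡ 1
  one-partner zero    = refl
  one-partner (suc i) = refl

  free₃ : S 3 3 Free G
  free₃ = is-free partner (λ x → ≤-reflexive (cong (2 +_) (one-partner x))) up down
   where
   up : ∀ {x z} → x < z → Mate x z ≡ true → z ∈ partner x
   up {x} {z} _ h with mate⁻ {x} {z} h
   up {zero} _ h | _ , refl , _ = #0
   up {suc i} _ h | e , refl , _ rewrite not-true {even i} e = #0
   down : ∀ {x z} → z < x → Mate z x ≡ true → z ∈ partner x
   down {x} {z} _ h with mate⁻ {z} {x} h
   ... | e , refl , _ rewrite e = #0

  size₃ : k + (k + k / 2) ≤ edgeCount G
  size₃ = ≤-trans (≤-reflexive (cong (λ l → k + (k + l)) (sym (length-applyUpTo (λ i → i * 2 , suc (i * 2)) (k / 2)))))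
   (size (family-unique (k / 2) λ {i} {j} → *-cancelʳ-≡ i j 2) λ m → inside (∈-applyUpTo⁻ (λ i → i * 2 , suc (i * 2)) m))
   where
   inside : ∀ {i j} → ∃[ t ] t < k / 2 × (i , j) ≡ (t * 2 , suc (t * 2)) → i < j × Mate i j ≡ true
   inside (t , l , refl) = ≤-refl , ∧-true (even-double t) (∧-true (⇒≡ᵇ {suc (t * 2)} refl) (⇒<ᵇ (≤-trans (*-monoˡ-≤ 2 l) (m/n*n≤m k 2))))

 module DoubleWheel (K : ℕ) (1≤K : 1 ≤ K) where
  Rim : ℕ → ℕ → Bool
  Rim i j = ((j ≡ᵇ suc i) ∧ (j <ᵇ suc (suc K))) ∨ ((i ≡ᵇ 0) ∧ (j ≡ᵇ suc K))

  rim⁻ : ∀ {i j} → Rim i j ≡ true → (j ≡ suc i × j < suc (suc K)) ⊎ (i ≡ 0 × j ≡ suc K)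
  rim⁻ {i} {j} h = by (∨-true {(j ≡ᵇ suc i) ∧ (j <ᵇ suc (suc K))} h)
   where
   by : (j ≡ᵇ suc i) ∧ (j <ᵇ suc (suc K)) ≡ true ⊎ (i ≡ᵇ 0) ∧ (j ≡ᵇ suc K) ≡ true → (j ≡ suc i × j < suc (suc K)) ⊎ (i ≡ 0 × j ≡ suc K)
   by (inj₁ e) = inj₁ (≡ᵇ⇒ {j} {suc i} (∧ˡ e) , <ᵇ⇒ (∧ʳ {j ≡ᵇ suc i} e))
   by (inj₂ e) = inj₂ (≡ᵇ⇒ {i} {0} (∧ˡ e) , ≡ᵇ⇒ {j} {suc K} (∧ʳ {i ≡ᵇ 0} e))

  extra : ∀ {i j} → i < j → Rim i j ≡ true → Wheel.Edge K 1≤K i j × j < suc (suc K)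
  extra {i} {j} _ h with rim⁻ {i} {j} h
  ... | inj₁ (refl , l) = Wheel.path l , l
  ... | inj₂ (refl , refl) = Wheel.closing , ≤-refl

  open Hubs K 1≤K Rim extra public

  previous next : ℕ → ℕ
  previous zero    = suc K
  previous (suc i) = i
  next i with i ≟ suc K
  ... | yes _ = 0
  ... | no _  = suc i

  free₄ : ∀ {m} → 4 ≤ m → S m m Free G
  free₄ h = is-free (λ x → previous x ∷ next x ∷ []) (λ _ → h) up down
   where
   up : ∀ {x z} → x < z → Rim x z ≡ true → z ∈ previous x ∷ next x ∷ []
   up {x} {z} _ h with rim⁻ {x} {z} h
   ... | inj₂ (refl , refl) = #0
   ... | inj₁ (refl , l) with x ≟ suc K
   ...   | yes refl = ⊥-elim (<-irrefl refl l)
   ...   | no _ = #1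
   down : ∀ {x z} → z < x → Rim z x ≡ true → z ∈ previous x ∷ next x ∷ []
   down {x} {z} _ h with rim⁻ {z} {x} h
   ... | inj₁ (refl , _) = #0
   ... | inj₂ (refl , refl) with suc K ≟ suc K
   ...   | yes _ = #1
   ...   | no g = ⊥-elim (g refl)

  size₄ : k + (k + k) ≤ edgeCount G
  size₄ = ≤-trans (≤-reflexive (cong (λ l → k + (k + suc l)) (sym (length-applyUpTo (λ i → i , suc i) (suc K)))))
   (size (All.tabulate fresh ∷ family-unique {λ i → i} {suc} (suc K) (λ e → e)) inside)
   where
   fresh : ∀ {z} → z ∈ applyUpTo (λ i → i , suc i) (suc K) → (0 , suc K) ≢ z
   fresh m refl with ∈-applyUpTo⁻ (λ i → i , suc i) m
   ... | _ , _ , refl = <-irrefl refl 1≤K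
   inside : ∀ {i j} → (i , j) ∈ (0 , suc K) ∷ applyUpTo (λ i → i , suc i) (suc K) → i < j × Rim i j ≡ true
   inside #0 = s≤s z≤n , ∨-introʳ _ (⇒≡ᵇ {suc K} refl)
   inside (there m) with ∈-applyUpTo⁻ (λ i → i , suc i) m
   ... | i , l , refl = ≤-refl , ∨-introˡ (∧-true (⇒≡ᵇ {suc i} refl) (⇒<ᵇ (s≤s l)))

 module Small (n : ℕ) (n≤4 : n ≤ 4) where
  open module R = Relation n (λ _ _ → true) public using (G; Below; Few; _~_; adjacent⁻)

  drawing : Drawing G
  drawing = Wheel.draw-wheel 1 ≤-refl G (≤-trans n≤4 (n≤1+n 4)) λ {u} {v} h → edge (toℕ u) (toℕ v) (≤-trans (Fin.toℕ<n v) n≤4) (proj₁ h)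
   where
   edge : ∀ i j → j < 4 → i < j → Wheel.Edge 1 ≤-refl i j
   edge 0 1 _ _ = Wheel.path (s≤s (s≤s z≤n))
   edge 0 2 _ _ = Wheel.closing
   edge 0 3 _ _ = Wheel.toA (s≤s z≤n)
   edge 1 2 _ _ = Wheel.path ≤-refl
   edge 1 3 _ _ = Wheel.toA (s≤s (s≤s z≤n))
   edge 2 3 _ _ = Wheel.toA ≤-refl
   edge (suc i) 1 _ (s≤s ())
   edge (suc (suc i)) 2 _ (s≤s (s≤s ()))
   edge (suc (suc (suc i))) 3 _ (s≤s (s≤s (s≤s ())))
   edge _ (suc (suc (suc (suc j)))) (s≤s (s≤s (s≤s (s≤s ())))) _

  is-free : ∀ {m} → 4 ≤ m → S m m Free G
  is-free h = R.free λ _ → inj₁ (0 ∷ 1 ∷ 2 ∷ 3 ∷ [] , h , λ {z} _ → inside (toℕ z) (≤-trans (Fin.toℕ<n z) n≤4))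
   where
   inside : ∀ i → i < 4 → i ∈ 0 ∷ 1 ∷ 2 ∷ 3 ∷ []
   inside 0 _ = #0
   inside 1 _ = #1
   inside 2 _ = #2
   inside 3 _ = #3
   inside (suc (suc (suc (suc i)))) (s≤s (s≤s (s≤s (s≤s ()))))

 size-three : 3 ≤ edgeCount (Small.G 3 (n≤1+n 3))
 size-three = ≤-reflexive refl

 size-four : 6 ≤ edgeCount (Small.G 4 ≤-refl)
 size-four = ≤-reflexive refl

 module Triangles (q : ℕ) where
  n : ℕ
  n = q * 3

  open module R = Relation n (λ i j → i / 3 ≡ᵇ j / 3) public using (G; Below; _~_; adjacent⁻)

  place : ℕ → Point
  place i = spot (i % 3) (i / 3)
   where
   spot : ℕ → ℕ → Point
   spot 0 = Strips.P₀
   spot 1 = Strips.P₁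
   spot _ = Strips.P₂

  quotient : ∀ r p → r < 3 → (r + p * 3) / 3 ≡ p
  quotient r p h = trans (+-distrib-/-∣ʳ r (n∣m*n p)) (cong₂ _+_ (m<n⇒m/n≡0 h) (m*n/n≡m p 3))

  remainder : ∀ r p → r < 3 → (r + p * 3) % 3 ≡ r
  remainder r p h = trans ([m+kn]%n≡m%n r p 3) (m<n⇒m%n≡m h)

  place₀ : ∀ p → place (p * 3) ≡ Strips.P₀ p
  place₀ p rewrite remainder 0 p (s≤s z≤n) | quotient 0 p (s≤s z≤n) = refl

  place₁ : ∀ p → place (1 + p * 3) ≡ Strips.P₁ p
  place₁ p rewrite remainder 1 p (s≤s (s≤s z≤n)) | quotient 1 p (s≤s (s≤s z≤n)) = refl

  place₂ : ∀ p → place (2 + p * 3) ≡ Strips.P₂ p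
  place₂ p rewrite remainder 2 p ≤-refl | quotient 2 p ≤-refl = refl

  data Residue : ℕ → ℕ → Set where
   zeroth : ∀ p → Residue p (p * 3)
   first  : ∀ p → Residue p (1 + p * 3)
   second : ∀ p → Residue p (2 + p * 3)

  residue : ∀ i → Residue (i / 3) i
  residue i = subst (Residue (i / 3)) (sym (m≡m%n+[m/n]*n i 3)) (by (i % 3) (m%n<n i 3))
   where
   by : ∀ r → r < 3 → Residue (i / 3) (r + (i / 3) * 3)
   by 0 _ = zeroth (i / 3)
   by 1 _ = first (i / 3)
   by 2 _ = second (i / 3)
   by (suc (suc (suc r))) (s≤s (s≤s (s≤s ())))

  abscissa : ∀ i → proj₁ (place i) ≡ ι i
  abscissa i = by (residue i)
   where
   by : ∀ {p i} → Residue p i → proj₁ (place i) ≡ ι i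
   by (zeroth p) = cong proj₁ (place₀ p)
   by (first p)  = cong proj₁ (place₁ p)
   by (second p) = cong proj₁ (place₂ p)

  drawing : Drawing G
  drawing = Scheme.draw Strips.scheme G (place ∘ toℕ)
   (λ {u} {v} e → Fin.toℕ-injective (ι-injective (trans (sym (abscissa (toℕ u))) (trans (cong proj₁ e) (abscissa (toℕ v))))))
   (λ u → vertex (residue (toℕ u))) (λ _ → [])
   λ {u} {v} h → edge (toℕ u) (toℕ v) (R.edge⁻ {u} {v} h)
   where
   vertex : ∀ {p i} → Residue p i → ∃[ j ] Strips.Vertex j (place i)
   vertex (zeroth p) rewrite place₀ p = p , Strips.v₀ p
   vertex (first p)  rewrite place₁ p = p , Strips.v₁ p
   vertex (second p) rewrite place₂ p = p , Strips.v₂ p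
   side : ∀ {p i j} → Residue p i → Residue p j → i < j → ∃[ m ] Strips.Shape m (place i) (place j) (place i ∷ place j ∷ [])
   side (zeroth p) (first .p)  l rewrite place₀ p | place₁ p = p , Strips.s₀₁ p
   side (zeroth p) (second .p) l rewrite place₀ p | place₂ p = p , Strips.s₀₂ p
   side (first p)  (second .p) l rewrite place₁ p | place₂ p = p , Strips.s₁₂ p
   side (zeroth p) (zeroth .p) l = ⊥-elim (<-irrefl refl l)
   side (first p)  (first .p)  l = ⊥-elim (<-irrefl refl l)
   side (second p) (second .p) l = ⊥-elim (<-irrefl refl l)
   side (first p)  (zeroth .p) l = ⊥-elim (<-asym l ≤-refl)
   side (second p) (zeroth .p) l = ⊥-elim (<-asym l (n≤1+n _))
   side (second p) (first .p)  l = ⊥-elim (<-asym l ≤-refl)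
   edge : ∀ i j → Below i j → ∃[ m ] Strips.Shape m (place i) (place j) (place i ∷ place j ∷ [])
   edge i j (l , e) = side (subst (λ p → Residue p i) (≡ᵇ⇒ {i / 3} e) (residue i)) (residue j) l

  same-block : ∀ {u v} → u ~ v → toℕ u / 3 ≡ toℕ v / 3
  same-block {u} {v} h = by (adjacent⁻ {u} {v} h)
   where
   by : Below (toℕ u) (toℕ v) ⊎ Below (toℕ v) (toℕ u) → toℕ u / 3 ≡ toℕ v / 3
   by (inj₁ (_ , e)) = ≡ᵇ⇒ {toℕ u / 3} e
   by (inj₂ (_ , e)) = sym (≡ᵇ⇒ {toℕ v / 3} e)

  is-free : S 1 1 Free G
  is-free C = <⇒≱ {3} (length-⊆ {xs = four} {ys = b * 3 ∷ 1 + b * 3 ∷ 2 + b * 3 ∷ []} four! inside) ≤-refl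
   where
   open _Contains_ C
   t : StarVertex 1 1 → ℕ
   t x = toℕ (embed x)
   b = t hubX / 3
   ne : ∀ {x y} → x ≢ y → t x ≢ t y
   ne h e = h (injective (Fin.toℕ-injective e))
   four : List ℕ
   four = t hubX ∷ t hubY ∷ t (leafX Fin.zero) ∷ t (leafY Fin.zero) ∷ []
   four! : Unique four
   four! = (ne (λ ()) ∷ ne (λ ()) ∷ ne (λ ()) ∷ []) ∷ (ne (λ ()) ∷ ne (λ ()) ∷ []) ∷ (ne (λ ()) ∷ []) ∷ [] ∷ []
   block : ∀ {p i} → Residue p i → p ≡ b → i ∈ b * 3 ∷ 1 + b * 3 ∷ 2 + b * 3 ∷ []
   block (zeroth p) refl = #0
   block (first p)  refl = #1
   block (second p) refl = #2
   blocks : ∀ {x y} → T (starAdj x y) → t x / 3 ≡ t y / 3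
   blocks {x} {y} a = same-block {embed x} {embed y} (preserves {x} {y} a)
   xy : t hubX / 3 ≡ t hubY / 3
   xy = blocks {hubX} {hubY} _
   inside : ∀ {i} → i ∈ four → i ∈ b * 3 ∷ 1 + b * 3 ∷ 2 + b * 3 ∷ []
   inside #0 = block (residue _) refl
   inside #1 = block (residue _) (sym xy)
   inside #2 = block (residue _) (sym (blocks {hubX} {leafX Fin.zero} _))
   inside #3 = block (residue _) (sym (trans xy (blocks {hubY} {leafY Fin.zero} _)))

  size : q * 3 ≤ edgeCount G
  size = ≤-trans (≤-reflexive lengths) (R.count≥ (++⁺ (family-unique q inj) (++⁺ (family-unique q inj₁′) (family-unique q inj) disjoint₂) disjoint₁) inside)
   where
   inj : ∀ {i j} → i * 3 ≡ j * 3 → i ≡ j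
   inj {i} {j} = *-cancelʳ-≡ i j 3
   inj₁′ : ∀ {i j} → 1 + i * 3 ≡ 1 + j * 3 → i ≡ j
   inj₁′ e = inj (suc-injective e)
   f g h : ℕ → ℕ × ℕ
   f i = i * 3 , 1 + i * 3
   g i = 1 + i * 3 , 2 + i * 3
   h i = i * 3 , 2 + i * 3
   lengths : q * 3 ≡ length (applyUpTo f q ++ (applyUpTo g q ++ applyUpTo h q))
   lengths = sym (trans (length-++ (applyUpTo f q)) (trans (cong₂ _+_ (length-applyUpTo f q) (trans (length-++ (applyUpTo g q))
    (trans (cong₂ _+_ (length-applyUpTo g q) (length-applyUpTo h q)) (cong (q +_) (sym (+-identityʳ q)))))) (*-comm 3 q)))
   one≢zero : ∀ {i j} → 1 + i * 3 ≢ j * 3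
   one≢zero {i} {j} e = 1≢0 (trans (sym (remainder 1 i (s≤s (s≤s z≤n)))) (trans (cong (_% 3) e) (remainder 0 j (s≤s z≤n))))
    where
    1≢0 : 1 ≢ 0
    1≢0 ()
   disjoint₂ : ∀ {z} → ¬ (z ∈ applyUpTo g q × z ∈ applyUpTo h q)
   disjoint₂ (m , m′) with ∈-applyUpTo⁻ g m | ∈-applyUpTo⁻ h m′
   ... | i , _ , refl | j , _ , e = one≢zero {i} {j} (cong proj₁ e)
   disjoint₁ : ∀ {z} → ¬ (z ∈ applyUpTo f q × z ∈ applyUpTo g q ++ applyUpTo h q)
   disjoint₁ (m , m′) with ∈-applyUpTo⁻ f m | ∈-++⁻ (applyUpTo g q) m′
   ... | i , _ , refl | inj₁ r with ∈-applyUpTo⁻ g r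
   ...   | j , _ , e = one≢zero {j} {i} (sym (cong proj₁ e))
   disjoint₁ (m , m′) | i , _ , refl | inj₂ r with ∈-applyUpTo⁻ h r
   ...   | j , _ , e = 2≢1 (+-cancelʳ-≡ (i * 3) 2 1 (trans (cong (λ p → 2 + p * 3) (inj {i} {j} (cong proj₁ e))) (sym (cong proj₂ e))))
    where
    2≢1 : 2 ≢ 1
    2≢1 ()
   in-block : ∀ {i r s} → i < q → r < s → s < 3 → Below (r + i * 3) (s + i * 3) × s + i * 3 < n
   in-block {i} {r} {s} l rs s3 = (+-monoˡ-< (i * 3) rs , ⇒≡ᵇ {(r + i * 3) / 3} (trans (quotient r i (<-trans rs s3)) (sym (quotient s i s3))))
    , ≤-trans (+-monoˡ-< (i * 3) s3) (*-monoˡ-≤ 3 l)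
   inside : ∀ {i j} → (i , j) ∈ applyUpTo f q ++ (applyUpTo g q ++ applyUpTo h q) → Below i j × j < n
   inside m with ∈-++⁻ (applyUpTo f q) m
   ... | inj₁ r with ∈-applyUpTo⁻ f r
   ...   | i , l , refl = in-block {i} {0} {1} l ≤-refl (s≤s (s≤s z≤n))
   inside m | inj₂ r with ∈-++⁻ (applyUpTo g q) r
   ... | inj₁ r′ with ∈-applyUpTo⁻ g r′
   ...   | i , l , refl = in-block {i} {1} {2} l ≤-refl ≤-refl
   inside m | inj₂ r | inj₂ r′ with ∈-applyUpTo⁻ h r′
   ... | i , l , refl = in-block {i} {0} {2} l (s≤s z≤n) ≤-refl

module Extremal where
 open import Data.Nat.Divisibility using (_∣_; divides; n∣m*n)
 open import Data.Nat.DivMod using (m*n/n≡m; +-distrib-/-∣ʳ; /-monoˡ-≤)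
 open import Data.Nat.Solver using (module +-*-Solver)
 open Examples

 extremal : ∀ {n m k} → (∀ (G : Graph (Fin n)) → Planar G → S m m Free G → edgeCount G ≤ k) →
  (G : Graph (Fin n)) → Drawing G → S m m Free G → k ≤ edgeCount G → ex𝒫[ n , S m m ]≡ k
 extremal upper G D free lower = record { attained = G , D , free , ≤-antisym (upper G D free) lower ; maximal = upper }

 triangles : ∀ n → 3 ∣ n → ex𝒫[ n , S 1 1 ]≡ n
 triangles n (divides q refl) = extremal (λ G D free → OneBound.edges≤n G D free) T.G T.drawing T.is-free T.size
  where module T = Triangles q

 star : ∀ n → 3 ≤ n → ¬ (3 ∣ n) → ex𝒫[ n , S 1 1 ]≡ (n ∸ 1)
 star 1 (s≤s ()) _
 star 2 (s≤s (s≤s ())) _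
 star 3 _ h = ⊥-elim (h (divides 1 refl))
 star (suc (suc (suc (suc j)))) _ h = extremal (λ G D free → upper G D free (OneBound.edge-bound G D free)) E.G drawing is-free size
  where
  open Star (suc j) (s≤s z≤n)
  upper : ∀ G → Planar G → S 1 1 Free G → edgeCount G < 4 + j ⊎ 3 ∣ 4 + j → edgeCount G ≤ 3 + j
  upper G D free (inj₁ l) = ≤-pred l
  upper G D free (inj₂ k) = ⊥-elim (h k)

 module _ (k : ℕ) where
  open +-*-Solver

  twice : 2 * (2 + k) ∸ 4 ≡ k + k
  twice = trans (cong (_∸ 4) (solve 1 (λ k → con 2 :* (con 2 :+ k) := k :+ k :+ con 4) refl k)) (m+n∸n≡m (k + k) 4)

  thrice : 3 * (2 + k) ∸ 6 ≡ k + (k + k)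
  thrice = trans (cong (_∸ 6) (solve 1 (λ k → con 3 :* (con 2 :+ k) := k :+ (k :+ k) :+ con 6) refl k)) (m+n∸n≡m (k + (k + k)) 6)

  five-halves : 5 * (2 + k) / 2 ∸ 5 ≡ k + (k + k / 2)
  five-halves = trans (cong (_∸ 5) (trans halved (solve 2 (λ k x → x :+ (k :+ k :+ con 5) := k :+ (k :+ x) :+ con 5) refl k (k / 2)))) (m+n∸n≡m (k + (k + k / 2)) 5)
   where
   halved : 5 * (2 + k) / 2 ≡ k / 2 + (k + k + 5)
   halved = trans (cong (λ z → z / 2) (solve 1 (λ k → con 5 :* (con 2 :+ k) := k :+ (k :+ k :+ con 5) :* con 2) refl k))
    (trans (+-distrib-/-∣ʳ k {(k + k + 5) * 2} {2} (n∣m*n (k + k + 5))) (cong (k / 2 +_) (m*n/n≡m (k + k + 5) 2)))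

 split≤ : ∀ {a b} → a ≤ b → ∃[ d ] b ≡ a + d
 split≤ {a} {b} h = b ∸ a , sym (m+[n∸m]≡n h)

 bipartite : ∀ n → 16 ≤ n → ex𝒫[ n , S 2 2 ]≡ (2 * n ∸ 4)
 bipartite n big = by (split≤ (≤-trans (m≤m+n 5 11) big))
  where
  by : ∃[ d ] n ≡ 5 + d → ex𝒫[ n , S 2 2 ]≡ (2 * n ∸ 4)
  by (d , refl) = extremal (λ G D free → m+n≤o⇒m≤o∸n (edgeCount G) (TwoBound.edge-bound G D free big)) G drawing free₂
    (≤-trans (≤-reflexive (twice (3 + d))) size₂)
   where open TwoHubs (suc d) (s≤s z≤n)

 matched : ∀ n → 10 ≤ n → ex𝒫[ n , S 3 3 ]≡ (5 * n / 2 ∸ 5)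
 matched n big = by (split≤ (≤-trans (m≤m+n 5 5) big))
  where
  upper : ∀ (G : Graph (Fin n)) → Planar G → S 3 3 Free G → edgeCount G ≤ 5 * n / 2 ∸ 5
  upper G D free = m+n≤o⇒m≤o∸n (edgeCount G) (≤-trans (≥-reflexive (m*n/n≡m (edgeCount G + 5) 2)) (/-monoˡ-≤ 2
   (≤-trans (≤-reflexive (trans (*-distribʳ-+ 2 (edgeCount G) 5) (cong (_+ 10) (trans (*-comm (edgeCount G) 2) (sym (PlanarGraph.degree-sum G D))))))
    (ThreeBound.degree-bound G D free big))))
  by : ∃[ d ] n ≡ 5 + d → ex𝒫[ n , S 3 3 ]≡ (5 * n / 2 ∸ 5)
  by (d , refl) = extremal upper G drawing free₃ (≤-trans (≤-reflexive (five-halves (3 + d))) size₃)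
   where open Matched (suc d) (s≤s z≤n)

 double-wheel : ∀ m n → 3 ≤ n → 4 ≤ m → ex𝒫[ n , S m m ]≡ (3 * n ∸ 6)
 double-wheel m n h m≥4 = by n h
  where
  upper : ∀ {n} → 3 ≤ n → (G : Graph (Fin n)) → Planar G → S m m Free G → edgeCount G ≤ 3 * n ∸ 6
  upper h G D _ = m+n≤o⇒m≤o∸n (edgeCount G) (PlanarGraph.euler-bound G D h)
  by : ∀ n → 3 ≤ n → ex𝒫[ n , S m m ]≡ (3 * n ∸ 6)
  by 1 (s≤s ())
  by 2 (s≤s (s≤s ()))
  by 3 h = extremal (upper h) S₃.G S₃.drawing (S₃.is-free m≥4) size-three
   where module S₃ = Small 3 (n≤1+n 3)
  by 4 h = extremal (upper h) S₄.G S₄.drawing (S₄.is-free m≥4) size-four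
   where module S₄ = Small 4 ≤-refl
  by (suc (suc (suc (suc (suc j))))) h = extremal (upper h) G drawing (free₄ m≥4) (≤-trans (≤-reflexive (thrice (3 + j))) size₄)
   where open DoubleWheel (suc j) (s≤s z≤n)

open import Data.Nat.Divisibility using (_∣_)
open Extremal

theorem1 : (m n : ℕ) → 1 ≤ m → 3 ≤ n →
  (m ≡ 1 → 3 ∣ n → ex𝒫[ n , S m m ]≡ n)
 × (m ≡ 1 → ¬ (3 ∣ n) → ex𝒫[ n , S m m ]≡ (n ∸ 1))
 × (m ≡ 2 → 16 ≤ n → ex𝒫[ n , S m m ]≡ (2 * n ∸ 4))
 × (m ≡ 3 → 10 ≤ n → ex𝒫[ n , S m m ]≡ (5 * n / 2 ∸ 5))
 × (4 ≤ m → ex𝒫[ n , S m m ]≡ (3 * n ∸ 6))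
theorem1 m n _ h = (λ { refl → triangles n }) , (λ { refl → star n h }) , (λ { refl → bipartite n }) , (λ { refl → matched n }) , double-wheel m n h
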